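{- Let $q$ be an odd prime power with $q \notin \{5,7,11,13,31,41\}$. Then for every $\theta \in \mathbb{F}_{q^2}$ with $\mathbb{F}_{q^2} = \mathbb{F}_q(\theta)$ there exists $x \in \mathbb{F}_q$ such that $\theta + x$ is $2$-primitive, i.e. the extension $\mathbb{F}_{q^2}/\mathbb{F}_q$ possesses the translate property for $2$-primitive elements. In particular, the least integer $T$ such that $\mathbb{F}_{q^2}/\mathbb{F}_q$ possesses the translate property for $2$-primitive elements for every odd prime power $q > T$ is $T = 41$.
   Context: For a prime power $q$ and integers $n,r$ with $r \mid q^n-1$, an element of $\mathbb{F}_{q^n}^*$ is called $r$-primitive if its multiplicative order is $(q^n-1)/r$. An element $\theta$ with $\mathbb{F}_{q^n}=\mathbb{F}_q(\theta)$ is a generator of the extension, and $\{\theta+x : x \in \mathbb{F}_q\}$ is its set of translates. The extension $\mathbb{F}_{q^n}/\mathbb{F}_q$ possesses the translate property for $r$-primitive elements if every set of translates of every generator contains an $r$-primitive element. -}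

module Defs where

open import Level using (0ℓ)
open import Algebra.Bundles using (CommutativeRing)
open import Data.Nat using (ℕ; zero; suc; _<_; _∸_)
open import Data.Nat.DivMod using (_/_)
open import Data.Nat.Primality using (Prime)
open import Data.Fin using (Fin)
open import Data.Product using (Σ; ∃; _×_)
open import Relation.Nullary using (¬_)
open import Relation.Binary.PropositionalEquality using (_≡_)

record Field : Set₁ where
  field
    commRing : CommutativeRing 0ℓ 0ℓ
  open CommutativeRing commRing public
  field
    1≉0     : ¬ (1# ≈ 0#)
    inverse : ∀ x → ¬ (x ≈ 0#) → Σ Carrier λ y → x * y ≈ 1#

IsPrimePower : ℕ → Set
IsPrimePower q = Σ ℕ λ p → Σ ℕ λ k → Prime p × 0 < k × q ≡ p Data.Nat.^ k

module FieldDefs (F : Field) where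
  open Field F

  _^_ : Carrier → ℕ → Carrier
  x ^ zero  = 1#
  x ^ suc n = x * (x ^ n)

  HasSize : ℕ → Set
  HasSize n = Σ (Fin n → Carrier) λ f →
                (∀ i j → f i ≈ f j → i ≡ j) × (∀ y → Σ (Fin n) λ i → f i ≈ y)

  -- the subfield F_q of F_{q^2}: the elements fixed by x ↦ x^q
  InBase : ℕ → Carrier → Set
  InBase q x = x ^ q ≈ x

  record IsSubfield (S : Carrier → Set) : Set where
    field
      resp  : ∀ {x y} → x ≈ y → S x → S y
      has0  : S 0#
      has1  : S 1#
      add   : ∀ {x y} → S x → S y → S (x + y)
      neg   : ∀ {x} → S x → S (- x)
      mul   : ∀ {x y} → S x → S y → S (x * y)
      inv   : ∀ {x y} → S x → x * y ≈ 1# → S y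

  Generates : ℕ → Carrier → Set₁
  Generates q θ = ∀ (S : Carrier → Set) → IsSubfield S →
                  (∀ x → InBase q x → S x) → S θ → ∀ y → S y

  HasOrder : Carrier → ℕ → Set
  HasOrder y m = 0 < m × y ^ m ≈ 1# × (∀ k → 0 < k → k < m → ¬ (y ^ k ≈ 1#))

  IsRPrimitive : (q n r : ℕ) → .{{_ : Data.Nat.NonZero r}} → Carrier → Set
  IsRPrimitive q n r y = HasOrder y ((q Data.Nat.^ n ∸ 1) / r)

  TranslateProperty2 : ℕ → Set₁
  TranslateProperty2 q = ∀ θ → Generates q θ →
                         Σ Carrier λ x → InBase q x × IsRPrimitive q 2 2 (θ + x)

-- Write n = q² - 1. An element is 2-primitive iff d ^ (n / 4) = -1 and d ^ (n / ℓ) ≠ 1 for every odd prime ℓ dividing n.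
-- For moduli m ∈ {4, ℓ, …} put e_m(x) = m [x ^ (n / m) = 1] - 1, a sum of characters of order dividing m; products φ of
-- such functions are idempotent for convolution on the units. Every z outside the base field is uniquely a ratio of two
-- elements of θ + 𝔽_q, so the second moment of the sums X(s) = ∑_x φ(s (θ + x)) is known exactly, and expanding
-- ∑_g (φ(1) T(g) - X φ(g / s))² ≥ 0 gives |X| ≤ φ(1) √q, with no complex numbers. Cohen's sieve (a core of small primes
-- treated by inclusion-exclusion, the others subtracted) then settles all q outside a finite list: by a linear
-- programming bound on ∑ 1/ℓ for q > 2¹⁷, by evaluating the criterion for each odd q below. Each of the remaining fields
-- except those with q = 5, 7, 11, 13, 31, 41 has a certificate: a generator ω of the units and a few exponents e with
-- ω ^ e ∈ ω + 𝔽_q whose shifts by multiples of q + 1 supply a 2-primitive element in every translate set.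

module Submission where

open import Defs

open import Data.Empty using (⊥-elim; ⊥)
open import Data.List.Membership.Propositional using (_∈_)
open import Data.List.Relation.Unary.All as All using (All; []; _∷_; all?)
open import Data.List.Relation.Unary.AllPairs using ([]; _∷_; AllPairs; allPairs?)
open import Data.List.Relation.Unary.Any as Any using (here; there; Any)
open import Data.List.Relation.Unary.Unique.Propositional using (Unique)
open import Data.Nat.Coprimality as Coprime using (Coprime; coprime-divisor; coprime-Bézout)
open import Data.Nat.DivMod using (m/n*n≡m; _%_; _/_; m≡m%n+[m/n]*n; m%n<n; m*n/n≡m; m*n%n≡0)
open import Data.Nat.Primality using (Prime; euclidsLemma; prime⇒nonZero; prime⇒nonTrivial; prime⇒irreducible; ¬prime[1]; prime?; prime[2]; _Rough_; 2-rough; ∤⇒rough-suc; rough∧square>⇒prime)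
open import Data.Product.Base using (∃; _×_; _,_; proj₁; proj₂; Σ)
open import Data.Sum.Base using (inj₁; inj₂; _⊎_; [_,_]′)
open import Data.Unit.Base using (tt)
open import Function.Base using (_∘_; id)
open import Relation.Nullary using (Dec; yes; no; ¬_; ¬?)
open import Relation.Nullary.Decidable using (_×-dec_; _→-dec_; toWitness)
open import Relation.Unary using (Decidable)
import Data.List.Relation.Unary.All.Properties as Allₚ
open import Relation.Binary.PropositionalEquality

-- The given field is an arbitrary setoid field with q² elements, so nothing can be evaluated in it.
-- It is moved to `Fin`, where every count is a sum of integer indicators. Certificates are
-- evaluated in a concrete model with bare operations, which is mapped into the given field after
-- the required roots have been found there by counting. Such a map transports equalities only, so
-- each test that must show an element nonzero is itself an equation, a ^ (q - 1) = 1, applied to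
-- the element or to its norm. The core is a trade-off: a prime in the core doubles the error term,
-- while a sieved prime ℓ costs about 1/ℓ of the main term and one more error term. Hence the
-- smallest primes go into the core. Integers replace reals throughout: √q by some r with q ≤ r²,
-- and 1/ℓ by a rounded numerator over a common denominator. Below 2¹⁷ all odd q are tested, and
-- numbers that fail the criterion without being prime powers are discarded by a witness prime. That
-- T cannot be smaller than 41 needs a failure at q = 41: one translate set is shown to miss every
-- 2-primitive element by listing all powers of a generator.

module IntegerSums where

  -- Finite sums of integers and indicator functions.

  open import Data.Fin.Base using (Fin; zero; suc)
  open import Data.Fin.Properties using (_≟_)
  open import Data.Integer.Base using (ℤ; +_; _+_; _*_; -_; _≤_; _<_; 0ℤ; 1ℤ; +≤+; -≤+; +<+; -<+)
  import Data.Integer.Properties as ℤ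
  open import Data.Nat.Base as ℕ using (zero; suc; z≤n; s≤s)
  open import Data.List.Base using (length; filter; tabulate)
  import Algebra.Properties.Semiring.Sum ℤ.+-*-semiring as Summation
  open import Data.Fin.Permutation using (Permutation; _⟨$⟩ʳ_)
  import Algebra.Properties.AbelianGroup ℤ.+-0-abelianGroup as ℤG

  𝟙 : {A : Set} → Dec A → ℤ
  𝟙 (yes _) = 1ℤ
  𝟙 (no _)  = 0ℤ

  𝟙-yes : {A : Set} (d : Dec A) → A → 𝟙 d ≡ 1ℤ
  𝟙-yes (yes _) a = refl
  𝟙-yes (no ¬a) a = ⊥-elim (¬a a)

  𝟙-no : {A : Set} (d : Dec A) → ¬ A → 𝟙 d ≡ 0ℤ
  𝟙-no (yes a) ¬a = ⊥-elim (¬a a)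
  𝟙-no (no _)  ¬a = refl

  𝟙-cong : {A B : Set} (d : Dec A) (e : Dec B) → (A → B) → (B → A) → 𝟙 d ≡ 𝟙 e
  𝟙-cong (yes a) e f g = sym (𝟙-yes e (f a))
  𝟙-cong (no ¬a) e f g = sym (𝟙-no e (¬a ∘ g))

  𝟙-≥0 : {A : Set} (d : Dec A) → 0ℤ ≤ 𝟙 d
  𝟙-≥0 (yes _) = +≤+ z≤n
  𝟙-≥0 (no _)  = +≤+ z≤n

  𝟙*-≤ : {A : Set} (d : Dec A) {x y : ℤ} → (A → x ≤ y) → 𝟙 d * x ≤ 𝟙 d * y
  𝟙*-≤ (yes a) {x} {y} f rewrite ℤ.*-identityˡ x | ℤ.*-identityˡ y = f a
  𝟙*-≤ (no _)  f = ℤ.≤-refl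

  𝟙*-cong : {A : Set} (d : Dec A) {x y : ℤ} → (A → x ≡ y) → 𝟙 d * x ≡ 𝟙 d * y
  𝟙*-cong (yes a) f = cong (1ℤ *_) (f a)
  𝟙*-cong (no _)  f = refl

  opaque
    sum : ∀ {m} → (Fin m → ℤ) → ℤ
    sum = Summation.sum

    sum-cong-≗ : ∀ {m} {f g : Fin m → ℤ} → (∀ i → f i ≡ g i) → sum f ≡ sum g
    sum-cong-≗ = Summation.sum-cong-≗

    ∑-comm : ∀ {m k} (f : Fin m → Fin k → ℤ) → sum (λ i → sum (f i)) ≡ sum (λ j → sum (λ i → f i j))
    ∑-comm = Summation.∑-comm

    ∑-distrib-+ : ∀ {m} (f g : Fin m → ℤ) → sum (λ i → f i + g i) ≡ sum f + sum g
    ∑-distrib-+ = Summation.∑-distrib-+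

    sum-permute : ∀ {m k} (f : Fin m → ℤ) (π : Permutation k m) → sum f ≡ sum (λ i → f (π ⟨$⟩ʳ i))
    sum-permute = Summation.sum-permute

    sum-mono-≤ : ∀ {m} {f g : Fin m → ℤ} → (∀ i → f i ≤ g i) → sum f ≤ sum g
    sum-mono-≤ {zero}  le = ℤ.≤-refl
    sum-mono-≤ {suc m} le = ℤ.+-mono-≤ (le zero) (sum-mono-≤ (le ∘ suc))

    sum-zero : ∀ {m} (f : Fin m → ℤ) → (∀ i → f i ≡ 0ℤ) → sum f ≡ 0ℤ
    sum-zero {zero}  f eq = refl
    sum-zero {suc m} f eq rewrite eq zero | sum-zero (f ∘ suc) (eq ∘ suc) = refl

    sum-≥0 : ∀ {m} {f : Fin m → ℤ} → (∀ i → 0ℤ ≤ f i) → 0ℤ ≤ sum f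
    sum-≥0 {zero}  le = ℤ.≤-refl
    sum-≥0 {suc m} le = ℤ.+-mono-≤ (le zero) (sum-≥0 (le ∘ suc))

    -- When the totals agree, no termwise inequality can be strict. This turns counting into a
    -- pointwise statement: `∑δ` passes with it from "at most one" to "exactly one".
    sum-≤∧≡⇒≡ : ∀ {m} {f g : Fin m → ℤ} → (∀ i → f i ≤ g i) → sum f ≡ sum g → ∀ i → f i ≡ g i
    sum-≤∧≡⇒≡ {suc m} {f} {g} le eq = λ { zero → head ; (suc i) → sum-≤∧≡⇒≡ (le ∘ suc) tail i }
      where
      head : f zero ≡ g zero
      head = ℤ.≤-antisym (le zero) (ℤ.≮⇒≥ (λ lt → ℤ.<-irrefl eq (ℤ.+-mono-<-≤ lt (sum-mono-≤ (le ∘ suc)))))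
      tail : sum (f ∘ suc) ≡ sum (g ∘ suc)
      tail = ℤG.∙-cancelˡ (f zero) _ _ (trans eq (cong (_+ sum (g ∘ suc)) (sym head)))

    sum-const : ∀ m (c : ℤ) → sum {m} (λ _ → c) ≡ + m * c
    sum-const zero    c = sym (ℤ.*-zeroˡ c)
    sum-const (suc m) c = trans (cong (λ z → c + z) (sum-const m c)) (sym (ℤ.suc-* (+ m) c))

    sum-at : ∀ {m} (f : Fin m → ℤ) j → (∀ i → i ≢ j → f i ≡ 0ℤ) → sum f ≡ f j
    sum-at f zero    z = trans (cong (λ z → f zero + z) (sum-zero (f ∘ suc) (λ i → z (suc i) (λ ())))) (ℤ.+-identityʳ _)
    sum-at f (suc j) z rewrite z zero (λ ()) =
      trans (ℤ.+-identityˡ _) (sum-at (f ∘ suc) j (λ i i≢j → z (suc i) (λ { refl → i≢j refl })))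

    sum-*ˡ : ∀ {m} c (f : Fin m → ℤ) → sum (λ i → c * f i) ≡ c * sum f
    sum-*ˡ c f = sym (Summation.*-distribˡ-sum c f)

    sum-*ʳ : ∀ {m} c (f : Fin m → ℤ) → sum (λ i → f i * c) ≡ sum f * c
    sum-*ʳ c f = sym (Summation.*-distribʳ-sum c f)

    sum-neg : ∀ {m} (f : Fin m → ℤ) → sum (λ i → - f i) ≡ - sum f
    sum-neg {zero}  f = refl
    sum-neg {suc m} f = trans (cong (λ z → - f zero + z) (sum-neg (f ∘ suc))) (sym (ℤ.neg-distrib-+ (f zero) _))

    -- Bridge between two ways of counting: roots of polynomials are handled as lists without
    -- repetition, other sets as sums of indicators.
    length-filter-tabulate : ∀ {m} {A : Set} {P : A → Set} (P? : Decidable P) (f : Fin m → A) →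
      + length (filter P? (tabulate f)) ≡ sum (λ i → 𝟙 (P? (f i)))
    length-filter-tabulate {zero}  P? f = refl
    length-filter-tabulate {suc m} P? f with P? (f zero)
    ... | yes _ = cong (λ z → 1ℤ + z) (length-filter-tabulate P? (f ∘ suc))
    ... | no _  = trans (length-filter-tabulate P? (f ∘ suc)) (sym (ℤ.+-identityˡ _))

  sum-select : ∀ {m} (f : Fin m → ℤ) j → sum (λ i → 𝟙 (i ≟ j) * f i) ≡ f j
  sum-select f j = trans
    (sum-at (λ i → 𝟙 (i ≟ j) * f i) j (λ i i≢j → trans (cong (_* f i) (𝟙-no (i ≟ j) i≢j)) (ℤ.*-zeroˡ (f i))))
    (trans (cong (_* f j) (𝟙-yes (j ≟ j) refl)) (ℤ.*-identityˡ (f j)))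

  sum-one : ∀ {m} (P : Fin m → Set) (P? : Decidable P) j → P j → (∀ i → P i → i ≡ j) → sum (λ i → 𝟙 (P? i)) ≡ 1ℤ
  sum-one P P? j pj uniq =
    trans (sum-at _ j (λ i i≢j → 𝟙-no (P? i) (λ pi → i≢j (uniq i pi)))) (𝟙-yes (P? j) pj)

  # : ∀ {m} {P : Fin m → Set} → Decidable P → ℤ
  # P? = sum (λ i → 𝟙 (P? i))

  <suc⇒≤ : ∀ {i m} → i < + suc m → i ≤ + m
  <suc⇒≤ (+<+ (s≤s le)) = +≤+ le
  <suc⇒≤ -<+            = -≤+

-- Finite fields on `Fin`: units, Lagrange's theorem, roots of polynomials, power maps.

module FiniteFields where

  open import Level using (0ℓ)
  open import Algebra.Bundles using (CommutativeRing)
  open import Algebra.Core using (Op₁; Op₂)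
  open import Algebra.Structures using (IsCommutativeRing)
  open import Data.Fin.Base using (Fin; zero; suc; punchIn)
  open import Data.Fin.Properties using (_≟_; any?; punchInᵢ≢i)
  open import Data.Fin.Permutation using (Permutation; permutation)
  open import Data.Integer.Base as ℤ using (ℤ; 0ℤ; 1ℤ) renaming (+_ to ⁺_)
  import Data.Integer.Properties as ℤ
  open import Data.List.Base using (List; []; _∷_; _++_; length; replicate; filter; allFin)
  open import Data.List.Properties using (length-++; length-replicate)
  open import Data.List.Relation.Unary.All.Properties using (all-filter)
  open import Data.List.Relation.Unary.Unique.Propositional.Properties using (allFin⁺; filter⁺)
  open import Data.Nat.Base as ℕ using (ℕ; zero; suc; s≤s; _∸_)
  import Data.Nat.Properties as ℕ
  import Algebra.Properties.CommutativeMonoid.Sum as CMSum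
  import Algebra.Properties.CommutativeSemiring.Exp as Exp
  import Algebra.Properties.Ring as RingProps
  import Algebra.Solver.Ring.NaturalCoefficients.Default as Solver
  open IntegerSums

  -- The index n is the number of units.
  record FiniteField (n : ℕ) : Set where
    infixl 6 _+_
    infixl 7 _*_
    infix  8 -_
    field
      _+_ _*_ : Op₂ (Fin (suc n))
      -_ : Op₁ (Fin (suc n))
      0# 1# : Fin (suc n)
      isCommutativeRing : IsCommutativeRing _≡_ _+_ _*_ -_ 0# 1#
      1≢0 : 1# ≢ 0#
      invertible : ∀ x → x ≢ 0# → ∃ λ y → x * y ≡ 1#

    commutativeRing : CommutativeRing 0ℓ 0ℓ
    commutativeRing = record { isCommutativeRing = isCommutativeRing }

  module FieldTheory {n : ℕ} (𝔽 : FiniteField n) where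
    open FiniteField 𝔽 public using (1≢0; invertible; commutativeRing)
    open CommutativeRing commutativeRing public
      using (_+_; _*_; -_; 0#; 1#; +-assoc; +-comm; +-identityˡ; +-identityʳ; -‿inverseˡ; -‿inverseʳ;
             *-assoc; *-comm; *-identityˡ; *-identityʳ; distribˡ; distribʳ; zeroˡ; zeroʳ;
             commutativeSemiring; semiring; *-commutativeMonoid; +-commutativeMonoid)
    open Exp commutativeSemiring public using (_^_; ^-homo-*; ^-assocʳ; ^-distrib-*)
    open RingProps (CommutativeRing.ring commutativeRing) public
      using (-‿distribˡ-*; -‿distribʳ-*; -‿involutive; -‿+-comm; -0#≈0#)
    open Solver commutativeSemiring public using (solve; _:=_; _:+_; _:*_; con)
    open ≡-Reasoning

    K : Set
    K = Fin (suc n)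

    +-cancelˡ : ∀ a {x y} → a + x ≡ a + y → x ≡ y
    +-cancelˡ a {x} {y} eq = trans (drop x) (trans (cong ((- a) +_) eq) (sym (drop y)))
      where
      drop : ∀ z → z ≡ - a + (a + z)
      drop z = sym (trans (sym (+-assoc (- a) a z)) (trans (cong (_+ z) (-‿inverseˡ a)) (+-identityˡ z)))

    +-cancelʳ : ∀ a {x y} → x + a ≡ y + a → x ≡ y
    +-cancelʳ a {x} {y} eq = +-cancelˡ a (trans (+-comm a x) (trans eq (+-comm y a)))

    *-cancelˡ : ∀ {a x y} → a ≢ 0# → a * x ≡ a * y → x ≡ y
    *-cancelˡ {a} {x} {y} a≢0 eq with invertible a a≢0
    ... | b , ab≡1 = trans (drop x) (trans (cong (b *_) eq) (sym (drop y)))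
      where
      drop : ∀ z → z ≡ b * (a * z)
      drop z = sym (trans (sym (*-assoc b a z)) (trans (cong (_* z) (trans (*-comm b a) ab≡1)) (*-identityˡ z)))

    *-cancelʳ : ∀ {a x y} → a ≢ 0# → x * a ≡ y * a → x ≡ y
    *-cancelʳ {a} {x} {y} a≢0 eq = *-cancelˡ a≢0 (trans (*-comm a x) (trans eq (*-comm y a)))

    *-nonzero : ∀ {x y} → x ≢ 0# → y ≢ 0# → x * y ≢ 0#
    *-nonzero {x} x≢0 y≢0 eq = y≢0 (*-cancelˡ x≢0 (trans eq (sym (zeroʳ x))))

    *≡1⇒≢0 : ∀ {x y} → x * y ≡ 1# → x ≢ 0#
    *≡1⇒≢0 {y = y} eq refl = 1≢0 (trans (sym eq) (zeroˡ y))

    ^-nonzero : ∀ {x} m → x ≢ 0# → x ^ m ≢ 0#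
    ^-nonzero zero    x≢0 = 1≢0
    ^-nonzero (suc m) x≢0 = *-nonzero x≢0 (^-nonzero m x≢0)

    1^ : ∀ m → 1# ^ m ≡ 1#
    1^ zero    = refl
    1^ (suc m) = trans (*-identityˡ _) (1^ m)

    0^suc : ∀ m → 0# ^ suc m ≡ 0#
    0^suc m = zeroˡ _

    ^-assoc-comm : ∀ x a b → (x ^ a) ^ b ≡ (x ^ b) ^ a
    ^-assoc-comm x a b = trans (^-assocʳ x a b) (trans (cong (x ^_) (ℕ.*-comm a b)) (sym (^-assocʳ x b a)))

    infix 9 _⁻¹
    -- Made total so that `∑-ratios` can write (θ + x) / (θ + y) under sums over all of `K`; an
    -- indicator masks the value at 0 there.
    _⁻¹ : K → K
    x ⁻¹ with x ≟ 0#
    ... | yes _  = 0#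
    ... | no x≢0 = proj₁ (invertible x x≢0)

    *-inverseʳ : ∀ {x} → x ≢ 0# → x * x ⁻¹ ≡ 1#
    *-inverseʳ {x} x≢0 with x ≟ 0#
    ... | yes x≡0 = ⊥-elim (x≢0 x≡0)
    ... | no x≢0′ = proj₂ (invertible x x≢0′)

    ⁻¹-nonzero : ∀ {x} → x ≢ 0# → x ⁻¹ ≢ 0#
    ⁻¹-nonzero {x} x≢0 = *≡1⇒≢0 (trans (*-comm (x ⁻¹) x) (*-inverseʳ x≢0))

    *-⁻¹-cancelʳ : ∀ {a} x → a ≢ 0# → x * a * a ⁻¹ ≡ x
    *-⁻¹-cancelʳ {a} x a≢0 = trans (*-assoc x a (a ⁻¹)) (trans (cong (x *_) (*-inverseʳ a≢0)) (*-identityʳ x))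

    ⁻¹-*-cancelʳ : ∀ {a} x → a ≢ 0# → x * a ⁻¹ * a ≡ x
    ⁻¹-*-cancelʳ {a} x a≢0 =
      trans (*-assoc x (a ⁻¹) a) (trans (cong (x *_) (trans (*-comm (a ⁻¹) a) (*-inverseʳ a≢0))) (*-identityʳ x))

    ∑ : (K → ℤ) → ℤ
    ∑ = sum

    unit? : Decidable (_≢ 0#)
    unit? x = ¬? (x ≟ 0#)

    ∑* : (K → ℤ) → ℤ
    ∑* h = ∑ λ x → 𝟙 (unit? x) ℤ.* h x

    scale : ∀ a → a ≢ 0# → Permutation (suc n) (suc n)
    scale a a≢0 = permutation (_* a) (_* a ⁻¹) (λ x → ⁻¹-*-cancelʳ x a≢0) (λ x → *-⁻¹-cancelʳ x a≢0)

    *-unit⇔ : ∀ {a} x → a ≢ 0# → 𝟙 (unit? (x * a)) ≡ 𝟙 (unit? x)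
    *-unit⇔ {a} x a≢0 = 𝟙-cong (unit? (x * a)) (unit? x)
      (λ xa≢0 x≡0 → xa≢0 (trans (cong (_* a) x≡0) (zeroˡ a))) (λ x≢0 → *-nonzero x≢0 a≢0)

    ∑*-scale : ∀ {a} (h : K → ℤ) → a ≢ 0# → ∑* (λ x → h (x * a)) ≡ ∑* h
    ∑*-scale {a} h a≢0 = sym (trans (sum-permute (λ x → 𝟙 (unit? x) ℤ.* h x) (scale a a≢0))
      (sum-cong-≗ (λ x → cong (ℤ._* h (x * a)) (*-unit⇔ x a≢0))))

    ∑*-cong : ∀ {g h : K → ℤ} → (∀ x → x ≢ 0# → g x ≡ h x) → ∑* g ≡ ∑* h
    ∑*-cong eq = sum-cong-≗ (λ x → 𝟙*-cong (unit? x) (eq x))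

    ∑*-*ˡ : ∀ c (h : K → ℤ) → ∑* (λ x → c ℤ.* h x) ≡ c ℤ.* ∑* h
    ∑*-*ˡ c h = trans (sum-cong-≗ (λ x → swap (𝟙 (unit? x)) c (h x))) (sum-*ˡ c (λ x → 𝟙 (unit? x) ℤ.* h x))
      where
      swap : ∀ u c h → u ℤ.* (c ℤ.* h) ≡ c ℤ.* (u ℤ.* h)
      swap u c h = trans (sym (ℤ.*-assoc u c h)) (trans (cong (ℤ._* h) (ℤ.*-comm u c)) (ℤ.*-assoc c u h))

    ∑*-sum : ∀ {m} (h : Fin m → K → ℤ) → ∑* (λ x → sum (λ j → h j x)) ≡ sum (λ j → ∑* (h j))
    ∑*-sum h = trans (sum-cong-≗ (λ x → sym (sum-*ˡ (𝟙 (unit? x)) (λ j → h j x))))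
      (∑-comm (λ x j → 𝟙 (unit? x) ℤ.* h j x))

    ∑*-1 : ∑* (λ _ → 1ℤ) ≡ ⁺ n
    ∑*-1 = trans (sum-cong-≗ (λ x → trans (ℤ.*-identityʳ _) (split x)))
      (trans (∑-distrib-+ (λ _ → 1ℤ) (λ x → ℤ.- 𝟙 (x ≟ 0#)))
        (trans (cong₂ ℤ._+_ (trans (sum-const (suc n) 1ℤ) (ℤ.*-identityʳ (⁺ suc n)))
                 (trans (sum-neg (λ x → 𝟙 (x ≟ 0#))) (cong ℤ.-_ (sum-one (_≡ 0#) (_≟ 0#) 0# refl (λ _ → id)))))
          refl))
      where
      split : ∀ x → 𝟙 (unit? x) ≡ 1ℤ ℤ.+ ℤ.- 𝟙 (x ≟ 0#)
      split x with x ≟ 0#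
      ... | yes _ = refl
      ... | no _  = refl

    private module Π = CMSum *-commutativeMonoid

    -- Multiplication by a permutes the units, so it fixes their product.
    lagrange : ∀ {a} → a ≢ 0# → a ^ n ≡ 1#
    lagrange {a} a≢0 = *-cancelʳ (Π-nonzero v v≢0) (begin
        a ^ n * Π.sum v ≡⟨ cong (_* Π.sum v) (sym Πa) ⟩
        Π.sum c * Π.sum v ≡⟨ sym (Π.∑-distrib-+ c v) ⟩
        Π.sum (λ x → c x * v x) ≡⟨ Π.sum-cong-≗ cv ⟩
        Π.sum (λ x → v (x * a)) ≡⟨ sym (Π.sum-permute v (scale a a≢0)) ⟩
        Π.sum v ≡⟨ sym (*-identityˡ _) ⟩
        1# * Π.sum v ∎)
      where
      -- Both functions are 1 at zero, so products over all of `K` see the units only, and `c`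
      -- contributes one factor `a` for each unit.
      v c : K → K
      v x with x ≟ 0#
      ... | yes _ = 1#
      ... | no _  = x
      c x with x ≟ 0#
      ... | yes _ = 1#
      ... | no _  = a
      v≢0 : ∀ x → v x ≢ 0#
      v≢0 x with x ≟ 0#
      ... | yes _  = 1≢0
      ... | no x≢0 = x≢0
      Π-nonzero : ∀ {m} (f : Fin m → K) → (∀ i → f i ≢ 0#) → Π.sum f ≢ 0#
      Π-nonzero {zero}  f ne = 1≢0
      Π-nonzero {suc m} f ne = *-nonzero (ne zero) (Π-nonzero (f ∘ suc) (ne ∘ suc))
      cv : ∀ x → c x * v x ≡ v (x * a)
      cv x with x ≟ 0# | x * a ≟ 0#
      ... | yes _    | yes _   = *-identityˡ 1#
      ... | yes refl | no ne   = ⊥-elim (ne (zeroˡ a))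
      ... | no x≢0   | yes xa≡0 = ⊥-elim (*-nonzero x≢0 a≢0 xa≡0)
      ... | no _     | no _    = *-comm a x
      c0 : c 0# ≡ 1#
      c0 with 0# ≟ 0#
      ... | yes _ = refl
      ... | no ne = ⊥-elim (ne refl)
      c-unit : ∀ x → x ≢ 0# → c x ≡ a
      c-unit x x≢0 with x ≟ 0#
      ... | yes x≡0 = ⊥-elim (x≢0 x≡0)
      ... | no _    = refl
      Πa : Π.sum c ≡ a ^ n
      Πa = begin
        Π.sum c ≡⟨ Π.sum-remove {n} {0#} c ⟩
        c 0# * Π.sum (λ j → c (punchIn 0# j)) ≡⟨ cong₂ _*_ c0 (Π.sum-cong-≗ (λ j → c-unit _ (λ e → punchInᵢ≢i 0# j e))) ⟩
        1# * Π.sum {n} (λ _ → a) ≡⟨ *-identityˡ _ ⟩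
        Π.sum {n} (λ _ → a) ≡⟨ Π.sum-replicate n ⟩
        a ^ n ∎

    -- Polynomials are lists of coefficients, the constant term first.
    eval : List K → K → K
    eval []       x = 0#
    eval (c ∷ cs) x = c + x * eval cs x

    -- Horner's scheme for (f(X) - f(a)) / (X - a): if f = c + X g, this quotient is g(a) + X (g(X)
    -- - g(a)) / (X - a).
    quotientBy : K → List K → List K
    quotientBy a []       = []
    quotientBy a (c ∷ []) = []
    quotientBy a (c ∷ cs@(_ ∷ _)) = eval cs a ∷ quotientBy a cs

    length-quotientBy : ∀ a cs → length (quotientBy a cs) ≡ length cs ∸ 1
    length-quotientBy a []           = refl
    length-quotientBy a (c ∷ [])     = refl
    length-quotientBy a (c ∷ cs@(_ ∷ _)) = cong suc (length-quotientBy a cs)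

    -- This is f(x) - f(a) = (x - a) q(x) with the negative terms moved across, so that it becomes
    -- an identity of semirings.
    eval-quotientBy : ∀ a cs x → eval cs x + a * eval (quotientBy a cs) x ≡ eval cs a + x * eval (quotientBy a cs) x
    eval-quotientBy a [] x = cong (0# +_) (trans (zeroʳ a) (sym (zeroʳ x)))
    eval-quotientBy a (c ∷ []) x = cong₂ _+_ (cong (c +_) (trans (zeroʳ x) (sym (zeroʳ a)))) (trans (zeroʳ a) (sym (zeroʳ x)))
    eval-quotientBy a (c ∷ cs@(_ ∷ _)) x = begin
        c + x * p + a * (pa + x * q)   ≡⟨ solve 6 (λ c x p a pa q → c :+ x :* p :+ a :* (pa :+ x :* q) := c :+ a :* pa :+ x :* (p :+ a :* q)) refl c x p a pa q ⟩
        c + a * pa + x * (p + a * q)   ≡⟨ cong (λ z → c + a * pa + x * z) (eval-quotientBy a cs x) ⟩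
        c + a * pa + x * (pa + x * q)  ∎
      where
      p pa q : K
      p = eval cs x
      pa = eval cs a
      q = eval (quotientBy a cs) x

    -- Dividing by X - a shortens the list by one and keeps the other roots. Measuring a polynomial
    -- by the length of its list avoids any case distinction on the leading coefficient.
    roots-vanish : ∀ cs xs → Unique xs → All (λ x → eval cs x ≡ 0#) xs → length cs ℕ.≤ length xs → ∀ y → eval cs y ≡ 0#
    roots-vanish [] xs u r le y = refl
    roots-vanish cs@(c ∷ cs′) (a ∷ xs) (a∉xs ∷ u) (ra ∷ r) (s≤s le) y = vanish y (roots-vanish q xs u (rootsq xs a∉xs r) le′ y)
      where
      q : List K
      q = quotientBy a cs
      le′ : length q ℕ.≤ length xs
      le′ = ℕ.≤-trans (ℕ.≤-reflexive (length-quotientBy a cs)) le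
      vanish : ∀ y → eval q y ≡ 0# → eval cs y ≡ 0#
      vanish y eq = begin
        eval cs y ≡⟨ sym (+-identityʳ _) ⟩
        eval cs y + 0# ≡⟨ cong (eval cs y +_) (sym (trans (cong (a *_) eq) (zeroʳ a))) ⟩
        eval cs y + a * eval q y ≡⟨ eval-quotientBy a cs y ⟩
        eval cs a + y * eval q y ≡⟨ cong₂ _+_ ra (trans (cong (y *_) eq) (zeroʳ y)) ⟩
        0# + 0# ≡⟨ +-identityˡ 0# ⟩
        0# ∎
      root : ∀ x → a ≢ x → eval cs x ≡ 0# → eval q x ≡ 0#
      root x a≢x rx with eval q x ≟ 0#
      ... | yes eq = eq
      ... | no ne  = ⊥-elim (a≢x (*-cancelʳ ne (begin
        a * eval q x ≡⟨ sym (+-identityˡ _) ⟩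
        0# + a * eval q x ≡⟨ cong (_+ a * eval q x) (sym rx) ⟩
        eval cs x + a * eval q x ≡⟨ eval-quotientBy a cs x ⟩
        eval cs a + x * eval q x ≡⟨ cong (_+ x * eval q x) ra ⟩
        0# + x * eval q x ≡⟨ +-identityˡ _ ⟩
        x * eval q x ∎)))
      rootsq : ∀ xs → All (a ≢_) xs → All (λ x → eval cs x ≡ 0#) xs → All (λ x → eval q x ≡ 0#) xs
      rootsq []       []       []       = []
      rootsq (x ∷ xs) (n ∷ ns) (r ∷ rs) = root x n r ∷ rootsq xs ns rs

    #-roots< : ∀ cs {P : K → Set} (P? : Decidable P) → (∀ x → P x → eval cs x ≡ 0#) → ∀ y → eval cs y ≢ 0# →
               # P? ℤ.< ⁺ length cs
    #-roots< cs P? P⇒root y ne = ℤ.≰⇒> (λ le → ne (roots-vanish cs xs (filter⁺ P? (allFin⁺ (suc n)))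
        (All.map (P⇒root _) (all-filter P? (allFin (suc n))))
        (ℤ.drop‿+≤+ (subst (⁺ length cs ℤ.≤_) (sym (length-filter-tabulate P? id)) le)) y))
      where
      xs : List K
      xs = filter P? (allFin (suc n))

    eval-X^ : ∀ m cs x → eval (replicate m 0# ++ cs) x ≡ x ^ m * eval cs x
    eval-X^ zero    cs x = sym (*-identityˡ _)
    eval-X^ (suc m) cs x = trans (+-identityˡ _) (trans (cong (x *_) (eval-X^ m cs x)) (sym (*-assoc x _ _)))

    #-^≡-≤ : ∀ m c .{{_ : ℕ.NonZero m}} → # (λ x → x ^ m ≟ c) ℤ.≤ ⁺ m
    #-^≡-≤ (suc m) c = <suc⇒≤ (subst (# (λ x → x ^ suc m ≟ c) ℤ.<_) (cong ⁺_ len) (bound (c ≟ 0#)))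
      where
      cs : List K
      cs = - c ∷ replicate m 0# ++ 1# ∷ []
      len : length cs ≡ suc (suc m)
      len = cong suc (trans (length-++ (replicate m 0#)) (trans (cong (ℕ._+ 1) (length-replicate m)) (ℕ.+-comm m 1)))
      evalcs : ∀ x → eval cs x ≡ - c + x ^ suc m
      evalcs x = cong (λ z → - c + x * z) (trans (eval-X^ m (1# ∷ []) x)
        (trans (cong (x ^ m *_) (trans (cong (1# +_) (zeroʳ x)) (+-identityʳ 1#))) (*-identityʳ _)))
      root : ∀ x → x ^ suc m ≡ c → eval cs x ≡ 0#
      root x eq = trans (evalcs x) (trans (cong ((- c) +_) eq) (-‿inverseˡ c))
      nonroot : ∀ x → x ^ suc m ≢ c → eval cs x ≢ 0#
      nonroot x ne eq = ne (+-cancelˡ (- c) (trans (sym (evalcs x)) (trans eq (sym (-‿inverseˡ c)))))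
      -- The root bound asks for a point where X ^ (m + 1) - c does not vanish: 1 if c = 0, and 0
      -- otherwise.
      bound : Dec (c ≡ 0#) → # (λ x → x ^ suc m ≟ c) ℤ.< ⁺ length cs
      bound (yes refl) = #-roots< cs _ root 1# (nonroot 1# (λ eq → 1≢0 (trans (sym (1^ (suc m))) eq)))
      bound (no c≢0)   = #-roots< cs _ root 0# (nonroot 0# (λ eq → c≢0 (trans (sym eq) (0^suc m))))

    -- Counting the units along the fibres of x ↦ x ^ e.
    #-≥-fibres : ∀ e .{{_ : ℕ.NonZero e}} {P : K → Set} (P? : Decidable P) → (∀ x → x ≢ 0# → P (x ^ e)) →
                 ⁺ n ℤ.≤ ⁺ e ℤ.* # P?
    #-≥-fibres e P? Pe = ℤ.≤-trans (ℤ.≤-reflexive (begin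
        ⁺ n ≡⟨ sym ∑*-1 ⟩
        ∑ (λ x → 𝟙 (unit? x) ℤ.* 1ℤ) ≡⟨ sum-cong-≗ (λ x → trans (ℤ.*-identityʳ _) (sym (sum-select (λ y → 𝟙 (unit? x)) (x ^ e)))) ⟩
        ∑ (λ x → ∑ (λ y → 𝟙 (y ≟ x ^ e) ℤ.* 𝟙 (unit? x))) ≡⟨ ∑-comm _ ⟩
        ∑ (λ y → ∑ (λ x → 𝟙 (y ≟ x ^ e) ℤ.* 𝟙 (unit? x))) ∎))
      (ℤ.≤-trans (sum-mono-≤ fibre) (ℤ.≤-reflexive (trans (sum-*ʳ (⁺ e) (λ y → 𝟙 (P? y))) (ℤ.*-comm _ (⁺ e)))))
      where
      term : ∀ y x → 𝟙 (y ≟ x ^ e) ℤ.* 𝟙 (unit? x) ℤ.≤ 𝟙 (P? y) ℤ.* 𝟙 (x ^ e ≟ y)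
      term y x with y ≟ x ^ e | x ≟ 0#
      ... | yes refl | no x≢0 = ℤ.≤-reflexive (sym (cong₂ ℤ._*_ (𝟙-yes (P? (x ^ e)) (Pe x x≢0)) (𝟙-yes (x ^ e ≟ x ^ e) refl)))
      ... | yes _ | yes _ = nonneg
        where nonneg : 0ℤ ℤ.≤ 𝟙 (P? y) ℤ.* 𝟙 (x ^ e ≟ y)
              nonneg = ℤ.≤-trans (ℤ.≤-reflexive (sym (ℤ.*-zeroʳ (𝟙 (P? y))))) (𝟙*-≤ (P? y) (λ _ → 𝟙-≥0 (x ^ e ≟ y)))
      ... | no _ | d = ℤ.≤-trans (ℤ.≤-reflexive (ℤ.*-zeroˡ (𝟙 (¬? d)))) (ℤ.≤-trans (ℤ.≤-reflexive (sym (ℤ.*-zeroʳ (𝟙 (P? y))))) (𝟙*-≤ (P? y) (λ _ → 𝟙-≥0 (x ^ e ≟ y))))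
      fibre : ∀ y → ∑ (λ x → 𝟙 (y ≟ x ^ e) ℤ.* 𝟙 (unit? x)) ℤ.≤ 𝟙 (P? y) ℤ.* ⁺ e
      fibre y = ℤ.≤-trans (sum-mono-≤ (term y)) (ℤ.≤-trans (ℤ.≤-reflexive (sum-*ˡ (𝟙 (P? y)) (λ x → 𝟙 (x ^ e ≟ y)))) (𝟙*-≤ (P? y) (λ _ → #-^≡-≤ e y)))

    #-^≡1 : ∀ e m .{{_ : ℕ.NonZero e}} .{{_ : ℕ.NonZero m}} → n ≡ e ℕ.* m → # (λ x → x ^ m ≟ 1#) ≡ ⁺ m
    #-^≡1 e m n≡em = ℤ.≤-antisym (#-^≡-≤ m 1#)
      -- Root counting gave the upper bound. For the lower one, the e-th powers of the n units are
      -- all solutions, and each is hit at most e times.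
      (ℤ.*-cancelˡ-≤-pos (⁺ m) _ (⁺ e) {{pos e}}
        (subst (ℤ._≤ ⁺ e ℤ.* # (λ x → x ^ m ≟ 1#)) (trans (cong ⁺_ n≡em) (ℤ.pos-* e m))
          (#-≥-fibres e (λ x → x ^ m ≟ 1#) (λ x x≢0 → trans (^-assocʳ x e m) (trans (cong (x ^_) (sym n≡em)) (lagrange x≢0))))))
      where
      pos : ∀ e .{{_ : ℕ.NonZero e}} → ℤ.Positive (⁺ e)
      pos (suc e) = _

    -- Otherwise X ^ m - 1 would have n > m roots. The witnesses become the `η` of `primeModulus`
    -- and `fourModulus`.
    ∃-^≢1 : ∀ m .{{_ : ℕ.NonZero m}} → m ℕ.< n → ∃ λ x → x ≢ 0# × x ^ m ≢ 1#
    ∃-^≢1 m m<n with any? (λ x → unit? x ×-dec ¬? (x ^ m ≟ 1#))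
    ... | yes p = p
    ... | no ¬p = ⊥-elim (ℕ.<⇒≱ m<n (ℤ.drop‿+≤+ (ℤ.≤-trans (ℤ.≤-reflexive (sym ∑*-1)) (ℤ.≤-trans (sum-mono-≤ le) (#-^≡-≤ m 1#)))))
      where
      le : ∀ x → 𝟙 (unit? x) ℤ.* 1ℤ ℤ.≤ 𝟙 (x ^ m ≟ 1#)
      le x with x ≟ 0#
      ... | yes _ = 𝟙-≥0 (x ^ m ≟ 1#)
      ... | no x≢0 with x ^ m ≟ 1#
      ...   | yes _ = ℤ.≤-refl
      ...   | no ne = ⊥-elim (¬p (x , x≢0 , ne))

-- Integer-valued character sums on the units and their orthogonality.

module Idempotents where

  open FiniteFields
  open IntegerSums
  open import Data.Fin.Base using (Fin; zero; suc; toℕ)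
  open import Data.Fin.Properties using (_≟_; any?; toℕ-injective; toℕ<n)
  open import Data.Integer.Base as ℤ using (ℤ; 0ℤ; 1ℤ; +≤+) renaming (+_ to ⁺_)
  import Data.Integer.Properties as ℤ
  open import Data.Integer.Tactic.RingSolver using (solve-∀)
  open import Data.List.Base using (List; []; _∷_; map)
  open import Data.Nat.Base as ℕ using (ℕ; zero; suc; z≤n; _∸_; NonZero)
  import Data.Nat.Properties as ℕ
  open import Data.Nat.Divisibility using (_∣_; ∣⇒≤)

  private
    e*e : ∀ m d d′ → (m ℤ.* d ℤ.- 1ℤ) ℤ.* (m ℤ.* d′ ℤ.- 1ℤ) ≡ m ℤ.* m ℤ.* (d ℤ.* d′) ℤ.+ (ℤ.- m ℤ.* d ℤ.+ (ℤ.- m ℤ.* d′ ℤ.+ 1ℤ))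
    e*e = solve-∀

    e*e-total : ∀ m d → m ℤ.* m ℤ.* d ℤ.+ (ℤ.- m ℤ.* 1ℤ ℤ.+ (ℤ.- m ℤ.* 1ℤ ℤ.+ m ℤ.* 1ℤ)) ≡ m ℤ.* (m ℤ.* d ℤ.- 1ℤ)
    e*e-total = solve-∀

    e-total : ∀ m → m ℤ.* 1ℤ ℤ.+ m ℤ.* (ℤ.- 1ℤ) ≡ m ℤ.* 0ℤ
    e-total = solve-∀

    interchange : ∀ a b c d → (a ℤ.* b) ℤ.* (c ℤ.* d) ≡ (a ℤ.* c) ℤ.* (b ℤ.* d)
    interchange = solve-∀

    left-comm : ∀ a b c → a ℤ.* (b ℤ.* c) ≡ b ℤ.* (a ℤ.* c)
    left-comm = solve-∀

  module AtomTheory {n : ℕ} (𝔽 : FiniteField n) where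
    open FieldTheory 𝔽
    open ≡-Reasoning

    -- `δ` is the indicator of the kernel of x ↦ x ^ c, a subgroup of index m. By `η-order` the
    -- element η ^ c has order m, so η generates the quotient by that kernel; it stands in for a
    -- generator of the whole unit group.
    record Modulus : Set where
      field
        m c : ℕ
        {{m≢0}} : NonZero m
        {{c≢0}} : NonZero c
        n≡m*c : n ≡ m ℕ.* c
        η : K
        η≢0 : η ≢ 0#
        η-order : ∀ j → (η ^ c) ^ j ≡ 1# → m ∣ j

      δ : K → ℤ
      δ x = 𝟙 (x ^ c ≟ 1#)

      e : K → ℤ
      e x = ⁺ m ℤ.* δ x ℤ.- 1ℤ

    open Modulus

    CoprimeModuli : Modulus → Modulus → Set
    CoprimeModuli M M′ = Coprime (m M) (m M′)

    φ : List Modulus → K → ℤ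
    φ []       x = 1ℤ
    φ (M ∷ Ms) x = e M x ℤ.* φ Ms x

    φ-weight : List Modulus → ℕ
    φ-weight []       = 1
    φ-weight (M ∷ Ms) = (m M ∸ 1) ℕ.* φ-weight Ms

    φ-1 : ∀ Ms → φ Ms 1# ≡ ⁺ φ-weight Ms
    φ-1 []       = refl
    φ-1 (M ∷ Ms) = begin
        (⁺ m M ℤ.* δ M 1# ℤ.- 1ℤ) ℤ.* φ Ms 1#
          ≡⟨ cong₂ ℤ._*_ (trans (cong (λ z → ⁺ m M ℤ.* z ℤ.- 1ℤ) (𝟙-yes (1# ^ c M ≟ 1#) (1^ (c M))))
               (trans (cong (ℤ._- 1ℤ) (ℤ.*-identityʳ (⁺ m M))) (pred-⊖ (m M)))) (φ-1 Ms) ⟩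
        ⁺ (m M ∸ 1) ℤ.* ⁺ φ-weight Ms ≡⟨ sym (ℤ.pos-* (m M ∸ 1) (φ-weight Ms)) ⟩
        ⁺ ((m M ∸ 1) ℕ.* φ-weight Ms) ∎
      where
      pred-⊖ : ∀ k .{{_ : NonZero k}} → ⁺ k ℤ.- 1ℤ ≡ ⁺ (k ∸ 1)
      pred-⊖ (suc k) = refl

    φ-cong-class : ∀ Ms x y → All (λ M → x ^ c M ≡ y ^ c M) Ms → φ Ms x ≡ φ Ms y
    φ-cong-class []       x y []       = refl
    φ-cong-class (M ∷ Ms) x y (p ∷ ps) =
      cong₂ ℤ._*_ (cong (λ z → ⁺ m M ℤ.* 𝟙 (z ≟ 1#) ℤ.- 1ℤ) p) (φ-cong-class Ms x y ps)

    *-^-trivial : ∀ x {h} k j → h ^ k ≡ 1# → (x * h ^ j) ^ k ≡ x ^ k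
    *-^-trivial x {h} k j eq = begin
      (x * h ^ j) ^ k ≡⟨ ^-distrib-* x (h ^ j) k ⟩
      x ^ k * (h ^ j) ^ k ≡⟨ cong (x ^ k *_) (trans (^-assoc-comm h j k) (trans (cong (_^ j) eq) (1^ j))) ⟩
      x ^ k * 1# ≡⟨ *-identityʳ _ ⟩
      x ^ k ∎

    -- The powers h⁰, …, hᵐ⁻¹ represent each coset of the kernel of x ↦ xᶜ once.
    module Average (M : Modulus) (h : K) (h≢0 : h ≢ 0#) (h-order : ∀ j → (h ^ c M) ^ j ≡ 1# → m M ∣ j) where
      private
        ζ : K
        ζ = h ^ c M
        ζ≢0 : ζ ≢ 0#
        ζ≢0 = ^-nonzero (c M) h≢0

      ^-shift : ∀ x j → (x * h ^ j) ^ c M ≡ x ^ c M * ζ ^ j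
      ^-shift x j = trans (^-distrib-* x (h ^ j) (c M)) (cong (x ^ c M *_) (^-assoc-comm h j (c M)))

      private
        ζ-inj′ : ∀ i k → i ℕ.+ k ℕ.< m M → ζ ^ i ≡ ζ ^ (i ℕ.+ k) → k ≡ 0
        ζ-inj′ i zero    lt eq = refl
        ζ-inj′ i (suc k) lt eq = ⊥-elim (ℕ.<⇒≱ (ℕ.≤-<-trans (ℕ.m≤n+m (suc k) i) lt) (∣⇒≤ (h-order (suc k)
          (sym (*-cancelˡ (^-nonzero i ζ≢0) (trans (*-identityʳ _) (trans eq (^-homo-* ζ i (suc k)))))))))

        ζ-inj : ∀ i j → i ℕ.< m M → j ℕ.< m M → ζ ^ i ≡ ζ ^ j → i ≡ j
        ζ-inj i j i< j< eq with ℕ.≤-total i j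
        ... | inj₁ i≤j with ℕ.m≤n⇒∃[o]m+o≡n i≤j
        ...   | k , refl = sym (trans (cong (i ℕ.+_) (ζ-inj′ i k j< eq)) (ℕ.+-identityʳ i))
        ζ-inj i j i< j< eq | inj₂ j≤i with ℕ.m≤n⇒∃[o]m+o≡n j≤i
        ...   | k , refl = trans (cong (j ℕ.+_) (ζ-inj′ j k i< (sym eq))) (ℕ.+-identityʳ j)

        N : K → ℤ
        N x = sum {m M} (λ j → δ M (x * h ^ toℕ j))

        N≤1 : ∀ x → x ≢ 0# → N x ℤ.≤ 1ℤ
        N≤1 x x≢0 with any? {n = m M} (λ j → (x * h ^ toℕ j) ^ c M ≟ 1#)
        ... | no ¬p = ℤ.≤-trans (ℤ.≤-reflexive (sum-zero _ (λ j → 𝟙-no (_ ≟ 1#) (λ eq → ¬p (j , eq))))) (+≤+ z≤n)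
        ... | yes (j , eq) = ℤ.≤-reflexive (sum-one _ (λ j → (x * h ^ toℕ j) ^ c M ≟ 1#) j eq (λ i eqi →
                toℕ-injective (ζ-inj (toℕ i) (toℕ j) (toℕ<n i) (toℕ<n j)
                  (*-cancelˡ (^-nonzero (c M) x≢0) (trans (sym (^-shift x (toℕ i))) (trans eqi (trans (sym eq) (^-shift x (toℕ j)))))))))

        ∑*N : ∑* N ≡ ∑* (λ _ → 1ℤ)
        ∑*N = begin
          ∑* N ≡⟨ ∑*-sum (λ j x → δ M (x * h ^ toℕ j)) ⟩
          sum {m M} (λ j → ∑* (λ x → δ M (x * h ^ toℕ j))) ≡⟨ sum-cong-≗ {m M} (λ j → ∑*-scale (δ M) (^-nonzero (toℕ j) h≢0)) ⟩
          sum {m M} (λ j → ∑* (δ M)) ≡⟨ sum-const (m M) _ ⟩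
          ⁺ m M ℤ.* ∑* (δ M) ≡⟨ cong (⁺ m M ℤ.*_) (trans (sum-cong-≗ units) (#-^≡1 (m M) (c M) (n≡m*c M))) ⟩
          ⁺ m M ℤ.* ⁺ c M ≡⟨ sym (ℤ.pos-* (m M) (c M)) ⟩
          ⁺ (m M ℕ.* c M) ≡⟨ cong ⁺_ (sym (n≡m*c M)) ⟩
          ⁺ n ≡⟨ sym ∑*-1 ⟩
          ∑* (λ _ → 1ℤ) ∎
          where
          0^c : ∀ c .{{_ : NonZero c}} → 0# ^ c ≢ 1#
          0^c (suc c) eq = 1≢0 (trans (sym eq) (0^suc c))
          units : ∀ x → 𝟙 (unit? x) ℤ.* δ M x ≡ δ M x
          units x with x ≟ 0#
          ... | yes refl = sym (𝟙-no (0# ^ c M ≟ 1#) (0^c (c M)))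
          ... | no _     = ℤ.*-identityˡ _

      -- The powers of h below m lie in different cosets, so at most one shift of x falls into the
      -- kernel. Summed over the units, both sides give n, hence exactly one shift does.
      ∑δ : ∀ x → x ≢ 0# → sum {m M} (λ j → δ M (x * h ^ toℕ j)) ≡ 1ℤ
      ∑δ x x≢0 = begin
        N x ≡⟨ sym (ℤ.*-identityˡ _) ⟩
        1ℤ ℤ.* N x ≡⟨ cong (ℤ._* N x) (sym (𝟙-yes (unit? x) x≢0)) ⟩
        𝟙 (unit? x) ℤ.* N x ≡⟨ sum-≤∧≡⇒≡ (λ y → 𝟙*-≤ (unit? y) (N≤1 y)) ∑*N x ⟩
        𝟙 (unit? x) ℤ.* 1ℤ ≡⟨ cong (ℤ._* 1ℤ) (𝟙-yes (unit? x) x≢0) ⟩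
        1ℤ ℤ.* 1ℤ ≡⟨⟩
        1ℤ ∎

      ∑e : ∀ x → x ≢ 0# → sum {m M} (λ j → e M (x * h ^ toℕ j)) ≡ ⁺ m M ℤ.* 0ℤ
      ∑e x x≢0 = begin
        sum {m M} (λ j → e M (x * h ^ toℕ j)) ≡⟨ ∑-distrib-+ {m M} (λ j → ⁺ m M ℤ.* δ M (x * h ^ toℕ j)) (λ _ → ℤ.- 1ℤ) ⟩
        sum {m M} (λ j → ⁺ m M ℤ.* δ M (x * h ^ toℕ j)) ℤ.+ sum {m M} (λ _ → ℤ.- 1ℤ)
          ≡⟨ cong₂ ℤ._+_ (trans (sum-*ˡ (⁺ m M) _) (cong (⁺ m M ℤ.*_) (∑δ x x≢0))) (sum-const (m M) _) ⟩
        ⁺ m M ℤ.* 1ℤ ℤ.+ ⁺ m M ℤ.* (ℤ.- 1ℤ) ≡⟨ e-total (⁺ m M) ⟩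
        ⁺ m M ℤ.* 0ℤ ∎

      -- Expand (m δ - 1)(m δ′ - 1). Where x hʲ lies in the kernel, y hʲ = k x hʲ does so exactly if
      -- k does, so the products δ δ′ add up to δ(k); each single δ adds up to 1 by `∑δ`.
      ∑e*e : ∀ k x y → k ≢ 0# → x ≢ 0# → y ≡ k * x →
             sum {m M} (λ j → e M (y * h ^ toℕ j) ℤ.* e M (x * h ^ toℕ j)) ≡ ⁺ m M ℤ.* e M k
      ∑e*e k x y k≢0 x≢0 refl = begin
        sum {m M} (λ j → e M (k * x * h ^ toℕ j) ℤ.* e M (x * h ^ toℕ j))
          ≡⟨ sum-cong-≗ (λ j → trans (e*e m′ (d j) (d′ j)) (cong (λ z → m′ ℤ.* m′ ℤ.* z ℤ.+ (ℤ.- m′ ℤ.* d j ℤ.+ (ℤ.- m′ ℤ.* d′ j ℤ.+ 1ℤ))) (dd j))) ⟩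
        sum (λ j → m′ ℤ.* m′ ℤ.* (δ M k ℤ.* d′ j) ℤ.+ (ℤ.- m′ ℤ.* d j ℤ.+ (ℤ.- m′ ℤ.* d′ j ℤ.+ 1ℤ)))
          ≡⟨ trans (∑-distrib-+ f₁ (λ j → f₂ j ℤ.+ (f₃ j ℤ.+ 1ℤ)))
               (cong (λ z → sum f₁ ℤ.+ z) (trans (∑-distrib-+ f₂ (λ j → f₃ j ℤ.+ 1ℤ)) (cong (λ z → sum f₂ ℤ.+ z) (∑-distrib-+ f₃ (λ _ → 1ℤ))))) ⟩
        sum (λ j → m′ ℤ.* m′ ℤ.* (δ M k ℤ.* d′ j)) ℤ.+ (sum (λ j → ℤ.- m′ ℤ.* d j) ℤ.+ (sum (λ j → ℤ.- m′ ℤ.* d′ j) ℤ.+ sum {m M} (λ _ → 1ℤ)))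
          ≡⟨ cong₂ ℤ._+_ (trans (sum-*ˡ (m′ ℤ.* m′) _) (cong (m′ ℤ.* m′ ℤ.*_) (trans (sum-*ˡ (δ M k) d′) (trans (cong (δ M k ℤ.*_) ∑d′) (ℤ.*-identityʳ _)))))
               (cong₂ ℤ._+_ (trans (sum-*ˡ (ℤ.- m′) d) (cong (ℤ.- m′ ℤ.*_) (∑δ (k * x) (*-nonzero k≢0 x≢0))))
                 (cong₂ ℤ._+_ (trans (sum-*ˡ (ℤ.- m′) d′) (cong (ℤ.- m′ ℤ.*_) ∑d′)) (sum-const (m M) 1ℤ))) ⟩
        m′ ℤ.* m′ ℤ.* δ M k ℤ.+ (ℤ.- m′ ℤ.* 1ℤ ℤ.+ (ℤ.- m′ ℤ.* 1ℤ ℤ.+ m′ ℤ.* 1ℤ)) ≡⟨ e*e-total m′ (δ M k) ⟩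
        m′ ℤ.* e M k ∎
        where
        m′ : ℤ
        m′ = ⁺ m M
        d d′ f₁ f₂ f₃ : Fin (m M) → ℤ
        f₁ j = m′ ℤ.* m′ ℤ.* (δ M k ℤ.* d′ j)
        f₂ j = ℤ.- m′ ℤ.* d j
        f₃ j = ℤ.- m′ ℤ.* d′ j
        d j = δ M (k * x * h ^ toℕ j)
        d′ j = δ M (x * h ^ toℕ j)
        ∑d′ : sum d′ ≡ 1ℤ
        ∑d′ = ∑δ x x≢0
        dd : ∀ j → d j ℤ.* d′ j ≡ δ M k ℤ.* d′ j
        dd j with (x * h ^ toℕ j) ^ c M ≟ 1#
        ... | no _  = trans (ℤ.*-zeroʳ (d j)) (sym (ℤ.*-zeroʳ (δ M k)))
        ... | yes eq = cong (λ z → 𝟙 (z ≟ 1#) ℤ.* 1ℤ) (begin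
          (k * x * h ^ toℕ j) ^ c M ≡⟨ cong (_^ c M) (*-assoc k x _) ⟩
          (k * (x * h ^ toℕ j)) ^ c M ≡⟨ ^-distrib-* k _ (c M) ⟩
          k ^ c M * (x * h ^ toℕ j) ^ c M ≡⟨ cong (k ^ c M *_) eq ⟩
          k ^ c M * 1# ≡⟨ *-identityʳ _ ⟩
          k ^ c M ∎)

      -- Replacing x by x hʲ permutes the units and leaves ψ unchanged, so A may be replaced by its
      -- mean C over these shifts. This splits one modulus off a product.
      ∑*-average : ∀ (A ψ : K → ℤ) C → (∀ j x → ψ (x * h ^ j) ≡ ψ x) →
                   (∀ x → x ≢ 0# → sum {m M} (λ j → A (x * h ^ toℕ j)) ≡ ⁺ m M ℤ.* C) →
                   ∑* (λ x → A x ℤ.* ψ x) ≡ C ℤ.* ∑* ψ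
      ∑*-average A ψ C inv eq = ℤ.*-cancelˡ-≡ (⁺ m M) _ _ {{m≢0 M}} (begin
        ⁺ m M ℤ.* ∑* (λ x → A x ℤ.* ψ x) ≡⟨ sym (sum-const (m M) _) ⟩
        sum {m M} (λ j → ∑* (λ x → A x ℤ.* ψ x)) ≡⟨ sum-cong-≗ {m M} (λ j → sym (∑*-scale (λ x → A x ℤ.* ψ x) (^-nonzero (toℕ j) h≢0))) ⟩
        sum {m M} (λ j → ∑* (λ x → A (x * h ^ toℕ j) ℤ.* ψ (x * h ^ toℕ j)))
          ≡⟨ sum-cong-≗ {m M} (λ j → ∑*-cong (λ x _ → cong (A (x * h ^ toℕ j) ℤ.*_) (inv (toℕ j) x))) ⟩
        sum {m M} (λ j → ∑* (λ x → A (x * h ^ toℕ j) ℤ.* ψ x)) ≡⟨ sym (∑*-sum (λ j x → A (x * h ^ toℕ j) ℤ.* ψ x)) ⟩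
        ∑* (λ x → sum {m M} (λ j → A (x * h ^ toℕ j) ℤ.* ψ x))
          ≡⟨ ∑*-cong (λ x x≢0 → trans (sum-*ʳ (ψ x) _) (trans (cong (ℤ._* ψ x) (eq x x≢0)) (ℤ.*-assoc (⁺ m M) C (ψ x)))) ⟩
        ∑* (λ x → ⁺ m M ℤ.* (C ℤ.* ψ x)) ≡⟨ trans (∑*-*ˡ (⁺ m M) _) (cong (⁺ m M ℤ.*_) (∑*-*ˡ C ψ)) ⟩
        ⁺ m M ℤ.* (C ℤ.* ∑* ψ) ∎)

    -- Raising η to the product of the other moduli makes it trivial for them and keeps its order at M.
    purify : ∀ M Ms → All (CoprimeModuli M) Ms → Σ K λ h → h ≢ 0# × All (λ M′ → h ^ c M′ ≡ 1#) Ms × (∀ j → (h ^ c M) ^ j ≡ 1# → m M ∣ j)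
    purify M []        []        = η M , η≢0 M , [] , η-order M
    purify M (M′ ∷ Ms) (cop ∷ cops) with purify M Ms cops
    ... | h , h≢0 , triv , ord = h ^ m M′ , ^-nonzero (m M′) h≢0 ,
        trans (^-assocʳ h (m M′) (c M′)) (trans (cong (h ^_) (sym (n≡m*c M′))) (lagrange h≢0)) ∷
        All.map (λ {M″} eq → trans (^-assoc-comm h (m M′) (c M″)) (trans (cong (_^ m M′) eq) (1^ (m M′)))) triv ,
        λ j eq → coprime-divisor cop (ord (m M′ ℕ.* j) (trans (sym (^-assocʳ (h ^ c M) (m M′) j)) (trans (cong (_^ j) (^-assoc-comm h (c M) (m M′))) eq)))

    -- Here k is the ratio a / b. `purify` yields an h that only the first modulus sees; averaging
    -- over its powers turns e(x a) e(x b) into e(k) and leaves the same sum for the remaining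
    -- moduli.
    φ-idempotent : ∀ Ms → AllPairs CoprimeModuli Ms → ∀ {a b} k → k ≢ 0# → b ≢ 0# → a ≡ k * b →
                   ∑* (λ x → φ Ms (x * a) ℤ.* φ Ms (x * b)) ≡ ⁺ n ℤ.* φ Ms k
    φ-idempotent [] [] k k≢0 b≢0 eq = trans ∑*-1 (sym (ℤ.*-identityʳ (⁺ n)))
    φ-idempotent (M ∷ Ms) (cop ∷ cops) {a} {b} k k≢0 b≢0 a≡kb with purify M Ms cop
    ... | h , h≢0 , triv , ord = begin
        ∑* (λ x → (e M (x * a) ℤ.* φ Ms (x * a)) ℤ.* (e M (x * b) ℤ.* φ Ms (x * b)))
          ≡⟨ ∑*-cong (λ x _ → interchange (e M (x * a)) _ _ _) ⟩
        ∑* (λ x → A x ℤ.* ψ x) ≡⟨ ∑*-average A ψ (e M k) inv total ⟩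
        e M k ℤ.* ∑* ψ ≡⟨ cong (e M k ℤ.*_) (φ-idempotent Ms cops k k≢0 b≢0 a≡kb) ⟩
        e M k ℤ.* (⁺ n ℤ.* φ Ms k) ≡⟨ left-comm (e M k) (⁺ n) _ ⟩
        ⁺ n ℤ.* (e M k ℤ.* φ Ms k) ∎
      where
      open Average M h h≢0 ord
      A ψ : K → ℤ
      A x = e M (x * a) ℤ.* e M (x * b)
      ψ x = φ Ms (x * a) ℤ.* φ Ms (x * b)
      swap : ∀ x y z → x * y * z ≡ x * z * y
      swap x y z = trans (*-assoc x y z) (trans (cong (x *_) (*-comm y z)) (sym (*-assoc x z y)))
      inv′ : ∀ j x y → φ Ms (x * h ^ j * y) ≡ φ Ms (x * y)
      inv′ j x y = trans (cong (φ Ms) (swap x (h ^ j) y))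
        (φ-cong-class Ms _ _ (All.map (λ {M′} eq → *-^-trivial (x * y) (c M′) j eq) triv))
      inv : ∀ j x → ψ (x * h ^ j) ≡ ψ x
      inv j x = cong₂ ℤ._*_ (inv′ j x a) (inv′ j x b)
      total : ∀ x → x ≢ 0# → sum {m M} (λ j → A (x * h ^ toℕ j)) ≡ ⁺ m M ℤ.* e M k
      total x x≢0 = trans (sum-cong-≗ {m M} (λ j → cong₂ (λ y z → e M y ℤ.* e M z) (swap x (h ^ toℕ j) a) (swap x (h ^ toℕ j) b)))
        (∑e*e k (x * b) (x * a) k≢0 (*-nonzero x≢0 b≢0)
          (trans (cong (x *_) a≡kb) (trans (sym (*-assoc x k b)) (trans (cong (_* b) (*-comm x k)) (*-assoc k x b)))))

    -- A nonempty product contains nontrivial characters only: averaging over the shifts seen by `M`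
    -- alone already gives 0.
    ∑*φ≡0 : ∀ M Ms → All (CoprimeModuli M) Ms → ∑* (φ (M ∷ Ms)) ≡ 0ℤ
    ∑*φ≡0 M Ms cop with purify M Ms cop
    ... | h , h≢0 , triv , ord = trans (Average.∑*-average M h h≢0 ord (e M) (φ Ms) 0ℤ
      (λ j x → φ-cong-class Ms _ _ (All.map (λ {M′} eq → *-^-trivial x (c M′) j eq) triv))
      (Average.∑e M h h≢0 ord)) (ℤ.*-zeroˡ (∑* (φ Ms)))

-- The characteristic and the Frobenius map.

module FrobeniusMap where

  open FiniteFields
  open IntegerSums
  open import Data.Fin.Base as Fin using (Fin; zero; suc; fromℕ; inject₁)
  open import Data.Fin.Properties using (_≟_; toℕ-fromℕ; toℕ-inject₁; toℕ<n)
  open import Data.Fin.Permutation using (Permutation; permutation)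
  open import Data.Nat.Base as ℕ using (ℕ; zero; suc; z≤n; s≤s; _∸_; _!)
  import Data.Nat.Properties as ℕ
  open import Data.Nat.Combinatorics using (_C_; k![n∸k]!∣n!; nCn≡1)
  open import Data.Nat.Combinatorics.Specification using (nCk≡n!/k![n-k]!)
  open import Data.Nat.Divisibility using (_∣_; divides; ∣⇒≤; m∣m*n; >⇒∤)
  open import Data.Nat.Properties using (_!*_!≢0)
  import Algebra.Properties.CommutativeMonoid.Sum as CMSum
  import Algebra.Properties.CommutativeSemiring.Binomial as Binomial
  import Algebra.Properties.Semiring.Mult as Mult

  prime∤! : ∀ {p} → Prime p → ∀ k → k ℕ.< p → ¬ (p ∣ k !)
  prime∤! pp zero    k<p p∣1 = ℕ.<⇒≱ (ℕ.nonTrivial⇒n>1 _ {{prime⇒nonTrivial pp}}) (∣⇒≤ p∣1)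
  prime∤! pp (suc k) k<p p∣ with euclidsLemma (suc k) (k !) pp p∣
  ... | inj₁ p∣suc = >⇒∤ k<p p∣suc
  ... | inj₂ p∣k!  = prime∤! pp k (ℕ.<⇒≤ k<p) p∣k!

  -- p divides p! = C(p, k) k! (p - k)! but neither of the two factorials.
  prime∣C : ∀ {p} → Prime p → ∀ {k} → 0 ℕ.< k → k ℕ.< p → p ∣ p C k
  prime∣C {suc p} pp {suc k} _ k<p with euclidsLemma (suc p C suc k) (suc k ! ℕ.* (p ∸ k) !) pp (subst (suc p ∣_) (sym eq) (m∣m*n (p !)))
    where
    eq : (suc p C suc k) ℕ.* (suc k ! ℕ.* (p ∸ k) !) ≡ suc p !
    eq = trans (cong (ℕ._* (suc k ! ℕ.* (p ∸ k) !)) (nCk≡n!/k![n-k]! (ℕ.<⇒≤ k<p)))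
           (m/n*n≡m {{suc k !* (p ∸ k) !≢0}} (k![n∸k]!∣n! (ℕ.<⇒≤ k<p)))
  ... | inj₁ d = d
  ... | inj₂ d with euclidsLemma (suc k !) ((p ∸ k) !) pp d
  ...   | inj₁ d′ = ⊥-elim (prime∤! pp (suc k) k<p d′)
  ...   | inj₂ d′ = ⊥-elim (prime∤! pp (p ∸ k) (s≤s (ℕ.m∸n≤m p k)) d′)

  module Frobenius {n : ℕ} (𝔽 : FiniteField n) {p : ℕ} (pp : Prime p) (k : ℕ) (N≡ : suc n ≡ (p ℕ.^ k) ℕ.* (p ℕ.^ k)) where
    open FieldTheory 𝔽
    open Mult semiring using (×1-homo-*; ×-assocˡ; ×-assoc-*; ×-congʳ; ×-homo-1) renaming (_×_ to _⨯_)
    private module S = CMSum +-commutativeMonoid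
    open ≡-Reasoning

    private
      shift : Permutation (suc n) (suc n)
      shift = permutation (_+ 1#) (_+ (- 1#))
        (λ x → trans (+-assoc x (- 1#) 1#) (trans (cong (x +_) (-‿inverseˡ 1#)) (+-identityʳ x)))
        (λ x → trans (+-assoc x 1# (- 1#)) (trans (cong (x +_) (-‿inverseʳ 1#)) (+-identityʳ x)))

      -- Adding 1 permutes the elements, so their sum stays the same although it grows by 1 for
      -- every element.
      card⨯1 : suc n ⨯ 1# ≡ 0#
      card⨯1 = sym (+-cancelˡ (S.sum {suc n} (λ x → x)) (begin
        S.sum {suc n} (λ x → x) + 0# ≡⟨ +-identityʳ _ ⟩
        S.sum {suc n} (λ x → x) ≡⟨ S.sum-permute (λ x → x) shift ⟩
        S.sum {suc n} (λ x → x + 1#) ≡⟨ S.∑-distrib-+ (λ x → x) (λ _ → 1#) ⟩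
        S.sum {suc n} (λ x → x) + S.sum {suc n} (λ _ → 1#) ≡⟨ cong (S.sum {suc n} (λ x → x) +_) (S.sum-replicate (suc n)) ⟩
        S.sum {suc n} (λ x → x) + suc n ⨯ 1# ∎))

      ^⨯1 : ∀ j → p ⨯ 1# ≢ 0# → (p ℕ.^ j) ⨯ 1# ≢ 0#
      ^⨯1 zero    ne eq = 1≢0 (trans (sym (×-homo-1 1#)) eq)
      ^⨯1 (suc j) ne eq = *-nonzero ne (^⨯1 j ne) (trans (sym (×1-homo-* p (p ℕ.^ j))) eq)

    -- The number of elements is a power of p, so a power of p · 1 vanishes, and a field has no zero
    -- divisors.
    char : p ⨯ 1# ≡ 0#
    char with p ⨯ 1# ≟ 0#
    ... | yes eq = eq
    ... | no ne  = ⊥-elim (*-nonzero (^⨯1 k ne) (^⨯1 k ne)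
          (trans (sym (×1-homo-* (p ℕ.^ k) (p ℕ.^ k))) (trans (cong (_⨯ 1#) (sym N≡)) card⨯1)))

    ∣⇒⨯≡0 : ∀ {c} x → p ∣ c → c ⨯ x ≡ 0#
    ∣⇒⨯≡0 x (divides c refl) = begin
      (c ℕ.* p) ⨯ x ≡⟨ cong ((c ℕ.* p) ⨯_) (sym (*-identityˡ x)) ⟩
      (c ℕ.* p) ⨯ (1# * x) ≡⟨ sym (×-assoc-* (c ℕ.* p) 1# x) ⟩
      ((c ℕ.* p) ⨯ 1#) * x ≡⟨ cong (_* x) (trans (×1-homo-* c p) (trans (cong ((c ⨯ 1#) *_) char) (zeroʳ _))) ⟩
      0# * x ≡⟨ zeroˡ x ⟩
      0# ∎

    private
      frob′ : ∀ p′ → p ≡ suc p′ → ∀ x y → (x + y) ^ p ≡ x ^ p + y ^ p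
      frob′ p′ refl x y = begin
        (x + y) ^ p ≡⟨ B.theorem p x y ⟩
        t zero + S.sum (λ j → t (suc j)) ≡⟨ cong (t zero +_) (S.sum-init-last (λ j → t (suc j))) ⟩
        t zero + (S.sum (λ j → t (suc (inject₁ j))) + t (suc (fromℕ p′)))
          ≡⟨ cong₂ _+_ first (cong₂ _+_ (trans (S.sum-cong-≗ middle) (S.sum-replicate-zero p′)) last) ⟩
        y ^ p + (0# + x ^ p) ≡⟨ trans (cong (y ^ p +_) (+-identityˡ _)) (+-comm _ _) ⟩
        x ^ p + y ^ p ∎
        where
        module B = Binomial commutativeSemiring
        t : Fin (suc p) → K
        t = B.binomialTerm x y p
        first : t zero ≡ y ^ p
        first = trans (×-homo-1 _) (*-identityˡ _)
        last : t (suc (fromℕ p′)) ≡ x ^ p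
        last rewrite toℕ-fromℕ p′ | nCn≡1 p | ℕ.n∸n≡0 p′ = trans (×-homo-1 _) (*-identityʳ _)
        middle : ∀ j → t (suc (inject₁ j)) ≡ 0#
        middle j = ∣⇒⨯≡0 _ (prime∣C pp (s≤s z≤n) (s≤s (subst (ℕ._< p′) (sym (toℕ-inject₁ j)) (toℕ<n j))))

    frobenius : ∀ x y → (x + y) ^ p ≡ x ^ p + y ^ p
    frobenius = frob′ (p ∸ 1) (sym (ℕ.suc-pred p {{prime⇒nonZero pp}}))

    frobenius^ : ∀ j x y → (x + y) ^ (p ℕ.^ j) ≡ x ^ (p ℕ.^ j) + y ^ (p ℕ.^ j)
    frobenius^ zero    x y = trans (*-identityʳ _) (sym (cong₂ _+_ (*-identityʳ x) (*-identityʳ y)))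
    frobenius^ (suc j) x y = begin
      (x + y) ^ (p ℕ.* p ℕ.^ j) ≡⟨ sym (^-assocʳ (x + y) p (p ℕ.^ j)) ⟩
      ((x + y) ^ p) ^ (p ℕ.^ j) ≡⟨ cong (_^ (p ℕ.^ j)) (frobenius x y) ⟩
      (x ^ p + y ^ p) ^ (p ℕ.^ j) ≡⟨ frobenius^ j (x ^ p) (y ^ p) ⟩
      (x ^ p) ^ (p ℕ.^ j) + (y ^ p) ^ (p ℕ.^ j) ≡⟨ cong₂ _+_ (^-assocʳ x p _) (^-assocʳ y p _) ⟩
      x ^ (p ℕ.* p ℕ.^ j) + y ^ (p ℕ.* p ℕ.^ j) ∎

-- The extension over its fixed field `B`, and the ratios of translates.

module QuadraticExtensions where

  open FiniteFields
  open IntegerSums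
  open FrobeniusMap
  open Idempotents
  open import Data.Fin.Base as Fin using (suc)
  open import Data.Fin.Properties using (_≟_)
  open import Data.Fin.Permutation using (Permutation; permutation)
  open import Data.Integer.Base as ℤ using (ℤ; 1ℤ) renaming (+_ to ⁺_)
  import Data.Integer.Properties as ℤ
  open import Data.Integer.Tactic.RingSolver using (solve-∀)
  import Data.List.Relation.Unary.All as All
  import Data.List.Relation.Unary.AllPairs as AllPairs
  open import Data.Nat.Base as ℕ using (ℕ; suc; _∸_; NonZero)
  import Data.Nat.Properties as ℕ

  module Quadratic {n : ℕ} (𝔽 : FiniteField n) {p : ℕ} (pp : Prime p) (k : ℕ)
    (1<q : 1 ℕ.< p ℕ.^ k) (N≡ : suc n ≡ (p ℕ.^ k) ℕ.* (p ℕ.^ k)) where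
    open FieldTheory 𝔽
    open AtomTheory 𝔽
    open Frobenius 𝔽 pp k N≡
    open ≡-Reasoning

    q : ℕ
    q = p ℕ.^ k

    q≡1+ : q ≡ suc (q ∸ 1)
    q≡1+ = sym (ℕ.m+[n∸m]≡n (ℕ.<⇒≤ 1<q))

    instance
      q∸1≢0 : NonZero (q ∸ 1)
      q∸1≢0 = ℕ.>-nonZero (ℕ.m<n⇒0<n∸m 1<q)

    n≡[q+1][q-1] : n ≡ suc q ℕ.* (q ∸ 1)
    n≡[q+1][q-1] = ℕ.suc-injective (trans N≡ (square (q ∸ 1) q≡1+))
      where
      square : ∀ r → q ≡ suc r → q ℕ.* q ≡ suc (suc q ℕ.* r)
      square r eq rewrite eq = cong suc (cong (r ℕ.+_) (ℕ.*-suc r r))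

    B : K → Set
    B x = x ^ q ≡ x

    B? : Decidable B
    B? x = x ^ q ≟ x

    ^q-* : ∀ x y → (x * y) ^ q ≡ x ^ q * y ^ q
    ^q-* x y = ^-distrib-* x y q

    ^q-+ : ∀ x y → (x + y) ^ q ≡ x ^ q + y ^ q
    ^q-+ = frobenius^ k

    ^q-0 : 0# ^ q ≡ 0#
    ^q-0 = trans (cong (0# ^_) q≡1+) (0^suc (q ∸ 1))

    ^q-neg : ∀ x → (- x) ^ q ≡ - (x ^ q)
    ^q-neg x = +-cancelˡ (x ^ q) (begin
      x ^ q + (- x) ^ q ≡⟨ sym (^q-+ x (- x)) ⟩
      (x + - x) ^ q ≡⟨ cong (_^ q) (-‿inverseʳ x) ⟩
      0# ^ q ≡⟨ ^q-0 ⟩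
      0# ≡⟨ sym (-‿inverseʳ (x ^ q)) ⟩
      x ^ q + - (x ^ q) ∎)

    ^q-involutive : ∀ x → (x ^ q) ^ q ≡ x
    ^q-involutive x = trans (^-assocʳ x q q) (trans (cong (x ^_) (sym N≡)) (fixed (x ≟ 0#)))
      where
      fixed : Dec (x ≡ 0#) → x * x ^ n ≡ x
      fixed (yes refl) = zeroˡ _
      fixed (no x≢0)   = trans (cong (x *_) (lagrange x≢0)) (*-identityʳ x)

    B-0 : B 0#
    B-0 = ^q-0

    B-1 : B 1#
    B-1 = 1^ q

    B-+ : ∀ {x y} → B x → B y → B (x + y)
    B-+ {x} {y} bx by = trans (^q-+ x y) (cong₂ _+_ bx by)

    B-* : ∀ {x y} → B x → B y → B (x * y)
    B-* {x} {y} bx by = trans (^q-* x y) (cong₂ _*_ bx by)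

    B-neg : ∀ {x} → B x → B (- x)
    B-neg {x} bx = trans (^q-neg x) (cong -_ bx)

    B-inv : ∀ {x y} → B x → x * y ≡ 1# → B y
    B-inv {x} {y} bx xy≡1 = *-cancelˡ (*≡1⇒≢0 xy≡1) (begin
      x * y ^ q ≡⟨ cong (_* y ^ q) (sym bx) ⟩
      x ^ q * y ^ q ≡⟨ sym (^q-* x y) ⟩
      (x * y) ^ q ≡⟨ cong (_^ q) xy≡1 ⟩
      1# ^ q ≡⟨ 1^ q ⟩
      1# ≡⟨ sym xy≡1 ⟩
      x * y ∎)

    -- The fixed points are 0 and the solutions of x ^ (q - 1) = 1, whose number is exact because q
    -- - 1 divides n.
    #B : # B? ≡ ⁺ q
    #B = begin
      # B? ≡⟨ sum-cong-≗ split ⟩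
      ∑ (λ x → 𝟙 (x ≟ 0#) ℤ.+ 𝟙 (x ^ (q ∸ 1) ≟ 1#)) ≡⟨ ∑-distrib-+ (λ x → 𝟙 (x ≟ 0#)) (λ x → 𝟙 (x ^ (q ∸ 1) ≟ 1#)) ⟩
      # (_≟ 0#) ℤ.+ # (λ x → x ^ (q ∸ 1) ≟ 1#) ≡⟨ cong₂ ℤ._+_ (sum-one (_≡ 0#) (_≟ 0#) 0# refl (λ _ → id)) (#-^≡1 (suc q) (q ∸ 1) n≡[q+1][q-1]) ⟩
      1ℤ ℤ.+ ⁺ (q ∸ 1) ≡⟨ cong ⁺_ (sym q≡1+) ⟩
      ⁺ q ∎
      where
      q∸1 : ∀ x → x ^ q ≡ x * x ^ (q ∸ 1)
      q∸1 x = cong (x ^_) q≡1+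
      0^nz : ∀ m .{{_ : NonZero m}} → 0# ^ m ≡ 0#
      0^nz (suc m) = 0^suc m
      split : ∀ x → 𝟙 (B? x) ≡ 𝟙 (x ≟ 0#) ℤ.+ 𝟙 (x ^ (q ∸ 1) ≟ 1#)
      split x with x ≟ 0#
      ... | yes refl = trans (𝟙-yes (B? 0#) B-0) (cong (λ z → 1ℤ ℤ.+ z) (sym (𝟙-no (0# ^ (q ∸ 1) ≟ 1#)
              (λ eq → 1≢0 (trans (sym eq) (0^nz (q ∸ 1)))))))
      ... | no x≢0   = trans (𝟙-cong (B? x) (x ^ (q ∸ 1) ≟ 1#)
              (λ b → *-cancelˡ x≢0 (trans (sym (q∸1 x)) (trans b (sym (*-identityʳ x)))))
              (λ eq → trans (q∸1 x) (trans (cong (x *_) eq) (*-identityʳ x)))) (sym (ℤ.+-identityˡ _))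

    -- The coordinates of y in the basis 1, θ are read off from y and its conjugate y ^ q.
    basis : ∀ {θ} → ¬ B θ → ∀ y → ∃ λ a → ∃ λ b → B a × B b × y ≡ a + b * θ
    basis {θ} θ∉B y = a , b , B-a , B-b , y≡
      where
      Δ δ b a : K
      Δ = θ + - (θ ^ q)
      δ = y + - (y ^ q)
      Δ≢0 : Δ ≢ 0#
      Δ≢0 eq = θ∉B (+-cancelʳ (- (θ ^ q)) (trans (-‿inverseʳ (θ ^ q)) (sym eq)))
      b = δ * Δ ⁻¹
      a = y + - (b * θ)
      bΔ : b * Δ ≡ δ
      bΔ = ⁻¹-*-cancelʳ δ Δ≢0
      conj : ∀ z → (z + - (z ^ q)) ^ q ≡ - (z + - (z ^ q))
      conj z = begin
        (z + - (z ^ q)) ^ q ≡⟨ ^q-+ z _ ⟩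
        z ^ q + (- (z ^ q)) ^ q ≡⟨ cong (z ^ q +_) (trans (^q-neg (z ^ q)) (cong -_ (^q-involutive z))) ⟩
        z ^ q + - z ≡⟨ +-comm _ _ ⟩
        - z + z ^ q ≡⟨ cong (- z +_) (sym (-‿involutive (z ^ q))) ⟩
        - z + - - (z ^ q) ≡⟨ -‿+-comm z _ ⟩
        - (z + - (z ^ q)) ∎
      -- Conjugation negates both Δ and δ, so it fixes their quotient.
      B-b : B b
      B-b = *-cancelʳ (λ eq → Δ≢0 (trans (sym (-‿involutive Δ)) (trans (cong -_ eq) -0#≈0#))) (begin
        b ^ q * - Δ ≡⟨ cong (b ^ q *_) (sym (conj θ)) ⟩
        b ^ q * Δ ^ q ≡⟨ sym (^q-* b Δ) ⟩
        (b * Δ) ^ q ≡⟨ cong (_^ q) bΔ ⟩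
        δ ^ q ≡⟨ conj y ⟩
        - δ ≡⟨ cong -_ (sym bΔ) ⟩
        - (b * Δ) ≡⟨ -‿distribʳ-* b Δ ⟩
        b * - Δ ∎)
      B-a : B a
      B-a = +-cancelʳ (b * θ) (begin
        a ^ q + b * θ ≡⟨ cong (_+ b * θ) (trans (^q-+ y _) (cong (y ^ q +_) (trans (^q-neg (b * θ)) (cong -_ (trans (^q-* b θ) (cong (_* θ ^ q) B-b)))))) ⟩
        y ^ q + - (b * θ ^ q) + b * θ ≡⟨ trans (+-assoc _ _ _) (cong (y ^ q +_) (trans (+-comm _ _) (cong (b * θ +_) (-‿distribʳ-* b (θ ^ q))))) ⟩
        y ^ q + (b * θ + b * - (θ ^ q)) ≡⟨ cong (y ^ q +_) (trans (sym (distribˡ b θ _)) bΔ) ⟩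
        y ^ q + (y + - (y ^ q)) ≡⟨ trans (sym (+-assoc _ _ _)) (trans (cong (_+ - (y ^ q)) (+-comm (y ^ q) y)) (trans (+-assoc _ _ _) (trans (cong (y +_) (-‿inverseʳ _)) (+-identityʳ y)))) ⟩
        y ≡⟨ y≡ ⟩
        a + b * θ ∎)
        where
        y≡ : y ≡ a + b * θ
        y≡ = sym (trans (+-assoc y _ _) (trans (cong (y +_) (-‿inverseˡ _)) (+-identityʳ y)))
      y≡ : y ≡ a + b * θ
      y≡ = sym (trans (+-assoc y _ _) (trans (cong (y +_) (-‿inverseˡ _)) (+-identityʳ y)))

    module Translates {θ : K} (θ∉B : ¬ B θ) where

      -- Independence of 1 and θ over `B`: a nonzero a would give θ = a⁻¹ ((a θ + b) - b) in `B`.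
      linear : ∀ {a b} → B a → B b → B (a * θ + b) → a ≡ 0#
      linear {a} {b} Ba Bb Bc with a ≟ 0#
      ... | yes eq = eq
      ... | no a≢0 = ⊥-elim (θ∉B (subst B eq (B-* (B-inv Ba (*-inverseʳ a≢0)) (B-+ Bc (B-neg Bb)))))
        where
        eq : a ⁻¹ * (a * θ + b + - b) ≡ θ
        eq = begin
          a ⁻¹ * (a * θ + b + - b) ≡⟨ cong (a ⁻¹ *_) (trans (+-assoc _ _ _) (trans (cong (a * θ +_) (-‿inverseʳ b)) (+-identityʳ _))) ⟩
          a ⁻¹ * (a * θ) ≡⟨ trans (*-comm _ _) (trans (cong (_* a ⁻¹) (*-comm a θ)) (*-⁻¹-cancelʳ θ a≢0)) ⟩
          θ ∎

      θ+≢0 : ∀ {x} → B x → θ + x ≢ 0#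
      θ+≢0 {x} Bx eq = 1≢0 (linear B-1 Bx (subst B (sym (trans (cong (_+ x) (*-identityˡ θ)) eq)) B-0))

      private
        -- Division-free form of z = (θ + x) / (θ + y) with x and y in `B`: the numerator is z (θ +
        -- y), so x is z (θ + y) - θ.
        Pair : K → K → Set
        Pair z y = B y × B (z * (θ + y) + - θ)

        -- In the basis 1, θ the θ-coordinate of z (θ + y) is a + b t + b y. It must be 1, a linear
        -- equation for y with b ≠ 0. Two solutions with difference d would put z d into `B`, which
        -- forces d = 0.
        solution : ∀ z → ¬ B z → ∀ a b s t → B a → B b → B s → B t → z ≡ a + b * θ → θ * θ ≡ s + t * θ →
                   ∃ λ y → Pair z y × (∀ y′ → Pair z y′ → y′ ≡ y)
        solution z z∉B a b s t Ba Bb Bs Bt z≡ θθ≡ = y , (By , Bx) , uniq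
          where
          b≢0 : b ≢ 0#
          b≢0 refl = z∉B (subst B (sym (trans z≡ (trans (cong (a +_) (zeroˡ θ)) (+-identityʳ a)))) Ba)
          y : K
          y = b ⁻¹ * (1# + - (a + b * t))
          By : B y
          By = B-* (B-inv Bb (*-inverseʳ b≢0)) (B-+ B-1 (B-neg (B-+ Ba (B-* Bb Bt))))
          by : a + b * t + b * y ≡ 1#
          by = begin
            a + b * t + b * y ≡⟨ cong (a + b * t +_) (trans (sym (*-assoc b _ _)) (trans (cong (_* (1# + - (a + b * t))) (*-inverseʳ b≢0)) (*-identityˡ _))) ⟩
            a + b * t + (1# + - (a + b * t)) ≡⟨ trans (+-comm _ _) (+-assoc _ _ _) ⟩
            1# + (- (a + b * t) + (a + b * t)) ≡⟨ trans (cong (1# +_) (-‿inverseˡ _)) (+-identityʳ 1#) ⟩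
            1# ∎
          x≡ : z * (θ + y) ≡ θ + (b * s + a * y)
          x≡ = begin
            z * (θ + y) ≡⟨ cong (_* (θ + y)) z≡ ⟩
            (a + b * θ) * (θ + y) ≡⟨ solve 4 (λ a b θ y → (a :+ b :* θ) :* (θ :+ y) := a :* θ :+ a :* y :+ b :* (θ :* θ) :+ b :* θ :* y) refl a b θ y ⟩
            a * θ + a * y + b * (θ * θ) + b * θ * y ≡⟨ cong (λ w → a * θ + a * y + b * w + b * θ * y) θθ≡ ⟩
            a * θ + a * y + b * (s + t * θ) + b * θ * y ≡⟨ solve 6 (λ a b θ y s t → a :* θ :+ a :* y :+ b :* (s :+ t :* θ) :+ b :* θ :* y := (a :+ b :* t :+ b :* y) :* θ :+ (b :* s :+ a :* y)) refl a b θ y s t ⟩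
            (a + b * t + b * y) * θ + (b * s + a * y) ≡⟨ cong (_+ (b * s + a * y)) (trans (cong (_* θ) by) (*-identityˡ θ)) ⟩
            θ + (b * s + a * y) ∎
          Bx : B (z * (θ + y) + - θ)
          Bx = subst B (sym (trans (cong (_+ - θ) x≡) (trans (cong (_+ - θ) (+-comm θ _)) (trans (+-assoc _ _ _) (trans (cong (b * s + a * y +_) (-‿inverseʳ θ)) (+-identityʳ _))))))
            (B-+ (B-* Bb Bs) (B-* Ba By))
          uniq : ∀ y′ → Pair z y′ → y′ ≡ y
          uniq y′ (By′ , Bx′) = sym (+-cancelʳ (- y′) (trans (linear′ (y + - y′) (B-+ By (B-neg By′)) diff) (sym (-‿inverseʳ y′))))
            where
            linear′ : ∀ d → B d → B (z * d) → d ≡ 0#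
            linear′ d Bd Bzd with d ≟ 0#
            ... | yes eq = eq
            ... | no d≢0 = ⊥-elim (z∉B (subst B (*-⁻¹-cancelʳ z d≢0) (B-* Bzd (B-inv Bd (*-inverseʳ d≢0)))))
            diff : B (z * (y + - y′))
            diff = subst B (begin
              z * (θ + y) + - θ + - (z * (θ + y′) + - θ) ≡⟨ cong (z * (θ + y) + - θ +_) (trans (sym (-‿+-comm _ _)) (cong₂ _+_ (trans (-‿distribʳ-* z _) (cong (z *_) (sym (-‿+-comm θ y′)))) (-‿involutive θ))) ⟩
              z * (θ + y) + - θ + (z * (- θ + - y′) + θ) ≡⟨ solve 5 (λ z θ mθ y my′ → z :* (θ :+ y) :+ mθ :+ (z :* (mθ :+ my′) :+ θ) := z :* (y :+ my′) :+ (z :* (θ :+ mθ) :+ (θ :+ mθ))) refl z θ (- θ) y (- y′) ⟩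
              z * (y + - y′) + (z * (θ + - θ) + (θ + - θ)) ≡⟨ cong (z * (y + - y′) +_) (trans (cong₂ _+_ (trans (cong (z *_) (-‿inverseʳ θ)) (zeroʳ z)) (-‿inverseʳ θ)) (+-identityʳ 0#)) ⟩
              z * (y + - y′) + 0# ≡⟨ +-identityʳ _ ⟩
              z * (y + - y′) ∎) (B-+ Bx (B-neg Bx′))

        ν-proof : ∀ z → ¬ B z → ∃ λ y → Pair z y × (∀ y′ → Pair z y′ → y′ ≡ y)
        ν-proof z z∉B = let a , b , Ba , Bb , z≡ = basis θ∉B z
                            s , t , Bs , Bt , θθ≡ = basis θ∉B (θ * θ)
                        in solution z z∉B a b s t Ba Bb Bs Bt z≡ θθ≡

        ν : K → ℤ
        ν z = ∑ λ y → 𝟙 (B? y ×-dec B? (z * (θ + y) + - θ))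

        -- The ratio 1 arises from every y, with x = y; another z in `B` never arises, by
        -- independence; a z outside `B` arises once, by `solution`.
        ν-case : ∀ z (d : Dec (z ≡ 1#)) (e : Dec (B z)) → ν z ≡ ⁺ q ℤ.* 𝟙 d ℤ.+ 𝟙 (¬? e)
        ν-case z (yes refl) (no ¬b) = ⊥-elim (¬b B-1)
        ν-case z (yes refl) (yes _) = trans (sum-cong-≗ (λ y → 𝟙-cong (B? y ×-dec B? (1# * (θ + y) + - θ)) (B? y) proj₁ (λ b → b , subst B (sym (one y)) b)))
                (trans #B (sym (trans (ℤ.+-identityʳ _) (ℤ.*-identityʳ (⁺ q)))))
          where
          one : ∀ y → 1# * (θ + y) + - θ ≡ y
          one y = trans (cong (_+ - θ) (trans (*-identityˡ _) (+-comm θ y))) (trans (+-assoc y θ _) (trans (cong (y +_) (-‿inverseʳ θ)) (+-identityʳ y)))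
        ν-case z (no z≢1) (yes Bz) = trans (sum-zero _ (λ y → 𝟙-no (B? y ×-dec B? (z * (θ + y) + - θ)) (λ { (By , Bx) → z≢1 (contra y By Bx) })))
                (sym (trans (ℤ.+-identityʳ _) (ℤ.*-zeroʳ (⁺ q))))
          where
          contra : ∀ y → B y → B (z * (θ + y) + - θ) → z ≡ 1#
          contra y By Bx = +-cancelʳ (- 1#) (trans (linear {z + - 1#} {z * y} (B-+ Bz (B-neg B-1)) (B-* Bz By) (subst B (begin
            z * (θ + y) + - θ ≡⟨ cong (z * (θ + y) +_) (trans (cong -_ (sym (*-identityˡ θ))) (-‿distribˡ-* 1# θ)) ⟩
            z * (θ + y) + - 1# * θ ≡⟨ solve 4 (λ z θ y m → z :* (θ :+ y) :+ m :* θ := (z :+ m) :* θ :+ z :* y) refl z θ y (- 1#) ⟩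
            (z + - 1#) * θ + z * y ∎) Bx)) (sym (-‿inverseʳ 1#)))
        ν-case z (no z≢1) (no z∉B) = let y , P , uniq = ν-proof z z∉B in
          trans (sum-one _ (λ y → B? y ×-dec B? (z * (θ + y) + - θ)) y P uniq)
                (sym (trans (cong (ℤ._+ 1ℤ) (ℤ.*-zeroʳ (⁺ q))) refl))

        ν≡ : ∀ z → ν z ≡ ⁺ q ℤ.* 𝟙 (z ≟ 1#) ℤ.+ 𝟙 (¬? (B? z))
        ν≡ z = ν-case z (z ≟ 1#) (B? z)

      -- The ratios of two distinct elements of θ + B run exactly once through the elements outside B.
      ∑-ratios : ∀ (f : K → ℤ) → ∑ (λ y → 𝟙 (B? y) ℤ.* ∑ (λ x → 𝟙 (B? x) ℤ.* f ((θ + x) * (θ + y) ⁻¹)))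
               ≡ ⁺ q ℤ.* f 1# ℤ.+ ∑ (λ z → 𝟙 (¬? (B? z)) ℤ.* f z)
      ∑-ratios f = begin
        ∑ (λ y → 𝟙 (B? y) ℤ.* ∑ (λ x → 𝟙 (B? x) ℤ.* f ((θ + x) * (θ + y) ⁻¹))) ≡⟨ sum-cong-≗ (λ y → 𝟙*-cong (B? y) (reindex y)) ⟩
        ∑ (λ y → 𝟙 (B? y) ℤ.* ∑ (λ z → 𝟙 (B? (z * (θ + y) + - θ)) ℤ.* f z)) ≡⟨ sum-cong-≗ (λ y → trans (sym (sum-*ˡ (𝟙 (B? y)) _)) (sum-cong-≗ (λ z → trans (sym (ℤ.*-assoc (𝟙 (B? y)) _ _)) (cong (ℤ._* f z) (𝟙-× (B? y) (B? (z * (θ + y) + - θ))))))) ⟩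
        ∑ (λ y → ∑ (λ z → 𝟙 (B? y ×-dec B? (z * (θ + y) + - θ)) ℤ.* f z)) ≡⟨ ∑-comm _ ⟩
        ∑ (λ z → ∑ (λ y → 𝟙 (B? y ×-dec B? (z * (θ + y) + - θ)) ℤ.* f z)) ≡⟨ sum-cong-≗ (λ z → trans (sum-*ʳ (f z) _) (trans (cong (ℤ._* f z) (ν≡ z)) (expand (⁺ q) (𝟙 (z ≟ 1#)) _ (f z)))) ⟩
        ∑ (λ z → 𝟙 (z ≟ 1#) ℤ.* (⁺ q ℤ.* f z) ℤ.+ 𝟙 (¬? (B? z)) ℤ.* f z) ≡⟨ ∑-distrib-+ (λ z → 𝟙 (z ≟ 1#) ℤ.* (⁺ q ℤ.* f z)) _ ⟩
        ∑ (λ z → 𝟙 (z ≟ 1#) ℤ.* (⁺ q ℤ.* f z)) ℤ.+ ∑ (λ z → 𝟙 (¬? (B? z)) ℤ.* f z) ≡⟨ cong (ℤ._+ ∑ (λ z → 𝟙 (¬? (B? z)) ℤ.* f z)) (sum-select (λ z → ⁺ q ℤ.* f z) 1#) ⟩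
        ⁺ q ℤ.* f 1# ℤ.+ ∑ (λ z → 𝟙 (¬? (B? z)) ℤ.* f z) ∎
        where
        expand : ∀ q d e f → (q ℤ.* d ℤ.+ e) ℤ.* f ≡ d ℤ.* (q ℤ.* f) ℤ.+ e ℤ.* f
        expand = solve-∀
        𝟙-× : ∀ {P Q : Set} (d : Dec P) (e : Dec Q) → 𝟙 d ℤ.* 𝟙 e ≡ 𝟙 (d ×-dec e)
        𝟙-× (yes _) (yes _) = refl
        𝟙-× (yes _) (no _)  = refl
        𝟙-× (no _)  e       = refl
        -- For fixed y the ratio z = (θ + x) / (θ + y) runs through `K` together with x, so the
        -- inner sum can be taken over z.
        reindex : ∀ y → B y → ∑ (λ x → 𝟙 (B? x) ℤ.* f ((θ + x) * (θ + y) ⁻¹)) ≡ ∑ (λ z → 𝟙 (B? (z * (θ + y) + - θ)) ℤ.* f z)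
        reindex y By = sym (trans (sum-permute (λ z → 𝟙 (B? (z * (θ + y) + - θ)) ℤ.* f z) π) (sum-cong-≗ (λ x → cong (λ w → 𝟙 (B? w) ℤ.* f ((θ + x) * u ⁻¹)) (back x))))
          where
          u : K
          u = θ + y
          u≢0 : u ≢ 0#
          u≢0 = θ+≢0 By
          back : ∀ x → (θ + x) * u ⁻¹ * u + - θ ≡ x
          back x = trans (cong (_+ - θ) (trans (⁻¹-*-cancelʳ (θ + x) u≢0) (+-comm θ x))) (trans (+-assoc x θ _) (trans (cong (x +_) (-‿inverseʳ θ)) (+-identityʳ x)))
          forth : ∀ z → (θ + (z * u + - θ)) * u ⁻¹ ≡ z
          forth z = trans (cong (_* u ⁻¹) (trans (+-comm θ _) (trans (+-assoc _ _ _) (trans (cong (z * u +_) (-‿inverseˡ θ)) (+-identityʳ _))))) (*-⁻¹-cancelʳ z u≢0)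
          π : Permutation (suc n) (suc n)
          π = permutation (λ x → (θ + x) * u ⁻¹) (λ z → z * u + - θ) forth back

-- The square-root bound for sums over a set of translates.

module CharacterSumBound where

  open FiniteFields
  open IntegerSums
  open FrobeniusMap
  open Idempotents
  open QuadraticExtensions
  open import Data.Fin.Base as Fin using (suc)
  open import Data.Fin.Properties using (_≟_)
  open import Data.Integer.Base as ℤ using (ℤ; 0ℤ; 1ℤ; +≤+; ∣_∣) renaming (+_ to ⁺_)
  import Data.Integer.Properties as ℤ
  open import Data.Integer.Tactic.RingSolver using (solve-∀)
  open import Data.Nat.Tactic.RingSolver using () renaming (solve-∀ to ℕ-solve-∀)
  open import Data.List.Base using ([]; _∷_)
  open import Data.Nat.Base as ℕ using (ℕ; suc; z≤n; _∸_; NonZero)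
  import Data.Nat.Properties as ℕ

  private
    interchange : ∀ a b c d → (a ℤ.* b) ℤ.* (c ℤ.* d) ≡ (a ℤ.* c) ℤ.* (b ℤ.* d)
    interchange = solve-∀

    left-comm : ∀ a b c → a ℤ.* (b ℤ.* c) ≡ b ℤ.* (a ℤ.* c)
    left-comm = solve-∀

    expand-square : ∀ w X t p → (w ℤ.* t ℤ.- X ℤ.* p) ℤ.* (w ℤ.* t ℤ.- X ℤ.* p) ≡
      w ℤ.* w ℤ.* (t ℤ.* t) ℤ.+ (ℤ.- (w ℤ.* X) ℤ.- w ℤ.* X) ℤ.* (t ℤ.* p) ℤ.+ X ℤ.* X ℤ.* (p ℤ.* p)
    expand-square = solve-∀

    collect : ∀ w X N V → w ℤ.* w ℤ.* (N ℤ.* V) ℤ.+ (ℤ.- (w ℤ.* X) ℤ.- w ℤ.* X) ℤ.* (N ℤ.* X) ℤ.+ X ℤ.* X ℤ.* (N ℤ.* w) ≡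
      N ℤ.* (w ℤ.* (w ℤ.* V ℤ.- X ℤ.* X))
    collect = solve-∀

    square-≥0 : ∀ x → 0ℤ ℤ.≤ x ℤ.* x
    square-≥0 (⁺ n)      = ℤ.≤-trans (+≤+ z≤n) (ℤ.≤-reflexive (ℤ.pos-* n n))
    square-≥0 ℤ.-[1+ n ] = +≤+ z≤n

    cancel-≥0 : ∀ k .{{_ : NonZero k}} {x} → 0ℤ ℤ.≤ ⁺ k ℤ.* x → 0ℤ ℤ.≤ x
    cancel-≥0 (suc k) {x} le = ℤ.*-cancelˡ-≤-pos 0ℤ x (⁺ suc k) (ℤ.≤-trans (ℤ.≤-reflexive (ℤ.*-zeroʳ (⁺ suc k))) le)

  module WeilBound {n : ℕ} (𝔽 : FiniteField n) {p : ℕ} (pp : Prime p) (k : ℕ)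
    (1<q : 1 ℕ.< p ℕ.^ k) (N≡ : suc n ≡ (p ℕ.^ k) ℕ.* (p ℕ.^ k)) where
    open FieldTheory 𝔽
    open AtomTheory 𝔽
    open Quadratic 𝔽 pp k 1<q N≡
    open ≡-Reasoning

    instance
      n≢0 : NonZero n
      n≢0 = subst NonZero (sym n≡[q+1][q-1]) (ℕ.m*n≢0 (suc q) (q ∸ 1))

    -- One expansion for two second moments: d is the identity for the subgroup of units of `B`, and
    -- θ + _ for the translate set.
    ∑*-square : ∀ (u : K → ℤ) (d : K → K) (f : K → ℤ) →
      ∑* (λ g → ∑ (λ x → u x ℤ.* f (g * d x)) ℤ.* ∑ (λ x → u x ℤ.* f (g * d x))) ≡
      ∑ (λ y → u y ℤ.* ∑ (λ x → u x ℤ.* ∑* (λ g → f (g * d x) ℤ.* f (g * d y))))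
    ∑*-square u d f = begin
      ∑* (λ g → T g ℤ.* T g) ≡⟨ ∑*-cong (λ g _ → trans (sym (sum-*ˡ (T g) (λ y → u y ℤ.* f (g * d y)))) (sum-cong-≗ (λ y → left-comm (T g) (u y) _))) ⟩
      ∑* (λ g → ∑ (λ y → u y ℤ.* (T g ℤ.* f (g * d y)))) ≡⟨ ∑*-sum (λ y g → u y ℤ.* (T g ℤ.* f (g * d y))) ⟩
      ∑ (λ y → ∑* (λ g → u y ℤ.* (T g ℤ.* f (g * d y)))) ≡⟨ sum-cong-≗ (λ y → trans (∑*-*ˡ (u y) _) (cong (u y ℤ.*_) (inner y))) ⟩
      ∑ (λ y → u y ℤ.* ∑ (λ x → u x ℤ.* ∑* (λ g → f (g * d x) ℤ.* f (g * d y)))) ∎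
      where
      T : K → ℤ
      T g = ∑ (λ x → u x ℤ.* f (g * d x))
      inner : ∀ y → ∑* (λ g → T g ℤ.* f (g * d y)) ≡ ∑ (λ x → u x ℤ.* ∑* (λ g → f (g * d x) ℤ.* f (g * d y)))
      inner y = trans (∑*-cong (λ g _ → trans (sym (sum-*ʳ (f (g * d y)) _)) (sum-cong-≗ (λ x → ℤ.*-assoc (u x) _ _))))
        (trans (∑*-sum (λ x g → u x ℤ.* (f (g * d x) ℤ.* f (g * d y)))) (sum-cong-≗ (λ x → ∑*-*ˡ (u x) _)))

    B*? : Decidable (λ x → B x × x ≢ 0#)
    B*? x = B? x ×-dec unit? x

    #B* : # B*? ≡ ⁺ (q ∸ 1)
    #B* = begin
      # B*? ≡⟨ sum-cong-≗ split ⟩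
      ∑ (λ x → 𝟙 (B? x) ℤ.+ ℤ.- 𝟙 (x ≟ 0#)) ≡⟨ ∑-distrib-+ (λ x → 𝟙 (B? x)) (λ x → ℤ.- 𝟙 (x ≟ 0#)) ⟩
      # B? ℤ.+ ∑ (λ x → ℤ.- 𝟙 (x ≟ 0#)) ≡⟨ cong₂ ℤ._+_ #B (trans (sum-neg (λ x → 𝟙 (x ≟ 0#))) (cong ℤ.-_ (sum-one (_≡ 0#) (_≟ 0#) 0# refl (λ _ e → e)))) ⟩
      ⁺ q ℤ.+ ℤ.- 1ℤ ≡⟨ cong (λ z → ⁺ z ℤ.+ ℤ.- 1ℤ) q≡1+ ⟩
      ⁺ (q ∸ 1) ∎
      where
      split : ∀ x → 𝟙 (B*? x) ≡ 𝟙 (B? x) ℤ.+ ℤ.- 𝟙 (x ≟ 0#)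
      split x with x ≟ 0# | B? x
      ... | yes refl | no ¬b = ⊥-elim (¬b B-0)
      ... | yes refl | yes _ = refl
      ... | no _ | yes _ = refl
      ... | no _ | no _  = refl

    -- φ is positive definite, so its sum over a subgroup is nonnegative.
    ∑B*φ≥0 : ∀ Ms → AllPairs CoprimeModuli Ms → 0ℤ ℤ.≤ ∑ (λ x → 𝟙 (B*? x) ℤ.* φ Ms x)
    ∑B*φ≥0 Ms cop = cancel-≥0 (q ∸ 1) (cancel-≥0 n (ℤ.≤-trans nonneg (ℤ.≤-reflexive eq)))
      where
      u : K → ℤ
      u x = 𝟙 (B*? x)
      W : ℤ
      W = ∑ (λ x → u x ℤ.* φ Ms x)
      T : K → ℤ
      T g = ∑ (λ x → u x ℤ.* φ Ms (g * x))
      nonneg : 0ℤ ℤ.≤ ∑* (λ g → T g ℤ.* T g)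
      nonneg = sum-≥0 (λ g → ℤ.≤-trans (ℤ.≤-reflexive (sym (ℤ.*-zeroʳ (𝟙 (unit? g))))) (𝟙*-≤ (unit? g) (λ _ → square-≥0 (T g))))
      -- By idempotence the inner sums are n φ(x / y), and x ↦ x / y permutes the units of `B`; so
      -- each y contributes the same n W.
      term : ∀ y → B y × y ≢ 0# → ∑ (λ x → u x ℤ.* ∑* (λ g → φ Ms (g * x) ℤ.* φ Ms (g * y))) ≡ ⁺ n ℤ.* W
      term y (By , y≢0) = begin
        ∑ (λ x → u x ℤ.* ∑* (λ g → φ Ms (g * x) ℤ.* φ Ms (g * y)))
          ≡⟨ sum-cong-≗ (λ x → trans (𝟙*-cong (B*? x) (λ { (Bx , x≢0) → φ-idempotent Ms cop (x * y ⁻¹) (*-nonzero x≢0 (⁻¹-nonzero y≢0)) y≢0 (sym (⁻¹-*-cancelʳ x y≢0)) })) (left-comm (u x) (⁺ n) _)) ⟩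
        ∑ (λ x → ⁺ n ℤ.* (u x ℤ.* φ Ms (x * y ⁻¹))) ≡⟨ sum-*ˡ (⁺ n) _ ⟩
        ⁺ n ℤ.* ∑ (λ x → u x ℤ.* φ Ms (x * y ⁻¹)) ≡⟨ cong (⁺ n ℤ.*_) (sum-cong-≗ (λ x → cong (ℤ._* φ Ms (x * y ⁻¹)) (𝟙-cong (B*? x) (B*? (x * y ⁻¹))
              (λ { (Bx , x≢0) → B-* Bx By⁻¹ , *-nonzero x≢0 (⁻¹-nonzero y≢0) })
              (λ { (Bxy , xy≢0) → subst B (⁻¹-*-cancelʳ x y≢0) (B-* Bxy By) , (λ { refl → xy≢0 (zeroˡ _) }) })))) ⟩
        ⁺ n ℤ.* ∑ (λ x → u (x * y ⁻¹) ℤ.* φ Ms (x * y ⁻¹)) ≡⟨ cong (⁺ n ℤ.*_) (sym (sum-permute (λ x → u x ℤ.* φ Ms x) (scale (y ⁻¹) (⁻¹-nonzero y≢0)))) ⟩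
        ⁺ n ℤ.* W ∎
        where
        By⁻¹ : B (y ⁻¹)
        By⁻¹ = B-inv By (*-inverseʳ y≢0)
      eq : ∑* (λ g → T g ℤ.* T g) ≡ ⁺ n ℤ.* (⁺ (q ∸ 1) ℤ.* W)
      eq = begin
        ∑* (λ g → T g ℤ.* T g) ≡⟨ ∑*-square u (λ x → x) (φ Ms) ⟩
        ∑ (λ y → u y ℤ.* ∑ (λ x → u x ℤ.* ∑* (λ g → φ Ms (g * x) ℤ.* φ Ms (g * y)))) ≡⟨ sum-cong-≗ (λ y → 𝟙*-cong (B*? y) (term y)) ⟩
        ∑ (λ y → u y ℤ.* (⁺ n ℤ.* W)) ≡⟨ sum-*ʳ (⁺ n ℤ.* W) u ⟩
        # B*? ℤ.* (⁺ n ℤ.* W) ≡⟨ cong (ℤ._* (⁺ n ℤ.* W)) #B* ⟩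
        ⁺ (q ∸ 1) ℤ.* (⁺ n ℤ.* W) ≡⟨ left-comm (⁺ (q ∸ 1)) (⁺ n) W ⟩
        ⁺ n ℤ.* (⁺ (q ∸ 1) ℤ.* W) ∎

    φ-weight≢0 : ∀ Ms → All (λ M → 1 ℕ.< Modulus.m M) Ms → NonZero (φ-weight Ms)
    φ-weight≢0 []       []       = _
    φ-weight≢0 (M ∷ Ms) (p ∷ ps) = ℕ.m*n≢0 (Modulus.m M ∸ 1) (φ-weight Ms) {{ℕ.>-nonZero (ℕ.m<n⇒0<n∸m p)}} {{φ-weight≢0 Ms ps}}

    module _ {θ : K} (θ∉B : ¬ B θ) where
      open Translates θ∉B

      -- The analogue of |∑ χ(θ + x)| ≤ √q for the character sums hidden in φ.
      translate-sum² : ∀ M Ms → AllPairs CoprimeModuli (M ∷ Ms) → All (λ M → 1 ℕ.< Modulus.m M) (M ∷ Ms) → ∀ s → s ≢ 0# →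
        let X = ∑ (λ x → 𝟙 (B? x) ℤ.* φ (M ∷ Ms) (s * (θ + x))) ; w = ⁺ φ-weight (M ∷ Ms) in
        X ℤ.* X ℤ.≤ w ℤ.* (⁺ q ℤ.* w)
      translate-sum² M Ms cop@(cop₀ ∷ _) big s s≢0 = ℤ.≤-trans
          (ℤ.0≤i-j⇒j≤i (cancel-≥0 (φ-weight (M ∷ Ms)) {{φ-weight≢0 (M ∷ Ms) big}} (cancel-≥0 n (ℤ.≤-trans nonneg (ℤ.≤-reflexive eq)))))
          (ℤ.*-monoˡ-≤-nonNeg w V≤)
        where
        f : K → ℤ
        f = φ (M ∷ Ms)
        w X V : ℤ
        w = ⁺ φ-weight (M ∷ Ms)
        X = ∑ (λ x → 𝟙 (B? x) ℤ.* f (s * (θ + x)))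
        V = ⁺ q ℤ.* f 1# ℤ.+ ∑ (λ z → 𝟙 (¬? (B? z)) ℤ.* f z)
        T : K → ℤ
        T g = ∑ (λ x → 𝟙 (B? x) ℤ.* f (g * (θ + x)))
        nonneg : 0ℤ ℤ.≤ ∑* (λ g → (w ℤ.* T g ℤ.- X ℤ.* f (g * s ⁻¹)) ℤ.* (w ℤ.* T g ℤ.- X ℤ.* f (g * s ⁻¹)))
        nonneg = sum-≥0 (λ g → ℤ.≤-trans (ℤ.≤-reflexive (sym (ℤ.*-zeroʳ (𝟙 (unit? g))))) (𝟙*-≤ (unit? g) (λ _ → square-≥0 (w ℤ.* T g ℤ.- X ℤ.* f (g * s ⁻¹)))))
        s⁻¹≢0 : s ⁻¹ ≢ 0#
        s⁻¹≢0 = ⁻¹-nonzero s≢0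
        -- A Cauchy-Schwarz argument over the units: T has square norm n V, its product with g ↦ f(g
        -- / s) is n X because f reproduces under convolution, and that function has square norm n
        -- w. The nonnegative sum is therefore n w (w V - X²).
        TT : ∑* (λ g → T g ℤ.* T g) ≡ ⁺ n ℤ.* V
        TT = begin
          ∑* (λ g → T g ℤ.* T g) ≡⟨ ∑*-square (λ x → 𝟙 (B? x)) (θ +_) f ⟩
          ∑ (λ y → 𝟙 (B? y) ℤ.* ∑ (λ x → 𝟙 (B? x) ℤ.* ∑* (λ g → f (g * (θ + x)) ℤ.* f (g * (θ + y)))))
            ≡⟨ sum-cong-≗ (λ y → trans (𝟙*-cong (B? y) (λ By → trans (sum-cong-≗ (λ x → trans (𝟙*-cong (B? x) (λ Bx →
                 φ-idempotent (M ∷ Ms) cop ((θ + x) * (θ + y) ⁻¹) (*-nonzero (θ+≢0 Bx) (⁻¹-nonzero (θ+≢0 By))) (θ+≢0 By) (sym (⁻¹-*-cancelʳ (θ + x) (θ+≢0 By))))) (left-comm (𝟙 (B? x)) (⁺ n) _)))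
                 (sum-*ˡ (⁺ n) _))) (left-comm (𝟙 (B? y)) (⁺ n) _)) ⟩
          ∑ (λ y → ⁺ n ℤ.* (𝟙 (B? y) ℤ.* ∑ (λ x → 𝟙 (B? x) ℤ.* f ((θ + x) * (θ + y) ⁻¹)))) ≡⟨ sum-*ˡ (⁺ n) _ ⟩
          ⁺ n ℤ.* ∑ (λ y → 𝟙 (B? y) ℤ.* ∑ (λ x → 𝟙 (B? x) ℤ.* f ((θ + x) * (θ + y) ⁻¹))) ≡⟨ cong (⁺ n ℤ.*_) (∑-ratios f) ⟩
          ⁺ n ℤ.* V ∎
        Tf : ∑* (λ g → T g ℤ.* f (g * s ⁻¹)) ≡ ⁺ n ℤ.* X
        Tf = begin
          ∑* (λ g → T g ℤ.* f (g * s ⁻¹)) ≡⟨ ∑*-cong (λ g _ → trans (sym (sum-*ʳ (f (g * s ⁻¹)) _)) (sum-cong-≗ (λ x → ℤ.*-assoc (𝟙 (B? x)) _ _))) ⟩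
          ∑* (λ g → ∑ (λ x → 𝟙 (B? x) ℤ.* (f (g * (θ + x)) ℤ.* f (g * s ⁻¹)))) ≡⟨ ∑*-sum (λ x g → 𝟙 (B? x) ℤ.* (f (g * (θ + x)) ℤ.* f (g * s ⁻¹))) ⟩
          ∑ (λ x → ∑* (λ g → 𝟙 (B? x) ℤ.* (f (g * (θ + x)) ℤ.* f (g * s ⁻¹)))) ≡⟨ sum-cong-≗ (λ x → trans (∑*-*ˡ (𝟙 (B? x)) _) (trans (𝟙*-cong (B? x) (λ Bx →
             φ-idempotent (M ∷ Ms) cop (s * (θ + x)) (*-nonzero s≢0 (θ+≢0 Bx)) s⁻¹≢0 (sym (trans (cong (_* s ⁻¹) (*-comm s (θ + x))) (*-⁻¹-cancelʳ (θ + x) s≢0))))) (left-comm (𝟙 (B? x)) (⁺ n) _))) ⟩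
          ∑ (λ x → ⁺ n ℤ.* (𝟙 (B? x) ℤ.* f (s * (θ + x)))) ≡⟨ sum-*ˡ (⁺ n) _ ⟩
          ⁺ n ℤ.* X ∎
        ff : ∑* (λ g → f (g * s ⁻¹) ℤ.* f (g * s ⁻¹)) ≡ ⁺ n ℤ.* w
        ff = trans (φ-idempotent (M ∷ Ms) cop 1# 1≢0 s⁻¹≢0 (sym (*-identityˡ _))) (cong (⁺ n ℤ.*_) (φ-1 (M ∷ Ms)))
        eq : ∑* (λ g → (w ℤ.* T g ℤ.- X ℤ.* f (g * s ⁻¹)) ℤ.* (w ℤ.* T g ℤ.- X ℤ.* f (g * s ⁻¹))) ≡ ⁺ n ℤ.* (w ℤ.* (w ℤ.* V ℤ.- X ℤ.* X))
        eq = begin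
          ∑* (λ g → (w ℤ.* T g ℤ.- X ℤ.* f (g * s ⁻¹)) ℤ.* (w ℤ.* T g ℤ.- X ℤ.* f (g * s ⁻¹))) ≡⟨ ∑*-cong (λ g _ → expand-square w X (T g) (f (g * s ⁻¹))) ⟩
          ∑* (λ g → w ℤ.* w ℤ.* (T g ℤ.* T g) ℤ.+ c ℤ.* (T g ℤ.* f (g * s ⁻¹)) ℤ.+ X ℤ.* X ℤ.* (f (g * s ⁻¹) ℤ.* f (g * s ⁻¹)))
            ≡⟨ trans (∑*-+ _ _) (cong₂ ℤ._+_ (trans (∑*-+ _ _) (cong₂ ℤ._+_ (trans (∑*-*ˡ (w ℤ.* w) _) (cong (w ℤ.* w ℤ.*_) TT)) (trans (∑*-*ˡ c _) (cong (c ℤ.*_) Tf)))) (trans (∑*-*ˡ (X ℤ.* X) _) (cong (X ℤ.* X ℤ.*_) ff))) ⟩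
          w ℤ.* w ℤ.* (⁺ n ℤ.* V) ℤ.+ c ℤ.* (⁺ n ℤ.* X) ℤ.+ X ℤ.* X ℤ.* (⁺ n ℤ.* w) ≡⟨ collect w X (⁺ n) V ⟩
          ⁺ n ℤ.* (w ℤ.* (w ℤ.* V ℤ.- X ℤ.* X)) ∎
          where
          c : ℤ
          c = ℤ.- (w ℤ.* X) ℤ.- w ℤ.* X
          ∑*-+ : ∀ (g h : K → ℤ) → ∑* (λ x → g x ℤ.+ h x) ≡ ∑* g ℤ.+ ∑* h
          ∑*-+ g h = trans (sum-cong-≗ (λ x → ℤ.*-distribˡ-+ (𝟙 (unit? x)) (g x) (h x))) (∑-distrib-+ (λ x → 𝟙 (unit? x) ℤ.* g x) _)
        -- f sums to 0 over all units, so its sum off `B` is minus the sum over the units of `B`.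
        -- The latter is nonnegative, which leaves V ≤ q w.
        outside : ∑ (λ z → 𝟙 (¬? (B? z)) ℤ.* f z) ≡ ℤ.- ∑ (λ x → 𝟙 (B*? x) ℤ.* f x)
        outside = begin
          ∑ (λ z → 𝟙 (¬? (B? z)) ℤ.* f z) ≡⟨ sum-cong-≗ split ⟩
          ∑ (λ z → 𝟙 (unit? z) ℤ.* f z ℤ.+ ℤ.- (𝟙 (B*? z) ℤ.* f z)) ≡⟨ ∑-distrib-+ (λ z → 𝟙 (unit? z) ℤ.* f z) (λ z → ℤ.- (𝟙 (B*? z) ℤ.* f z)) ⟩
          ∑* f ℤ.+ ∑ (λ z → ℤ.- (𝟙 (B*? z) ℤ.* f z)) ≡⟨ cong₂ ℤ._+_ (∑*φ≡0 M Ms cop₀) (sum-neg (λ z → 𝟙 (B*? z) ℤ.* f z)) ⟩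
          0ℤ ℤ.+ ℤ.- ∑ (λ x → 𝟙 (B*? x) ℤ.* f x) ≡⟨ ℤ.+-identityˡ _ ⟩
          ℤ.- ∑ (λ x → 𝟙 (B*? x) ℤ.* f x) ∎
          where
          s₁ : ∀ a → 0ℤ ℤ.* a ≡ 1ℤ ℤ.* a ℤ.+ ℤ.- (1ℤ ℤ.* a)
          s₁ = solve-∀
          s₂ : ∀ a → 1ℤ ℤ.* a ≡ 1ℤ ℤ.* a ℤ.+ ℤ.- (0ℤ ℤ.* a)
          s₂ = solve-∀
          s₃ : ∀ a → 0ℤ ℤ.* a ≡ 0ℤ ℤ.* a ℤ.+ ℤ.- (0ℤ ℤ.* a)
          s₃ = solve-∀
          split : ∀ z → 𝟙 (¬? (B? z)) ℤ.* f z ≡ 𝟙 (unit? z) ℤ.* f z ℤ.+ ℤ.- (𝟙 (B*? z) ℤ.* f z)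
          split z with B? z | z ≟ 0#
          ... | yes _ | yes _ = s₃ (f z)
          ... | yes _ | no _  = s₁ (f z)
          ... | no ¬b | yes refl = ⊥-elim (¬b B-0)
          ... | no _  | no _  = s₂ (f z)
        V≤ : V ℤ.≤ ⁺ q ℤ.* w
        V≤ = ℤ.≤-trans (ℤ.+-mono-≤ (ℤ.≤-reflexive (cong (⁺ q ℤ.*_) (φ-1 (M ∷ Ms))))
               (ℤ.≤-trans (ℤ.≤-reflexive outside) (ℤ.neg-mono-≤ (∑B*φ≥0 (M ∷ Ms) cop)))) (ℤ.≤-reflexive (ℤ.+-identityʳ _))

      -- The integer r is any upper bound for √q; comparing squares gives the linear bound without
      -- leaving the integers.
      translate-sum : ∀ M Ms → AllPairs CoprimeModuli (M ∷ Ms) → All (λ M → 1 ℕ.< Modulus.m M) (M ∷ Ms) → ∀ s → s ≢ 0# →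
        ∀ r → q ℕ.≤ r ℕ.* r →
        ∣ ∑ (λ x → 𝟙 (B? x) ℤ.* φ (M ∷ Ms) (s * (θ + x))) ∣ ℕ.≤ r ℕ.* φ-weight (M ∷ Ms)
      translate-sum M Ms cop big s s≢0 r q≤rr = ℕ.≮⇒≥ (λ lt → ℕ.<⇒≱ (ℕ.*-mono-< lt lt)
          (ℕ.≤-trans le (ℕ.≤-trans (ℕ.*-monoʳ-≤ w (ℕ.*-monoˡ-≤ w q≤rr)) (ℕ.≤-reflexive (regroup w r)))))
        where
        regroup : ∀ w r → w ℕ.* (r ℕ.* r ℕ.* w) ≡ (r ℕ.* w) ℕ.* (r ℕ.* w)
        regroup = ℕ-solve-∀
        X : ℤ
        X = ∑ (λ x → 𝟙 (B? x) ℤ.* φ (M ∷ Ms) (s * (θ + x)))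
        w : ℕ
        w = φ-weight (M ∷ Ms)
        abs² : ∀ x → x ℤ.* x ≡ ⁺ (∣ x ∣ ℕ.* ∣ x ∣)
        abs² (⁺ m)      = sym (ℤ.pos-* m m)
        abs² ℤ.-[1+ m ] = refl
        le : ∣ X ∣ ℕ.* ∣ X ∣ ℕ.≤ w ℕ.* (q ℕ.* w)
        le = ℤ.drop‿+≤+ (subst₂ ℤ._≤_ (abs² X) (trans (cong (⁺ w ℤ.*_) (sym (ℤ.pos-* q w))) (sym (ℤ.pos-* w (q ℕ.* w)))) (translate-sum² M Ms cop big s s≢0))

-- The sieve with a core over a set of translates.

module Sieving where

  open FiniteFields
  open IntegerSums
  open FrobeniusMap
  open Idempotents
  open QuadraticExtensions
  open CharacterSumBound
  open import Data.Fin.Base as Fin using (suc)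
  open import Data.Fin.Properties using (_≟_; any?)
  open import Data.Integer.Base as ℤ using (ℤ; 0ℤ; 1ℤ; +≤+; ∣_∣) renaming (+_ to ⁺_)
  import Data.Integer.Properties as ℤ
  open import Data.Integer.Tactic.RingSolver using (solve-∀)
  open import Data.Nat.Tactic.RingSolver using () renaming (solve-∀ to ℕ-solve-∀)
  open import Data.List.Base using (List; []; _∷_; _++_; length)
  open import Data.List.Properties using (++-identityʳ)
  open import Data.List.Relation.Binary.Sublist.Propositional using (_⊆_; []; _∷_; _∷ʳ_; ⊆-refl; ⊆-trans; minimum)
  open import Data.List.Relation.Binary.Sublist.Propositional.Properties using (++⁺; ++⁺ˡ; ++⁺ʳ; All-resp-⊆)
  open import Data.Nat.Base as ℕ using (ℕ; suc; z≤n; _∸_; NonZero)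
  import Data.Nat.Properties as ℕ
  import Data.Nat.Coprimality as Coprime

  private
    ∣∣≤⇒≤ : ∀ {i m} → ∣ i ∣ ℕ.≤ m → i ℤ.≤ ⁺ m
    ∣∣≤⇒≤ {⁺ _}        le = +≤+ le
    ∣∣≤⇒≤ {ℤ.-[1+ _ ]} le = ℤ.-≤+

    ∣-∣≤⇒≤ : ∀ {i j m} → ∣ i ℤ.- j ∣ ℕ.≤ m → i ℤ.≤ j ℤ.+ ⁺ m
    ∣-∣≤⇒≤ {i} {j} {m} le = subst (ℤ._≤ j ℤ.+ ⁺ m) (cancel i j) (ℤ.+-monoʳ-≤ j (∣∣≤⇒≤ {i ℤ.- j} le))
      where
      cancel : ∀ i j → j ℤ.+ (i ℤ.- j) ≡ i
      cancel = solve-∀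

    ∣-∣-comm : ∀ i j → ∣ i ℤ.- j ∣ ≡ ∣ j ℤ.- i ∣
    ∣-∣-comm = ℤ.∣i-j∣≡∣j-i∣

    -- c is K / m rounded up. Rounding up is legitimate for t ≥ 0; for negative t the left side is
    -- at most 0, which settles that case separately.
    scale-bound : ∀ K c m .{{_ : NonZero m}} (t : ℤ) x → K ℕ.≤ c ℕ.* m → ⁺ m ℤ.* t ℤ.≤ ⁺ x → ⁺ K ℤ.* t ℤ.≤ ⁺ (c ℕ.* x)
    scale-bound K c m (⁺ t) x K≤ mt≤ = ℤ.≤-trans (ℤ.≤-reflexive (sym (ℤ.pos-* K t))) (+≤+ (ℕ.≤-trans (ℕ.*-monoˡ-≤ t K≤)
      (ℕ.≤-trans (ℕ.≤-reflexive (ℕ.*-assoc c m t)) (ℕ.*-monoʳ-≤ c (ℤ.drop‿+≤+ (ℤ.≤-trans (ℤ.≤-reflexive (ℤ.pos-* m t)) mt≤))))))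
    scale-bound K c m ℤ.-[1+ j ] x K≤ mt≤ =
      ℤ.≤-trans (ℤ.*-monoˡ-≤-nonNeg (⁺ K) (ℤ.-≤+ {j} {0})) (ℤ.≤-trans (ℤ.≤-reflexive (ℤ.*-zeroʳ (⁺ K))) (+≤+ z≤n))

  AllPairs-resp-⊆ : ∀ {A : Set} {R : A → A → Set} {xs ys} → xs ⊆ ys → AllPairs R ys → AllPairs R xs
  AllPairs-resp-⊆ []          []       = []
  AllPairs-resp-⊆ (y ∷ʳ τ)    (_ ∷ rs) = AllPairs-resp-⊆ τ rs
  AllPairs-resp-⊆ (refl ∷ τ)  (r ∷ rs) = All-resp-⊆ τ r ∷ AllPairs-resp-⊆ τ rs

  module SieveTheory {n : ℕ} (𝔽 : FiniteField n) {p : ℕ} (pp : Prime p) (k : ℕ)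
    (1<q : 1 ℕ.< p ℕ.^ k) (N≡ : suc n ≡ (p ℕ.^ k) ℕ.* (p ℕ.^ k)) where
    open FieldTheory 𝔽
    open AtomTheory 𝔽
    open Modulus
    open Quadratic 𝔽 pp k 1<q N≡
    open WeilBound 𝔽 pp k 1<q N≡
    open ≡-Reasoning

    totalWeight : (ℕ → ℕ) → List Modulus → ℕ
    totalWeight wt []       = 0
    totalWeight wt (M ∷ Ms) = wt (m M) ℕ.+ totalWeight wt Ms

    module _ {θ : K} (θ∉B : ¬ B θ) (r : ℕ) (q≤rr : q ℕ.≤ r ℕ.* r) (M₄ : Modulus) (m₄≡4 : m M₄ ≡ 4) (s : K) (s≢0 : s ≢ 0#) where

      -- The factor s turns the condition d ^ (n / 4) = -1 into (s d) ^ (n / 4) = 1.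
      ΣD : (K → ℤ) → ℤ
      ΣD h = ∑ (λ x → 𝟙 (B? x) ℤ.* h (s * (θ + x)))

      ΣD-cong : ∀ {g h : K → ℤ} → (∀ y → g y ≡ h y) → ΣD g ≡ ΣD h
      ΣD-cong eq = sum-cong-≗ (λ x → cong (𝟙 (B? x) ℤ.*_) (eq _))

      ΣD-+ : ∀ (g h : K → ℤ) → ΣD (λ y → g y ℤ.+ h y) ≡ ΣD g ℤ.+ ΣD h
      ΣD-+ g h = trans (sum-cong-≗ (λ x → ℤ.*-distribˡ-+ (𝟙 (B? x)) _ _)) (∑-distrib-+ (λ x → 𝟙 (B? x) ℤ.* g (s * (θ + x))) _)

      ΣD-* : ∀ c (h : K → ℤ) → ΣD (λ y → c ℤ.* h y) ≡ c ℤ.* ΣD h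
      ΣD-* c h = trans (sum-cong-≗ (λ x → left-comm (𝟙 (B? x)) c _)) (sum-*ˡ c _)
        where
        left-comm : ∀ a b c → a ℤ.* (b ℤ.* c) ≡ b ℤ.* (a ℤ.* c)
        left-comm = solve-∀

      ΣD-1 : ΣD (λ _ → 1ℤ) ≡ ⁺ q
      ΣD-1 = trans (sum-cong-≗ (λ x → ℤ.*-identityʳ _)) #B

      -- 4 δ₄ ∏ m (1 - δ_m), since 1 + e₄ = 4 δ₄ and (m - 1) - e_m = m (1 - δ_m).
      Ψ : List Modulus → K → ℤ
      Ψ []      y = 1ℤ ℤ.+ e M₄ y
      Ψ (M ∷ C) y = (⁺ (m M ∸ 1) ℤ.- e M y) ℤ.* Ψ C y

      -- The ℓ¹-norm of the nonconstant part of the expansion of Ψ in the functions φ.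
      E : List Modulus → ℕ
      E []      = 3
      E (M ∷ C) = (m M ∸ 1) ℕ.* (E C ℕ.+ (E C ℕ.+ φ-weight C))

      -- The full ℓ¹-norm of Ψ, constant part included, is a product: 1 + e₄ has norm 4 and each (m
      -- - 1) - e has norm 2 (m - 1).
      E+w : ∀ C → E C ℕ.+ φ-weight C ≡ φ-weight C ℕ.* 2 ℕ.^ (2 ℕ.+ length C)
      E+w []      = refl
      E+w (M ∷ C) = trans (lem₁ (m M ∸ 1) (E C) (φ-weight C)) (trans (cong (λ z → (m M ∸ 1) ℕ.* (2 ℕ.* z)) (E+w C)) (lem₂ (m M ∸ 1) (φ-weight C) (2 ℕ.^ (2 ℕ.+ length C))))
        where
        lem₁ : ∀ a e w → a ℕ.* (e ℕ.+ (e ℕ.+ w)) ℕ.+ a ℕ.* w ≡ a ℕ.* (2 ℕ.* (e ℕ.+ w))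
        lem₁ = ℕ-solve-∀
        lem₂ : ∀ a w t → a ℕ.* (2 ℕ.* (w ℕ.* t)) ≡ a ℕ.* w ℕ.* (2 ℕ.* t)
        lem₂ = ℕ-solve-∀

      Admissible : List Modulus → Set
      Admissible Ms = AllPairs CoprimeModuli (M₄ ∷ Ms) × All (λ M → 1 ℕ.< m M) (M₄ ∷ Ms)

      admissible-⊆ : ∀ {Ms Ms′} → Ms ⊆ Ms′ → Admissible Ms′ → Admissible Ms
      admissible-⊆ sub (ap , big) = AllPairs-resp-⊆ (refl ∷ sub) ap , All-resp-⊆ (refl ∷ sub) big

      admissible-drop : ∀ C {Ms} → Admissible (C ++ Ms) → Admissible Ms
      admissible-drop C = admissible-⊆ (++⁺ˡ C ⊆-refl)

      admissible-insert : ∀ {M} C {Ms} → Admissible (M ∷ C ++ Ms) → Admissible (C ++ M ∷ Ms)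
      admissible-insert {M} C {Ms} ((c₄ ∷ cs) ∷ ap , b₄ ∷ b ∷ bs) = insertAll C c₄ cs ∷ insertPairs C ap , b₄ ∷ insertAll C b bs
        where
        insertAll : ∀ {P : Modulus → Set} C → P M → All P (C ++ Ms) → All P (C ++ M ∷ Ms)
        insertAll []      p ps       = p ∷ ps
        insertAll (N ∷ C) p (x ∷ ps) = x ∷ insertAll C p ps
        insertPairs : ∀ C → AllPairs CoprimeModuli (M ∷ C ++ Ms) → AllPairs CoprimeModuli (C ++ M ∷ Ms)
        insertPairs []      ap = ap
        insertPairs (N ∷ C) ((mn ∷ ms) ∷ ns ∷ ap) = insertAll C (Coprime.sym mn) ns ∷ insertPairs C (ms ∷ ap)

      ∣ΣDφ∣≤ : ∀ M Ms → Admissible (M ∷ Ms) → ∣ ΣD (φ (M ∷ Ms)) ∣ ℕ.≤ r ℕ.* φ-weight (M ∷ Ms)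
      ∣ΣDφ∣≤ M Ms (_ ∷ ap , _ ∷ big) = translate-sum θ∉B M Ms ap big s s≢0 r q≤rr

      -- Ψ (M ∷ C) φ Ms equals (m - 1) Ψ C φ Ms - Ψ C φ (M ∷ Ms). The induction carries the extra
      -- factor `φ Ms` so that the second term is again of the same shape; its own main term is an
      -- error term by the character sum bound.
      core-bound : ∀ C Ms → Admissible (C ++ Ms) →
        ∣ ΣD (λ y → Ψ C y ℤ.* φ Ms y) ℤ.- ⁺ φ-weight C ℤ.* ΣD (φ Ms) ∣ ℕ.≤ E C ℕ.* (r ℕ.* φ-weight Ms)
      core-bound [] Ms (ap , big) = ℕ.≤-trans (ℕ.≤-reflexive (cong ∣_∣ eq))
          (ℕ.≤-trans (translate-sum θ∉B M₄ Ms ap big s s≢0 r q≤rr) (ℕ.≤-reflexive (trans (cong (λ z → r ℕ.* ((z ∸ 1) ℕ.* φ-weight Ms)) m₄≡4) (lem r (φ-weight Ms)))))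
        where
        lem : ∀ r w → r ℕ.* (3 ℕ.* w) ≡ 3 ℕ.* (r ℕ.* w)
        lem = ℕ-solve-∀
        dist : ∀ e f → (1ℤ ℤ.+ e) ℤ.* f ≡ f ℤ.+ e ℤ.* f
        dist = solve-∀
        cancel : ∀ a b → a ℤ.+ b ℤ.- 1ℤ ℤ.* a ≡ b
        cancel = solve-∀
        eq : ΣD (λ y → (1ℤ ℤ.+ e M₄ y) ℤ.* φ Ms y) ℤ.- 1ℤ ℤ.* ΣD (φ Ms) ≡ ΣD (φ (M₄ ∷ Ms))
        eq = trans (cong (ℤ._- 1ℤ ℤ.* ΣD (φ Ms)) (trans (ΣD-cong (λ y → dist (e M₄ y) (φ Ms y))) (ΣD-+ (φ Ms) (φ (M₄ ∷ Ms))))) (cancel (ΣD (φ Ms)) _)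
      core-bound (M ∷ C) Ms adm = ℕ.≤-trans (ℕ.≤-reflexive (cong ∣_∣ eq)) (ℕ.≤-trans (triangle (a ℤ.* (A ℤ.- w ℤ.* S)) (A′ ℤ.- w ℤ.* S′) (w ℤ.* S′))
          (ℕ.≤-trans (ℕ.+-mono-≤ (ℕ.+-mono-≤ (ℕ.≤-trans (ℕ.≤-reflexive (ℤ.abs-* a _)) (ℕ.*-monoʳ-≤ a′ (core-bound C Ms adm₁))) (core-bound C (M ∷ Ms) adm₂))
            (ℕ.≤-trans (ℕ.≤-reflexive (ℤ.abs-* w S′)) (ℕ.*-monoʳ-≤ (φ-weight C) (∣ΣDφ∣≤ M Ms (admissible-drop C adm₂)))))
            (ℕ.≤-reflexive (final a′ (E C) (φ-weight C) r (φ-weight Ms)))))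
        where
        a′ : ℕ
        a′ = m M ∸ 1
        a w A A′ S S′ : ℤ
        a = ⁺ a′
        w = ⁺ φ-weight C
        A = ΣD (λ y → Ψ C y ℤ.* φ Ms y)
        A′ = ΣD (λ y → Ψ C y ℤ.* φ (M ∷ Ms) y)
        S = ΣD (φ Ms)
        S′ = ΣD (φ (M ∷ Ms))
        adm₂ : Admissible (C ++ M ∷ Ms)
        adm₂ = admissible-insert C adm
        adm₁ : Admissible (C ++ Ms)
        adm₁ = admissible-drop (M ∷ []) adm
        final : ∀ a e w r v → a ℕ.* (e ℕ.* (r ℕ.* v)) ℕ.+ e ℕ.* (r ℕ.* (a ℕ.* v)) ℕ.+ w ℕ.* (r ℕ.* (a ℕ.* v)) ≡ a ℕ.* (e ℕ.+ (e ℕ.+ w)) ℕ.* (r ℕ.* v)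
        final = ℕ-solve-∀
        triangle : ∀ x y z → ∣ x ℤ.- y ℤ.- z ∣ ℕ.≤ ∣ x ∣ ℕ.+ ∣ y ∣ ℕ.+ ∣ z ∣
        triangle x y z = ℕ.≤-trans (ℤ.∣i-j∣≤∣i∣+∣j∣ (x ℤ.- y) z) (ℕ.+-monoˡ-≤ ∣ z ∣ (ℤ.∣i-j∣≤∣i∣+∣j∣ x y))
        dist : ∀ a e p f → (a ℤ.- e) ℤ.* p ℤ.* f ≡ a ℤ.* (p ℤ.* f) ℤ.+ (ℤ.- 1ℤ) ℤ.* (p ℤ.* (e ℤ.* f))
        dist = solve-∀
        rearrange : ∀ a A A′ w S S′ → a ℤ.* A ℤ.+ (ℤ.- 1ℤ) ℤ.* A′ ℤ.- a ℤ.* w ℤ.* S ≡ a ℤ.* (A ℤ.- w ℤ.* S) ℤ.- (A′ ℤ.- w ℤ.* S′) ℤ.- w ℤ.* S′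
        rearrange = solve-∀
        eq : ΣD (λ y → Ψ (M ∷ C) y ℤ.* φ Ms y) ℤ.- ⁺ φ-weight (M ∷ C) ℤ.* S ≡ a ℤ.* (A ℤ.- w ℤ.* S) ℤ.- (A′ ℤ.- w ℤ.* S′) ℤ.- w ℤ.* S′
        eq = trans (cong₂ (λ x y → x ℤ.- y ℤ.* S)
               (trans (ΣD-cong (λ y → dist a (e M y) (Ψ C y) (φ Ms y))) (trans (ΣD-+ (λ y → a ℤ.* (Ψ C y ℤ.* φ Ms y)) (λ y → (ℤ.- 1ℤ) ℤ.* (Ψ C y ℤ.* φ (M ∷ Ms) y))) (cong₂ ℤ._+_ (ΣD-* a (λ y → Ψ C y ℤ.* φ Ms y)) (ΣD-* (ℤ.- 1ℤ) (λ y → Ψ C y ℤ.* φ (M ∷ Ms) y)))))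
               (ℤ.pos-* a′ (φ-weight C)))
             (rearrange a A A′ w S S′)

      1+e : ∀ M y → 1ℤ ℤ.+ e M y ≡ ⁺ m M ℤ.* δ M y
      1+e M y = lem (⁺ m M ℤ.* δ M y)
        where
        lem : ∀ x → 1ℤ ℤ.+ (x ℤ.- 1ℤ) ≡ x
        lem = solve-∀

      m-1-e : ∀ M y → ⁺ (m M ∸ 1) ℤ.- e M y ≡ ⁺ m M ℤ.* (1ℤ ℤ.- δ M y)
      m-1-e M y = trans (cong (ℤ._- e M y) (pred (m M))) (lem (⁺ m M) (δ M y))
        where
        lem : ∀ x d → x ℤ.- 1ℤ ℤ.- (x ℤ.* d ℤ.- 1ℤ) ≡ x ℤ.* (1ℤ ℤ.- d)
        lem = solve-∀
        pred : ∀ j .{{_ : NonZero j}} → ⁺ (j ∸ 1) ≡ ⁺ j ℤ.- 1ℤ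
        pred (suc j) = refl

      Ψ-Cases : List Modulus → K → Set
      Ψ-Cases C y = Ψ C y ≡ 0ℤ ⊎ (∃ λ v → Ψ C y ≡ ⁺ v × y ^ c M₄ ≡ 1# × All (λ M → y ^ c M ≢ 1#) C)

      -- Every factor of Ψ is a modulus times an indicator, so a value other than 0 is a natural
      -- number that certifies all the core conditions at once.
      Ψ-cases : ∀ C y → Ψ-Cases C y
      Ψ-cases [] y = cases (y ^ c M₄ ≟ 1#) (1+e M₄ y)
        where
        cases : (d : Dec (y ^ c M₄ ≡ 1#)) → 1ℤ ℤ.+ e M₄ y ≡ ⁺ m M₄ ℤ.* 𝟙 d → Ψ-Cases [] y
        cases (no _)   eq = inj₁ (trans eq (ℤ.*-zeroʳ (⁺ m M₄)))
        cases (yes y1) eq = inj₂ (m M₄ , trans eq (ℤ.*-identityʳ (⁺ m M₄)) , y1 , [])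
      Ψ-cases (M ∷ C) y = cases (Ψ-cases C y) (y ^ c M ≟ 1#) (m-1-e M y)
        where
        cases : Ψ-Cases C y → (d : Dec (y ^ c M ≡ 1#)) → ⁺ (m M ∸ 1) ℤ.- e M y ≡ ⁺ m M ℤ.* (1ℤ ℤ.- 𝟙 d) → Ψ-Cases (M ∷ C) y
        cases (inj₁ z) _ _ = inj₁ (trans (cong ((⁺ (m M ∸ 1) ℤ.- e M y) ℤ.*_) z) (ℤ.*-zeroʳ (⁺ (m M ∸ 1) ℤ.- e M y)))
        cases (inj₂ _) (yes _) eq = inj₁ (trans (cong (ℤ._* Ψ C y) (trans eq (ℤ.*-zeroʳ (⁺ m M)))) (ℤ.*-zeroˡ (Ψ C y)))
        cases (inj₂ (v , eq , y1 , all)) (no ne) eq′ = inj₂ (m M ℕ.* v , trans (cong₂ ℤ._*_ (trans eq′ (ℤ.*-identityʳ (⁺ m M))) eq) (sym (ℤ.pos-* (m M) v)) , y1 , ne ∷ all)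

      sieved : List Modulus → List Modulus → ℤ
      sieved C []       = 0ℤ
      sieved C (M ∷ Ms) = ΣD (λ y → Ψ C y ℤ.* δ M y) ℤ.+ sieved C Ms

      sievedAt : List Modulus → List Modulus → K → ℤ
      sievedAt C []       y = 0ℤ
      sievedAt C (M ∷ Ms) y = Ψ C y ℤ.* δ M y ℤ.+ sievedAt C Ms y

      sieved≡ : ∀ C Ms → ΣD (sievedAt C Ms) ≡ sieved C Ms
      sieved≡ C []       = trans (sum-zero _ (λ x → ℤ.*-zeroʳ (𝟙 (B? x)))) refl
      sieved≡ C (M ∷ Ms) = trans (ΣD-+ (λ y → Ψ C y ℤ.* δ M y) (sievedAt C Ms)) (cong (λ z → ΣD (λ y → Ψ C y ℤ.* δ M y) ℤ.+ z) (sieved≡ C Ms))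

      Good : List Modulus → List Modulus → K → Set
      Good C Ms y = y ^ c M₄ ≡ 1# × All (λ M → y ^ c M ≢ 1#) (C ++ Ms)

      Good? : ∀ C Ms y → Dec (Good C Ms y)
      Good? C Ms y = (y ^ c M₄ ≟ 1#) ×-dec all? (λ M → ¬? (y ^ c M ≟ 1#)) (C ++ Ms)

      -- The sieve inequality: if the core conditions hold at a bad y, then some sieving modulus has
      -- δ = 1, and its term alone equals Ψ; the other terms are nonnegative.
      Ψ≤sievedAt : ∀ C Ms y → ¬ Good C Ms y → Ψ C y ℤ.≤ sievedAt C Ms y
      Ψ≤sievedAt C Ms y bad with Ψ-cases C y
      ... | inj₁ z = ℤ.≤-trans (ℤ.≤-reflexive z) (nonneg Ms)
        where
        nonneg : ∀ Ms → 0ℤ ℤ.≤ sievedAt C Ms y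
        nonneg []       = ℤ.≤-refl
        nonneg (M ∷ Ms) = ℤ.+-mono-≤ (ℤ.≤-reflexive (sym (trans (cong (ℤ._* δ M y) z) (ℤ.*-zeroˡ (δ M y))))) (nonneg Ms)
      ... | inj₂ (v , eq , y1 , all) = go Ms (λ rest → bad (y1 , Allₚ.++⁺ all rest))
        where
        term≥0 : ∀ M → 0ℤ ℤ.≤ Ψ C y ℤ.* δ M y
        term≥0 M rewrite eq = ℤ.≤-trans (ℤ.≤-reflexive (sym (ℤ.*-zeroʳ (⁺ v)))) (ℤ.*-monoˡ-≤-nonNeg (⁺ v) (𝟙-≥0 (y ^ c M ≟ 1#)))
        nonneg : ∀ Ms → 0ℤ ℤ.≤ sievedAt C Ms y
        nonneg []       = ℤ.≤-refl
        nonneg (M ∷ Ms) = ℤ.+-mono-≤ (term≥0 M) (nonneg Ms)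
        go : ∀ Ms → ¬ All (λ M → y ^ c M ≢ 1#) Ms → Ψ C y ℤ.≤ sievedAt C Ms y
        go [] bad = ⊥-elim (bad [])
        go (M ∷ Ms) bad with y ^ c M ≟ 1#
        ... | yes _ = ℤ.≤-trans (ℤ.≤-reflexive (sym (trans (ℤ.+-identityʳ _) (ℤ.*-identityʳ (Ψ C y))))) (ℤ.+-monoʳ-≤ (Ψ C y ℤ.* 1ℤ) (nonneg Ms))
        ... | no ne = ℤ.≤-trans (go Ms (λ rest → bad (ne ∷ rest))) (ℤ.≤-reflexive (sym (trans (cong (ℤ._+ sievedAt C Ms y) (ℤ.*-zeroʳ (Ψ C y))) (ℤ.+-identityˡ _))))

      module _ (C : List Modulus) where
        private
          w W : ℕ
          w = φ-weight C
          W = E C ℕ.+ w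
          T : ℤ
          T = ΣD (Ψ C)

        T-bound : Admissible C → ∣ T ℤ.- ⁺ (w ℕ.* q) ∣ ℕ.≤ E C ℕ.* r
        T-bound adm = subst₂ (λ x y → ∣ x ∣ ℕ.≤ E C ℕ.* y) (cong₂ ℤ._-_ (ΣD-cong (λ y → ℤ.*-identityʳ (Ψ C y))) (trans (cong (⁺ w ℤ.*_) ΣD-1) (sym (ℤ.pos-* w q))))
          (ℕ.*-identityʳ r) (core-bound C [] (subst Admissible (sym (++-identityʳ C)) adm))

        -- Since m δ = 1 + e, the sum of Ψ δ times m is T plus the sum of Ψ e. The former is at most
        -- w q + E r, the latter at most (m - 1) W r, so together at most w q + m W r.
        one-prime : ∀ M → Admissible (C ++ M ∷ []) → ⁺ m M ℤ.* (ΣD (λ y → Ψ C y ℤ.* δ M y) ℤ.- ⁺ (W ℕ.* r)) ℤ.≤ ⁺ (w ℕ.* q)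
        one-prime M adm = ℤ.≤-trans (ℤ.≤-reflexive eq) (ℤ.≤-trans (ℤ.+-monoˡ-≤ (ℤ.- ⁺ (m M ℕ.* (W ℕ.* r))) (ℤ.+-mono-≤ (∣-∣≤⇒≤ {T} {⁺ (w ℕ.* q)} (T-bound admC)) Ue≤))
            (ℤ.≤-trans (ℤ.≤-reflexive (cong (λ z → z ℤ.+ ℤ.- ⁺ (m M ℕ.* (W ℕ.* r))) assoc)) (ℤ.≤-trans (ℤ.+-monoˡ-≤ (ℤ.- ⁺ (m M ℕ.* (W ℕ.* r))) (ℤ.+-monoʳ-≤ (⁺ (w ℕ.* q)) (+≤+ (fits (m M)))))
              (ℤ.≤-reflexive (cancel (⁺ (w ℕ.* q)) (⁺ (m M ℕ.* (W ℕ.* r))))))))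
          where
          a : ℕ
          a = m M ∸ 1
          admC : Admissible C
          admC = admissible-⊆ (++⁺ʳ (M ∷ []) ⊆-refl) adm
          Ue S₁ : ℤ
          Ue = ΣD (λ y → Ψ C y ℤ.* φ (M ∷ []) y)
          S₁ = ΣD (φ (M ∷ []))
          Ue≤ : Ue ℤ.≤ ⁺ (w ℕ.* (r ℕ.* (a ℕ.* 1)) ℕ.+ E C ℕ.* (r ℕ.* (a ℕ.* 1)))
          Ue≤ = ℤ.≤-trans (∣-∣≤⇒≤ {Ue} {⁺ w ℤ.* S₁} (core-bound C (M ∷ []) adm)) (ℤ.+-monoˡ-≤ (⁺ (E C ℕ.* (r ℕ.* (a ℕ.* 1))))
                  (ℤ.≤-trans (ℤ.*-monoˡ-≤-nonNeg (⁺ w) (∣∣≤⇒≤ {S₁} (∣ΣDφ∣≤ M [] (admissible-drop C adm)))) (ℤ.≤-reflexive (sym (ℤ.pos-* w _)))))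
          split : ∀ mδ Ψ → mδ ℤ.* Ψ ≡ Ψ ℤ.+ Ψ ℤ.* ((mδ ℤ.- 1ℤ) ℤ.* 1ℤ)
          split = solve-∀
          mδ : ∀ m Ψ d → m ℤ.* (Ψ ℤ.* d) ≡ (m ℤ.* d) ℤ.* Ψ
          mδ = solve-∀
          eq : ⁺ m M ℤ.* (ΣD (λ y → Ψ C y ℤ.* δ M y) ℤ.- ⁺ (W ℕ.* r)) ≡ T ℤ.+ Ue ℤ.+ ℤ.- ⁺ (m M ℕ.* (W ℕ.* r))
          eq = trans (ℤ.*-distribˡ-+ (⁺ m M) (ΣD (λ y → Ψ C y ℤ.* δ M y)) (ℤ.- ⁺ (W ℕ.* r))) (cong₂ ℤ._+_
                 (trans (sym (ΣD-* (⁺ m M) (λ y → Ψ C y ℤ.* δ M y))) (trans (ΣD-cong (λ y → trans (mδ (⁺ m M) (Ψ C y) (δ M y)) (split (⁺ m M ℤ.* δ M y) (Ψ C y)))) (ΣD-+ (Ψ C) (λ y → Ψ C y ℤ.* φ (M ∷ []) y))))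
                 (trans (sym (ℤ.neg-distribʳ-* (⁺ m M) (⁺ (W ℕ.* r)))) (cong ℤ.-_ (sym (ℤ.pos-* (m M) (W ℕ.* r))))))
          assoc : ⁺ (w ℕ.* q) ℤ.+ ⁺ (E C ℕ.* r) ℤ.+ ⁺ (w ℕ.* (r ℕ.* (a ℕ.* 1)) ℕ.+ E C ℕ.* (r ℕ.* (a ℕ.* 1)))
                ≡ ⁺ (w ℕ.* q) ℤ.+ ⁺ (E C ℕ.* r ℕ.+ (w ℕ.* (r ℕ.* (a ℕ.* 1)) ℕ.+ E C ℕ.* (r ℕ.* (a ℕ.* 1))))
          assoc = ℤ.+-assoc (⁺ (w ℕ.* q)) (⁺ (E C ℕ.* r)) (⁺ (w ℕ.* (r ℕ.* (a ℕ.* 1)) ℕ.+ E C ℕ.* (r ℕ.* (a ℕ.* 1))))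
          cancel : ∀ x y → x ℤ.+ y ℤ.+ ℤ.- y ≡ x
          cancel = solve-∀
          fits : ∀ j .{{_ : NonZero j}} → E C ℕ.* r ℕ.+ (w ℕ.* (r ℕ.* ((j ∸ 1) ℕ.* 1)) ℕ.+ E C ℕ.* (r ℕ.* ((j ∸ 1) ℕ.* 1))) ℕ.≤ j ℕ.* ((E C ℕ.+ w) ℕ.* r)
          fits (suc j) = ℕ.≤-trans (ℕ.m≤m+n _ (w ℕ.* r)) (ℕ.≤-reflexive (lem (E C) w r j))
            where
            lem : ∀ e w r j → e ℕ.* r ℕ.+ (w ℕ.* (r ℕ.* (j ℕ.* 1)) ℕ.+ e ℕ.* (r ℕ.* (j ℕ.* 1))) ℕ.+ w ℕ.* r ≡ (e ℕ.+ w) ℕ.* r ℕ.+ j ℕ.* ((e ℕ.+ w) ℕ.* r)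
            lem = ℕ-solve-∀

        module _ (Kc : ℕ) (wt : ℕ → ℕ) (wt-ok : ∀ j .{{_ : NonZero j}} → Kc ℕ.≤ wt j ℕ.* j) where

          -- `one-prime` divided by m and summed, the reciprocals 1 / m being replaced by the
          -- integers `wt m` over the common denominator `Kc`.
          sieved-bound : ∀ Ms → All (λ M → Admissible (C ++ M ∷ [])) Ms →
            ⁺ Kc ℤ.* sieved C Ms ℤ.≤ ⁺ (totalWeight wt Ms ℕ.* (w ℕ.* q) ℕ.+ length Ms ℕ.* (Kc ℕ.* (W ℕ.* r)))
          sieved-bound []       []           = ℤ.≤-reflexive (ℤ.*-zeroʳ (⁺ Kc))
          sieved-bound (M ∷ Ms) (adm ∷ adms) = ℤ.≤-trans (ℤ.≤-reflexive (split (⁺ Kc) t (⁺ (W ℕ.* r)) (sieved C Ms)))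
              (ℤ.≤-trans (ℤ.+-mono-≤ (ℤ.+-mono-≤ (scale-bound Kc (wt (m M)) (m M) (t ℤ.- ⁺ (W ℕ.* r)) (w ℕ.* q) (wt-ok (m M)) (one-prime M adm))
                   (ℤ.≤-reflexive (sym (ℤ.pos-* Kc (W ℕ.* r))))) (sieved-bound Ms adms))
                (+≤+ (ℕ.≤-reflexive (regroup (wt (m M)) (w ℕ.* q) (Kc ℕ.* (W ℕ.* r)) (totalWeight wt Ms) (length Ms)))))
            where
            t : ℤ
            t = ΣD (λ y → Ψ C y ℤ.* δ M y)
            split : ∀ K t u v → K ℤ.* (t ℤ.+ v) ≡ K ℤ.* (t ℤ.- u) ℤ.+ K ℤ.* u ℤ.+ K ℤ.* v
            split = solve-∀
            regroup : ∀ a x y b l → a ℕ.* x ℕ.+ y ℕ.+ (b ℕ.* x ℕ.+ l ℕ.* y) ≡ (a ℕ.+ b) ℕ.* x ℕ.+ (y ℕ.+ l ℕ.* y)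
            regroup = ℕ-solve-∀

          -- Without a good translate T is at most the sieved sum, while T ≥ w q - E r. By `E+w` all
          -- error terms share the factor w with the main term; dividing by it leaves the criterion.
          exists-good : .{{_ : NonZero Kc}} → ∀ Ms → Admissible (C ++ Ms) →
            totalWeight wt Ms ℕ.* q ℕ.+ Kc ℕ.* (r ℕ.* 2 ℕ.^ (2 ℕ.+ length C) ℕ.* suc (length Ms)) ℕ.≤ Kc ℕ.* q →
            ∃ λ x → B x × Good C Ms (s * (θ + x))
          exists-good Ms adm crit with any? (λ x → B? x ×-dec Good? C Ms (s * (θ + x)))
          ... | yes p = p
          ... | no ¬p = ⊥-elim (ℕ.<⇒≱ strict below)
            where
            l tw : ℕ
            l = length Ms
            tw = totalWeight wt Ms
            2^c : ℕ
            2^c = 2 ℕ.^ (2 ℕ.+ length C)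
            T≤ : T ℤ.≤ sieved C Ms
            T≤ = ℤ.≤-trans (sum-mono-≤ (λ x → 𝟙*-≤ (B? x) (λ Bx → Ψ≤sievedAt C Ms _ (λ g → ¬p (x , Bx , g))))) (ℤ.≤-reflexive (sieved≡ C Ms))
            picks : ∀ Ns → Ns ⊆ Ms → All (λ M → Admissible (C ++ M ∷ [])) Ns
            picks []       sub = []
            picks (N ∷ Ns) sub = admissible-⊆ (++⁺ (⊆-refl {x = C}) (⊆-trans (refl ∷ minimum Ns) sub)) adm ∷ picks Ns (⊆-trans (N ∷ʳ ⊆-refl) sub)
            wq≤ : ⁺ (w ℕ.* q) ℤ.≤ T ℤ.+ ⁺ (E C ℕ.* r)
            wq≤ = ∣-∣≤⇒≤ {⁺ (w ℕ.* q)} {T} (subst (ℕ._≤ E C ℕ.* r) (∣-∣-comm T (⁺ (w ℕ.* q))) (T-bound (admissible-⊆ (++⁺ʳ Ms ⊆-refl) adm)))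
            X : ℕ
            X = tw ℕ.* (w ℕ.* q) ℕ.+ l ℕ.* (Kc ℕ.* (W ℕ.* r)) ℕ.+ Kc ℕ.* (E C ℕ.* r)
            below : Kc ℕ.* (w ℕ.* q) ℕ.≤ X
            below = ℤ.drop‿+≤+ (ℤ.≤-trans (ℤ.≤-reflexive (ℤ.pos-* Kc (w ℕ.* q)))
              (ℤ.≤-trans (ℤ.*-monoˡ-≤-nonNeg (⁺ Kc) (ℤ.≤-trans wq≤ (ℤ.+-monoˡ-≤ (⁺ (E C ℕ.* r)) T≤)))
              (ℤ.≤-trans (ℤ.≤-reflexive (ℤ.*-distribˡ-+ (⁺ Kc) (sieved C Ms) (⁺ (E C ℕ.* r))))
              (ℤ.+-mono-≤ (sieved-bound Ms (picks Ms ⊆-refl)) (ℤ.≤-reflexive (sym (ℤ.pos-* Kc (E C ℕ.* r))))))))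
            instance
              w≢0 : NonZero w
              w≢0 = φ-weight≢0 C (All.tail (proj₂ (admissible-⊆ (++⁺ʳ Ms ⊆-refl) adm)))
              r≢0 : NonZero r
              r≢0 = ℕ.≢-nonZero (λ { refl → ℕ.<⇒≱ 1<q (ℕ.≤-trans q≤rr z≤n) })
            -- The criterion counts the error of the core as W r instead of E r. The surplus w r > 0
            -- makes the contradiction strict, so equality may be allowed in the criterion.
            E<W : E C ℕ.* r ℕ.< W ℕ.* r
            E<W = ℕ.*-monoˡ-< r (ℕ.m<m+n (E C) (ℕ.>-nonZero⁻¹ w))
            regroup : ∀ tw w q l K u r → tw ℕ.* (w ℕ.* q) ℕ.+ l ℕ.* (K ℕ.* (w ℕ.* u ℕ.* r)) ℕ.+ K ℕ.* (w ℕ.* u ℕ.* r) ≡ w ℕ.* (tw ℕ.* q ℕ.+ K ℕ.* (r ℕ.* u ℕ.* suc l))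
            regroup = ℕ-solve-∀
            strict : X ℕ.< Kc ℕ.* (w ℕ.* q)
            strict = ℕ.<-≤-trans (ℕ.+-monoʳ-< (tw ℕ.* (w ℕ.* q) ℕ.+ l ℕ.* (Kc ℕ.* (W ℕ.* r))) (ℕ.*-monoʳ-< Kc E<W))
              (ℕ.≤-trans (ℕ.≤-reflexive (trans (cong (λ z → tw ℕ.* (w ℕ.* q) ℕ.+ l ℕ.* (Kc ℕ.* (z ℕ.* r)) ℕ.+ Kc ℕ.* (z ℕ.* r)) (E+w C)) (regroup tw w q l Kc 2^c r)))
              (ℕ.≤-trans (ℕ.*-monoʳ-≤ w crit) (ℕ.≤-reflexive (trans (sym (ℕ.*-assoc w Kc q)) (trans (cong (ℕ._* q) (ℕ.*-comm w Kc)) (ℕ.*-assoc Kc w q))))))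

-- Orders of elements, existence of the moduli, and 2-primitivity.

module TwoPrimitiveElements where

  open FiniteFields
  open FrobeniusMap
  open Idempotents
  open QuadraticExtensions
  open CharacterSumBound
  open Sieving
  open import Data.Fin.Properties using (_≟_)
  open import Data.List.Base using (List; []; _∷_; _++_; length; map)
  open import Data.Nat.ListAction using (sum; product)
  open import Data.Nat.Base as ℕ using (ℕ; suc; z≤n; s≤s; NonZero)
  import Data.Nat.Properties as ℕ
  open import Data.Nat.Divisibility as ∣ using (_∣_; m%n≡0⇒n∣m; divides; ∣⇒≤; _∣?_)
  open import Data.Nat.GCD using (module Bézout; gcd; gcd[m,n]∣m; gcd[m,n]∣n; gcd-GCD)
  open import Data.Nat.Primality.Factorisation using (factorise; PrimeFactorisation)

  1<prime : ∀ {p} → Prime p → 1 ℕ.< p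
  1<prime pp = ℕ.nonTrivial⇒n>1 _ {{prime⇒nonTrivial pp}}

  ∃-prime-divisor : ∀ {n} → 1 ℕ.< n → ∃ λ p → Prime p × p ∣ n
  ∃-prime-divisor {n} 1<n = go (PrimeFactorisation.factors f) (PrimeFactorisation.isFactorisation f) (PrimeFactorisation.factorsPrime f)
    where
    instance
      n≢0 : NonZero n
      n≢0 = ℕ.>-nonZero (ℕ.<-trans (s≤s z≤n) 1<n)
    f : PrimeFactorisation n
    f = factorise n
    go : ∀ ps → n ≡ product ps → All Prime ps → ∃ λ p → Prime p × p ∣ n
    go []       eq []        = ⊥-elim (ℕ.<-irrefl (sym eq) 1<n)
    go (p ∷ ps) eq (pp ∷ _) = p , pp , divides (product ps) (trans eq (ℕ.*-comm p _))

  prime∤⇒coprime : ∀ {p} → Prime p → ∀ {j} → ¬ (p ∣ j) → Coprime p j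
  prime∤⇒coprime pp p∤j (d∣p , d∣j) with prime⇒irreducible pp d∣p
  ... | inj₁ eq   = eq
  ... | inj₂ refl = ⊥-elim (p∤j d∣j)

  distinct⇒coprime : ∀ {p p′} → Prime p → Prime p′ → p ≢ p′ → Coprime p p′
  distinct⇒coprime pp pp′ ne = prime∤⇒coprime pp (λ p∣p′ → [ (λ { refl → ¬prime[1] pp }) , ne ]′ (prime⇒irreducible pp′ p∣p′))

  module OrderTheory {n : ℕ} (𝔽 : FiniteField n) where
    open FieldTheory 𝔽
    open AtomTheory 𝔽
    open Modulus

    ^-*≡1 : ∀ {x} a b → x ^ a ≡ 1# → x ^ (b ℕ.* a) ≡ 1#
    ^-*≡1 {x} a b eq = trans (cong (x ^_) (ℕ.*-comm b a)) (trans (sym (^-assocʳ x a b)) (trans (cong (_^ b) eq) (1^ b)))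

    ^-cancel≡1 : ∀ {x} a b → x ^ (a ℕ.+ b) ≡ 1# → x ^ b ≡ 1# → x ^ a ≡ 1#
    ^-cancel≡1 {x} a b eq xb = trans (sym (*-identityʳ _)) (trans (cong (x ^ a *_) (sym xb)) (trans (sym (^-homo-* x a b)) eq))

    ^-Bézout : ∀ {x} {d} a b → Bézout.Identity d a b → x ^ a ≡ 1# → x ^ b ≡ 1# → x ^ d ≡ 1#
    ^-Bézout {x} {d} a b (Bézout.+- u v eq) xa xb = ^-cancel≡1 d (v ℕ.* b) (trans (cong (x ^_) eq) (^-*≡1 a u xa)) (^-*≡1 b v xb)
    ^-Bézout {x} {d} a b (Bézout.-+ u v eq) xa xb = ^-cancel≡1 d (u ℕ.* a) (trans (cong (x ^_) eq) (^-*≡1 b v xb)) (^-*≡1 a u xa)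

    -- Bézout gives x ^ g = 1 for g = gcd(k, N). If g were a proper divisor of N, then some N / ℓ
    -- would be a multiple of g, against minimality.
    order∣ : ∀ {x N} → 0 ℕ.< N → x ^ N ≡ 1# → (∀ ℓ c → Prime ℓ → N ≡ ℓ ℕ.* c → x ^ c ≢ 1#) → ∀ k → x ^ k ≡ 1# → N ∣ k
    order∣ {x} {N} 0<N xN minimal k xk = go (gcd[m,n]∣n k N)
      where
      xg : x ^ gcd k N ≡ 1#
      xg = ^-Bézout k N (Bézout.identity (gcd-GCD k N)) xk xN
      go : gcd k N ∣ N → N ∣ k
      go (divides 0 eq) = ⊥-elim (ℕ.<⇒≢ 0<N (sym eq))
      go (divides 1 eq) = subst (_∣ k) (sym (trans eq (ℕ.+-identityʳ _))) (gcd[m,n]∣m k N)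
      go (divides t@(suc (suc _)) eq) with ∃-prime-divisor {t} (s≤s (s≤s z≤n))
      ... | ℓ , pℓ , divides u t≡ = ⊥-elim (minimal ℓ (u ℕ.* gcd k N) pℓ
              (trans eq (trans (cong (ℕ._* gcd k N) (trans t≡ (ℕ.*-comm u ℓ))) (ℕ.*-assoc ℓ u _))) (^-*≡1 (gcd k N) u xg))

    ord-1∣ : ∀ {x} a b → Coprime a b → x ^ a ≡ 1# → x ^ b ≡ 1# → x ≡ 1#
    ord-1∣ a b cop xa xb = trans (sym (*-identityʳ _)) (^-Bézout a b (coprime-Bézout cop) xa xb)

    η^m≡1 : ∀ {x} m c → n ≡ m ℕ.* c → x ≢ 0# → (x ^ c) ^ m ≡ 1#
    η^m≡1 {x} m c eq x≢0 = trans (^-assocʳ x c m) (trans (cong (x ^_) (trans (ℕ.*-comm c m) (sym eq))) (lagrange x≢0))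

    -- Root counting gives a unit with x ^ c ≠ 1 for c = n / p. Its power ζ = x ^ c satisfies ζ ^ p
    -- = 1, so ζ ^ j = 1 with j prime to p would force ζ = 1.
    primeModulus : 0 ℕ.< n → ∀ {p} → Prime p → p ∣ n → Σ Modulus λ M → m M ≡ p
    primeModulus 0<n {p} pp (divides c n≡) with prime⇒nonZero pp
    ... | p≢0 = record { m = p ; c = c ; m≢0 = p≢0 ; c≢0 = c≢0′ ; n≡m*c = n≡p*c ; η = proj₁ wit ; η≢0 = proj₁ (proj₂ wit) ; η-order = order } , refl
      where
      n≡p*c : n ≡ p ℕ.* c
      n≡p*c = trans n≡ (ℕ.*-comm c p)
      c≢0′ : NonZero c
      c≢0′ = ℕ.≢-nonZero (λ { refl → ℕ.<-irrefl (sym n≡) 0<n })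
      wit : ∃ λ x → x ≢ 0# × x ^ c ≢ 1#
      wit = ∃-^≢1 c {{c≢0′}} (ℕ.<-≤-trans (ℕ.m<m*n c p {{c≢0′}} (1<prime pp)) (ℕ.≤-reflexive (sym n≡)))
      order : ∀ j → (proj₁ wit ^ c) ^ j ≡ 1# → p ∣ j
      order j eq with p ∣? j
      ... | yes p∣j = p∣j
      ... | no p∤j  = ⊥-elim (proj₂ (proj₂ wit) (ord-1∣ p j (prime∤⇒coprime pp p∤j) (η^m≡1 p c n≡p*c (proj₁ (proj₂ wit))) eq))

    -- A unit with x ^ (n / 2) ≠ 1 is needed here: then ζ = x ^ c₄ has ζ ^ 4 = 1 and ζ ^ 2 ≠ 1, and
    -- only the exponents 0 to 3 remain to be examined.
    fourModulus : 0 ℕ.< n → ∀ c₄ → n ≡ 4 ℕ.* c₄ → Σ Modulus λ M → m M ≡ 4 × c M ≡ c₄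
    fourModulus 0<n c₄ n≡ = record { m = 4 ; c = c₄ ; c≢0 = c≢0′ ; n≡m*c = n≡ ; η = proj₁ wit ; η≢0 = proj₁ (proj₂ wit) ; η-order = order } , refl , refl
      where
      c≢0′ : NonZero c₄
      c≢0′ = ℕ.≢-nonZero (λ { refl → ℕ.<-irrefl (sym n≡) 0<n })
      n≡′ : n ≡ 2 ℕ.* c₄ ℕ.* 2
      n≡′ = trans n≡ (trans (ℕ.*-assoc 2 2 c₄) (ℕ.*-comm 2 (2 ℕ.* c₄)))
      2c≢0′ : NonZero (2 ℕ.* c₄)
      2c≢0′ = ℕ.m*n≢0 2 c₄ {{_}} {{c≢0′}}
      wit : ∃ λ x → x ≢ 0# × x ^ (2 ℕ.* c₄) ≢ 1#
      wit = ∃-^≢1 (2 ℕ.* c₄) {{2c≢0′}} (ℕ.<-≤-trans (ℕ.m<m*n (2 ℕ.* c₄) 2 {{2c≢0′}} (s≤s (s≤s z≤n))) (ℕ.≤-reflexive (sym n≡′)))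
      ζ : K
      ζ = proj₁ wit ^ c₄
      ζ⁴≡1 : ζ ^ 4 ≡ 1#
      ζ⁴≡1 = η^m≡1 4 c₄ n≡ (proj₁ (proj₂ wit))
      ζ²≢1 : ζ ^ 2 ≢ 1#
      ζ²≢1 eq = proj₂ (proj₂ wit) (trans (cong (proj₁ wit ^_) (ℕ.*-comm 2 c₄)) (trans (sym (^-assocʳ (proj₁ wit) c₄ 2)) eq))
      small : ∀ ρ → ρ ℕ.< 4 → ζ ^ ρ ≡ 1# → ρ ≡ 0
      small 0 lt eq = refl
      small 1 lt eq = ⊥-elim (ζ²≢1 (^-*≡1 1 2 eq))
      small 2 lt eq = ⊥-elim (ζ²≢1 eq)
      small 3 lt eq = ⊥-elim (ζ²≢1 (^-*≡1 1 2 (^-cancel≡1 1 3 ζ⁴≡1 eq)))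
      small (suc (suc (suc (suc _)))) (s≤s (s≤s (s≤s (s≤s ())))) eq
      order : ∀ j → ζ ^ j ≡ 1# → 4 ∣ j
      order j eq = m%n≡0⇒n∣m j 4 (small (j % 4) (m%n<n j 4)
        (^-cancel≡1 (j % 4) ((j / 4) ℕ.* 4) (trans (cong (ζ ^_) (sym (m≡m%n+[m/n]*n j 4))) eq) (^-*≡1 4 (j / 4) ζ⁴≡1)))

  OddPrimeDivisor : ℕ → ℕ → Set
  OddPrimeDivisor n p = Prime p × 2 ℕ.< p × p ∣ n

  module PrimitiveTheory {n : ℕ} (𝔽 : FiniteField n) {p : ℕ} (pp : Prime p) (k : ℕ)
    (1<q : 1 ℕ.< p ℕ.^ k) (N≡ : suc n ≡ (p ℕ.^ k) ℕ.* (p ℕ.^ k)) (c₄ : ℕ) (n≡4c : n ≡ 4 ℕ.* c₄) where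
    open FieldTheory 𝔽
    open AtomTheory 𝔽
    open Modulus
    open OrderTheory 𝔽
    open Quadratic 𝔽 pp k 1<q N≡
    open WeilBound 𝔽 pp k 1<q N≡ using (n≢0)
    open SieveTheory 𝔽 pp k 1<q N≡

    0<n : 0 ℕ.< n
    0<n = ℕ.>-nonZero⁻¹ n {{n≢0}}

    TwoPrimitive : K → Set
    TwoPrimitive d = d ^ (2 ℕ.* c₄) ≡ 1# × (∀ j → 0 ℕ.< j → j ℕ.< 2 ℕ.* c₄ → d ^ j ≢ 1#)

    -- The order to be reached is n / 2 = 2 c₄. Its quotient by 2 is c₄; for an odd ℓ, the power d ^
    -- (n / (2 ℓ)) = 1 would give d ^ (n / ℓ) = 1 by squaring.
    twoPrimitive : ∀ {d} → d ^ (2 ℕ.* c₄) ≡ 1# → d ^ c₄ ≢ 1# → (∀ ℓ c → OddPrimeDivisor n ℓ → n ≡ ℓ ℕ.* c → d ^ c ≢ 1#) → TwoPrimitive d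
    twoPrimitive {d} d2c dc odd = d2c , λ j 0<j j<2c dj → ℕ.<⇒≱ j<2c (∣⇒≤ {{ℕ.>-nonZero 0<j}} (order∣ 0<2c d2c minimal j dj))
      where
      0<2c : 0 ℕ.< 2 ℕ.* c₄
      0<2c = ℕ.n≢0⇒n>0 (λ eq → ℕ.<-irrefl (sym (trans n≡4c (trans (ℕ.*-assoc 2 2 c₄) (trans (cong (2 ℕ.*_) eq) refl)))) 0<n)
      minimal : ∀ ℓ c → Prime ℓ → 2 ℕ.* c₄ ≡ ℓ ℕ.* c → d ^ c ≢ 1#
      minimal ℓ c pℓ eq dc≡1 with 2 ℕ.≟ ℓ
      ... | yes refl = dc (trans (cong (d ^_) (ℕ.*-cancelˡ-≡ c₄ c 2 eq)) dc≡1)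
      ... | no ne    = odd ℓ (2 ℕ.* c) (pℓ , ℕ.≤∧≢⇒< (1<prime pℓ) ne , divides (2 ℕ.* c) (trans n≡ (ℕ.*-comm ℓ _))) n≡ (^-*≡1 c 2 dc≡1)
        where
        n≡ : n ≡ ℓ ℕ.* (2 ℕ.* c)
        n≡ = trans n≡4c (trans (ℕ.*-assoc 2 2 c₄) (trans (cong (2 ℕ.*_) eq) (trans (sym (ℕ.*-assoc 2 ℓ c)) (trans (cong (ℕ._* c) (ℕ.*-comm 2 ℓ)) (ℕ.*-assoc ℓ 2 c)))))

    moduli : ∀ ps → All (OddPrimeDivisor n) ps → List Modulus
    moduli []       []                      = []
    moduli (p ∷ ps) ((pp , _ , p∣n) ∷ oks) = proj₁ (primeModulus 0<n pp p∣n) ∷ moduli ps oks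

    length-moduli : ∀ ps oks → length (moduli ps oks) ≡ length ps
    length-moduli []       []         = refl
    length-moduli (p ∷ ps) (_ ∷ oks) = cong suc (length-moduli ps oks)

    moduli-++ : ∀ ps ps′ oks oks′ → moduli ps oks ++ moduli ps′ oks′ ≡ moduli (ps ++ ps′) (Allₚ.++⁺ oks oks′)
    moduli-++ []       ps′ []          oks′ = refl
    moduli-++ (p ∷ ps) ps′ (ok ∷ oks) oks′ = cong (_ ∷_) (moduli-++ ps ps′ oks oks′)

    totalWeight-moduli : ∀ wt ps oks → totalWeight wt (moduli ps oks) ≡ sum (map wt ps)
    totalWeight-moduli wt []       []         = refl
    totalWeight-moduli wt (p ∷ ps) (_ ∷ oks) = cong (wt p ℕ.+_) (totalWeight-moduli wt ps oks)

    All-moduli : ∀ {P : ℕ → Set} ps oks → All P ps → All (P ∘ m) (moduli ps oks)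
    All-moduli []       []         []         = []
    All-moduli (p ∷ ps) (_ ∷ oks) (x ∷ xs) = x ∷ All-moduli ps oks xs

    AllPairs-moduli : ∀ ps oks → Unique ps → AllPairs CoprimeModuli (moduli ps oks)
    AllPairs-moduli []       []                  []       = []
    AllPairs-moduli (p ∷ ps) ((pp , _ , p∣n) ∷ oks) (u ∷ us) =
      coprimes ps oks u ∷ AllPairs-moduli ps oks us
      where
      coprimes : ∀ ps oks → All (p ≢_) ps → All (CoprimeModuli (proj₁ (primeModulus 0<n pp p∣n))) (moduli ps oks)
      coprimes []       []                 []       = []
      coprimes (p′ ∷ ps) ((pp′ , _) ∷ oks) (u ∷ us) = distinct⇒coprime pp pp′ u ∷ coprimes ps oks us

    All-moduli-c : ∀ {Q : ℕ → Set} ps oks → All (Q ∘ c) (moduli ps oks) → ∀ {ℓ} c′ → ℓ ∈ ps → n ≡ ℓ ℕ.* c′ → Q c′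
    All-moduli-c {Q} (p ∷ ps) ((pp , _ , divides c p∣n) ∷ oks) (x ∷ xs) c′ (here refl) n≡ =
      subst Q (ℕ.*-cancelˡ-≡ c c′ p {{prime⇒nonZero pp}} (trans (trans (ℕ.*-comm p c) (sym p∣n)) n≡)) x
    All-moduli-c (p ∷ ps) (_ ∷ oks) (x ∷ xs) c′ (there ℓ∈) n≡ = All-moduli-c ps oks xs c′ ℓ∈ n≡

    translate : ∀ {θ} → ¬ B θ → ∀ r → q ℕ.≤ r ℕ.* r → ∀ Cs Ss → Unique (Cs ++ Ss) → All (OddPrimeDivisor n) Cs → All (OddPrimeDivisor n) Ss →
      (∀ ℓ → OddPrimeDivisor n ℓ → ℓ ∈ Cs ++ Ss) →
      ∀ Kc .{{_ : NonZero Kc}} wt → (∀ j .{{_ : NonZero j}} → Kc ℕ.≤ wt j ℕ.* j) →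
      sum (map wt Ss) ℕ.* q ℕ.+ Kc ℕ.* (r ℕ.* 2 ℕ.^ (2 ℕ.+ length Cs) ℕ.* suc (length Ss)) ℕ.≤ Kc ℕ.* q →
      ∃ λ x → B x × TwoPrimitive (θ + x)
    translate {θ} θ∉B r q≤rr Cs Ss uniq okC okS complete Kc wt wt-ok crit = found
      where
      MC MS Ms : List Modulus
      MC = moduli Cs okC
      MS = moduli Ss okS
      Ms = moduli (Cs ++ Ss) (Allₚ.++⁺ okC okS)
      M₄ : Modulus
      M₄ = proj₁ (fourModulus 0<n c₄ n≡4c)
      m₄≡4 : m M₄ ≡ 4
      m₄≡4 = refl
      all4 : All (CoprimeModuli M₄) Ms
      all4 = go (Cs ++ Ss) (Allₚ.++⁺ okC okS)
        where
        ∤4 : ∀ {p′} → Prime p′ → 2 ℕ.< p′ → ¬ (p′ ∣ 4)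
        ∤4 pp′ 2<p′ p∣4 with euclidsLemma 2 2 pp′ p∣4
        ... | inj₁ d = ℕ.<⇒≱ 2<p′ (∣⇒≤ d)
        ... | inj₂ d = ℕ.<⇒≱ 2<p′ (∣⇒≤ d)
        go : ∀ ps oks → All (CoprimeModuli M₄) (moduli ps oks)
        go []       []                          = []
        go (p′ ∷ ps) ((pp′ , 2<p′ , _) ∷ oks) = Coprime.sym (prime∤⇒coprime pp′ (∤4 pp′ 2<p′)) ∷ go ps oks
      -- h has image of order 4 at `M₄` and trivial image at the odd moduli. Multiplying by s = h ^
      -- 2 thus changes d ^ c₄ by the element ζ ^ 2 of order 2 and leaves every other d ^ c
      -- unchanged.
      pure : Σ K λ h → h ≢ 0# × All (λ M′ → h ^ c M′ ≡ 1#) Ms × (∀ j → (h ^ c M₄) ^ j ≡ 1# → m M₄ ∣ j)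
      pure = purify M₄ Ms all4
      h s ζ : K
      h = proj₁ pure
      s = h ^ 2
      ζ = h ^ c₄
      h≢0 : h ≢ 0#
      h≢0 = proj₁ (proj₂ pure)
      s^c₄ : s ^ c₄ ≡ ζ ^ 2
      s^c₄ = ^-assoc-comm h 2 c₄
      ζ⁴≡1 : ζ ^ 4 ≡ 1#
      ζ⁴≡1 = η^m≡1 4 c₄ n≡4c h≢0
      ζ²≢1 : ζ ^ 2 ≢ 1#
      ζ²≢1 eq = ℕ.<⇒≱ (s≤s (s≤s (s≤s z≤n))) (∣⇒≤ (proj₂ (proj₂ (proj₂ pure)) 2 eq))
      adm : Admissible θ∉B r q≤rr M₄ m₄≡4 s (^-nonzero 2 h≢0) (MC ++ MS)
      adm = subst (Admissible θ∉B r q≤rr M₄ m₄≡4 s (^-nonzero 2 h≢0)) (sym (moduli-++ Cs Ss okC okS)) ((all4 ∷ AllPairs-moduli (Cs ++ Ss) _ uniq) , s≤s (s≤s z≤n) ∷ All-moduli (Cs ++ Ss) _ (All.map (λ { (pp′ , _) → 1<prime pp′ }) (Allₚ.++⁺ okC okS)))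
      good : ∃ λ x → B x × Good θ∉B r q≤rr M₄ m₄≡4 s (^-nonzero 2 h≢0) MC MS (s * (θ + x))
      good = exists-good θ∉B r q≤rr M₄ m₄≡4 s (^-nonzero 2 h≢0) MC Kc wt wt-ok MS adm
        (subst₂ (λ a b → a ℕ.* q ℕ.+ b ℕ.≤ Kc ℕ.* q) (sym (totalWeight-moduli wt Ss okS))
          (cong₂ (λ a b → Kc ℕ.* (r ℕ.* 2 ℕ.^ (2 ℕ.+ a) ℕ.* suc b)) (sym (length-moduli Cs okC)) (sym (length-moduli Ss okS))) crit)
      found : ∃ λ x → B x × TwoPrimitive (θ + x)
      found = let x , Bx , sd^c , odd = good in x , Bx , finish (θ + x) sd^c (subst (All _) (moduli-++ Cs Ss okC okS) odd)
        where
        finish : ∀ d → (s * d) ^ c₄ ≡ 1# → All (λ M → (s * d) ^ c M ≢ 1#) Ms → TwoPrimitive d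
        finish d sd^c odd = twoPrimitive d^2c d^c (λ ℓ c′ ok n≡ → All-moduli-c {Q = λ c → d ^ c ≢ 1#} (Cs ++ Ss) _
            (All.zipWith (λ { {M} (ne , h1) eq → ne (trans (^-distrib-* s d (c M)) (trans (cong₂ _*_ (trans (^-assoc-comm h 2 (c M)) (trans (cong (_^ 2) h1) (1^ 2))) eq) (*-identityˡ 1#))) }) (odd , proj₁ (proj₂ (proj₂ pure)))) c′ (complete ℓ ok) n≡)
          where
          ζ²d : ζ ^ 2 * d ^ c₄ ≡ 1#
          ζ²d = trans (cong (_* d ^ c₄) (sym s^c₄)) (trans (sym (^-distrib-* s d c₄)) sd^c)
          d^c : d ^ c₄ ≢ 1#
          d^c eq = ζ²≢1 (trans (sym (*-identityʳ _)) (trans (cong (ζ ^ 2 *_) (sym eq)) ζ²d))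
          d^2c : d ^ (2 ℕ.* c₄) ≡ 1#
          d^2c = begin
            d ^ (2 ℕ.* c₄) ≡⟨ trans (cong (d ^_) (ℕ.*-comm 2 c₄)) (sym (^-assocʳ d c₄ 2)) ⟩
            (d ^ c₄) ^ 2 ≡⟨ sym (*-identityˡ _) ⟩
            1# * (d ^ c₄) ^ 2 ≡⟨ cong (_* (d ^ c₄) ^ 2) (sym (trans (^-assocʳ ζ 2 2) ζ⁴≡1)) ⟩
            (ζ ^ 2) ^ 2 * (d ^ c₄) ^ 2 ≡⟨ sym (^-distrib-* (ζ ^ 2) (d ^ c₄) 2) ⟩
            (ζ ^ 2 * d ^ c₄) ^ 2 ≡⟨ cong (_^ 2) ζ²d ⟩
            1# ^ 2 ≡⟨ 1^ 2 ⟩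
            1# ∎
            where open ≡-Reasoning

-- The sieve criterion as a Boolean test on q.

module SieveCriterion where

  open TwoPrimitiveElements using (OddPrimeDivisor)
  open import Data.Bool.Base using (Bool; true; false; T; _∧_; _∨_; if_then_else_)
  open import Data.Bool.Properties using (T-∧; T-∨)
  open import Data.List.Base using (List; []; _∷_; _++_; length; map; filter; upTo)
  open import Data.List.Properties using (length-++; map-++; ++-assoc)
  open import Data.Nat.ListAction using (sum; product)
  open import Data.Nat.ListAction.Properties using (sum-++)
  open import Data.List.Membership.Propositional.Properties using (∈-filter⁺; ∈-filter⁻; ∈-upTo⁺; ∈-++⁺ˡ; ∈-++⁺ʳ)
  open import Data.List.Relation.Unary.Unique.Propositional.Properties using (upTo⁺; filter⁺; ++⁺)
  open import Data.Nat.Base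
  open import Data.Nat.Properties
  open import Data.Nat.DivMod
  open import Data.Nat.Divisibility
  open import Data.Nat.Primality.Factorisation using (factorisationHasAllPrimeFactors)
  open import Function.Bundles using (Equivalence)

  ∧-elim : ∀ {a b} → T (a ∧ b) → T a × T b
  ∧-elim = Equivalence.to T-∧

  ∨-elim : ∀ {a b} → T (a ∨ b) → T a ⊎ T b
  ∨-elim = Equivalence.to T-∨

  prime∣prime⇒≡ : ∀ {p ℓ} → Prime p → Prime ℓ → ℓ ∣ p → ℓ ≡ p
  prime∣prime⇒≡ pp pℓ ℓ∣p = [ (λ { refl → ⊥-elim (¬prime[1] pℓ) }) , id ]′ (prime⇒irreducible pp ℓ∣p)

  product∣ : ∀ {m} ps → Unique ps → All Prime ps → All (_∣ m) ps → product ps ∣ m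
  product∣ {m} [] u ps d = 1∣ m
  product∣ (p ∷ ps) (p∉ ∷ u) (pp ∷ prs) (p∣m ∷ ds) with product∣ ps u prs ds
  ... | divides c refl with euclidsLemma c (product ps) pp p∣m
  ...   | inj₁ (divides b refl) = divides b (*-assoc b p (product ps))
  ...   | inj₂ p∣Π = ⊥-elim (All.lookup p∉ (factorisationHasAllPrimeFactors pp p∣Π prs) refl)

  ^≤product : ∀ z ps → All (z ≤_) ps → z ^ length ps ≤ product ps
  ^≤product z []       []         = ≤-refl
  ^≤product z (p ∷ ps) (le ∷ les) = *-mono-≤ le (^≤product z ps les)

  -- ⌊log_b m⌋, cut off at f.
  logᵇ : (b f m : ℕ) → .{{NonZero b}} → ℕ
  logᵇ b zero    m = 0
  logᵇ b (suc f) m = if m <ᵇ b then 0 else suc (logᵇ b f (m / b))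

  ^-logᵇ≤ : ∀ b f m .{{_ : NonZero b}} → 0 < m → b ^ logᵇ b f m ≤ m
  ^-logᵇ≤ b zero    m 0<m = 0<m
  ^-logᵇ≤ b (suc f) m 0<m with m <ᵇ b in eq
  ... | true  = 0<m
  ... | false = ≤-trans (*-monoʳ-≤ b (^-logᵇ≤ b f (m / b) (m≥n⇒m/n>0 (≮⇒≥ (λ lt → subst T eq (<⇒<ᵇ lt)))))) (≤-trans (≤-reflexive (*-comm b (m / b))) (m/n*n≤m m b))

  ≤-logᵇ : ∀ b f l m .{{_ : NonZero b}} → 1 < b → l ≤ f → b ^ l ≤ m → l ≤ logᵇ b f m
  ≤-logᵇ b f       zero    m 1<b l≤f le = z≤n
  ≤-logᵇ b (suc f) (suc l) m 1<b (s≤s l≤f) le with m <ᵇ b in eq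
  ... | true  = ⊥-elim (<⇒≱ (<ᵇ⇒< m b (subst T (sym eq) tt)) (≤-trans (≤-trans (≤-reflexive (sym (*-identityʳ b))) (*-monoʳ-≤ b (m^n>0 b l))) le))
  ... | false = s≤s (≤-logᵇ b f l (m / b) 1<b l≤f (≤-trans (≤-reflexive (sym (m*n/n≡m (b ^ l) b))) (/-monoˡ-≤ b (≤-trans (≤-reflexive (*-comm (b ^ l) b)) le))))

  -- f bounds the number of divisions. Running out of it leaves factors p behind, which is harmless:
  -- `strip-∣` asserts that the other primes survive, and `strip-^` that a power of p stays one.
  strip : (f p m : ℕ) → .{{NonZero p}} → ℕ
  strip zero    p m = m
  strip (suc f) p m = if m % p ≡ᵇ 0 then strip f p (m / p) else m

  strip-≢0 : ∀ f p m .{{_ : NonZero p}} → 0 < m → 0 < strip f p m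
  strip-≢0 zero    p m 0<m = 0<m
  strip-≢0 (suc f) p m 0<m with m % p ≡ᵇ 0 in eq
  ... | false = 0<m
  ... | true  = strip-≢0 f p (m / p) (m≥n⇒m/n>0 (∣⇒≤ {{>-nonZero 0<m}} (m%n≡0⇒n∣m m p (≡ᵇ⇒≡ _ _ (subst T (sym eq) tt)))))

  strip-∣ : ∀ f p m .{{_ : NonZero p}} → Prime p → ∀ {ℓ} → Prime ℓ → ℓ ≢ p → ℓ ∣ m → ℓ ∣ strip f p m
  strip-∣ zero    p m pp pℓ ne d = d
  strip-∣ (suc f) p m pp pℓ ne d with m % p ≡ᵇ 0 in eq
  ... | false = d
  ... | true  with euclidsLemma (m / p) p pℓ (subst (_ ∣_) (sym (m/n*n≡m (m%n≡0⇒n∣m m p (≡ᵇ⇒≡ _ _ (subst T (sym eq) tt))))) d)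
  ...   | inj₁ d′ = strip-∣ f p (m / p) pp pℓ ne d′
  ...   | inj₂ ℓ∣p = ⊥-elim (ne (prime∣prime⇒≡ pp pℓ ℓ∣p))

  strip-^ : ∀ f p .{{_ : NonZero p}} k → ∃ λ j → strip f p (p ^ k) ≡ p ^ j
  strip-^ zero    p k = k , refl
  strip-^ (suc f) p k with p ^ k % p ≡ᵇ 0 in eq
  ... | false = k , refl
  strip-^ (suc f) 1 zero | true = strip-^ f 1 zero
  strip-^ (suc f) (suc (suc p)) zero | true = ⊥-elim (subst T (sym eq) tt)
  strip-^ (suc f) p (suc k) | true = let j , eq = strip-^ f p k in
    j , trans (cong (λ z → strip f p z) (trans (cong (_/ p) (*-comm p (p ^ k))) (m*n/n≡m (p ^ k) p))) eq

  -- Forty divisions exhaust each prime as long as m < 2 ^ 40, in particular for q² - 1 with q < 2 ^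
  -- 20.
  stripAll : List ℕ → ℕ → ℕ
  stripAll []            m = m
  stripAll (zero ∷ ps)   m = stripAll ps m
  stripAll (p@(suc _) ∷ ps) m = stripAll ps (strip 40 p m)

  stripAll-≢0 : ∀ ps m → 0 < m → 0 < stripAll ps m
  stripAll-≢0 []            m 0<m = 0<m
  stripAll-≢0 (zero ∷ ps)   m 0<m = stripAll-≢0 ps m 0<m
  stripAll-≢0 (suc p ∷ ps)  m 0<m = stripAll-≢0 ps _ (strip-≢0 40 (suc p) m 0<m)

  stripAll-∣ : ∀ ps m → All Prime ps → ∀ {ℓ} → Prime ℓ → All (ℓ ≢_) ps → ℓ ∣ m → ℓ ∣ stripAll ps m
  stripAll-∣ []           m []        pℓ []         d = d
  stripAll-∣ (zero ∷ ps)  m (_ ∷ pps) pℓ (_ ∷ nes)  d = stripAll-∣ ps m pps pℓ nes d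
  stripAll-∣ (suc p ∷ ps) m (pp ∷ pps) pℓ (ne ∷ nes) d = stripAll-∣ ps _ pps pℓ nes (strip-∣ 40 (suc p) m pp pℓ ne d)

  -- An integer upper bound for Kc / j.
  wt : ℕ → ℕ → ℕ
  wt Kc zero    = 0
  wt Kc (suc j) = suc (Kc / suc j)

  wt-ok : ∀ Kc j .{{_ : NonZero j}} → Kc ≤ wt Kc j * j
  wt-ok Kc j@(suc _) = ≤-trans (≤-reflexive (m≡m%n+[m/n]*n Kc j)) (+-monoˡ-≤ ((Kc / j) * j) (<⇒≤ (m%n<n Kc j)))

  wt-anti : ∀ Kc {i j} .{{_ : NonZero i}} → i ≤ j → wt Kc j ≤ wt Kc i
  wt-anti Kc {i@(suc _)} {j@(suc _)} i≤j = s≤s (/-monoʳ-≤ Kc i≤j)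

  sum-map-≤-const : ∀ (f : ℕ → ℕ) c ps → All (λ p → f p ≤ c) ps → sum (map f ps) ≤ length ps * c
  sum-map-≤-const f c []       []         = z≤n
  sum-map-≤-const f c (p ∷ ps) (le ∷ les) = +-mono-≤ le (sum-map-≤-const f c ps les)

  sum-map-++ : ∀ (f : ℕ → ℕ) ps ps′ → sum (map f (ps ++ ps′)) ≡ sum (map f ps) + sum (map f ps′)
  sum-map-++ f ps ps′ = trans (cong sum (map-++ f ps ps′)) (sum-++ (map f ps) (map f ps′))

  -- n stands for q² - 1, Cs for the core primes and Ss for the sieving primes.
  record Sieveable (q n : ℕ) : Set where
    field
      r Kc : ℕ
      {{Kc≢0}} : NonZero Kc
      q≤rr : q ≤ r * r
      Cs Ss : List ℕ
      unique : Unique (Cs ++ Ss)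
      Cs-ok : All (OddPrimeDivisor n) Cs
      Ss-ok : All (OddPrimeDivisor n) Ss
      complete : ∀ ℓ → OddPrimeDivisor n ℓ → ℓ ∈ Cs ++ Ss
      criterion : sum (map (wt Kc) Ss) * q + Kc * (r * 2 ^ (2 + length Cs) * suc (length Ss)) ≤ Kc * q

  -- The prime divisors of n are split at z: `D` can be computed from a fixed list, while `bigs`
  -- occurs in proofs only and enters the test through a bound on its length.
  module Divisors (sp : List ℕ) (z : ℕ) {{z≢0 : NonZero z}} (sp-ok : All (λ p → Prime p × 2 < p × p < z) sp) (sp-unique : Unique sp)
    (sp-complete : ∀ {ℓ} → ℓ < z → Prime ℓ → 2 < ℓ → ℓ ∈ sp) (2<z : 2 < z) (n : ℕ) (0<n : 0 < n) where

    Big : ℕ → Set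
    Big p = z ≤ p × Prime p × p ∣ n

    Big? : Decidable Big
    Big? p = (z ≤? p) ×-dec (prime? p ×-dec (p ∣? n))

    D bigs : List ℕ
    D = filter (_∣? n) sp
    bigs = filter Big? (upTo (suc n))

    bigs-ok : All Big bigs
    bigs-ok = Allₚ.all-filter Big? (upTo (suc n))

    bigs-unique : Unique bigs
    bigs-unique = filter⁺ Big? (upTo⁺ (suc n))

    ok : All (OddPrimeDivisor n) (D ++ bigs)
    ok = Allₚ.++⁺ (All.zipWith (λ { ((pp , 2<p , _) , d) → pp , 2<p , d }) (Allₚ.filter⁺ (_∣? n) sp-ok , Allₚ.all-filter (_∣? n) sp))
           (All.map (λ { (z≤p , pp , d) → pp , <-≤-trans 2<z z≤p , d }) bigs-ok)

    unique : Unique (D ++ bigs)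
    unique = ++⁺ (filter⁺ (_∣? n) sp-unique) bigs-unique
      (λ { (x∈D , x∈bigs) → <⇒≱ (proj₂ (proj₂ (All.lookup sp-ok (proj₁ (∈-filter⁻ (_∣? n) x∈D))))) (proj₁ (All.lookup bigs-ok x∈bigs)) })

    complete : ∀ ℓ → OddPrimeDivisor n ℓ → ℓ ∈ D ++ bigs
    complete ℓ (pℓ , 2<ℓ , d) with ℓ <? z
    ... | yes ℓ<z = ∈-++⁺ˡ (∈-filter⁺ (_∣? n) (sp-complete ℓ<z pℓ 2<ℓ) d)
    ... | no ℓ≮z  = ∈-++⁺ʳ D (∈-filter⁺ Big? (∈-upTo⁺ (s≤s (∣⇒≤ {{>-nonZero 0<n}} d))) (≮⇒≥ ℓ≮z , pℓ , d))

    -- The product of the large primes divides what is left of n after the small ones are stripped,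
    -- and each factor is at least z.
    #bigs≤ : ∀ f → length bigs ≤ f → length bigs ≤ logᵇ z f (stripAll (2 ∷ D) n)
    #bigs≤ f le = ≤-logᵇ z f (length bigs) _ (<-trans (s≤s (s≤s z≤n)) 2<z) le
      (≤-trans (^≤product z bigs (All.map proj₁ bigs-ok)) (∣⇒≤ {{>-nonZero (stripAll-≢0 (2 ∷ D) n 0<n)}}
        (product∣ bigs bigs-unique (All.map (proj₁ ∘ proj₂) bigs-ok) (All.map rest bigs-ok))))
      where
      rest : ∀ {p} → Big p → p ∣ stripAll (2 ∷ D) n
      rest {p} (z≤p , pp , d) = stripAll-∣ (2 ∷ D) n (prime[2] ∷ All.map proj₁ (Allₚ.filter⁺ (_∣? n) sp-ok)) pp
        ((λ { refl → <⇒≱ 2<z z≤p }) ∷ All.map (λ { (_ , _ , lt) refl → <⇒≱ lt z≤p }) (Allₚ.filter⁺ (_∣? n) sp-ok)) d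

    sieveable : ∀ {q} r Kc {{Kc≢0 : NonZero Kc}} → q ≤ r * r → ∀ Cs Ss → Cs ++ Ss ≡ D ++ bigs →
      sum (map (wt Kc) Ss) * q + Kc * (r * 2 ^ (2 + length Cs) * suc (length Ss)) ≤ Kc * q → Sieveable q n
    sieveable r Kc {{Kc≢0}} q≤rr Cs Ss eq crit = record
      { r = r ; Kc = Kc ; Kc≢0 = Kc≢0 ; q≤rr = q≤rr ; Cs = Cs ; Ss = Ss ; unique = subst Unique (sym eq) unique
      ; Cs-ok = Allₚ.++⁻ˡ Cs ok′ ; Ss-ok = Allₚ.++⁻ʳ Cs ok′
      ; complete = λ ℓ o → subst (ℓ ∈_) (sym eq) (complete ℓ o) ; criterion = crit }
      where
      ok′ : All (OddPrimeDivisor n) (Cs ++ Ss)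
      ok′ = subst (All (OddPrimeDivisor n)) (sym eq) ok

  2^-double : ∀ {e} l {l′} → l′ ≡ l + 1 → e ≡ 2 ^ (2 + l) → 2 * e ≡ 2 ^ (2 + l′)
  2^-double l l′≡ refl = cong (λ j → 2 ^ (2 + j)) (sym (trans l′≡ (+-comm l 1)))

  -- t bounds the number of prime divisors from z on; each is charged `wz`, the weight of z itself,
  -- which is the largest possible.
  criterionᵇ : (Kc wz q r t e : ℕ) → List ℕ → Bool
  criterionᵇ Kc wz q r t e S = (sum (map (wt Kc) S) + t * wz) * q + Kc * (r * e * suc (length S + t)) ≤ᵇ Kc * q

  -- Only cores consisting of the smallest primes are tried; e is 2 ^ (2 + size of the core).
  anyCoreᵇ : (Kc wz q r t e : ℕ) → List ℕ → Bool
  anyCoreᵇ Kc wz q r t e []      = criterionᵇ Kc wz q r t e []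
  anyCoreᵇ Kc wz q r t e (p ∷ S) = criterionᵇ Kc wz q r t e (p ∷ S) ∨ anyCoreᵇ Kc wz q r t (2 * e) S

  sieveᵇ : (sp : List ℕ) (z Kc : ℕ) → .{{NonZero z}} → (q r : ℕ) → Bool
  sieveᵇ sp z Kc q r = withDivisors (filter (_∣? (q * q ∸ 1)) sp)
    where
    withDivisors : List ℕ → Bool
    withDivisors D = anyCoreᵇ Kc (wt Kc z) q r (logᵇ z 40 (stripAll (2 ∷ D) (q * q ∸ 1))) 4 D

  module SieveCheck (sp : List ℕ) (z : ℕ) {{z≢0 : NonZero z}} (sp-ok : All (λ p → Prime p × 2 < p × p < z) sp) (sp-unique : Unique sp)
    (sp-complete : ∀ {ℓ} → ℓ < z → Prime ℓ → 2 < ℓ → ℓ ∈ sp) (2<z : 2 < z) (Kc : ℕ) {{Kc≢0 : NonZero Kc}} where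

    sieve-sound : ∀ q r → 1 < q → q < 2 ^ 20 → q ≤ r * r → T (sieveᵇ sp z Kc q r) → Sieveable q (q * q ∸ 1)
    sieve-sound q r 1<q q<2²⁰ q≤rr passed = go [] D 4 refl refl passed
      where
      n : ℕ
      n = q * q ∸ 1
      0<n : 0 < n
      0<n = m<n⇒0<n∸m (<-≤-trans 1<q (m≤m*n q q {{>-nonZero (<-trans (s≤s z≤n) 1<q)}}))
      open Divisors sp z sp-ok sp-unique sp-complete 2<z n 0<n
      t : ℕ
      t = logᵇ z 40 (stripAll (2 ∷ D) n)
      -- More than 40 prime factors would give n > 2 ^ 40, but q < 2 ^ 20. This justifies the
      -- cut-off 40 in `logᵇ`.
      l≤40 : length bigs ≤ 40
      l≤40 = ≮⇒≥ (λ lt → <⇒≱ (<-≤-trans (^-monoʳ-< 2 (s≤s (s≤s z≤n)) lt) (≤-trans (≤-trans (^-monoˡ-≤ (length bigs) (<⇒≤ 2<z)) (^≤product z bigs (All.map proj₁ bigs-ok)))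
          (≤-trans (∣⇒≤ {{>-nonZero 0<n}} (product∣ bigs bigs-unique (All.map (proj₁ ∘ proj₂) bigs-ok) (All.map (proj₂ ∘ proj₂) bigs-ok))) (m∸n≤m (q * q) 1))))
          (≤-trans (*-mono-≤ (<⇒≤ q<2²⁰) (<⇒≤ q<2²⁰)) (≤-reflexive (sym (^-distribˡ-+-* 2 20 20)))))
      t-ok : length bigs ≤ t
      t-ok = #bigs≤ 40 l≤40
      test : ∀ C S e → C ++ S ≡ D → e ≡ 2 ^ (2 + length C) → T (criterionᵇ Kc (wt Kc z) q r t e S) → Sieveable q n
      test C S e eq e≡ c = sieveable r Kc {{Kc≢0}} q≤rr C (S ++ bigs) (trans (sym (++-assoc C S bigs)) (cong (_++ bigs) eq))
        (≤-trans (+-mono-≤ (*-monoˡ-≤ q weight) (*-monoʳ-≤ Kc (*-mono-≤ (≤-reflexive (cong (r *_) (sym e≡))) (s≤s len)))) (≤ᵇ⇒≤ _ _ c))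
        where
        weight : sum (map (wt Kc) (S ++ bigs)) ≤ sum (map (wt Kc) S) + t * wt Kc z
        weight = ≤-trans (≤-reflexive (sum-map-++ (wt Kc) S bigs)) (+-monoʳ-≤ (sum (map (wt Kc) S))
          (≤-trans (sum-map-≤-const (wt Kc) (wt Kc z) bigs (All.map (λ { (z≤p , _) → wt-anti Kc z≤p }) bigs-ok)) (*-monoˡ-≤ (wt Kc z) t-ok)))
        len : length (S ++ bigs) ≤ length S + t
        len = ≤-trans (≤-reflexive (length-++ S)) (+-monoʳ-≤ (length S) t-ok)
      go : ∀ C S e → C ++ S ≡ D → e ≡ 2 ^ (2 + length C) → T (anyCoreᵇ Kc (wt Kc z) q r t e S) → Sieveable q n
      go C []      e eq e≡ c = test C [] e eq e≡ c
      go C (p ∷ S) e eq e≡ c = [ test C (p ∷ S) e eq e≡ ,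
        go (C ++ p ∷ []) S (2 * e) (trans (++-assoc C (p ∷ []) S) eq) (2^-double (length C) (length-++ C) e≡) ]′ (∨-elim {criterionᵇ Kc (wt Kc z) q r t e (p ∷ S)} c)

-- Large q: linear programming bounds and the unbounded range.

module LargeFields where

  open SieveCriterion
  open import Data.List.Base using (List; []; _∷_; _++_; length; map; filter; take; drop)
  open import Data.List.Properties using (filter-accept; filter-reject; ++-assoc; ++-identityʳ; filter-++; take++drop≡id; length-filter; length-take)
  open import Data.Nat.ListAction using (sum; product)
  open import Data.Nat.Base
  open import Data.Nat.Properties
  open import Data.Nat.Divisibility
  open import Data.Nat.Tactic.RingSolver using (solve-∀)

  -- Take the least r with q ≤ r². Then r R ≤ q is the integer form of R ≤ √q; rounding r upwards is
  -- paid for by assuming (R + 1)² ≤ q.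
  ∃-isqrt : ∀ R q → suc R * suc R ≤ q → ∃ λ r → q ≤ r * r × r * R ≤ q
  ∃-isqrt R q le = search q (m≤m*n q q {{>-nonZero (≤-trans (s≤s z≤n) le)}})
    where
    search : ∀ r → q ≤ r * r → ∃ λ r → q ≤ r * r × r * R ≤ q
    search zero    q≤rr = zero , q≤rr , z≤n
    search (suc r) q≤rr with q ≤? r * r
    ... | yes p = search r p
    ... | no ¬p = suc r , q≤rr , bound (m≤n⇒m<n∨m≡n R≤r)
      where
      R≤r : R ≤ r
      R≤r = ≮⇒≥ (λ r<R → ¬p (⊥-elim (<⇒≱ (*-mono-< (s≤s r<R) (s≤s r<R)) (≤-trans le q≤rr))))
      bound : R < r ⊎ R ≡ r → suc r * R ≤ q
      bound (inj₂ refl) = ≤-trans (*-monoʳ-≤ (suc r) (n≤1+n r)) le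
      bound (inj₁ R<r)  = ≤-trans (≤-trans (+-monoˡ-≤ (r * R) (<⇒≤ R<r)) (≤-reflexive (sym (*-suc r R)))) (≤-trans (*-monoʳ-≤ r R<r) (<⇒≤ (≰⇒> ¬p)))

  2^-cancel-≤ : ∀ {a b} → 2 ^ a ≤ 2 ^ b → a ≤ b
  2^-cancel-≤ le = ≮⇒≥ (λ lt → <⇒≱ (^-monoʳ-< 2 (s≤s (s≤s z≤n)) lt) le)

  -- ⌊16 log₂ p⌋, but 96 for p ≥ 64.
  L : ℕ → ℕ
  L p = logᵇ 2 96 (p ^ 16)

  2^ΣL≤ : ∀ ps → All Prime ps → 2 ^ sum (map L ps) ≤ product ps ^ 16
  2^ΣL≤ []       []         = ≤-refl
  2^ΣL≤ (p ∷ ps) (pp ∷ pps) = begin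
    2 ^ (L p + sum (map L ps))     ≡⟨ ^-distribˡ-+-* 2 (L p) _ ⟩
    2 ^ L p * 2 ^ sum (map L ps)   ≤⟨ *-mono-≤ (^-logᵇ≤ 2 96 (p ^ 16) (m^n>0 p {{prime⇒nonZero pp}} 16)) (2^ΣL≤ ps pps) ⟩
    p ^ 16 * product ps ^ 16       ≡⟨ sym (^-distribʳ-*′ p (product ps) 16) ⟩
    (p * product ps) ^ 16          ∎
    where
    open ≤-Reasoning
    ^-distribʳ-*′ : ∀ x y k → (x * y) ^ k ≡ x ^ k * y ^ k
    ^-distribʳ-*′ x y zero    = refl
    ^-distribʳ-*′ x y (suc k) = trans (cong (x * y *_) (^-distribʳ-*′ x y k)) (lem x y (x ^ k) (y ^ k))
      where
      lem : ∀ x y a b → x * y * (a * b) ≡ x * a * (y * b)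
      lem = solve-∀

  module RangeCheck (sp : List ℕ) (sp-ok : All (λ p → Prime p × 2 < p × p < 64) sp) (sp-unique : Unique sp)
    (sp-complete : ∀ {ℓ} → ℓ < 64 → Prime ℓ → 2 < ℓ → ℓ ∈ sp) (q : ℕ) (1<q : 1 < q) where

    n : ℕ
    n = q * q ∸ 1

    0<n : 0 < n
    0<n = m<n⇒0<n∸m (<-≤-trans 1<q (m≤m*n q q {{>-nonZero (<-trans (s≤s z≤n) 1<q)}}))

    2<64 : 2 < 64
    2<64 = s≤s (s≤s (s≤s z≤n))

    open Divisors sp 64 sp-ok sp-unique sp-complete 2<64 n 0<n

    64≤⇒L : ∀ {p} → 64 ≤ p → 96 ≤ L p
    64≤⇒L {p} le = ≤-logᵇ 2 96 96 (p ^ 16) (s≤s (s≤s z≤n)) ≤-refl (≤-trans (≤-reflexive (sym (^-*-assoc 2 6 16))) (^-monoˡ-≤ 16 le))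

    -- The distinct primes dividing n have a product of at most q² ≤ 2 ^ (2 b), and `L` measures 16
    -- times the binary logarithm. This is the one constraint of the linear program.
    ΣL≤ : ∀ b → q ≤ 2 ^ b → sum (map L (D ++ bigs)) ≤ 32 * b
    ΣL≤ b q≤ = 2^-cancel-≤ (begin
      2 ^ sum (map L (D ++ bigs)) ≤⟨ 2^ΣL≤ (D ++ bigs) (All.map proj₁ ok) ⟩
      product (D ++ bigs) ^ 16 ≤⟨ ^-monoˡ-≤ 16 (≤-trans (∣⇒≤ {{>-nonZero 0<n}} (product∣ (D ++ bigs) unique (All.map proj₁ ok) (All.map (proj₂ ∘ proj₂) ok))) (m∸n≤m (q * q) 1)) ⟩
      (q * q) ^ 16 ≤⟨ ^-monoˡ-≤ 16 (*-mono-≤ q≤ q≤) ⟩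
      (2 ^ b * 2 ^ b) ^ 16 ≡⟨ cong (_^ 16) (sym (^-distribˡ-+-* 2 b b)) ⟩
      (2 ^ (b + b)) ^ 16 ≡⟨ ^-*-assoc 2 (b + b) 16 ⟩
      2 ^ ((b + b) * 16) ≡⟨ cong (2 ^_) (lem b) ⟩
      2 ^ (32 * b) ∎)
      where
      open ≤-Reasoning
      lem : ∀ b → (b + b) * 16 ≡ 32 * b
      lem = solve-∀

    -- Linear programming duality: G is split into a part charged to the small primes and a multiple of the logarithm,
    -- whose sum over the primes dividing n is at most that of n.
    dual-bound : ∀ (G : ℕ → ℕ) lam → (∀ p → 64 ≤ p → G p ≤ lam * 96) → ∀ xs →
      sum (map G (filter (_∣? n) xs ++ bigs)) ≤ sum (map (λ p → G p ∸ lam * L p) xs) + lam * sum (map L (filter (_∣? n) xs ++ bigs))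
    dual-bound G lam big [] = go bigs (All.map proj₁ bigs-ok)
      where
      go : ∀ ps → All (64 ≤_) ps → sum (map G ps) ≤ lam * sum (map L ps)
      go []       []         = z≤n
      go (p ∷ ps) (le ∷ les) = ≤-trans (+-mono-≤ (≤-trans (big p le) (*-monoʳ-≤ lam (64≤⇒L le))) (go ps les)) (≤-reflexive (sym (*-distribˡ-+ lam (L p) _)))
    dual-bound G lam big (x ∷ xs) = step (x ∣? n)
      where
      rest : sum (map G (filter (_∣? n) xs ++ bigs)) ≤ sum (map (λ p → G p ∸ lam * L p) xs) + lam * sum (map L (filter (_∣? n) xs ++ bigs))
      rest = dual-bound G lam big xs
      lem : ∀ g lam l s t → lam * l + g + (s + lam * t) ≡ g + s + lam * (l + t)
      lem = solve-∀
      Bound : List ℕ → Set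
      Bound ds = sum (map G (ds ++ bigs)) ≤ G x ∸ lam * L x + sum (map (λ p → G p ∸ lam * L p) xs) + lam * sum (map L (ds ++ bigs))
      step : Dec (x ∣ n) → Bound (filter (_∣? n) (x ∷ xs))
      step (no x∤n)  = subst Bound (sym (filter-reject (_∣? n) x∤n)) (≤-trans rest (+-monoˡ-≤ _ (m≤n+m _ (G x ∸ lam * L x))))
      step (yes x∣n) = subst Bound (sym (filter-accept (_∣? n) x∣n)) (≤-trans (+-mono-≤ (m≤n+m∸n (G x) (lam * L x)) rest)
        (≤-reflexive (lem (G x ∸ lam * L x) lam (L x) _ _)))

    module Core (k Kc : ℕ) {{Kc≢0 : NonZero Kc}} (R : ℕ) {{R≢0 : NonZero R}} where
      C S : List ℕ
      C = filter (_∣? n) (take k sp)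
      S = filter (_∣? n) (drop k sp) ++ bigs

      C++S : C ++ S ≡ D ++ bigs
      C++S = trans (sym (++-assoc C _ bigs)) (cong (_++ bigs) (trans (sym (filter-++ (_∣? n) (take k sp) (drop k sp))) (cong (filter (_∣? n)) (take++drop≡id k sp))))

      |C|≤k : length C ≤ k
      |C|≤k = ≤-trans (length-filter (_∣? n) (take k sp)) (≤-trans (≤-reflexive (length-take k sp)) (m⊓n≤m k (length sp)))

      e : ℕ
      e = 2 ^ (2 + k)

      -- The cost of sieving by p: the criterion divided by r, with q / r replaced by its lower
      -- bound `R`. The costs over `S` plus `Kc * e` must not exceed `Kc * R`.
      G : ℕ → ℕ
      G p = wt Kc p * R + Kc * e

      ΣG : ∀ ps → sum (map G ps) ≡ sum (map (wt Kc) ps) * R + Kc * (e * length ps)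
      ΣG []       = sym (trans (cong (Kc *_) (*-zeroʳ e)) (*-zeroʳ Kc))
      ΣG (p ∷ ps) = trans (cong (G p +_) (ΣG ps)) (lem (wt Kc p) R Kc e (sum (map (wt Kc) ps)) (length ps))
        where
        lem : ∀ w R K e s l → w * R + K * e + (s * R + K * (e * l)) ≡ (w + s) * R + K * (e * suc l)
        lem = solve-∀

      -- The assumption gives Kc e (l + 1) ≤ R (Kc - s). Multiplying by r and using r R ≤ q turns
      -- the right side into q (Kc - s), which is the criterion. That s ≤ Kc has to be shown first,
      -- because subtraction is truncated.
      fromΣG : suc R * suc R ≤ q → sum (map G S) + Kc * e ≤ Kc * R → Sieveable q n
      fromΣG R²≤q le = sieveable r Kc q≤rr C S C++S (begin
          s * q + Kc * (r * 2 ^ (2 + length C) * suc l) ≤⟨ +-monoʳ-≤ (s * q) (*-monoʳ-≤ Kc (*-monoˡ-≤ (suc l) (*-monoʳ-≤ r (^-monoʳ-≤ 2 (+-monoʳ-≤ 2 |C|≤k))))) ⟩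
          s * q + Kc * (r * e * suc l) ≡⟨ cong (s * q +_) (lem₁ Kc r e l) ⟩
          s * q + r * (Kc * (e * suc l)) ≤⟨ +-monoʳ-≤ (s * q) (*-monoʳ-≤ r A≤) ⟩
          s * q + r * (R * (Kc ∸ s)) ≡⟨ cong (s * q +_) (sym (*-assoc r R _)) ⟩
          s * q + r * R * (Kc ∸ s) ≤⟨ +-monoʳ-≤ (s * q) (*-monoˡ-≤ (Kc ∸ s) rR≤q) ⟩
          s * q + q * (Kc ∸ s) ≡⟨ trans (cong (_+ q * (Kc ∸ s)) (*-comm s q)) (trans (sym (*-distribˡ-+ q s _)) (cong (q *_) (m+[n∸m]≡n s≤K))) ⟩
          q * Kc ≡⟨ *-comm q Kc ⟩
          Kc * q ∎)
        where
        open ≤-Reasoning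
        s l r : ℕ
        s = sum (map (wt Kc) S)
        l = length S
        isqrt : ∃ λ r → q ≤ r * r × r * R ≤ q
        isqrt = ∃-isqrt R q R²≤q
        r = proj₁ isqrt
        q≤rr : q ≤ r * r
        q≤rr = proj₁ (proj₂ isqrt)
        rR≤q : r * R ≤ q
        rR≤q = proj₂ (proj₂ isqrt)
        lem₁ : ∀ K r e l → K * (r * e * suc l) ≡ r * (K * (e * suc l))
        lem₁ = solve-∀
        lem₂ : ∀ s R K e l → s * R + K * (e * l) + K * e ≡ s * R + K * (e * suc l)
        lem₂ = solve-∀
        total : s * R + Kc * (e * suc l) ≤ Kc * R
        total = ≤-trans (≤-reflexive (trans (sym (lem₂ s R Kc e l)) (cong (_+ Kc * e) (sym (ΣG S))))) le
        s≤K : s ≤ Kc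
        s≤K = *-cancelʳ-≤ s Kc R (≤-trans (m≤m+n (s * R) _) total)
        A≤ : Kc * (e * suc l) ≤ R * (Kc ∸ s)
        A≤ = +-cancelˡ-≤ (s * R) _ _ (≤-trans total (≤-reflexive (trans (cong (_* R) (sym (m+[n∸m]≡n s≤K))) (trans (*-distribʳ-+ R s (Kc ∸ s)) (cong (s * R +_) (*-comm (Kc ∸ s) R))))))

      -- Weak duality: `lam` prices the constraint `ΣL≤`. By the condition on `G 64` no prime from
      -- 64 on has a positive reduced cost, so only the listed small primes outside the core
      -- contribute one.
      inRange : ∀ a b lam → 2 ^ a ≤ q → q ≤ 2 ^ b → suc R * suc R ≤ 2 ^ a → G 64 ≤ lam * 96 →
        sum (map (λ p → G p ∸ lam * L p) (drop k sp)) + lam * (32 * b) + Kc * e ≤ Kc * R → Sieveable q n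
      inRange a b lam 2^a≤q q≤2^b R²≤ G64 total = fromΣG (≤-trans R²≤ 2^a≤q) (≤-trans (+-monoˡ-≤ (Kc * e)
          (≤-trans (dual-bound G lam (λ p 64≤p → ≤-trans (+-monoˡ-≤ (Kc * e) (*-monoˡ-≤ R (wt-anti Kc 64≤p))) G64) (drop k sp))
            (+-monoʳ-≤ (sum (map (λ p → G p ∸ lam * L p) (drop k sp))) (*-monoʳ-≤ lam (≤-trans ΣLS (ΣL≤ b q≤2^b)))))) total)
        where
        ΣLS : sum (map L S) ≤ sum (map L (D ++ bigs))
        ΣLS = ≤-trans (m≤n+m _ (sum (map L C))) (≤-reflexive (trans (sym (sum-map-++ L C S)) (cong (sum ∘ map L) C++S)))

    ∃-log₄ : ∀ m → 0 < m → ∃ λ h → 4 ^ h ≤ m × m < 4 ^ suc h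
    ∃-log₄ (suc zero)    _ = 0 , ≤-refl , s≤s (s≤s z≤n)
    ∃-log₄ (suc (suc m)) _ with ∃-log₄ (suc m) (s≤s z≤n)
    ... | h , lo , hi with suc (suc m) <? 4 ^ suc h
    ...   | yes lt = h , m≤n⇒m≤1+n lo , lt
    ...   | no ¬lt = suc h , ≮⇒≥ ¬lt , ≤-<-trans hi (^-monoʳ-< 4 (s≤s (s≤s z≤n)) (n<1+n (suc h)))

    4^≡2^ : ∀ h → 4 ^ h ≡ 2 ^ (2 * h)
    4^≡2^ h = ^-*-assoc 2 2 h

    -- For large q every odd prime divisor of q² - 1 goes into the core.
    wholeCore : ∀ h → 24 ≤ h → 4 ^ h ≤ q → q < 4 ^ suc h → sum (map (λ p → 96 ∸ 1 * L p) sp) ≤ 431 → Sieveable q n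
    -- No prime is sieved, so no weight occurs: the denominator is 1 and the criterion reads r 2 ^
    -- (2 + l) ≤ q.
    wholeCore h 24≤h lo hi small = sieveable r 1 q≤rr (D ++ bigs) [] (++-identityʳ (D ++ bigs)) (begin
          1 * (r * 2 ^ (2 + l) * 1) ≡⟨ trans (*-identityˡ _) (*-identityʳ _) ⟩
          r * 2 ^ (2 + l) ≤⟨ *-monoʳ-≤ r 2^l≤R ⟩
          r * R ≤⟨ rR≤q ⟩
          q ≡⟨ sym (*-identityˡ q) ⟩
          1 * q ∎)
      where
      open ≤-Reasoning
      l R r : ℕ
      l = length (D ++ bigs)
      R = 2 ^ h ∸ 1
      R+1 : suc R ≡ 2 ^ h
      R+1 = m+[n∸m]≡n (m^n>0 2 h)
      isqrt : ∃ λ r → q ≤ r * r × r * R ≤ q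
      isqrt = ∃-isqrt R q (≤-trans (≤-reflexive (trans (cong (λ x → x * x) R+1) (trans (sym (^-distribˡ-+-* 2 h h)) (trans (cong (2 ^_) (cong (h +_) (sym (+-identityʳ h)))) (sym (4^≡2^ h)))))) lo)
      r = proj₁ isqrt
      q≤rr : q ≤ r * r
      q≤rr = proj₁ (proj₂ isqrt)
      rR≤q : r * R ≤ q
      rR≤q = proj₂ (proj₂ isqrt)
      -- The dual bound with cost 96 for every prime and multiplier 1. The sum of 96 - L p over the
      -- odd primes below 64 is 431.
      96l≤ : l * 96 ≤ 431 + 32 * (2 * suc h)
      96l≤ = ≤-trans (≤-reflexive (sym (Σ96 (D ++ bigs)))) (≤-trans (dual-bound (λ _ → 96) 1 (λ _ _ → ≤-refl) sp)
        (+-mono-≤ small (≤-trans (≤-reflexive (*-identityˡ _)) (ΣL≤ (2 * suc h) (≤-trans (<⇒≤ hi) (≤-reflexive (4^≡2^ (suc h))))))))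
        where
        Σ96 : ∀ ps → sum (map (λ _ → 96) ps) ≡ length ps * 96
        Σ96 []       = refl
        Σ96 (_ ∷ ps) = cong (96 +_) (Σ96 ps)
      -- If h ≤ l + 2, the bound 96 l ≤ 495 + 64 h would give 32 h ≤ 687, whereas 32 · 24 = 768.
      3+l≤h : 3 + l ≤ h
      3+l≤h = ≮⇒≥ (λ h<3+l → <⇒≱ {431 + 32 * (2 * suc h)} {l * 96} (+-cancelʳ-< 192 _ _ (begin-strict
        431 + 32 * (2 * suc h) + 192 ≡⟨ lem₁ h ⟩
        687 + 64 * h <⟨ +-monoˡ-< (64 * h) (<-≤-trans (≤ᵇ⇒≤ 688 768 _) (*-monoʳ-≤ 32 24≤h)) ⟩
        32 * h + 64 * h ≡⟨ lem₂ h ⟩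
        96 * h ≤⟨ *-monoʳ-≤ 96 (s≤s⁻¹ h<3+l) ⟩
        96 * (2 + l) ≡⟨ lem₃ l ⟩
        l * 96 + 192 ∎)) 96l≤)
        where
        lem₁ : ∀ h → 431 + 32 * (2 * suc h) + 192 ≡ 687 + 64 * h
        lem₁ = solve-∀
        lem₂ : ∀ h → 32 * h + 64 * h ≡ 96 * h
        lem₂ = solve-∀
        lem₃ : ∀ l → 96 * (2 + l) ≡ l * 96 + 192
        lem₃ = solve-∀
      2^l≤R : 2 ^ (2 + l) ≤ R
      2^l≤R = s≤s⁻¹ (≤-trans (^-monoʳ-< 2 (s≤s (s≤s z≤n)) 3+l≤h) (≤-reflexive (sym R+1)))

    unbounded : ∀ h₀ → 24 ≤ h₀ → 4 ^ h₀ ≤ q → sum (map (λ p → 96 ∸ 1 * L p) sp) ≤ 431 → Sieveable q n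
    unbounded h₀ 24≤h₀ 4^h₀≤q small = let h , lo , hi = ∃-log₄ q (<-trans (s≤s z≤n) 1<q) in
      wholeCore h (≤-trans 24≤h₀ (s≤s⁻¹ (≰⇒> (λ le → <⇒≱ (≤-<-trans 4^h₀≤q hi) (^-monoʳ-≤ 4 le))))) lo hi small

-- Certificates and the programs that check them.

module Certificates where

  open SieveCriterion using (stripAll)
  open import Data.Bool.Base using (Bool; true; false; _∧_; _∨_; not; if_then_else_)
  open import Data.Bool.ListAction using (any; all)
  open import Data.List.Base using (List; []; _∷_; map; length; replicate; _++_; reverse)
  open import Data.Vec.Base as Vec using (Vec; []; _∷_)
  open import Data.Nat.Base

  -- Bare operations for evaluation. Their meaning, and with it all algebraic laws, comes from an
  -- `Interpretation` in the given field.
  record Ops : Set₁ where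
    field
      A : Set
      one negOne : A
      add mul : A → A → A
      eqᵇ : A → A → Bool

  oddStep : {X : Set} → (X → X → X) → X → X → Bool → X
  oddStep mul x y true  = y
  oddStep mul x y false = mul x y

  -- Square and multiply. When the fuel is used up it falls back on repeated multiplication, so the
  -- value is right for any fuel; 30 halvings exhaust every exponent below 2 ^ 30.
  power : {X : Set} → X → (X → X → X) → ℕ → X → ℕ → X
  power one mul zero    x zero    = one
  power one mul zero    x (suc m) = mul x (power one mul zero x m)
  power one mul (suc f) x m = oddStep mul x (power one mul f (mul x x) (m / 2)) (m % 2 ≡ᵇ 0)

  -- m / l, with m / 0 = 0
  _div_ : ℕ → ℕ → ℕ
  m div zero  = 0
  m div suc l = m / suc l

  _∣ᵇ_ : ℕ → ℕ → Bool
  zero  ∣ᵇ m = false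
  suc l ∣ᵇ m = m % suc l ≡ᵇ 0

  -- Trial division by d, d + 1, ... up to the square root. Exhausted fuel counts as failure; the
  -- 200 rounds of `primeᵇ` reach d = 201 and so settle every m below 201².
  roughᵇ : ℕ → ℕ → ℕ → Bool
  roughᵇ zero    d m = false
  roughᵇ (suc f) d m = (m <ᵇ d * d) ∨ (not (d ∣ᵇ m) ∧ roughᵇ f (suc d) m)

  primeᵇ : ℕ → Bool
  primeᵇ m = (1 <ᵇ m) ∧ roughᵇ 200 2 m

  -- For ω of order n the power ω ^ m has order n / gcd(m, n). As 4 divides n, this gcd is 2 exactly
  -- if m ≡ 2 modulo 4 and no odd prime divisor of n divides m.
  goodᵇ : List ℕ → ℕ → Bool
  goodᵇ ols m = (m % 4 ≡ᵇ 2) ∧ all (λ l → not (l ∣ᵇ m)) ols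

  coverᵇ : (es ols : List ℕ) → (f step s : ℕ) → Bool
  coverᵇ es ols zero    step s = true
  coverᵇ es ols (suc f) step s = if any (λ e → goodᵇ ols (e + s)) es then coverᵇ es ols f step (step + s) else false

  module Extension (fuel : ℕ) (O : Ops) (q : ℕ) (δ u : Ops.A O) where
    open Ops O

    -- a + b σ with σ² = δ
    A² : Set
    A² = A × A

    mul² : A² → A² → A²
    mul² (a , b) (a′ , b′) = add (mul a a′) (mul δ (mul b b′)) , add (mul a b′) (mul b a′)

    one² ω : A²
    -- `Ops` has no zero, so the second coordinate is written 1 + (-1).
    one² = one , add one negOne
    ω = u , one

    ω^ : ℕ → A²
    ω^ e = power one² mul² fuel ω e

    -- An interpretation transports equalities but says nothing about terms that differ. That a is
    -- nonzero is therefore certified by an equation, namely Fermat's.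
    unitᵇ : A → Bool
    unitᵇ a = eqᵇ (power one mul fuel a (q ∸ 1)) one

    -- The same test applied to the norm a² - δ b² of a + b σ, which lies in the base field.
    unit²ᵇ : A² → Bool
    unit²ᵇ (a , b) = unitᵇ (add (mul a a) (mul negOne (mul δ (mul b b))))

    ≢1ᵇ : A² → Bool
    ≢1ᵇ (a , b) = unit²ᵇ (add a negOne , b)

    #units : ℕ
    #units = q * q ∸ 1

    dividesᵇ orderᵇ : ℕ → Bool
    dividesᵇ l = primeᵇ l ∧ ((2 <ᵇ l) ∧ (l ∣ᵇ #units))
    orderᵇ l = ≢1ᵇ (ω^ (#units div l))

    -- That stripping leaves 1 shows 2 and `ols` to be all the prime divisors of q² - 1; ω is then a
    -- generator because no power ω ^ ((q² - 1) / ℓ) is 1.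
    primitiveᵇ : List ℕ → Bool
    primitiveᵇ ols = all dividesᵇ ols ∧ ((stripAll (2 ∷ ols) #units ≡ᵇ 1) ∧ (unit²ᵇ ω ∧ all orderᵇ (2 ∷ ols)))

    insideᵇ : ℕ → Bool
    insideᵇ e = eqᵇ (proj₂ (ω^ e)) one

    translatesᵇ : List ℕ → List ℕ → Bool
    translatesᵇ ols es = all insideᵇ es ∧ coverᵇ es ols (q ∸ 1) (suc q) 0

    -- If no good power of ω has σ-coordinate v, then no translate of v σ is 2-primitive.
    avoidsᵇ : List ℕ → A → ℕ → ℕ → A² → Bool
    avoidsᵇ ols v zero    m z = true
    avoidsᵇ ols v (suc f) m z = (not (goodᵇ ols m) ∨ unitᵇ (add (proj₂ z) (mul negOne v))) ∧ avoidsᵇ ols v f (suc m) (mul² ω z)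

    exceptionalᵇ : List ℕ → A → Bool
    exceptionalᵇ ols v = primitiveᵇ ols ∧ (unitᵇ v ∧ avoidsᵇ ols v #units 0 one²)

  primeOps : (p : ℕ) → .{{NonZero p}} → Ops
  primeOps p = record { A = ℕ ; one = 1 ; negOne = p ∸ 1 ; add = λ a b → (a + b) % p ; mul = λ a b → (a * b) % p ; eqᵇ = _≡ᵇ_ }

  -- ℤ/p [α], with α ^ k given by the polynomial g, coefficients listed from the constant term up.
  module Power (p : ℕ) .{{p≢0 : NonZero p}} {k : ℕ} (g : Vec ℕ k) where
    -- Multiplication by α as a shift: c enters at the bottom and the top coefficient t drops out,
    -- to come back as t g in `mulα`.
    rotate : ∀ {j} → ℕ → Vec ℕ j → Vec ℕ j × ℕ
    rotate c []       = [] , c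
    rotate c (x ∷ xs) = let ys , t = rotate x xs in c ∷ ys , t

    addV : ∀ {j} → Vec ℕ j → Vec ℕ j → Vec ℕ j
    addV = Vec.zipWith (λ a b → (a + b) % p)

    scaleV : ∀ {j} → ℕ → Vec ℕ j → Vec ℕ j
    scaleV c = Vec.map (λ x → (c * x) % p)

    mulα : Vec ℕ k → Vec ℕ k
    mulα w = let ys , t = rotate 0 w in addV ys (scaleV t g)

    mulV : ∀ {j} → Vec ℕ j → Vec ℕ k → Vec ℕ k
    mulV []       v = Vec.replicate k 0
    mulV (c ∷ cs) v = addV (scaleV c v) (mulα (mulV cs v))

    constV : ℕ → ∀ k → Vec ℕ k
    constV c zero    = []
    constV c (suc k) = c ∷ Vec.replicate k 0

    eqV : ∀ {j} → Vec ℕ j → Vec ℕ j → Bool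
    eqV []       []       = true
    eqV (x ∷ xs) (y ∷ ys) = (x ≡ᵇ y) ∧ eqV xs ys

    powerOps : Ops
    powerOps = record { A = Vec ℕ k ; one = constV 1 k ; negOne = constV (p ∸ 1) k ; add = addV ; mul = mulV ; eqᵇ = eqV }

  -- The cofactor of X^k - g in X^q - X, by linear recurrence from the top coefficient down.
  module Cofactor (p : ℕ) .{{p≢0 : NonZero p}} where
    dot : List ℕ → List ℕ → ℕ
    dot (x ∷ xs) (y ∷ ys) = x * y + dot xs ys
    dot _        _        = 0

    cofactor : List ℕ → ℕ → List ℕ → List ℕ
    cofactor g zero    h = h
    cofactor g (suc f) h = cofactor g f (dot g h % p ∷ h)

    addP : List ℕ → List ℕ → List ℕ
    addP []       ys       = ys
    addP (x ∷ xs) []       = x ∷ xs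
    addP (x ∷ xs) (y ∷ ys) = x + y ∷ addP xs ys

    mulP : List ℕ → List ℕ → List ℕ
    mulP []       ys = []
    mulP (x ∷ xs) ys = addP (map (x *_) ys) (0 ∷ mulP xs ys)

    congruentᵇ : List ℕ → List ℕ → Bool
    congruentᵇ []       []       = true
    congruentᵇ (x ∷ xs) (y ∷ ys) = (x % p ≡ᵇ y % p) ∧ congruentᵇ xs ys
    congruentᵇ _        _        = false

    -- X^k - g
    modulus : ∀ {k} → Vec ℕ k → List ℕ
    modulus []       = 1 ∷ []
    modulus (c ∷ cs) = (p ∸ 1) * c ∷ modulus cs

    -- The recurrence only finds h; here the product is compared, coefficient by coefficient modulo
    -- p, with X ^ q - X. The bound on the length keeps h from vanishing on q points without being
    -- zero everywhere.
    splitsᵇ : ∀ {k} → Vec ℕ k → ℕ → List ℕ → Bool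
    splitsᵇ g q h = congruentᵇ (mulP (modulus g) h) (0 ∷ p ∸ 1 ∷ replicate (q ∸ 2) 0 ++ 1 ∷ []) ∧ (length h ≤ᵇ q)

  -- The field of order q is ℤ/p or ℤ/p [α]; σ² = δ, and ω = u + σ generates the units of the quadratic extension.
  -- ols lists the odd primes dividing q² - 1. The exponents e in es satisfy ω ^ e ∈ ω + 𝔽_q, and for every i < q - 1
  -- some ω ^ (e + (q + 1) i) is 2-primitive; since the ω ^ ((q + 1) i) are the units of 𝔽_q, this covers all translate sets.
  data Certificate : Set where
    prime-field : (p δ u : ℕ) (ols es : List ℕ) → Certificate
    power-field : (p k : ℕ) (g δ u : Vec ℕ k) (ols es : List ℕ) → Certificate

  -- `p ^ 1` keeps the order in the shape `p ^ k` that the theory of the extension takes as its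
  -- parameters.
  order : Certificate → ℕ
  order (prime-field p δ u ols es)     = p ^ 1
  order (power-field p k g δ u ols es) = p ^ k

  extensionᵇ : (fuel : ℕ) (O : Ops) (q : ℕ) (δ u : Ops.A O) (ols es : List ℕ) → Bool
  extensionᵇ fuel O q δ u ols es = Extension.primitiveᵇ fuel O q δ u ols ∧ Extension.translatesᵇ fuel O q δ u ols es

  baseᵇ : (p : ℕ) .{{_ : NonZero p}} {k : ℕ} → Vec ℕ k → Bool
  baseᵇ p {k} g = Cofactor.splitsᵇ p g (p ^ k) (Cofactor.cofactor p (reverse (Vec.toList g)) (p ^ k ∸ k) (1 ∷ []))

  validᵇ : Certificate → Bool
  validᵇ (prime-field zero δ u ols es) = false
  validᵇ (prime-field p@(suc _) δ u ols es) = primeᵇ p ∧ extensionᵇ 30 (primeOps p) (p ^ 1) δ u ols es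
  validᵇ (power-field zero k g δ u ols es) = false
  validᵇ (power-field p@(suc _) zero g δ u ols es) = false
  validᵇ (power-field p@(suc _) k@(suc _) g δ u ols es) = primeᵇ p ∧ (baseᵇ p g ∧ extensionᵇ 30 (Power.powerOps p g) (p ^ k) δ u ols es)

-- The list of certificates.

module CertificateData where

  open Certificates
  open import Data.Bool.Base using (true)
  open import Data.Bool.ListAction using (all)
  open import Data.List.Base using (List; []; _∷_)
  open import Data.Vec.Base using ([]; _∷_)
  open import Relation.Binary.PropositionalEquality using (_≡_; refl)

  -- In increasing order of q, from 3 to 17291. The first entry describes 𝔽₉ by σ² = 2 over ℤ/3 with
  -- ω = 1 + σ of order 8: no odd primes are listed, and the single exponent 6 serves both shifts, 6
  -- and 10.
  certificates : List Certificate
  certificates =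
    prime-field 3 2 1 ([]) (6 ∷ []) ∷
    power-field 3 2 (1 ∷ 1 ∷ []) (0 ∷ 1 ∷ []) (1 ∷ 0 ∷ []) (5 ∷ []) (16 ∷ 18 ∷ []) ∷
    prime-field 17 3 3 (3 ∷ []) (10 ∷ 272 ∷ []) ∷
    prime-field 19 2 2 (3 ∷ 5 ∷ []) (134 ∷ 178 ∷ []) ∷
    prime-field 23 5 1 (3 ∷ 11 ∷ []) (386 ∷ 106 ∷ []) ∷
    power-field 5 2 (3 ∷ 1 ∷ []) (0 ∷ 1 ∷ []) (0 ∷ 2 ∷ []) (3 ∷ 13 ∷ []) (126 ∷ 388 ∷ 38 ∷ 192 ∷ []) ∷
    power-field 3 3 (2 ∷ 1 ∷ 0 ∷ []) (0 ∷ 0 ∷ 2 ∷ []) (0 ∷ 0 ∷ 1 ∷ []) (7 ∷ 13 ∷ []) (358 ∷ 142 ∷ []) ∷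
    prime-field 29 2 4 (3 ∷ 5 ∷ 7 ∷ []) (148 ∷ 34 ∷ 698 ∷ 704 ∷ []) ∷
    prime-field 37 2 2 (3 ∷ 19 ∷ []) (666 ∷ 500 ∷ 276 ∷ 1342 ∷ []) ∷
    prime-field 43 2 6 (3 ∷ 7 ∷ 11 ∷ []) (262 ∷ 606 ∷ 910 ∷ 1338 ∷ []) ∷
    prime-field 47 5 4 (3 ∷ 23 ∷ []) (322 ∷ 1774 ∷ []) ∷
    power-field 7 2 (4 ∷ 1 ∷ []) (0 ∷ 1 ∷ []) (0 ∷ 3 ∷ []) (3 ∷ 5 ∷ []) (1216 ∷ 1138 ∷ 924 ∷ 1358 ∷ []) ∷
    prime-field 53 2 2 (3 ∷ 13 ∷ []) (1378 ∷ 980 ∷ 482 ∷ 2312 ∷ []) ∷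
    prime-field 59 2 5 (3 ∷ 5 ∷ 29 ∷ []) (3226 ∷ 2842 ∷ []) ∷
    prime-field 61 2 2 (3 ∷ 5 ∷ 31 ∷ []) (3690 ∷ 2808 ∷ 1700 ∷ 2494 ∷ 352 ∷ 2690 ∷ 2706 ∷ []) ∷
    prime-field 67 2 2 (3 ∷ 11 ∷ 17 ∷ []) (1038 ∷ 626 ∷ 2242 ∷ []) ∷
    prime-field 71 7 1 (3 ∷ 5 ∷ 7 ∷ []) (146 ∷ 2138 ∷ 994 ∷ []) ∷
    prime-field 73 5 4 (3 ∷ 37 ∷ []) (1564 ∷ 4074 ∷ 2916 ∷ 2318 ∷ []) ∷
    prime-field 79 3 1 (3 ∷ 5 ∷ 13 ∷ []) (3042 ∷ 3706 ∷ 1958 ∷ []) ∷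
    power-field 3 4 (1 ∷ 1 ∷ 0 ∷ 0 ∷ []) (0 ∷ 0 ∷ 0 ∷ 1 ∷ []) (0 ∷ 1 ∷ 0 ∷ 2 ∷ []) (5 ∷ 41 ∷ []) (4918 ∷ 5384 ∷ 3520 ∷ 5886 ∷ []) ∷
    prime-field 83 2 2 (3 ∷ 7 ∷ 41 ∷ []) (3082 ∷ 2390 ∷ []) ∷
    prime-field 89 3 3 (3 ∷ 5 ∷ 11 ∷ []) (1396 ∷ 934 ∷ 7832 ∷ 1274 ∷ []) ∷
    prime-field 97 5 8 (3 ∷ 7 ∷ []) (2588 ∷ 6770 ∷ 1296 ∷ 6394 ∷ []) ∷
    prime-field 101 2 2 (3 ∷ 5 ∷ 17 ∷ []) (5050 ∷ 4564 ∷ 1486 ∷ 6268 ∷ []) ∷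
    prime-field 103 3 1 (3 ∷ 13 ∷ 17 ∷ []) (5202 ∷ 4430 ∷ 1630 ∷ []) ∷
    prime-field 107 2 2 (3 ∷ 53 ∷ []) (9818 ∷ 8870 ∷ []) ∷
    prime-field 109 2 4 (3 ∷ 5 ∷ 11 ∷ []) (4266 ∷ 2428 ∷ 8198 ∷ 11108 ∷ []) ∷
    prime-field 113 3 3 (3 ∷ 7 ∷ 19 ∷ []) (8836 ∷ 4766 ∷ 12656 ∷ 12302 ∷ []) ∷
    power-field 11 2 (3 ∷ 1 ∷ []) (0 ∷ 1 ∷ []) (1 ∷ 0 ∷ []) (3 ∷ 5 ∷ 61 ∷ []) (672 ∷ 12306 ∷ 10528 ∷ 4814 ∷ 682 ∷ 12344 ∷ []) ∷
    power-field 5 3 (2 ∷ 1 ∷ 0 ∷ []) (0 ∷ 0 ∷ 2 ∷ []) (0 ∷ 0 ∷ 1 ∷ []) (3 ∷ 7 ∷ 31 ∷ []) (8900 ∷ 12178 ∷ 15004 ∷ 7918 ∷ []) ∷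
    prime-field 127 3 3 (3 ∷ 7 ∷ []) (16002 ∷ 7654 ∷ 650 ∷ []) ∷
    prime-field 131 2 2 (3 ∷ 5 ∷ 11 ∷ 13 ∷ []) (4190 ∷ 9158 ∷ 9194 ∷ []) ∷
    prime-field 137 3 3 (3 ∷ 17 ∷ 23 ∷ []) (11938 ∷ 18632 ∷ 4364 ∷ 6526 ∷ []) ∷
    prime-field 139 2 2 (3 ∷ 5 ∷ 7 ∷ 23 ∷ []) (4386 ∷ 15758 ∷ 13186 ∷ []) ∷
    prime-field 149 2 2 (3 ∷ 5 ∷ 37 ∷ []) (11026 ∷ 20048 ∷ 9466 ∷ 21568 ∷ []) ∷
    prime-field 151 3 3 (3 ∷ 5 ∷ 19 ∷ []) (22650 ∷ 11414 ∷ 19402 ∷ []) ∷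
    prime-field 157 2 6 (3 ∷ 13 ∷ 79 ∷ []) (13962 ∷ 12192 ∷ 20864 ∷ 19462 ∷ 2908 ∷ 13982 ∷ []) ∷
    prime-field 163 2 2 (3 ∷ 41 ∷ []) (14978 ∷ 12502 ∷ []) ∷
    prime-field 167 5 1 (3 ∷ 7 ∷ 83 ∷ []) (20834 ∷ 14738 ∷ []) ∷
    power-field 13 2 (11 ∷ 1 ∷ []) (0 ∷ 1 ∷ []) (1 ∷ 0 ∷ []) (3 ∷ 5 ∷ 7 ∷ 17 ∷ []) (1106 ∷ 972 ∷ 10018 ∷ 22552 ∷ 17024 ∷ 10974 ∷ []) ∷
    prime-field 173 2 2 (3 ∷ 29 ∷ 43 ∷ []) (29842 ∷ 21736 ∷ 27020 ∷ 10262 ∷ []) ∷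
    prime-field 179 2 3 (3 ∷ 5 ∷ 89 ∷ []) (9554 ∷ 23758 ∷ []) ∷
    prime-field 181 2 2 (3 ∷ 5 ∷ 7 ∷ 13 ∷ []) (16290 ∷ 916 ∷ 11302 ∷ 4664 ∷ 7272 ∷ 2438 ∷ []) ∷
    prime-field 191 7 7 (3 ∷ 5 ∷ 19 ∷ []) (23974 ∷ 33602 ∷ 28466 ∷ []) ∷
    prime-field 193 5 7 (3 ∷ 97 ∷ []) (6316 ∷ 4886 ∷ 15456 ∷ 31702 ∷ []) ∷
    prime-field 197 2 9 (3 ∷ 7 ∷ 11 ∷ []) (2978 ∷ 6808 ∷ 2740 ∷ 35470 ∷ []) ∷
    prime-field 199 3 1 (3 ∷ 5 ∷ 11 ∷ []) (19602 ∷ 32206 ∷ 10958 ∷ []) ∷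
    prime-field 211 2 2 (3 ∷ 5 ∷ 7 ∷ 53 ∷ []) (31070 ∷ 14814 ∷ 34426 ∷ 8438 ∷ 11470 ∷ []) ∷
    prime-field 223 3 3 (3 ∷ 7 ∷ 37 ∷ []) (49506 ∷ 39482 ∷ 30346 ∷ []) ∷
    prime-field 227 2 4 (3 ∷ 19 ∷ 113 ∷ []) (1642 ∷ 49214 ∷ []) ∷
    prime-field 229 2 3 (3 ∷ 5 ∷ 19 ∷ 23 ∷ []) (42064 ∷ 31522 ∷ 884 ∷ 11018 ∷ 40908 ∷ 39042 ∷ []) ∷
    prime-field 233 3 3 (3 ∷ 13 ∷ 29 ∷ []) (43876 ∷ 8494 ∷ 54056 ∷ 24118 ∷ []) ∷
    prime-field 239 7 7 (3 ∷ 5 ∷ 7 ∷ 17 ∷ []) (34322 ∷ 52294 ∷ 19582 ∷ []) ∷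
    prime-field 241 7 7 (3 ∷ 5 ∷ 11 ∷ []) (39084 ∷ 44294 ∷ 21910 ∷ 3148 ∷ 1326 ∷ 13556 ∷ []) ∷
    prime-field 251 2 4 (3 ∷ 5 ∷ 7 ∷ []) (9470 ∷ 12818 ∷ []) ∷
    prime-field 257 3 3 (3 ∷ 43 ∷ []) (6064 ∷ 59786 ∷ []) ∷
    prime-field 263 5 9 (3 ∷ 11 ∷ 131 ∷ []) (27502 ∷ 51826 ∷ []) ∷
    prime-field 269 2 10 (3 ∷ 5 ∷ 67 ∷ []) (51484 ∷ 33434 ∷ 53096 ∷ 41542 ∷ []) ∷
    prime-field 271 3 1 (3 ∷ 5 ∷ 17 ∷ []) (36450 ∷ 26782 ∷ 34346 ∷ []) ∷
    prime-field 277 2 4 (3 ∷ 23 ∷ 139 ∷ []) (35742 ∷ 55732 ∷ 32266 ∷ 36632 ∷ 61466 ∷ 48108 ∷ []) ∷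
    prime-field 281 3 4 (3 ∷ 5 ∷ 7 ∷ 47 ∷ []) (60176 ∷ 52606 ∷ 8680 ∷ 46102 ∷ 7444 ∷ 50530 ∷ []) ∷
    prime-field 283 2 4 (3 ∷ 47 ∷ 71 ∷ []) (34726 ∷ 56886 ∷ 25286 ∷ []) ∷
    power-field 17 2 (7 ∷ 1 ∷ []) (0 ∷ 1 ∷ []) (0 ∷ 2 ∷ []) (3 ∷ 5 ∷ 29 ∷ []) (26298 ∷ 70172 ∷ 36528 ∷ 52834 ∷ []) ∷
    prime-field 293 2 3 (3 ∷ 7 ∷ 73 ∷ []) (2714 ∷ 20584 ∷ 57874 ∷ 65440 ∷ []) ∷
    prime-field 307 2 4 (3 ∷ 7 ∷ 11 ∷ 17 ∷ []) (93570 ∷ 48922 ∷ 2942 ∷ []) ∷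
    prime-field 311 11 1 (3 ∷ 5 ∷ 13 ∷ 31 ∷ []) (49514 ∷ 76246 ∷ 21742 ∷ []) ∷
    prime-field 313 5 5 (3 ∷ 13 ∷ 157 ∷ []) (30616 ∷ 65222 ∷ 48516 ∷ 89830 ∷ 21212 ∷ 32574 ∷ []) ∷
    prime-field 317 2 2 (3 ∷ 53 ∷ 79 ∷ []) (100330 ∷ 86144 ∷ 75788 ∷ 55678 ∷ []) ∷
    prime-field 331 2 10 (3 ∷ 5 ∷ 11 ∷ 83 ∷ []) (95134 ∷ 2870 ∷ 57462 ∷ 34498 ∷ 70506 ∷ []) ∷
    prime-field 337 5 5 (3 ∷ 7 ∷ 13 ∷ []) (91768 ∷ 50222 ∷ 113064 ∷ 76018 ∷ 88448 ∷ 45870 ∷ []) ∷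
    power-field 7 3 (5 ∷ 1 ∷ 0 ∷ []) (0 ∷ 0 ∷ 3 ∷ []) (0 ∷ 0 ∷ 1 ∷ []) (3 ∷ 19 ∷ 43 ∷ []) (36286 ∷ 50294 ∷ 80946 ∷ []) ∷
    prime-field 347 2 2 (3 ∷ 29 ∷ 173 ∷ []) (114590 ∷ 117794 ∷ []) ∷
    prime-field 349 2 2 (3 ∷ 5 ∷ 7 ∷ 29 ∷ []) (121626 ∷ 88576 ∷ 48434 ∷ 94604 ∷ 70548 ∷ 43258 ∷ []) ∷
    prime-field 353 3 4 (3 ∷ 11 ∷ 59 ∷ []) (106336 ∷ 91274 ∷ 45398 ∷ 30736 ∷ []) ∷
    prime-field 359 7 2 (3 ∷ 5 ∷ 179 ∷ []) (47714 ∷ 96706 ∷ []) ∷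
    power-field 19 2 (5 ∷ 1 ∷ []) (0 ∷ 1 ∷ []) (0 ∷ 3 ∷ []) (3 ∷ 5 ∷ 181 ∷ []) (100720 ∷ 57662 ∷ 107010 ∷ 116468 ∷ 106666 ∷ 71532 ∷ []) ∷
    prime-field 367 3 1 (3 ∷ 23 ∷ 61 ∷ []) (66978 ∷ 19558 ∷ 28778 ∷ []) ∷
    prime-field 373 2 2 (3 ∷ 11 ∷ 17 ∷ 31 ∷ []) (69378 ∷ 63936 ∷ 87454 ∷ 2716 ∷ 90734 ∷ 47384 ∷ []) ∷
    prime-field 379 2 7 (3 ∷ 5 ∷ 7 ∷ 19 ∷ []) (67854 ∷ 97238 ∷ 7462 ∷ []) ∷
    prime-field 389 2 6 (3 ∷ 5 ∷ 13 ∷ 97 ∷ []) (114148 ∷ 11366 ∷ 5756 ∷ 38522 ∷ []) ∷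
    prime-field 397 2 3 (3 ∷ 11 ∷ 199 ∷ []) (81774 ∷ 152020 ∷ 68434 ∷ 140468 ∷ 109836 ∷ 142862 ∷ []) ∷
    prime-field 401 3 3 (3 ∷ 5 ∷ 67 ∷ []) (128038 ∷ 160400 ∷ 142376 ∷ 34294 ∷ []) ∷
    prime-field 409 7 6 (3 ∷ 5 ∷ 17 ∷ 41 ∷ []) (130908 ∷ 71786 ∷ 103556 ∷ 126306 ∷ 97624 ∷ 35902 ∷ []) ∷
    prime-field 419 2 13 (3 ∷ 5 ∷ 7 ∷ 11 ∷ 19 ∷ []) (67282 ∷ 2666 ∷ 9238 ∷ []) ∷
    prime-field 421 2 2 (3 ∷ 5 ∷ 7 ∷ 211 ∷ []) (88410 ∷ 54596 ∷ 34672 ∷ 22138 ∷ 168974 ∷ 91608 ∷ 20526 ∷ 117080 ∷ 99290 ∷ 33904 ∷ []) ∷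
    prime-field 431 7 7 (3 ∷ 5 ∷ 43 ∷ []) (3890 ∷ 7798 ∷ 41674 ∷ []) ∷
    prime-field 433 5 5 (3 ∷ 7 ∷ 31 ∷ []) (96132 ∷ 115210 ∷ 89234 ∷ 151624 ∷ []) ∷
    prime-field 439 3 6 (3 ∷ 5 ∷ 11 ∷ 73 ∷ []) (40734 ∷ 106138 ∷ 1202 ∷ []) ∷
    prime-field 443 2 3 (3 ∷ 13 ∷ 17 ∷ 37 ∷ []) (86746 ∷ 178558 ∷ 189022 ∷ []) ∷
    prime-field 449 3 6 (3 ∷ 5 ∷ 7 ∷ []) (152726 ∷ 2416 ∷ 157978 ∷ 172948 ∷ []) ∷
    prime-field 457 5 6 (3 ∷ 19 ∷ 229 ∷ []) (68688 ∷ 5426 ∷ 202240 ∷ 123450 ∷ 193846 ∷ 25628 ∷ []) ∷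
    prime-field 461 2 2 (3 ∷ 5 ∷ 7 ∷ 11 ∷ 23 ∷ []) (212290 ∷ 76540 ∷ 212486 ∷ 167828 ∷ 101372 ∷ 54974 ∷ []) ∷
    prime-field 463 3 1 (3 ∷ 7 ∷ 11 ∷ 29 ∷ []) (106722 ∷ 24886 ∷ 157778 ∷ 162934 ∷ 180582 ∷ []) ∷
    prime-field 467 2 2 (3 ∷ 13 ∷ 233 ∷ []) (3670 ∷ 2762 ∷ []) ∷
    prime-field 479 13 2 (3 ∷ 5 ∷ 239 ∷ []) (103846 ∷ 9514 ∷ []) ∷
    prime-field 491 2 2 (3 ∷ 5 ∷ 7 ∷ 41 ∷ []) (64874 ∷ 162470 ∷ 153626 ∷ []) ∷
    prime-field 499 2 3 (3 ∷ 5 ∷ 83 ∷ []) (38206 ∷ 238466 ∷ 113958 ∷ []) ∷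
    prime-field 503 5 1 (3 ∷ 7 ∷ 251 ∷ []) (189506 ∷ 232318 ∷ []) ∷
    prime-field 509 2 2 (3 ∷ 5 ∷ 17 ∷ 127 ∷ []) (258826 ∷ 200476 ∷ 75304 ∷ 71078 ∷ []) ∷
    prime-field 521 3 9 (3 ∷ 5 ∷ 13 ∷ 29 ∷ []) (186398 ∷ 168692 ∷ 118502 ∷ 141356 ∷ 219830 ∷ 25268 ∷ []) ∷
    prime-field 523 2 2 (3 ∷ 29 ∷ 131 ∷ []) (14222 ∷ 207370 ∷ 140826 ∷ []) ∷
    power-field 23 2 (4 ∷ 1 ∷ []) (0 ∷ 1 ∷ []) (0 ∷ 2 ∷ []) (3 ∷ 5 ∷ 11 ∷ 53 ∷ []) (187104 ∷ 270142 ∷ 235182 ∷ 254972 ∷ 228398 ∷ 224992 ∷ []) ∷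
    prime-field 541 2 2 (3 ∷ 5 ∷ 271 ∷ []) (292410 ∷ 148688 ∷ 17380 ∷ 9262 ∷ 203616 ∷ 220718 ∷ []) ∷
    prime-field 547 2 2 (3 ∷ 7 ∷ 13 ∷ 137 ∷ []) (45422 ∷ 95742 ∷ 31150 ∷ 259058 ∷ 212494 ∷ []) ∷
    prime-field 557 2 2 (3 ∷ 31 ∷ 139 ∷ []) (309970 ∷ 254996 ∷ 34714 ∷ 3640 ∷ []) ∷
    prime-field 563 2 2 (3 ∷ 47 ∷ 281 ∷ []) (19238 ∷ 21658 ∷ []) ∷
    prime-field 569 3 5 (3 ∷ 5 ∷ 19 ∷ 71 ∷ []) (56342 ∷ 192664 ∷ 74998 ∷ 222368 ∷ []) ∷
    prime-field 571 2 9 (3 ∷ 5 ∷ 11 ∷ 13 ∷ 19 ∷ []) (207266 ∷ 200818 ∷ 262542 ∷ 317674 ∷ 107070 ∷ []) ∷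
    prime-field 587 2 2 (3 ∷ 7 ∷ 293 ∷ []) (148642 ∷ 276026 ∷ []) ∷
    prime-field 593 3 3 (3 ∷ 11 ∷ 37 ∷ []) (331156 ∷ 176882 ∷ 351056 ∷ 99106 ∷ []) ∷
    prime-field 599 7 1 (3 ∷ 5 ∷ 13 ∷ 23 ∷ []) (264002 ∷ 98306 ∷ 58958 ∷ []) ∷
    prime-field 601 7 6 (3 ∷ 5 ∷ 7 ∷ 43 ∷ []) (48196 ∷ 207078 ∷ 329352 ∷ 152654 ∷ 125288 ∷ 149230 ∷ []) ∷
    prime-field 607 3 7 (3 ∷ 19 ∷ 101 ∷ []) (286094 ∷ 174678 ∷ 359554 ∷ []) ∷
    prime-field 613 2 2 (3 ∷ 17 ∷ 307 ∷ []) (187578 ∷ 245536 ∷ 24680 ∷ 310550 ∷ 285480 ∷ 215086 ∷ []) ∷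
    prime-field 617 3 4 (3 ∷ 7 ∷ 11 ∷ 103 ∷ []) (307400 ∷ 61046 ∷ 33880 ∷ 163714 ∷ 345934 ∷ 117968 ∷ []) ∷
    prime-field 619 2 2 (3 ∷ 5 ∷ 31 ∷ 103 ∷ []) (218414 ∷ 48622 ∷ 176094 ∷ []) ∷
    power-field 5 4 (2 ∷ 1 ∷ 1 ∷ 0 ∷ []) (0 ∷ 0 ∷ 0 ∷ 1 ∷ []) (0 ∷ 0 ∷ 0 ∷ 1 ∷ []) (3 ∷ 13 ∷ 313 ∷ []) (96330 ∷ 352760 ∷ 156242 ∷ 289828 ∷ 634 ∷ 217656 ∷ []) ∷
    prime-field 631 3 4 (3 ∷ 5 ∷ 7 ∷ 79 ∷ []) (54810 ∷ 332174 ∷ 83218 ∷ 152046 ∷ 146426 ∷ []) ∷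
    prime-field 641 3 3 (3 ∷ 5 ∷ 107 ∷ []) (131290 ∷ 410240 ∷ 190006 ∷ 33484 ∷ []) ∷
    prime-field 643 2 7 (3 ∷ 7 ∷ 23 ∷ 107 ∷ []) (57682 ∷ 382638 ∷ 344378 ∷ []) ∷
    prime-field 647 5 1 (3 ∷ 17 ∷ 19 ∷ []) (313634 ∷ 285542 ∷ 193786 ∷ []) ∷
    prime-field 659 2 2 (3 ∷ 5 ∷ 7 ∷ 11 ∷ 47 ∷ []) (75682 ∷ 122926 ∷ 297074 ∷ []) ∷
    prime-field 661 2 2 (3 ∷ 5 ∷ 11 ∷ 331 ∷ []) (218130 ∷ 27952 ∷ 302746 ∷ 291788 ∷ 328454 ∷ 362604 ∷ 390518 ∷ 390400 ∷ 382458 ∷ 72540 ∷ []) ∷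
    prime-field 673 5 4 (3 ∷ 7 ∷ 337 ∷ []) (344260 ∷ 20930 ∷ 60852 ∷ 402622 ∷ 208508 ∷ 269838 ∷ []) ∷
    prime-field 677 2 3 (3 ∷ 13 ∷ 113 ∷ []) (204740 ∷ 407074 ∷ 99742 ∷ 156740 ∷ []) ∷
    prime-field 683 2 3 (3 ∷ 11 ∷ 19 ∷ 31 ∷ []) (95618 ∷ 107998 ∷ 208162 ∷ []) ∷
    prime-field 691 2 10 (3 ∷ 5 ∷ 23 ∷ 173 ∷ []) (210890 ∷ 358474 ∷ 124998 ∷ 259582 ∷ 381602 ∷ []) ∷
    prime-field 701 2 2 (3 ∷ 5 ∷ 7 ∷ 13 ∷ []) (491050 ∷ 181772 ∷ 489682 ∷ 424516 ∷ 132226 ∷ 423560 ∷ []) ∷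
    prime-field 709 2 2 (3 ∷ 5 ∷ 59 ∷ 71 ∷ []) (250986 ∷ 14212 ∷ 457466 ∷ 136844 ∷ 157164 ∷ 196762 ∷ []) ∷
    prime-field 719 11 2 (3 ∷ 5 ∷ 359 ∷ []) (208286 ∷ 23818 ∷ []) ∷
    prime-field 727 3 9 (3 ∷ 7 ∷ 11 ∷ 13 ∷ []) (434874 ∷ 146 ∷ 342130 ∷ []) ∷
    power-field 3 6 (1 ∷ 1 ∷ 0 ∷ 0 ∷ 0 ∷ 0 ∷ []) (0 ∷ 0 ∷ 0 ∷ 0 ∷ 0 ∷ 1 ∷ []) (0 ∷ 0 ∷ 0 ∷ 1 ∷ 2 ∷ 0 ∷ []) (5 ∷ 7 ∷ 13 ∷ 73 ∷ []) (267132 ∷ 177246 ∷ 1626 ∷ 337448 ∷ 19726 ∷ 351324 ∷ []) ∷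
    prime-field 739 2 5 (3 ∷ 5 ∷ 37 ∷ 41 ∷ []) (12466 ∷ 459978 ∷ 377294 ∷ []) ∷
    prime-field 743 5 8 (3 ∷ 7 ∷ 31 ∷ 53 ∷ []) (52202 ∷ 506210 ∷ 58270 ∷ []) ∷
    prime-field 751 3 1 (3 ∷ 5 ∷ 47 ∷ []) (281250 ∷ 31238 ∷ 281914 ∷ []) ∷
    prime-field 757 2 2 (3 ∷ 7 ∷ 379 ∷ []) (286146 ∷ 56824 ∷ 42228 ∷ 435758 ∷ 97520 ∷ 486814 ∷ []) ∷
    prime-field 761 3 3 (3 ∷ 5 ∷ 19 ∷ 127 ∷ []) (276226 ∷ 578360 ∷ 57196 ∷ 85402 ∷ 282532 ∷ 492710 ∷ []) ∷
    prime-field 769 7 7 (3 ∷ 5 ∷ 7 ∷ 11 ∷ []) (470086 ∷ 356512 ∷ 170486 ∷ 397968 ∷ []) ∷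
    prime-field 797 2 2 (3 ∷ 7 ∷ 19 ∷ 199 ∷ []) (634810 ∷ 112108 ∷ 574102 ∷ 185116 ∷ []) ∷
    prime-field 809 3 3 (3 ∷ 5 ∷ 101 ∷ []) (37666 ∷ 653672 ∷ 139604 ∷ 503654 ∷ []) ∷
    prime-field 811 2 5 (3 ∷ 5 ∷ 7 ∷ 29 ∷ []) (421710 ∷ 551722 ∷ 638018 ∷ []) ∷
    prime-field 821 2 4 (3 ∷ 5 ∷ 41 ∷ 137 ∷ []) (76922 ∷ 536252 ∷ 530206 ∷ 543508 ∷ 493418 ∷ 259976 ∷ []) ∷
    prime-field 827 2 3 (3 ∷ 7 ∷ 23 ∷ 59 ∷ []) (548474 ∷ 411914 ∷ 539330 ∷ []) ∷
    prime-field 829 2 2 (3 ∷ 5 ∷ 23 ∷ 83 ∷ []) (686826 ∷ 265448 ∷ 350458 ∷ 27856 ∷ 255182 ∷ 604296 ∷ []) ∷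
    prime-field 839 11 1 (3 ∷ 5 ∷ 7 ∷ 419 ∷ []) (608162 ∷ 354538 ∷ []) ∷
    power-field 29 2 (15 ∷ 1 ∷ []) (0 ∷ 1 ∷ []) (0 ∷ 7 ∷ []) (3 ∷ 5 ∷ 7 ∷ 421 ∷ []) (96870 ∷ 296780 ∷ 250452 ∷ 579482 ∷ 17356 ∷ 541978 ∷ 352744 ∷ 655286 ∷ 85086 ∷ 291608 ∷ []) ∷
    prime-field 853 2 8 (3 ∷ 7 ∷ 61 ∷ 71 ∷ []) (709160 ∷ 163214 ∷ 326622 ∷ 669604 ∷ 266508 ∷ 229966 ∷ []) ∷
    prime-field 857 3 3 (3 ∷ 11 ∷ 13 ∷ 107 ∷ []) (268126 ∷ 733592 ∷ 620870 ∷ 649664 ∷ []) ∷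
    prime-field 859 2 2 (3 ∷ 5 ∷ 11 ∷ 13 ∷ 43 ∷ []) (460858 ∷ 49614 ∷ 723662 ∷ 11842 ∷ 629214 ∷ []) ∷
    prime-field 881 3 7 (3 ∷ 5 ∷ 7 ∷ 11 ∷ []) (283942 ∷ 488252 ∷ 676490 ∷ 318128 ∷ 424294 ∷ 745636 ∷ []) ∷
    prime-field 883 2 2 (3 ∷ 7 ∷ 13 ∷ 17 ∷ []) (491978 ∷ 283666 ∷ 307770 ∷ []) ∷
    prime-field 911 7 9 (3 ∷ 5 ∷ 7 ∷ 13 ∷ 19 ∷ []) (620030 ∷ 589054 ∷ 167362 ∷ 676538 ∷ []) ∷
    prime-field 919 3 6 (3 ∷ 5 ∷ 17 ∷ 23 ∷ []) (193098 ∷ 790462 ∷ 683414 ∷ []) ∷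
    prime-field 929 3 3 (3 ∷ 5 ∷ 29 ∷ 31 ∷ []) (593806 ∷ 862112 ∷ 529864 ∷ 816118 ∷ []) ∷
    prime-field 937 5 4 (3 ∷ 7 ∷ 13 ∷ 67 ∷ []) (302956 ∷ 167786 ∷ 683748 ∷ 147754 ∷ 59684 ∷ 798162 ∷ []) ∷
    prime-field 941 2 2 (3 ∷ 5 ∷ 47 ∷ 157 ∷ []) (885010 ∷ 762800 ∷ 247162 ∷ 746636 ∷ 377432 ∷ 634034 ∷ []) ∷
    prime-field 947 2 2 (3 ∷ 11 ∷ 43 ∷ 79 ∷ []) (254078 ∷ 449402 ∷ 287554 ∷ []) ∷
    prime-field 953 3 3 (3 ∷ 7 ∷ 17 ∷ 53 ∷ []) (446950 ∷ 907256 ∷ 600130 ∷ 25624 ∷ 467980 ∷ 502510 ∷ []) ∷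
    power-field 31 2 (7 ∷ 1 ∷ []) (0 ∷ 1 ∷ []) (0 ∷ 6 ∷ []) (3 ∷ 5 ∷ 13 ∷ 37 ∷ []) (911910 ∷ 408076 ∷ 225274 ∷ 439148 ∷ 565358 ∷ 738744 ∷ []) ∷
    prime-field 967 3 1 (3 ∷ 7 ∷ 11 ∷ 23 ∷ []) (466578 ∷ 852410 ∷ 775210 ∷ 879002 ∷ 284082 ∷ []) ∷
    prime-field 971 2 6 (3 ∷ 5 ∷ 97 ∷ []) (599510 ∷ 941422 ∷ 381658 ∷ []) ∷
    prime-field 991 3 1 (3 ∷ 5 ∷ 11 ∷ 31 ∷ []) (490050 ∷ 627038 ∷ 855874 ∷ 867726 ∷ 354706 ∷ []) ∷
    prime-field 1009 11 7 (3 ∷ 5 ∷ 7 ∷ 101 ∷ []) (712316 ∷ 687514 ∷ 736584 ∷ 430658 ∷ 124746 ∷ 738808 ∷ []) ∷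
    prime-field 1013 2 3 (3 ∷ 11 ∷ 13 ∷ 23 ∷ []) (166640 ∷ 687698 ∷ 90308 ∷ 905558 ∷ 424468 ∷ 191342 ∷ []) ∷
    prime-field 1019 2 2 (3 ∷ 5 ∷ 17 ∷ 509 ∷ []) (774158 ∷ 97082 ∷ []) ∷
    prime-field 1021 2 17 (3 ∷ 5 ∷ 7 ∷ 17 ∷ 73 ∷ []) (113730 ∷ 519312 ∷ 975176 ∷ 932446 ∷ 139324 ∷ 454658 ∷ 967040 ∷ 202882 ∷ 736696 ∷ 626466 ∷ []) ∷
    prime-field 1031 7 9 (3 ∷ 5 ∷ 43 ∷ 103 ∷ []) (21454 ∷ 30682 ∷ 808886 ∷ []) ∷
    prime-field 1033 5 4 (3 ∷ 11 ∷ 43 ∷ 47 ∷ []) (146780 ∷ 464006 ∷ 874620 ∷ 256326 ∷ 537880 ∷ 538246 ∷ []) ∷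
    prime-field 1039 3 1 (3 ∷ 5 ∷ 13 ∷ 173 ∷ []) (538722 ∷ 4874 ∷ 934402 ∷ []) ∷
    prime-field 1049 3 6 (3 ∷ 5 ∷ 7 ∷ 131 ∷ []) (342866 ∷ 783296 ∷ 922598 ∷ 533704 ∷ []) ∷
    prime-field 1051 2 3 (3 ∷ 5 ∷ 7 ∷ 263 ∷ []) (746126 ∷ 469938 ∷ 17494 ∷ 1058222 ∷ 229282 ∷ []) ∷
    prime-field 1061 2 2 (3 ∷ 5 ∷ 53 ∷ 59 ∷ []) (562330 ∷ 817756 ∷ 212428 ∷ 738866 ∷ 545492 ∷ 862094 ∷ []) ∷
    prime-field 1063 3 1 (3 ∷ 7 ∷ 19 ∷ 59 ∷ []) (563922 ∷ 702890 ∷ 272086 ∷ []) ∷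
    prime-field 1069 2 3 (3 ∷ 5 ∷ 89 ∷ 107 ∷ []) (1101642 ∷ 670884 ∷ 895666 ∷ 804452 ∷ 152678 ∷ 735868 ∷ []) ∷
    prime-field 1091 2 4 (3 ∷ 5 ∷ 7 ∷ 13 ∷ 109 ∷ []) (694882 ∷ 12694 ∷ 256070 ∷ []) ∷
    prime-field 1093 2 4 (3 ∷ 7 ∷ 13 ∷ 547 ∷ []) (989898 ∷ 47416 ∷ 880788 ∷ 778730 ∷ 68168 ∷ 657250 ∷ 326280 ∷ 591978 ∷ 1056236 ∷ 79030 ∷ []) ∷
    prime-field 1103 5 4 (3 ∷ 19 ∷ 23 ∷ 29 ∷ []) (605374 ∷ 692746 ∷ 1158362 ∷ []) ∷
    prime-field 1109 2 5 (3 ∷ 5 ∷ 37 ∷ 277 ∷ []) (457348 ∷ 577882 ∷ 627652 ∷ 136946 ∷ []) ∷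
    prime-field 1117 2 2 (3 ∷ 13 ∷ 31 ∷ 43 ∷ []) (1247130 ∷ 238008 ∷ 536026 ∷ 875620 ∷ 726038 ∷ 858332 ∷ []) ∷
    prime-field 1123 2 2 (3 ∷ 11 ∷ 17 ∷ 281 ∷ []) (602482 ∷ 497742 ∷ 476702 ∷ 109510 ∷ 1251134 ∷ []) ∷
    prime-field 1129 11 7 (3 ∷ 5 ∷ 47 ∷ 113 ∷ []) (1030358 ∷ 1123932 ∷ 1202944 ∷ 1228474 ∷ 795296 ∷ 361458 ∷ []) ∷
    prime-field 1163 2 10 (3 ∷ 7 ∷ 83 ∷ 97 ∷ []) (1266946 ∷ 1346434 ∷ 1104718 ∷ []) ∷
    prime-field 1171 2 2 (3 ∷ 5 ∷ 13 ∷ 293 ∷ []) (1012398 ∷ 975542 ∷ 275626 ∷ 878534 ∷ 960642 ∷ []) ∷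
    prime-field 1181 2 3 (3 ∷ 5 ∷ 59 ∷ 197 ∷ []) (994150 ∷ 962924 ∷ 1010854 ∷ 654100 ∷ 538222 ∷ 1375456 ∷ []) ∷
    prime-field 1217 3 3 (3 ∷ 7 ∷ 19 ∷ 29 ∷ []) (559672 ∷ 831374 ∷ 1479872 ∷ 1048478 ∷ []) ∷
    prime-field 1223 5 6 (3 ∷ 13 ∷ 17 ∷ 47 ∷ []) (1348282 ∷ 685370 ∷ 986522 ∷ []) ∷
    prime-field 1229 2 2 (3 ∷ 5 ∷ 41 ∷ 307 ∷ []) (1509826 ∷ 1104788 ∷ 603074 ∷ 587288 ∷ []) ∷
    prime-field 1231 3 1 (3 ∷ 5 ∷ 7 ∷ 11 ∷ 41 ∷ []) (756450 ∷ 945806 ∷ 1427302 ∷ 748354 ∷ 988382 ∷ []) ∷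
    prime-field 1259 2 12 (3 ∷ 5 ∷ 7 ∷ 17 ∷ 37 ∷ []) (188218 ∷ 1077166 ∷ 575026 ∷ []) ∷
    prime-field 1277 2 3 (3 ∷ 11 ∷ 29 ∷ 71 ∷ []) (828626 ∷ 563512 ∷ 1372546 ∷ 296528 ∷ 213818 ∷ 374000 ∷ []) ∷
    prime-field 1289 3 4 (3 ∷ 5 ∷ 7 ∷ 23 ∷ 43 ∷ []) (1088972 ∷ 175718 ∷ 1219976 ∷ 551678 ∷ 1064264 ∷ 1534766 ∷ []) ∷
    prime-field 1291 2 2 (3 ∷ 5 ∷ 17 ∷ 19 ∷ 43 ∷ []) (374058 ∷ 740042 ∷ 1649434 ∷ 1361430 ∷ 1225346 ∷ []) ∷
    prime-field 1301 2 3 (3 ∷ 5 ∷ 7 ∷ 13 ∷ 31 ∷ []) (413666 ∷ 524084 ∷ 321956 ∷ 1104002 ∷ 158390 ∷ 1229428 ∷ []) ∷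
    prime-field 1303 3 1 (3 ∷ 7 ∷ 31 ∷ 163 ∷ []) (529014 ∷ 1511062 ∷ 1219370 ∷ 145350 ∷ 136810 ∷ []) ∷
    prime-field 1319 13 2 (3 ∷ 5 ∷ 11 ∷ 659 ∷ []) (1729906 ∷ 1435634 ∷ []) ∷
    prime-field 1321 7 8 (3 ∷ 5 ∷ 11 ∷ 661 ∷ []) (702082 ∷ 1726908 ∷ 369506 ∷ 1100824 ∷ 646112 ∷ 114318 ∷ 1096414 ∷ 328056 ∷ 1221976 ∷ 1529030 ∷ []) ∷
    prime-field 1327 3 3 (3 ∷ 13 ∷ 17 ∷ 83 ∷ []) (300258 ∷ 1756426 ∷ 681230 ∷ 1759602 ∷ 37798 ∷ []) ∷
    power-field 11 3 (7 ∷ 1 ∷ 0 ∷ []) (0 ∷ 0 ∷ 2 ∷ []) (0 ∷ 1 ∷ 6 ∷ []) (3 ∷ 5 ∷ 7 ∷ 19 ∷ 37 ∷ []) (80782 ∷ 584074 ∷ 1721678 ∷ 251450 ∷ []) ∷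
    prime-field 1361 3 3 (3 ∷ 5 ∷ 17 ∷ 227 ∷ []) (1101178 ∷ 1850960 ∷ 552536 ∷ 1087166 ∷ 1704908 ∷ 1221430 ∷ []) ∷
    power-field 37 2 (15 ∷ 1 ∷ []) (0 ∷ 1 ∷ []) (0 ∷ 2 ∷ []) (3 ∷ 5 ∷ 19 ∷ 137 ∷ []) (864082 ∷ 1807464 ∷ 860222 ∷ 1765352 ∷ 1523694 ∷ 1701568 ∷ []) ∷
    prime-field 1381 2 2 (3 ∷ 5 ∷ 23 ∷ 691 ∷ []) (1407202 ∷ 1859744 ∷ 952890 ∷ 978828 ∷ 1249718 ∷ 487060 ∷ 1357146 ∷ 1088872 ∷ 1063810 ∷ 995640 ∷ []) ∷
    prime-field 1399 3 4 (3 ∷ 5 ∷ 7 ∷ 233 ∷ []) (826542 ∷ 584978 ∷ 748642 ∷ []) ∷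
    prime-field 1409 3 3 (3 ∷ 5 ∷ 11 ∷ 47 ∷ []) (1362766 ∷ 1983872 ∷ 286294 ∷ 294916 ∷ []) ∷
    prime-field 1427 2 2 (3 ∷ 7 ∷ 17 ∷ 23 ∷ 31 ∷ []) (1475354 ∷ 1985006 ∷ 975454 ∷ []) ∷
    prime-field 1429 2 7 (3 ∷ 5 ∷ 7 ∷ 11 ∷ 13 ∷ 17 ∷ []) (1172174 ∷ 695876 ∷ 100674 ∷ 636132 ∷ 1240318 ∷ 1376572 ∷ 1025282 ∷ 752428 ∷ 1575032 ∷ 155994 ∷ []) ∷
    prime-field 1451 2 5 (3 ∷ 5 ∷ 11 ∷ 29 ∷ []) (853382 ∷ 1108946 ∷ 1288774 ∷ []) ∷
    prime-field 1471 3 3 (3 ∷ 5 ∷ 7 ∷ 23 ∷ []) (2162370 ∷ 933322 ∷ 1161794 ∷ 1735946 ∷ 1548094 ∷ []) ∷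
    prime-field 1481 3 3 (3 ∷ 5 ∷ 13 ∷ 19 ∷ 37 ∷ []) (363832 ∷ 1321898 ∷ 2191880 ∷ 1996582 ∷ 735268 ∷ 2083954 ∷ []) ∷
    prime-field 1483 2 2 (3 ∷ 7 ∷ 13 ∷ 19 ∷ 53 ∷ []) (237766 ∷ 653750 ∷ 263850 ∷ 1584242 ∷ 1149166 ∷ []) ∷
    prime-field 1489 7 6 (3 ∷ 5 ∷ 31 ∷ 149 ∷ []) (1314652 ∷ 549062 ∷ 1152906 ∷ 412368 ∷ 1142014 ∷ 37064 ∷ []) ∷
    prime-field 1499 2 2 (3 ∷ 5 ∷ 7 ∷ 107 ∷ []) (238822 ∷ 861886 ∷ 1456294 ∷ []) ∷
    prime-field 1511 11 1 (3 ∷ 5 ∷ 7 ∷ 151 ∷ []) (1757746 ∷ 670994 ∷ 1977698 ∷ []) ∷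
    prime-field 1531 2 2 (3 ∷ 5 ∷ 17 ∷ 383 ∷ []) (2146086 ∷ 524542 ∷ 1293398 ∷ 1855950 ∷ 963226 ∷ []) ∷
    prime-field 1549 2 6 (3 ∷ 5 ∷ 31 ∷ 43 ∷ []) (2295418 ∷ 1914752 ∷ 524702 ∷ 1401288 ∷ 103086 ∷ 1000996 ∷ []) ∷
    prime-field 1553 3 4 (3 ∷ 7 ∷ 37 ∷ 97 ∷ []) (2069384 ∷ 2337770 ∷ 585896 ∷ 1979822 ∷ []) ∷
    prime-field 1559 17 1 (3 ∷ 5 ∷ 13 ∷ 19 ∷ 41 ∷ []) (911042 ∷ 1475258 ∷ 24346 ∷ []) ∷
    prime-field 1571 2 2 (3 ∷ 5 ∷ 131 ∷ 157 ∷ []) (178894 ∷ 1789066 ∷ 754970 ∷ []) ∷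
    prime-field 1579 2 6 (3 ∷ 5 ∷ 79 ∷ 263 ∷ []) (882678 ∷ 1479926 ∷ 1382002 ∷ []) ∷
    prime-field 1583 5 1 (3 ∷ 7 ∷ 11 ∷ 113 ∷ []) (431030 ∷ 1878626 ∷ 1761290 ∷ []) ∷
    prime-field 1597 2 6 (3 ∷ 7 ∷ 17 ∷ 19 ∷ 47 ∷ []) (1961360 ∷ 752614 ∷ 283290 ∷ 2430352 ∷ 2439218 ∷ 320796 ∷ 1037674 ∷ 2542336 ∷ 884046 ∷ 2505380 ∷ []) ∷
    prime-field 1609 7 14 (3 ∷ 5 ∷ 7 ∷ 23 ∷ 67 ∷ []) (1205678 ∷ 1277916 ∷ 161382 ∷ 2320604 ∷ 808768 ∷ 425554 ∷ []) ∷
    prime-field 1637 2 2 (3 ∷ 7 ∷ 13 ∷ 409 ∷ []) (640322 ∷ 2397832 ∷ 1339066 ∷ 101084 ∷ []) ∷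
    prime-field 1667 2 2 (3 ∷ 7 ∷ 17 ∷ 139 ∷ []) (2308442 ∷ 817762 ∷ 2154602 ∷ []) ∷
    prime-field 1669 2 2 (3 ∷ 5 ∷ 139 ∷ 167 ∷ []) (1946548 ∷ 331046 ∷ 1391946 ∷ 2476028 ∷ 1954 ∷ 939576 ∷ []) ∷
    power-field 41 2 (7 ∷ 1 ∷ []) (0 ∷ 1 ∷ []) (0 ∷ 6 ∷ []) (3 ∷ 5 ∷ 7 ∷ 29 ∷ []) (1751358 ∷ 2488420 ∷ 2507626 ∷ 939972 ∷ 1698134 ∷ 2120216 ∷ 1073922 ∷ 1520088 ∷ 1317212 ∷ 173242 ∷ []) ∷
    prime-field 1693 2 2 (3 ∷ 7 ∷ 11 ∷ 47 ∷ []) (2865402 ∷ 1742460 ∷ 777842 ∷ 1563904 ∷ 942286 ∷ 2437772 ∷ []) ∷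
    prime-field 1699 2 4 (3 ∷ 5 ∷ 17 ∷ 283 ∷ []) (1876614 ∷ 940006 ∷ 1891238 ∷ []) ∷
    prime-field 1709 2 4 (3 ∷ 5 ∷ 7 ∷ 19 ∷ 61 ∷ []) (1462082 ∷ 1816904 ∷ 675434 ∷ 2040688 ∷ 692104 ∷ 2118506 ∷ []) ∷
    prime-field 1721 3 6 (3 ∷ 5 ∷ 7 ∷ 41 ∷ 43 ∷ []) (2169250 ∷ 2270228 ∷ 2500742 ∷ 1203452 ∷ 284506 ∷ 1263076 ∷ []) ∷
    prime-field 1741 2 2 (3 ∷ 5 ∷ 13 ∷ 29 ∷ 67 ∷ []) (481230 ∷ 2071220 ∷ 1157842 ∷ 1953292 ∷ 868716 ∷ 673238 ∷ 1973994 ∷ 1892588 ∷ 1872840 ∷ 742006 ∷ []) ∷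
    prime-field 1759 3 1 (3 ∷ 5 ∷ 11 ∷ 293 ∷ []) (26914 ∷ 1545282 ∷ 1419698 ∷ []) ∷
    prime-field 1789 2 4 (3 ∷ 5 ∷ 149 ∷ 179 ∷ []) (2597672 ∷ 2842566 ∷ 925042 ∷ 2584032 ∷ 173294 ∷ 115876 ∷ []) ∷
    prime-field 1801 11 7 (3 ∷ 5 ∷ 17 ∷ 53 ∷ []) (2555458 ∷ 1520536 ∷ 1737572 ∷ 2853794 ∷ 1423080 ∷ 1003422 ∷ []) ∷
    prime-field 1847 5 1 (3 ∷ 7 ∷ 11 ∷ 13 ∷ 71 ∷ []) (3038270 ∷ 3016910 ∷ 1654150 ∷ []) ∷
    power-field 43 2 (9 ∷ 1 ∷ []) (0 ∷ 1 ∷ []) (0 ∷ 2 ∷ []) (3 ∷ 5 ∷ 7 ∷ 11 ∷ 37 ∷ []) (2954168 ∷ 778418 ∷ 546832 ∷ 1409938 ∷ 748896 ∷ 975114 ∷ 1937904 ∷ 129998 ∷ 2109628 ∷ 2951862 ∷ []) ∷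
    prime-field 1861 2 2 (3 ∷ 5 ∷ 7 ∷ 19 ∷ 31 ∷ []) (1482204 ∷ 2766306 ∷ 2672330 ∷ 1022816 ∷ 2273188 ∷ 829222 ∷ 2638298 ∷ 1940520 ∷ 1730730 ∷ 16820 ∷ []) ∷
    prime-field 1871 7 1 (3 ∷ 5 ∷ 11 ∷ 13 ∷ 17 ∷ []) (3263386 ∷ 718850 ∷ 1744634 ∷ 1140082 ∷ []) ∷
    prime-field 1889 3 3 (3 ∷ 5 ∷ 7 ∷ 59 ∷ []) (1696276 ∷ 1389358 ∷ 3566432 ∷ 3150442 ∷ []) ∷
    prime-field 1901 2 8 (3 ∷ 5 ∷ 19 ∷ 317 ∷ []) (1725806 ∷ 1036216 ∷ 740290 ∷ 888112 ∷ 800554 ∷ 57680 ∷ []) ∷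
    prime-field 1931 2 2 (3 ∷ 5 ∷ 7 ∷ 23 ∷ 193 ∷ []) (2528950 ∷ 3620026 ∷ 2174318 ∷ []) ∷
    prime-field 1949 2 3 (3 ∷ 5 ∷ 13 ∷ 487 ∷ []) (3060394 ∷ 2446484 ∷ 416818 ∷ 2324116 ∷ []) ∷
    prime-field 1951 3 1 (3 ∷ 5 ∷ 13 ∷ 61 ∷ []) (1901250 ∷ 597502 ∷ 1890926 ∷ 2151954 ∷ 3661430 ∷ []) ∷
    prime-field 1973 2 2 (3 ∷ 7 ∷ 17 ∷ 29 ∷ 47 ∷ []) (1289474 ∷ 3651428 ∷ 1945378 ∷ 3264040 ∷ 3641990 ∷ 2904140 ∷ []) ∷
    prime-field 1979 2 2 (3 ∷ 5 ∷ 11 ∷ 23 ∷ 43 ∷ []) (1201514 ∷ 447362 ∷ 909446 ∷ []) ∷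
    prime-field 2003 2 10 (3 ∷ 7 ∷ 11 ∷ 13 ∷ 167 ∷ []) (1982698 ∷ 151094 ∷ 225290 ∷ 1118306 ∷ []) ∷
    prime-field 2029 2 2 (3 ∷ 5 ∷ 7 ∷ 13 ∷ 29 ∷ []) (4115826 ∷ 1045608 ∷ 1038958 ∷ 3039728 ∷ 503836 ∷ 2492474 ∷ []) ∷
    prime-field 2069 2 2 (3 ∷ 5 ∷ 11 ∷ 23 ∷ 47 ∷ []) (4182334 ∷ 4045636 ∷ 2139346 ∷ 2409412 ∷ 3340456 ∷ 1470014 ∷ []) ∷
    prime-field 2089 7 8 (3 ∷ 5 ∷ 11 ∷ 19 ∷ 29 ∷ []) (3949546 ∷ 2331332 ∷ 1354986 ∷ 119752 ∷ 3074666 ∷ 1424664 ∷ []) ∷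
    prime-field 2099 2 2 (3 ∷ 5 ∷ 7 ∷ 1049 ∷ []) (2376986 ∷ 55162 ∷ []) ∷
    prime-field 2111 7 1 (3 ∷ 5 ∷ 11 ∷ 211 ∷ []) (2846590 ∷ 2865686 ∷ 2919298 ∷ []) ∷
    prime-field 2129 3 10 (3 ∷ 5 ∷ 7 ∷ 19 ∷ 71 ∷ []) (1509184 ∷ 1238866 ∷ 1311704 ∷ 2722078 ∷ 2807848 ∷ 4344278 ∷ []) ∷
    prime-field 2131 2 2 (3 ∷ 5 ∷ 13 ∷ 41 ∷ 71 ∷ []) (4085970 ∷ 4149674 ∷ 2638426 ∷ 2746362 ∷ 2687098 ∷ []) ∷
    prime-field 2141 2 2 (3 ∷ 5 ∷ 7 ∷ 17 ∷ 107 ∷ []) (1973534 ∷ 2564312 ∷ 4582810 ∷ 1950100 ∷ 4206218 ∷ 4286344 ∷ []) ∷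
    power-field 47 2 (8 ∷ 1 ∷ []) (0 ∷ 1 ∷ []) (0 ∷ 7 ∷ []) (3 ∷ 5 ∷ 13 ∷ 17 ∷ 23 ∷ []) (1285824 ∷ 348422 ∷ 1255544 ∷ 3582174 ∷ 3612334 ∷ 3300172 ∷ []) ∷
    prime-field 2221 2 2 (3 ∷ 5 ∷ 11 ∷ 37 ∷ 101 ∷ []) (2751306 ∷ 3790464 ∷ 3651422 ∷ 1803512 ∷ 2977840 ∷ 3910798 ∷ 4931730 ∷ 472796 ∷ 3845966 ∷ 1146012 ∷ []) ∷
    prime-field 2239 3 1 (3 ∷ 5 ∷ 7 ∷ 373 ∷ []) (4923334 ∷ 2504322 ∷ 1661414 ∷ []) ∷
    prime-field 2243 2 13 (3 ∷ 11 ∷ 17 ∷ 19 ∷ 59 ∷ []) (1783246 ∷ 2640734 ∷ 1005530 ∷ []) ∷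
    prime-field 2269 2 2 (3 ∷ 5 ∷ 7 ∷ 227 ∷ []) (5147226 ∷ 2618512 ∷ 1548422 ∷ 4858664 ∷ 1101574 ∷ 4908096 ∷ []) ∷
    prime-field 2281 7 9 (3 ∷ 5 ∷ 7 ∷ 19 ∷ 163 ∷ []) (440852 ∷ 1923918 ∷ 3026410 ∷ 4450548 ∷ 5184086 ∷ 3275920 ∷ 1151544 ∷ 3200354 ∷ 3829228 ∷ 3940042 ∷ []) ∷
    prime-field 2309 2 2 (3 ∷ 5 ∷ 7 ∷ 11 ∷ 577 ∷ []) (1242344 ∷ 2664586 ∷ 3845872 ∷ 4911526 ∷ []) ∷
    prime-field 2311 3 1 (3 ∷ 5 ∷ 7 ∷ 11 ∷ 17 ∷ []) (1015490 ∷ 4329078 ∷ 3461986 ∷ 3870882 ∷ 5112874 ∷ 954218 ∷ 1357274 ∷ []) ∷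
    prime-field 2339 2 3 (3 ∷ 5 ∷ 7 ∷ 13 ∷ 167 ∷ []) (1844866 ∷ 2101922 ∷ 979754 ∷ []) ∷
    prime-field 2351 13 1 (3 ∷ 5 ∷ 7 ∷ 47 ∷ []) (2469602 ∷ 4370930 ∷ 5135014 ∷ []) ∷
    prime-field 2381 2 7 (3 ∷ 5 ∷ 7 ∷ 17 ∷ 397 ∷ []) (1798484 ∷ 4504222 ∷ 4739426 ∷ 3626756 ∷ 3705580 ∷ 1555118 ∷ 5217010 ∷ 91712 ∷ []) ∷
    prime-field 2393 3 5 (3 ∷ 7 ∷ 13 ∷ 19 ∷ 23 ∷ []) (861256 ∷ 2125402 ∷ 2951776 ∷ 2010590 ∷ 4884916 ∷ 4603250 ∷ []) ∷
    prime-field 2437 2 2 (3 ∷ 7 ∷ 23 ∷ 29 ∷ 53 ∷ []) (63890 ∷ 2221676 ∷ 947526 ∷ 1503816 ∷ 3079576 ∷ 3416410 ∷ 2968266 ∷ 3826872 ∷ 4372864 ∷ 5002066 ∷ []) ∷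
    prime-field 2441 3 3 (3 ∷ 5 ∷ 11 ∷ 37 ∷ 61 ∷ []) (2049154 ∷ 1141636 ∷ 5956040 ∷ 1551338 ∷ 5947424 ∷ 4051462 ∷ []) ∷
    prime-field 2521 11 11 (3 ∷ 5 ∷ 7 ∷ 13 ∷ 97 ∷ []) (4028896 ∷ 3581986 ∷ 942458 ∷ 749288 ∷ 5725422 ∷ 3818520 ∷ 2530354 ∷ 2726652 ∷ 1747230 ∷ 5952484 ∷ []) ∷
    prime-field 2531 2 2 (3 ∷ 5 ∷ 11 ∷ 23 ∷ 211 ∷ []) (30494 ∷ 2623646 ∷ 2957810 ∷ 647702 ∷ []) ∷
    prime-field 2549 2 2 (3 ∷ 5 ∷ 7 ∷ 13 ∷ 17 ∷ []) (3247426 ∷ 4734056 ∷ 4991018 ∷ 4497208 ∷ 4741694 ∷ 3972916 ∷ []) ∷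
    prime-field 2551 3 1 (3 ∷ 5 ∷ 11 ∷ 17 ∷ 29 ∷ []) (3251250 ∷ 1544822 ∷ 2762734 ∷ 4602298 ∷ 1206714 ∷ []) ∷
    prime-field 2617 5 6 (3 ∷ 7 ∷ 11 ∷ 17 ∷ 109 ∷ []) (1164824 ∷ 5961598 ∷ 2214444 ∷ 5831450 ∷ 4198410 ∷ 6470104 ∷ []) ∷
    prime-field 2621 2 2 (3 ∷ 5 ∷ 19 ∷ 23 ∷ 131 ∷ []) (5635330 ∷ 2692760 ∷ 5250922 ∷ 645688 ∷ 3299072 ∷ 1717054 ∷ []) ∷
    prime-field 2659 2 7 (3 ∷ 5 ∷ 7 ∷ 19 ∷ 443 ∷ []) (719618 ∷ 6495646 ∷ 1280514 ∷ []) ∷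
    prime-field 2729 3 3 (3 ∷ 5 ∷ 7 ∷ 11 ∷ 13 ∷ 31 ∷ []) (4078318 ∷ 7444712 ∷ 492766 ∷ 4259852 ∷ 5243584 ∷ 3692522 ∷ []) ∷
    prime-field 2731 2 3 (3 ∷ 5 ∷ 7 ∷ 13 ∷ 683 ∷ []) (4157070 ∷ 4899998 ∷ 450274 ∷ 3191386 ∷ 3348762 ∷ 1539254 ∷ 3398146 ∷ []) ∷
    prime-field 2789 2 6 (3 ∷ 5 ∷ 17 ∷ 31 ∷ 41 ∷ []) (766304 ∷ 810022 ∷ 1027544 ∷ 4092286 ∷ 4933594 ∷ 6984448 ∷ []) ∷
    prime-field 2851 2 2 (3 ∷ 5 ∷ 19 ∷ 23 ∷ 31 ∷ []) (728746 ∷ 8109174 ∷ 6151322 ∷ 4582678 ∷ 7747266 ∷ []) ∷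
    prime-field 2861 2 2 (3 ∷ 5 ∷ 11 ∷ 13 ∷ 53 ∷ []) (569392 ∷ 6064358 ∷ 8031802 ∷ 5895800 ∷ 8183890 ∷ 4871488 ∷ 289286 ∷ 1228724 ∷ []) ∷
    prime-field 2927 5 1 (3 ∷ 7 ∷ 11 ∷ 19 ∷ 61 ∷ []) (83026 ∷ 4994666 ∷ 6424034 ∷ 1305902 ∷ []) ∷
    prime-field 2939 2 2 (3 ∷ 5 ∷ 7 ∷ 13 ∷ 113 ∷ []) (3800998 ∷ 5748362 ∷ 6680242 ∷ []) ∷
    prime-field 2969 3 3 (3 ∷ 5 ∷ 7 ∷ 11 ∷ 53 ∷ []) (7453858 ∷ 1819156 ∷ 5380156 ∷ 7341614 ∷ 8811992 ∷ 1826674 ∷ []) ∷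
    prime-field 3011 2 2 (3 ∷ 5 ∷ 7 ∷ 43 ∷ 251 ∷ []) (2973050 ∷ 8389078 ∷ 1178006 ∷ 8897674 ∷ []) ∷
    prime-field 3037 2 2 (3 ∷ 7 ∷ 11 ∷ 23 ∷ 31 ∷ []) (219874 ∷ 1089952 ∷ 1516650 ∷ 8009340 ∷ 5937662 ∷ 6306428 ∷ 9221850 ∷ 1721556 ∷ 6681634 ∷ 3413392 ∷ []) ∷
    prime-field 3079 3 6 (3 ∷ 5 ∷ 7 ∷ 11 ∷ 19 ∷ []) (3487774 ∷ 7477766 ∷ 3079158 ∷ []) ∷
    prime-field 3109 2 4 (3 ∷ 5 ∷ 7 ∷ 37 ∷ 311 ∷ []) (3271478 ∷ 9652592 ∷ 1069546 ∷ 2551956 ∷ 4577802 ∷ 1972204 ∷ 6504236 ∷ 3768066 ∷ 2895394 ∷ 3974196 ∷ []) ∷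
    prime-field 3121 7 14 (3 ∷ 5 ∷ 7 ∷ 13 ∷ 223 ∷ []) (7639580 ∷ 232150 ∷ 9320546 ∷ 4520472 ∷ 4662402 ∷ 3419356 ∷ 5940204 ∷ 5591074 ∷ 720812 ∷ 1252490 ∷ []) ∷
    prime-field 3191 11 2 (3 ∷ 5 ∷ 7 ∷ 11 ∷ 19 ∷ 29 ∷ []) (6485470 ∷ 5564098 ∷ 3368222 ∷ 3431486 ∷ []) ∷
    prime-field 3221 2 4 (3 ∷ 5 ∷ 7 ∷ 23 ∷ 179 ∷ []) (7072018 ∷ 2169500 ∷ 7527068 ∷ 5564542 ∷ 668150 ∷ 6720856 ∷ 3643666 ∷ 6787312 ∷ []) ∷
    prime-field 3229 2 4 (3 ∷ 5 ∷ 17 ∷ 19 ∷ 269 ∷ []) (6597472 ∷ 464698 ∷ 876206 ∷ 8904156 ∷ 6832014 ∷ 8883356 ∷ []) ∷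
    prime-field 3299 2 3 (3 ∷ 5 ∷ 11 ∷ 17 ∷ 97 ∷ []) (4407758 ∷ 8838506 ∷ 1307158 ∷ []) ∷
    prime-field 3301 2 4 (3 ∷ 5 ∷ 11 ∷ 13 ∷ 127 ∷ []) (8330566 ∷ 8883684 ∷ 8703750 ∷ 5634032 ∷ 3943442 ∷ 3305968 ∷ 4413034 ∷ 6897136 ∷ 10003086 ∷ 7443108 ∷ []) ∷
    prime-field 3319 3 1 (3 ∷ 5 ∷ 7 ∷ 79 ∷ 83 ∷ []) (3960918 ∷ 5219794 ∷ 5042762 ∷ 5504562 ∷ 10455494 ∷ []) ∷
    prime-field 3331 2 4 (3 ∷ 5 ∷ 7 ∷ 17 ∷ 37 ∷ []) (10679294 ∷ 9319498 ∷ 10537902 ∷ 3600166 ∷ 4321250 ∷ []) ∷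
    prime-field 3359 11 1 (3 ∷ 5 ∷ 7 ∷ 23 ∷ 73 ∷ []) (10633682 ∷ 7365122 ∷ 5817202 ∷ []) ∷
    prime-field 3389 2 8 (3 ∷ 5 ∷ 7 ∷ 11 ∷ 113 ∷ []) (4340752 ∷ 4164334 ∷ 2164738 ∷ 189184 ∷ 6064786 ∷ 663844 ∷ []) ∷
    prime-field 3499 2 2 (3 ∷ 5 ∷ 7 ∷ 11 ∷ 53 ∷ []) (6517522 ∷ 10723586 ∷ 7238046 ∷ 11562154 ∷ 138414 ∷ []) ∷
    prime-field 3541 2 3 (3 ∷ 5 ∷ 7 ∷ 11 ∷ 23 ∷ 59 ∷ []) (8934358 ∷ 1264072 ∷ 10226690 ∷ 10078484 ∷ 12461940 ∷ 6977886 ∷ 3343482 ∷ 9252616 ∷ 1527012 ∷ 4064626 ∷ []) ∷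
    prime-field 3571 2 2 (3 ∷ 5 ∷ 7 ∷ 17 ∷ 19 ∷ 47 ∷ []) (6381522 ∷ 4365038 ∷ 9682354 ∷ 3271370 ∷ 2707966 ∷ 773634 ∷ 5189862 ∷ []) ∷
    prime-field 3709 2 2 (3 ∷ 5 ∷ 7 ∷ 53 ∷ 103 ∷ []) (2634886 ∷ 13128232 ∷ 13754826 ∷ 2304044 ∷ 2900822 ∷ 7013508 ∷ []) ∷
    prime-field 3719 7 7 (3 ∷ 5 ∷ 11 ∷ 13 ∷ 31 ∷ []) (5833942 ∷ 13239482 ∷ 950626 ∷ []) ∷
    prime-field 3739 2 3 (3 ∷ 5 ∷ 7 ∷ 11 ∷ 17 ∷ 89 ∷ []) (1499286 ∷ 11114746 ∷ 2722826 ∷ 6919062 ∷ 1899958 ∷ []) ∷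
    prime-field 3761 3 5 (3 ∷ 5 ∷ 11 ∷ 19 ∷ 47 ∷ []) (7535270 ∷ 6084440 ∷ 13424668 ∷ 11428078 ∷ 1146844 ∷ 4490482 ∷ []) ∷
    prime-field 3821 2 8 (3 ∷ 5 ∷ 7 ∷ 13 ∷ 191 ∷ []) (9574466 ∷ 13368556 ∷ 4803934 ∷ 9997888 ∷ 11765602 ∷ 12049364 ∷ []) ∷
    prime-field 3851 2 2 (3 ∷ 5 ∷ 7 ∷ 11 ∷ 107 ∷ []) (1919026 ∷ 3539350 ∷ 2829538 ∷ 5340274 ∷ []) ∷
    prime-field 3989 2 3 (3 ∷ 5 ∷ 7 ∷ 19 ∷ 997 ∷ []) (8406628 ∷ 11324134 ∷ 13310456 ∷ 12365798 ∷ []) ∷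
    prime-field 4003 2 2 (3 ∷ 7 ∷ 11 ∷ 13 ∷ 23 ∷ 29 ∷ []) (1308550 ∷ 8851382 ∷ 8289042 ∷ 1778726 ∷ 4332802 ∷ []) ∷
    prime-field 4019 2 2 (3 ∷ 5 ∷ 7 ∷ 41 ∷ 67 ∷ []) (7311598 ∷ 13739218 ∷ 9470834 ∷ []) ∷
    prime-field 4129 7 6 (3 ∷ 5 ∷ 7 ∷ 43 ∷ 59 ∷ []) (10664006 ∷ 16251728 ∷ 362848 ∷ 6327634 ∷ 15126402 ∷ 6407892 ∷ []) ∷
    prime-field 4159 3 1 (3 ∷ 5 ∷ 7 ∷ 11 ∷ 13 ∷ []) (8832354 ∷ 7088246 ∷ 9939478 ∷ 6272418 ∷ 8980022 ∷ []) ∷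
    prime-field 4201 11 13 (3 ∷ 5 ∷ 7 ∷ 11 ∷ 191 ∷ []) (2234670 ∷ 10695716 ∷ 734524 ∷ 14031062 ∷ 1747440 ∷ 13737466 ∷ 10412408 ∷ 4369538 ∷ 7032148 ∷ 10166718 ∷ []) ∷
    prime-field 4229 2 2 (3 ∷ 5 ∷ 7 ∷ 47 ∷ 151 ∷ []) (13714792 ∷ 1864862 ∷ 11266682 ∷ 1283012 ∷ 4059422 ∷ 10950988 ∷ []) ∷
    prime-field 4409 3 3 (3 ∷ 5 ∷ 7 ∷ 19 ∷ 29 ∷ []) (3338998 ∷ 13222628 ∷ 632836 ∷ 11181706 ∷ 19434872 ∷ 17153686 ∷ []) ∷
    prime-field 4421 2 4 (3 ∷ 5 ∷ 11 ∷ 13 ∷ 17 ∷ 67 ∷ []) (10375138 ∷ 9595192 ∷ 14976920 ∷ 13443634 ∷ 7583446 ∷ 16073276 ∷ 19107122 ∷ 2800304 ∷ []) ∷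
    prime-field 4523 2 6 (3 ∷ 7 ∷ 13 ∷ 17 ∷ 19 ∷ 29 ∷ []) (422614 ∷ 11807690 ∷ 1633790 ∷ 3021118 ∷ []) ∷
    prime-field 4549 2 10 (3 ∷ 5 ∷ 7 ∷ 13 ∷ 379 ∷ []) (660666 ∷ 5520168 ∷ 353686 ∷ 8366824 ∷ 7262786 ∷ 1455968 ∷ []) ∷
    prime-field 4591 3 1 (3 ∷ 5 ∷ 7 ∷ 17 ∷ 41 ∷ []) (14310754 ∷ 10534050 ∷ 14296466 ∷ 14561018 ∷ 7160086 ∷ []) ∷
    prime-field 4621 2 2 (3 ∷ 5 ∷ 7 ∷ 11 ∷ 2311 ∷ []) (21006558 ∷ 15440236 ∷ 19892350 ∷ 13069380 ∷ 17090414 ∷ 7115072 ∷ 8152162 ∷ 11051184 ∷ 8101586 ∷ 12916888 ∷ 15222222 ∷ 14944868 ∷ 21351330 ∷ 112232 ∷ []) ∷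
    prime-field 4691 2 3 (3 ∷ 5 ∷ 7 ∷ 17 ∷ 23 ∷ 67 ∷ []) (19049422 ∷ 17300218 ∷ 6453434 ∷ 10711630 ∷ []) ∷
    prime-field 4759 3 3 (3 ∷ 5 ∷ 7 ∷ 13 ∷ 17 ∷ 61 ∷ []) (16218042 ∷ 5599214 ∷ 7269826 ∷ 22643322 ∷ 14932262 ∷ []) ∷
    prime-field 4861 2 7 (3 ∷ 5 ∷ 11 ∷ 13 ∷ 17 ∷ []) (22547970 ∷ 6579060 ∷ 12702764 ∷ 8705306 ∷ 11646676 ∷ 11354578 ∷ []) ∷
    prime-field 5039 11 7 (3 ∷ 5 ∷ 7 ∷ 11 ∷ 229 ∷ []) (3671786 ∷ 24497726 ∷ 18744886 ∷ []) ∷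
    prime-field 5081 3 4 (3 ∷ 5 ∷ 7 ∷ 11 ∷ 127 ∷ []) (23458240 ∷ 23770910 ∷ 25386308 ∷ 13245014 ∷ 7572284 ∷ 16833658 ∷ []) ∷
    prime-field 5279 7 2 (3 ∷ 5 ∷ 7 ∷ 11 ∷ 13 ∷ 29 ∷ []) (26112338 ∷ 17224138 ∷ 4238446 ∷ 11229494 ∷ []) ∷
    prime-field 5641 7 20 (3 ∷ 5 ∷ 7 ∷ 13 ∷ 31 ∷ 47 ∷ []) (2322058 ∷ 21032944 ∷ 12083634 ∷ 30521940 ∷ 18115016 ∷ 29441642 ∷ 8890412 ∷ 18019570 ∷ 18839738 ∷ 24849556 ∷ []) ∷
    prime-field 5741 2 5 (3 ∷ 5 ∷ 7 ∷ 11 ∷ 29 ∷ 41 ∷ []) (15358246 ∷ 4517872 ∷ 30755882 ∷ 23415784 ∷ 1992028 ∷ 30183278 ∷ 30174736 ∷ 8030470 ∷ []) ∷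
    prime-field 5851 2 2 (3 ∷ 5 ∷ 7 ∷ 11 ∷ 13 ∷ 19 ∷ []) (32943478 ∷ 29781002 ∷ 11824710 ∷ 12575674 ∷ 25777538 ∷ []) ∷
    power-field 83 2 (21 ∷ 1 ∷ []) (0 ∷ 1 ∷ []) (0 ∷ 11 ∷ []) (3 ∷ 5 ∷ 7 ∷ 13 ∷ 41 ∷ 53 ∷ []) (5242538 ∷ 7489316 ∷ 19708282 ∷ 3375004 ∷ 29490696 ∷ 43772634 ∷ 39375504 ∷ 14477514 ∷ 36969194 ∷ 24545704 ∷ []) ∷
    prime-field 6971 2 4 (3 ∷ 5 ∷ 7 ∷ 17 ∷ 41 ∷ 83 ∷ []) (40367186 ∷ 39043234 ∷ 47666342 ∷ 15074338 ∷ []) ∷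
    prime-field 7069 2 2 (3 ∷ 5 ∷ 7 ∷ 19 ∷ 31 ∷ 101 ∷ []) (20452024 ∷ 31444662 ∷ 8555616 ∷ 42258434 ∷ 15456982 ∷ 35945228 ∷ 49967226 ∷ 16965612 ∷ 28140964 ∷ 8382938 ∷ []) ∷
    prime-field 7309 2 6 (3 ∷ 5 ∷ 7 ∷ 17 ∷ 29 ∷ 43 ∷ []) (23268758 ∷ 51612656 ∷ 11176828 ∷ 727102 ∷ 44132664 ∷ 18478278 ∷ 3803598 ∷ 19273208 ∷ 17058266 ∷ 42319456 ∷ []) ∷
    prime-field 7589 2 2 (3 ∷ 5 ∷ 7 ∷ 11 ∷ 23 ∷ 271 ∷ []) (1797482 ∷ 48120068 ∷ 140204 ∷ 11377162 ∷ 28792666 ∷ 40859312 ∷ []) ∷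
    prime-field 8009 3 7 (3 ∷ 5 ∷ 7 ∷ 11 ∷ 13 ∷ 89 ∷ []) (45747578 ∷ 4042724 ∷ 3051482 ∷ 60550492 ∷ 43946962 ∷ 62853176 ∷ 20531342 ∷ 52955908 ∷ []) ∷
    prime-field 8161 7 8 (3 ∷ 5 ∷ 7 ∷ 11 ∷ 17 ∷ 53 ∷ []) (24003888 ∷ 60845086 ∷ 11417682 ∷ 42694012 ∷ 44695094 ∷ 44741864 ∷ 49241380 ∷ 42950738 ∷ 65820252 ∷ 32074194 ∷ []) ∷
    prime-field 8581 2 3 (3 ∷ 5 ∷ 7 ∷ 11 ∷ 13 ∷ 613 ∷ []) (21583616 ∷ 72880426 ∷ 26758458 ∷ 69239988 ∷ 29980190 ∷ 50587924 ∷ 10050562 ∷ 41238700 ∷ 22095432 ∷ 17163494 ∷ 39223470 ∷ 45202628 ∷ 51865706 ∷ 30609056 ∷ []) ∷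
    prime-field 8779 2 9 (3 ∷ 5 ∷ 7 ∷ 11 ∷ 19 ∷ 439 ∷ []) (77039138 ∷ 71385958 ∷ 59297454 ∷ 51394018 ∷ 5775642 ∷ 36567002 ∷ []) ∷
    prime-field 9281 3 3 (3 ∷ 5 ∷ 7 ∷ 13 ∷ 17 ∷ 29 ∷ []) (48323774 ∷ 5932544 ∷ 24462712 ∷ 85620286 ∷ 86127680 ∷ 10122878 ∷ []) ∷
    prime-field 10009 7 7 (3 ∷ 5 ∷ 7 ∷ 11 ∷ 13 ∷ 139 ∷ []) (27963682 ∷ 27930724 ∷ 60224988 ∷ 78883626 ∷ 54384332 ∷ 40402058 ∷ []) ∷
    prime-field 14629 2 6 (3 ∷ 5 ∷ 7 ∷ 11 ∷ 19 ∷ 23 ∷ 53 ∷ []) (167618196 ∷ 182721766 ∷ 121933058 ∷ 144378832 ∷ 112468434 ∷ 91454648 ∷ 182868508 ∷ 108167182 ∷ 127122272 ∷ 123308046 ∷ []) ∷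
    prime-field 17291 2 3 (3 ∷ 5 ∷ 7 ∷ 11 ∷ 13 ∷ 19 ∷ 131 ∷ []) (3385762 ∷ 192260954 ∷ 153091126 ∷ 74505698 ∷ 294288470 ∷ []) ∷ []

  valid : all validᵇ certificates ≡ true
  valid = refl

-- Soundness of the certificate checks.

module Soundness where

  open FiniteFields
  open FrobeniusMap
  open Idempotents
  open QuadraticExtensions
  open TwoPrimitiveElements
  open SieveCriterion using (∧-elim; ∨-elim; stripAll; stripAll-∣)
  open Certificates
  open import Data.Bool.Base using (Bool; true; false; T; _∧_; not; if_then_else_)
  open import Data.Bool.ListAction using (any; all)
  open import Data.Fin.Properties using (_≟_; any?)
  open import Data.List.Base using (List; []; _∷_)
  open import Data.Fin.Base as Fin using (toℕ)
  open import Data.Fin.Properties using (toℕ<n)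
  open import Data.Nat.Base as ℕ using (ℕ; zero; suc; z≤n; s≤s; _∸_; NonZero; NonTrivial)
  import Data.Nat.Properties as ℕ
  open import Data.Nat.Divisibility using (_∣_; divides; 0∣⇒≡0; ∣⇒≤; m%n≡0⇒n∣m; n∣m⇒m%n≡0; *-cancelʳ-∣)
  open import Data.Nat.Tactic.RingSolver using () renaming (solve-∀ to ℕ-solve-∀)
  open import Data.Integer.Base using (0ℤ; 1ℤ)

  not-elim : ∀ {b} → T (not b) → ¬ T b
  not-elim {false} _ ()

  all-elim : ∀ {A : Set} (P : A → Bool) xs → T (all P xs) → All (T ∘ P) xs
  all-elim P []       t = []
  all-elim P (x ∷ xs) t = proj₁ (∧-elim {P x} t) ∷ all-elim P xs (proj₂ (∧-elim {P x} t))

  ∧-elim³ : ∀ a b c → T (a ∧ (b ∧ c)) → T a × T b × T c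
  ∧-elim³ true true true t = tt , tt , tt

  any-elim : ∀ {A : Set} (P : A → Bool) xs → T (any P xs) → ∃ λ x → x ∈ xs × T (P x)
  any-elim P (x ∷ xs) t = [ (λ a → x , here refl , a) , (λ b → let y , y∈ , py = any-elim P xs b in y , there y∈ , py) ]′ (∨-elim {P x} t)

  if-elim : ∀ {b c} → T (if b then c else false) → T b × T c
  if-elim {true} t = tt , t

  ∣ᵇ⇒∣ : ∀ l m → T (l ∣ᵇ m) → l ∣ m
  ∣ᵇ⇒∣ (suc l) m t = m%n≡0⇒n∣m m (suc l) (ℕ.≡ᵇ⇒≡ _ 0 t)

  ∣⇒∣ᵇ : ∀ l m .{{_ : NonZero l}} → l ∣ m → T (l ∣ᵇ m)
  ∣⇒∣ᵇ (suc l) m d = ℕ.≡⇒≡ᵇ _ 0 (n∣m⇒m%n≡0 m (suc l) d)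

  primeᵇ⇒prime : ∀ m → T (primeᵇ m) → Prime m
  primeᵇ⇒prime m t = go 200 2 2-rough (proj₂ (∧-elim {1 ℕ.<ᵇ m} t))
    where
    instance
      nt : NonTrivial m
      nt = ℕ.n>1⇒nonTrivial (ℕ.<ᵇ⇒< 1 m (proj₁ (∧-elim {1 ℕ.<ᵇ m} t)))
    go : ∀ f d → d Rough m → T (roughᵇ f d m) → Prime m
    go (suc f) zero    r t = [ (λ m<0 → ⊥-elim (ℕ.n≮0 (ℕ.<ᵇ⇒< m 0 m<0))) , (λ t′ → go f 1 (∤⇒rough-suc (λ 0∣m → ℕ.<⇒≢ (ℕ.<-trans (s≤s z≤n) (ℕ.nonTrivial⇒n>1 m)) (sym (0∣⇒≡0 0∣m))) r) t′) ]′ (∨-elim {m ℕ.<ᵇ 0} t)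
    go (suc f) d@(suc _) r t = [ (λ m<dd → rough∧square>⇒prime r (ℕ.<ᵇ⇒< m (d ℕ.* d) m<dd)) ,
      (λ t′ → go f (suc d) (∤⇒rough-suc (λ d∣m → not-elim (proj₁ (∧-elim {not (d ∣ᵇ m)} t′)) (∣⇒∣ᵇ d m d∣m)) r) (proj₂ (∧-elim {not (d ∣ᵇ m)} t′))) ]′ (∨-elim {m ℕ.<ᵇ d ℕ.* d} t)

  div-* : ∀ l m → l ∣ m → .{{NonZero l}} → m ≡ l ℕ.* (m div l)
  div-* (suc l) m d = sym (trans (ℕ.*-comm (suc l) _) (m/n*n≡m d))

  -- A prime divisor missing from the list survives the stripping and would divide 1.
  stripAll≡1⇒∈ : ∀ ps m → T (stripAll ps m ℕ.≡ᵇ 1) → All Prime ps → ∀ ℓ → Prime ℓ → ℓ ∣ m → ℓ ∈ ps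
  stripAll≡1⇒∈ ps m t pps ℓ pℓ ℓ∣m with Any.any? (ℓ ℕ.≟_) ps
  ... | yes ℓ∈ = ℓ∈
  ... | no ℓ∉  = ⊥-elim (ℕ.<⇒≱ (1<prime pℓ) (∣⇒≤ (subst (ℓ ∣_) (ℕ.≡ᵇ⇒≡ (stripAll ps m) 1 t) (stripAll-∣ ps m pps pℓ (Allₚ.¬Any⇒All¬ ps ℓ∉) ℓ∣m))))

  module Models {n : ℕ} (𝔽 : FiniteField n) {p : ℕ} (pp : Prime p) (k : ℕ)
    (1<q : 1 ℕ.< p ℕ.^ k) (N≡ : suc n ≡ (p ℕ.^ k) ℕ.* (p ℕ.^ k)) (c₄ : ℕ) (n≡4c : n ≡ 4 ℕ.* c₄) where
    open FieldTheory 𝔽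
    open AtomTheory 𝔽
    open OrderTheory 𝔽
    open Quadratic 𝔽 pp k 1<q N≡
    open PrimitiveTheory 𝔽 pp k 1<q N≡ c₄ n≡4c
    open ≡-Reasoning

    -- A map into `B` that respects the operations. `⟦eq⟧` goes one way only, from a successful test
    -- to an equality; injectivity is not part of the notion.
    record Interpretation (O : Ops) : Set where
      open Ops O
      field
        ⟦_⟧ : A → K
        ⟦one⟧ : ⟦ one ⟧ ≡ 1#
        ⟦negOne⟧ : ⟦ negOne ⟧ ≡ - 1#
        ⟦add⟧ : ∀ a b → ⟦ add a b ⟧ ≡ ⟦ a ⟧ + ⟦ b ⟧
        ⟦mul⟧ : ∀ a b → ⟦ mul a b ⟧ ≡ ⟦ a ⟧ * ⟦ b ⟧
        ⟦eq⟧ : ∀ a b → T (eqᵇ a b) → ⟦ a ⟧ ≡ ⟦ b ⟧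
        ⟦⟧∈B : ∀ a → B ⟦ a ⟧

    power-sound : ∀ {X : Set} (h : X → K) one mul → h one ≡ 1# → (∀ x y → h (mul x y) ≡ h x * h y) →
      ∀ f x m → h (power one mul f x m) ≡ h x ^ m
    power-sound h one mul h1 h* zero    x zero    = h1
    power-sound h one mul h1 h* zero    x (suc m) = trans (h* x _) (cong (h x *_) (power-sound h one mul h1 h* zero x m))
    power-sound h one mul h1 h* (suc f) x m = step (m % 2) (m%n<n m 2) (m≡m%n+[m/n]*n m 2)
      where
      y : _
      y = power one mul f (mul x x) (m / 2)
      half : h y ≡ h x ^ ((m / 2) ℕ.* 2)
      half = trans (power-sound h one mul h1 h* f (mul x x) (m / 2)) (trans (cong (_^ (m / 2)) (trans (h* x x) (cong (h x *_) (sym (*-identityʳ (h x))))))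
        (trans (^-assocʳ (h x) 2 (m / 2)) (cong (h x ^_) (ℕ.*-comm 2 (m / 2)))))
      step : ∀ r → r ℕ.< 2 → m ≡ r ℕ.+ (m / 2) ℕ.* 2 → h (oddStep mul x y (r ℕ.≡ᵇ 0)) ≡ h x ^ m
      step 0 _ eq = trans half (cong (h x ^_) (sym eq))
      step 1 _ eq = trans (h* x y) (trans (cong (h x *_) half) (cong (h x ^_) (sym eq)))
      step (suc (suc _)) (s≤s (s≤s ())) eq

    n≡q²-1 : n ≡ q ℕ.* q ∸ 1
    n≡q²-1 = cong ℕ.pred N≡

    module Sound (fuel : ℕ) (O : Ops) (I : Interpretation O) (δ u : Ops.A O) (σ : K) (σσ≡δ : σ * σ ≡ Interpretation.⟦_⟧ I δ) where
      open Ops O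
      open Interpretation I
      open Extension fuel O q δ u

      ⟦_⟧² : A² → K
      ⟦ a , b ⟧² = ⟦ a ⟧ + ⟦ b ⟧ * σ

      Ω : K
      Ω = ⟦ ω ⟧²

      one²-sound : ⟦ one² ⟧² ≡ 1#
      one²-sound = trans (cong₂ _+_ ⟦one⟧ (trans (cong (_* σ) (trans (⟦add⟧ one negOne) (trans (cong₂ _+_ ⟦one⟧ ⟦negOne⟧) (-‿inverseʳ 1#)))) (zeroˡ σ))) (+-identityʳ 1#)

      mul²-sound : ∀ x y → ⟦ mul² x y ⟧² ≡ ⟦ x ⟧² * ⟦ y ⟧²
      mul²-sound (a , b) (a′ , b′) = begin
        ⟦ add (mul a a′) (mul δ (mul b b′)) ⟧ + ⟦ add (mul a b′) (mul b a′) ⟧ * σ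
          ≡⟨ cong₂ (λ x y → x + y * σ) (trans (⟦add⟧ _ _) (cong₂ _+_ (⟦mul⟧ a a′) (trans (⟦mul⟧ δ _) (cong₂ _*_ (sym σσ≡δ) (⟦mul⟧ b b′)))))
               (trans (⟦add⟧ _ _) (cong₂ _+_ (⟦mul⟧ a b′) (⟦mul⟧ b a′))) ⟩
        ⟦ a ⟧ * ⟦ a′ ⟧ + σ * σ * (⟦ b ⟧ * ⟦ b′ ⟧) + (⟦ a ⟧ * ⟦ b′ ⟧ + ⟦ b ⟧ * ⟦ a′ ⟧) * σ
          ≡⟨ solve 5 (λ a b a′ b′ s → a :* a′ :+ s :* s :* (b :* b′) :+ (a :* b′ :+ b :* a′) :* s := (a :+ b :* s) :* (a′ :+ b′ :* s)) refl ⟦ a ⟧ ⟦ b ⟧ ⟦ a′ ⟧ ⟦ b′ ⟧ σ ⟩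
        (⟦ a ⟧ + ⟦ b ⟧ * σ) * (⟦ a′ ⟧ + ⟦ b′ ⟧ * σ) ∎

      ω^-sound : ∀ e → ⟦ ω^ e ⟧² ≡ Ω ^ e
      ω^-sound e = power-sound ⟦_⟧² one² mul² one²-sound mul²-sound fuel ω e

      unit-sound : ∀ a → T (unitᵇ a) → ⟦ a ⟧ ≢ 0#
      unit-sound a t eq = 1≢0 (trans (sym pow) (trans (cong (_^ (q ∸ 1)) eq) (0^ (q ∸ 1))))
        where
        0^ : ∀ m .{{_ : NonZero m}} → 0# ^ m ≡ 0#
        0^ (suc m) = 0^suc m
        pow : ⟦ a ⟧ ^ (q ∸ 1) ≡ 1#
        pow = trans (sym (power-sound ⟦_⟧ one mul ⟦one⟧ ⟦mul⟧ fuel a (q ∸ 1))) (trans (⟦eq⟧ _ one t) ⟦one⟧)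

      unit²-sound : ∀ z → T (unit²ᵇ z) → ⟦ z ⟧² ≢ 0#
      unit²-sound (a , b) t eq = unit-sound _ t (begin
        ⟦ add (mul a a) (mul negOne (mul δ (mul b b))) ⟧
          ≡⟨ trans (⟦add⟧ _ _) (cong₂ _+_ (⟦mul⟧ a a) (trans (⟦mul⟧ negOne _) (cong₂ _*_ ⟦negOne⟧ (trans (⟦mul⟧ δ _) (cong₂ _*_ (sym σσ≡δ) (⟦mul⟧ b b)))))) ⟩
        -- The norm is (x + y σ)(x - y σ). The cancelling cross terms are inserted first, because
        -- the semiring solver treats -1 as an unknown.
        x * x + - 1# * (σ * σ * (y * y)) ≡⟨ cong (λ z → z + - 1# * (σ * σ * (y * y))) (sym (drop x (y * σ))) ⟩
        x * x + x * (y * σ) + - 1# * (x * (y * σ)) + - 1# * (σ * σ * (y * y))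
          ≡⟨ solve 4 (λ x y s m → x :* x :+ x :* (y :* s) :+ m :* (x :* (y :* s)) :+ m :* (s :* s :* (y :* y)) := (x :+ y :* s) :* (x :+ m :* (y :* s))) refl x y σ (- 1#) ⟩
        (x + y * σ) * (x + - 1# * (y * σ)) ≡⟨ cong (_* (x + - 1# * (y * σ))) eq ⟩
        0# * (x + - 1# * (y * σ)) ≡⟨ zeroˡ _ ⟩
        0# ∎)
        where
        x y : K
        x = ⟦ a ⟧
        y = ⟦ b ⟧
        drop : ∀ x s → x * x + x * s + - 1# * (x * s) ≡ x * x
        drop x s = trans (+-assoc _ _ _) (trans (cong (x * x +_) (trans (cong (x * s +_) (trans (sym (-‿distribˡ-* 1# _)) (cong -_ (*-identityˡ _)))) (-‿inverseʳ _))) (+-identityʳ _))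

      ≢1-sound : ∀ z → T (≢1ᵇ z) → ⟦ z ⟧² ≢ 1#
      ≢1-sound z@(a , b) t eq = unit²-sound (add a negOne , b) t (begin
        ⟦ add a negOne ⟧ + ⟦ b ⟧ * σ ≡⟨ cong (_+ ⟦ b ⟧ * σ) (trans (⟦add⟧ a negOne) (cong (⟦ a ⟧ +_) ⟦negOne⟧)) ⟩
        ⟦ a ⟧ + - 1# + ⟦ b ⟧ * σ ≡⟨ solve 3 (λ a m s → a :+ m :+ s := a :+ s :+ m) refl ⟦ a ⟧ (- 1#) (⟦ b ⟧ * σ) ⟩
        ⟦ z ⟧² + - 1# ≡⟨ cong (_+ - 1#) eq ⟩
        1# + - 1# ≡⟨ -‿inverseʳ 1# ⟩
        0# ∎)

      module Primitive (ols : List ℕ) (t : T (primitiveᵇ ols)) where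
        private
          t₁ : T (all dividesᵇ ols)
          t₁ = proj₁ (∧-elim {all dividesᵇ ols} t)
          t₂ : T ((stripAll (2 ∷ ols) #units ℕ.≡ᵇ 1) ∧ (unit²ᵇ ω ∧ all orderᵇ (2 ∷ ols)))
          t₂ = proj₂ (∧-elim {all dividesᵇ ols} t)
          t₃ : T (unit²ᵇ ω ∧ all orderᵇ (2 ∷ ols))
          t₃ = proj₂ (∧-elim {stripAll (2 ∷ ols) #units ℕ.≡ᵇ 1} t₂)

        dividesᵇ-sound : ∀ l → T (dividesᵇ l) → OddPrimeDivisor n l
        dividesᵇ-sound l t = let t₁ , t₂ , t₃ = ∧-elim³ (primeᵇ l) (2 ℕ.<ᵇ l) (l ∣ᵇ #units) t in
          primeᵇ⇒prime l t₁ , ℕ.<ᵇ⇒< 2 l t₂ , subst (l ∣_) (sym n≡q²-1) (∣ᵇ⇒∣ l #units t₃)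

        ols-ok : All (OddPrimeDivisor n) ols
        ols-ok = All.map (dividesᵇ-sound _) (all-elim dividesᵇ ols t₁)

        Ω≢0 : Ω ≢ 0#
        Ω≢0 = unit²-sound ω (proj₁ (∧-elim {unit²ᵇ ω} t₃))

        complete : ∀ ℓ → Prime ℓ → ℓ ∣ n → ℓ ∈ 2 ∷ ols
        complete ℓ pℓ ℓ∣n = stripAll≡1⇒∈ (2 ∷ ols) #units (proj₁ (∧-elim {stripAll (2 ∷ ols) #units ℕ.≡ᵇ 1} t₂)) (prime[2] ∷ All.map proj₁ ols-ok) ℓ pℓ (subst (ℓ ∣_) n≡q²-1 ℓ∣n)

        Ω-order : ∀ j → Ω ^ j ≡ 1# → n ∣ j
        Ω-order = order∣ 0<n (lagrange Ω≢0) (λ ℓ c pℓ n≡ Ωc → All.lookup (all-elim orderᵇ (2 ∷ ols) (proj₂ (∧-elim {unit²ᵇ ω} t₃)))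
            (complete ℓ pℓ (divides c (trans n≡ (ℕ.*-comm ℓ c)))) |> λ t → ≢1-sound _ t (trans (ω^-sound (#units div ℓ)) (trans (cong (Ω ^_) (quot ℓ c pℓ n≡)) Ωc)))
          where
          infixl 1 _|>_
          _|>_ : {A C : Set} → A → (A → C) → C
          x |> f = f x
          quot : ∀ ℓ c → Prime ℓ → n ≡ ℓ ℕ.* c → #units div ℓ ≡ c
          quot ℓ c pℓ n≡ = ℕ.*-cancelˡ-≡ _ c ℓ {{prime⇒nonZero pℓ}} (trans (sym (div-* ℓ #units (divides c (trans (sym n≡q²-1) (trans n≡ (ℕ.*-comm ℓ c)))) {{prime⇒nonZero pℓ}})) (trans (sym n≡q²-1) n≡))

        -- The case m = n, c = 1 of the coset count: the powers of Ω below n represent each coset of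
        -- the trivial group once, so some shift of x⁻¹ by a power of Ω is 1.
        Ω^-surjective : ∀ {x} → x ≢ 0# → ∃ λ m → m ℕ.< n × Ω ^ m ≡ x
        Ω^-surjective {x} x≢0 with any? {n = n} (λ j → Ω ^ toℕ j ≟ x)
        ... | yes (j , eq) = toℕ j , toℕ<n j , eq
        ... | no ¬p = ⊥-elim (absurd (trans (sym (Average.∑δ M Ω Ω≢0 (λ j eq → Ω-order j (trans (cong (_^ j) (sym (*-identityʳ Ω))) eq)) (x ⁻¹) (⁻¹-nonzero x≢0)))
              (IntegerSums.sum-zero _ (λ j → IntegerSums.𝟙-no (_ ≟ 1#) (λ eq → ¬p (j , solved j eq))))))
          where
          absurd : 1ℤ ≡ 0ℤ → ⊥
          absurd ()
          M : Modulus
          M = record { m = n ; c = 1 ; m≢0 = ℕ.>-nonZero 0<n ; n≡m*c = sym (ℕ.*-identityʳ n) ; η = Ω ; η≢0 = Ω≢0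
                     ; η-order = λ j eq → Ω-order j (trans (cong (_^ j) (sym (*-identityʳ Ω))) eq) }
          solved : ∀ j → (x ⁻¹ * Ω ^ toℕ j) ^ 1 ≡ 1# → Ω ^ toℕ j ≡ x
          solved j eq = *-cancelˡ (⁻¹-nonzero x≢0) (trans (sym (*-identityʳ _)) (trans eq (sym (trans (*-comm _ _) (*-inverseʳ x≢0)))))

        n∣⇒Ω^≡1 : ∀ {j} → n ∣ j → Ω ^ j ≡ 1#
        n∣⇒Ω^≡1 (divides i refl) = ^-*≡1 n i (lagrange Ω≢0)

        Ω∉B : ¬ B Ω
        Ω∉B BΩ = ℕ.<⇒≱ q-1<n (∣⇒≤ (Ω-order (q ∸ 1) (*-cancelˡ Ω≢0 (trans (cong (Ω ^_) (sym q≡1+)) (trans BΩ (sym (*-identityʳ Ω)))))))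
          where
          q-1<n : q ∸ 1 ℕ.< n
          q-1<n = ℕ.<-≤-trans (ℕ.m<m*n (q ∸ 1) (suc q) (s≤s (ℕ.<⇒≤ 1<q))) (ℕ.≤-reflexive (trans (ℕ.*-comm (q ∸ 1) (suc q)) (sym n≡[q+1][q-1])))

        -- Write b = Ω ^ m. From b ^ (q - 1) = 1 it follows that n = (q + 1)(q - 1) divides m (q -
        -- 1), hence q + 1 divides m.
        ∈B*⇒power : ∀ {b} → B b → b ≢ 0# → ∃ λ i → i ℕ.< q ∸ 1 × Ω ^ (i ℕ.* suc q) ≡ b
        ∈B*⇒power {b} Bb b≢0 = conclude (Ω^-surjective b≢0)
          where
          b^q-1 : b ^ (q ∸ 1) ≡ 1#
          b^q-1 = *-cancelˡ b≢0 (trans (cong (b ^_) (sym q≡1+)) (trans Bb (sym (*-identityʳ b))))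
          conclude : (∃ λ m → m ℕ.< n × Ω ^ m ≡ b) → ∃ λ i → i ℕ.< q ∸ 1 × Ω ^ (i ℕ.* suc q) ≡ b
          conclude (m , m<n , eq) = quotient (*-cancelʳ-∣ {suc q} {m} (q ∸ 1) (subst (_∣ m ℕ.* (q ∸ 1)) n≡[q+1][q-1]
              (Ω-order (m ℕ.* (q ∸ 1)) (trans (sym (^-assocʳ Ω m (q ∸ 1))) (trans (cong (_^ (q ∸ 1)) eq) b^q-1)))))
            where
            quotient : suc q ∣ m → ∃ λ i → i ℕ.< q ∸ 1 × Ω ^ (i ℕ.* suc q) ≡ b
            quotient (divides i m≡) = i , ℕ.*-cancelʳ-< (suc q) i (q ∸ 1) (subst₂ ℕ._<_ m≡ (trans n≡[q+1][q-1] (ℕ.*-comm (suc q) (q ∸ 1))) m<n) , trans (cong (Ω ^_) (sym m≡)) eq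

        good-sound : ∀ m → T (goodᵇ ols m) → TwoPrimitive (Ω ^ m)
        good-sound m t = twoPrimitive sq quart odd
          where
          m%4 : m % 4 ≡ 2
          m%4 = ℕ.≡ᵇ⇒≡ _ 2 (proj₁ (∧-elim {m % 4 ℕ.≡ᵇ 2} t))
          nd : All (λ l → T (not (l ∣ᵇ m))) ols
          nd = all-elim (λ l → not (l ∣ᵇ m)) ols (proj₂ (∧-elim {m % 4 ℕ.≡ᵇ 2} t))
          m≡ : m ≡ 2 ℕ.* (1 ℕ.+ 2 ℕ.* (m / 4))
          m≡ = trans (m≡m%n+[m/n]*n m 4) (trans (cong (ℕ._+ (m / 4) ℕ.* 4) m%4) (lem (m / 4)))
            where
            lem : ∀ x → 2 ℕ.+ x ℕ.* 4 ≡ 2 ℕ.* (1 ℕ.+ 2 ℕ.* x)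
            lem = ℕ-solve-∀
          sq : (Ω ^ m) ^ (2 ℕ.* c₄) ≡ 1#
          sq = trans (^-assocʳ Ω m (2 ℕ.* c₄)) (n∣⇒Ω^≡1 (divides (1 ℕ.+ 2 ℕ.* (m / 4)) (trans (cong (ℕ._* (2 ℕ.* c₄)) m≡) (trans (lem (1 ℕ.+ 2 ℕ.* (m / 4)) c₄) (cong ((1 ℕ.+ 2 ℕ.* (m / 4)) ℕ.*_) (sym n≡4c))))))
            where
            lem : ∀ x c → 2 ℕ.* x ℕ.* (2 ℕ.* c) ≡ x ℕ.* (4 ℕ.* c)
            lem = ℕ-solve-∀
          quart : (Ω ^ m) ^ c₄ ≢ 1#
          quart eq = 2≢0 (trans (sym m%4) (n∣m⇒m%n≡0 m 4 (*-cancelʳ-∣ c₄ {{c₄≢0}} (subst (_∣ m ℕ.* c₄) n≡4c (Ω-order (m ℕ.* c₄) (trans (sym (^-assocʳ Ω m c₄)) eq))))))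
            where
            2≢0 : 2 ≢ 0
            2≢0 ()
            c₄≢0 : NonZero c₄
            c₄≢0 = ℕ.≢-nonZero (λ { refl → ℕ.<-irrefl (sym n≡4c) 0<n })
          odd : ∀ ℓ c → OddPrimeDivisor n ℓ → n ≡ ℓ ℕ.* c → (Ω ^ m) ^ c ≢ 1#
          odd ℓ c (pℓ , 2<ℓ , ℓ∣n) n≡ eq = contra (complete ℓ pℓ ℓ∣n)
            where
            c≢0 : NonZero c
            c≢0 = ℕ.≢-nonZero (λ { refl → ℕ.<-irrefl (sym (trans n≡ (ℕ.*-zeroʳ ℓ))) 0<n })
            ℓ∣m : ℓ ∣ m
            ℓ∣m = *-cancelʳ-∣ c {{c≢0}} (subst (_∣ m ℕ.* c) n≡ (Ω-order (m ℕ.* c) (trans (sym (^-assocʳ Ω m c)) eq)))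
            contra : ℓ ∈ 2 ∷ ols → ⊥
            contra (here refl) = ℕ.<-irrefl refl 2<ℓ
            contra (there ℓ∈)  = not-elim (All.lookup nd ℓ∈) (∣⇒∣ᵇ ℓ m {{prime⇒nonZero pℓ}} ℓ∣m)

        cover-sound : ∀ es f s → T (coverᵇ es ols f (suc q) s) → ∀ i → i ℕ.< f → ∃ λ e → e ∈ es × T (goodᵇ ols (e ℕ.+ (i ℕ.* suc q ℕ.+ s)))
        cover-sound es (suc f) s t i i<f = at i i<f (if-elim {any (λ e → goodᵇ ols (e ℕ.+ s)) es} t)
          where
          at : ∀ i → i ℕ.< suc f → T (any (λ e → goodᵇ ols (e ℕ.+ s)) es) × T (coverᵇ es ols f (suc q) (suc q ℕ.+ s)) → ∃ λ e → e ∈ es × T (goodᵇ ols (e ℕ.+ (i ℕ.* suc q ℕ.+ s)))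
          at zero    _         (t₁ , t₂) = any-elim _ es t₁
          at (suc i) (s≤s i<f) (t₁ , t₂) = let e , e∈ , g = cover-sound es f (suc q ℕ.+ s) t₂ i i<f in
            e , e∈ , subst (λ z → T (goodᵇ ols (e ℕ.+ z))) (lem (suc q) i s) g
            where
            lem : ∀ Q i s → i ℕ.* Q ℕ.+ (Q ℕ.+ s) ≡ Q ℕ.+ i ℕ.* Q ℕ.+ s
            lem = ℕ-solve-∀

        -- Write θ = a + b Ω with b = Ω ^ (i (q + 1)), and Ω ^ e = Ω + y with y in `B`. Multiplying
        -- by b gives Ω ^ (e + i (q + 1)) = b Ω + b y, which is the translate θ + (b y - a).
        translates-sound : ∀ es → T (translatesᵇ ols es) → ∀ {θ} → ¬ B θ → ∃ λ x → B x × TwoPrimitive (θ + x)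
        translates-sound es tr {θ} θ∉B = found (basis Ω∉B θ)
          where
          found : (∃ λ a → ∃ λ b → B a × B b × θ ≡ a + b * Ω) → ∃ λ x → B x × TwoPrimitive (θ + x)
          found (a , b , Ba , Bb , θ≡) = covered (∈B*⇒power Bb b≢0)
            where
            b≢0 : b ≢ 0#
            b≢0 refl = θ∉B (subst B (sym (trans θ≡ (trans (cong (a +_) (zeroˡ Ω)) (+-identityʳ a)))) Ba)
            at : ∀ i → Ω ^ (i ℕ.* suc q) ≡ b → ∀ e → e ∈ es → T (goodᵇ ols (e ℕ.+ (i ℕ.* suc q ℕ.+ 0))) → ∃ λ x → B x × TwoPrimitive (θ + x)
            covered : (∃ λ i → i ℕ.< q ∸ 1 × Ω ^ (i ℕ.* suc q) ≡ b) → ∃ λ x → B x × TwoPrimitive (θ + x)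
            covered (i , i< , pow) = let e , e∈ , g = cover-sound es (q ∸ 1) 0 (proj₂ (∧-elim {all insideᵇ es} tr)) i i< in at i pow e e∈ g
            at i pow e e∈ g = b * y + - a , B-+ (B-* Bb By) (B-neg Ba) , subst TwoPrimitive eq (good-sound (e ℕ.+ (i ℕ.* suc q ℕ.+ 0)) g)
             where
             z : A²
             z = ω^ e
             z₂≡1 : ⟦ proj₂ z ⟧ ≡ ⟦ one ⟧
             z₂≡1 = ⟦eq⟧ _ one (All.lookup (all-elim insideᵇ es (proj₁ (∧-elim {all insideᵇ es} tr))) e∈)
             y : K
             y = ⟦ proj₁ z ⟧ + - ⟦ u ⟧
             By : B y
             By = B-+ (⟦⟧∈B _) (B-neg (⟦⟧∈B u))
             Ω+y : Ω + y ≡ Ω ^ e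
             Ω+y = begin
               ⟦ u ⟧ + ⟦ one ⟧ * σ + (⟦ proj₁ z ⟧ + - ⟦ u ⟧) ≡⟨ solve 4 (λ u s z m → u :+ s :+ (z :+ m) := z :+ s :+ (u :+ m)) refl ⟦ u ⟧ (⟦ one ⟧ * σ) ⟦ proj₁ z ⟧ (- ⟦ u ⟧) ⟩
               ⟦ proj₁ z ⟧ + ⟦ one ⟧ * σ + (⟦ u ⟧ + - ⟦ u ⟧) ≡⟨ trans (cong (⟦ proj₁ z ⟧ + ⟦ one ⟧ * σ +_) (-‿inverseʳ ⟦ u ⟧)) (+-identityʳ _) ⟩
               ⟦ proj₁ z ⟧ + ⟦ one ⟧ * σ ≡⟨ cong (λ w → ⟦ proj₁ z ⟧ + w * σ) (sym z₂≡1) ⟩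
               ⟦ z ⟧² ≡⟨ ω^-sound e ⟩
               Ω ^ e ∎
             eq : Ω ^ (e ℕ.+ (i ℕ.* suc q ℕ.+ 0)) ≡ θ + (b * y + - a)
             eq = begin
               Ω ^ (e ℕ.+ (i ℕ.* suc q ℕ.+ 0)) ≡⟨ trans (^-homo-* Ω e (i ℕ.* suc q ℕ.+ 0)) (cong₂ _*_ (sym Ω+y) (trans (cong (Ω ^_) (ℕ.+-identityʳ (i ℕ.* suc q))) pow)) ⟩
               (Ω + y) * b ≡⟨ solve 3 (λ Ω y b → (Ω :+ y) :* b := b :* Ω :+ b :* y) refl Ω y b ⟩
               b * Ω + b * y ≡⟨ sym (trans (cong (λ w → b * Ω + b * y + w) (-‿inverseʳ a)) (+-identityʳ _)) ⟩
               b * Ω + b * y + (a + - a) ≡⟨ solve 4 (λ s t a m → s :+ t :+ (a :+ m) := a :+ s :+ (t :+ m)) refl (b * Ω) (b * y) a (- a) ⟩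
               a + b * Ω + (b * y + - a) ≡⟨ cong (_+ (b * y + - a)) (sym θ≡) ⟩
               θ + (b * y + - a) ∎

-- Interpreting ℤ/p and ℤ/p [α] in the given field.

module BaseFieldModels where

  open FiniteFields
  open IntegerSums using (𝟙; #; sum-one; sum-mono-≤; ∑-distrib-+)
  open FrobeniusMap
  open QuadraticExtensions
  open TwoPrimitiveElements
  open SieveCriterion using (∧-elim)
  open Certificates
  open Soundness
  open import Data.Bool.Base using (T)
  open import Data.Fin.Properties using (_≟_; any?)
  import Data.Integer.Base as ℤ
  import Data.Integer.Properties as ℤ
  open import Data.List.Base as List using (List; []; _∷_; _++_; length; replicate)
  open import Data.List.Properties using (length-map)
  open import Data.Nat.Base as ℕ using (ℕ; zero; suc; _∸_; NonZero)
  import Data.Nat.Properties as ℕ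
  open import Data.Vec.Base as Vec using (Vec; []; _∷_)
  import Algebra.Properties.Semiring.Mult as Mult

  module Interpretations {n : ℕ} (𝔽 : FiniteField n) {p : ℕ} (pp : Prime p) (k : ℕ)
    (1<q : 1 ℕ.< p ℕ.^ k) (N≡ : suc n ≡ (p ℕ.^ k) ℕ.* (p ℕ.^ k)) (c₄ : ℕ) (n≡4c : n ≡ 4 ℕ.* c₄) (h : ℕ) (q+1≡2h : suc (p ℕ.^ k) ≡ 2 ℕ.* h) where
    open FieldTheory 𝔽
    open OrderTheory 𝔽
    open Frobenius 𝔽 pp k N≡
    open Quadratic 𝔽 pp k 1<q N≡
    open PrimitiveTheory 𝔽 pp k 1<q N≡ c₄ n≡4c
    open Models 𝔽 pp k 1<q N≡ c₄ n≡4c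
    open Mult semiring using (×1-homo-*; ×-homo-+; ×-homo-1) renaming (_×_ to _⨯_)
    open ≡-Reasoning

    instance
      p≢0 : NonZero p
      p≢0 = prime⇒nonZero pp

    -- If b were not a square, the n units would have fewer than n / 2 squares.
    sqrt : ∀ {b} → B b → ∃ λ σ → σ * σ ≡ b
    sqrt {b} Bb with any? (λ s → s * s ≟ b)
    ... | yes found = found
    ... | no ¬found = ⊥-elim (ℕ.<⇒≱ less (ℤ.drop‿+≤+ (subst (ℤ.+ n ℤ.≤_) (sym (ℤ.pos-* 2 m)) (ℤ.≤-trans (#-≥-fibres 2 P? squares) (ℤ.*-monoˡ-≤-nonNeg (ℤ.+ 2) #P≤)))))
      where
      m : ℕ
      m = 2 ℕ.* c₄ ∸ 1
      b≢0 : b ≢ 0#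
      b≢0 refl = ¬found (0# , zeroˡ 0#)
      n≡2·2c : n ≡ 2 ℕ.* (2 ℕ.* c₄)
      n≡2·2c = trans n≡4c (ℕ.*-assoc 2 2 c₄)
      -- As q + 1 is even, n / 2 is a multiple of q - 1, so b is among the at most n / 2 solutions
      -- of y ^ (n / 2) = 1. If b is not a square, all squares of units lie among the others.
      2c≡ : 2 ℕ.* c₄ ≡ h ℕ.* (q ∸ 1)
      2c≡ = ℕ.*-cancelˡ-≡ _ _ 2 (trans (sym n≡2·2c) (trans n≡[q+1][q-1] (trans (cong (ℕ._* (q ∸ 1)) q+1≡2h) (ℕ.*-assoc 2 h (q ∸ 1)))))
      2c≢0 : NonZero (2 ℕ.* c₄)
      2c≢0 = ℕ.≢-nonZero (λ eq → ℕ.<-irrefl (sym (trans n≡2·2c (cong (2 ℕ.*_) eq))) 0<n)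
      b^ : b ^ (2 ℕ.* c₄) ≡ 1#
      b^ = trans (cong (b ^_) 2c≡) (^-*≡1 (q ∸ 1) h (*-cancelˡ b≢0 (trans (cong (b ^_) (sym q≡1+)) (trans Bb (sym (*-identityʳ b))))))
      P? : ∀ y → Dec (y ^ (2 ℕ.* c₄) ≡ 1# × y ≢ b)
      P? y = (y ^ (2 ℕ.* c₄) ≟ 1#) ×-dec ¬? (y ≟ b)
      squares : ∀ x → x ≢ 0# → (x ^ 2) ^ (2 ℕ.* c₄) ≡ 1# × x ^ 2 ≢ b
      squares x x≢0 = trans (^-assocʳ x 2 (2 ℕ.* c₄)) (trans (cong (x ^_) (sym n≡2·2c)) (lagrange x≢0)) ,
        λ eq → ¬found (x , trans (cong (x *_) (sym (*-identityʳ x))) eq)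
      split : ∀ y → 𝟙 (P? y) ℤ.+ 𝟙 (y ≟ b) ℤ.≤ 𝟙 (y ^ (2 ℕ.* c₄) ≟ 1#)
      split y = cases (y ^ (2 ℕ.* c₄) ≟ 1#) (y ≟ b)
        where
        cases : (d : Dec (y ^ (2 ℕ.* c₄) ≡ 1#)) (e : Dec (y ≡ b)) → 𝟙 (d ×-dec ¬? e) ℤ.+ 𝟙 e ℤ.≤ 𝟙 d
        cases (yes _) (yes _) = ℤ.≤-refl
        cases (yes _) (no _)  = ℤ.≤-refl
        cases (no ne) (yes refl) = ⊥-elim (ne b^)
        cases (no _)  (no _)  = ℤ.≤-refl
      #P+1 : # P? ℤ.+ ℤ.1ℤ ℤ.≤ ℤ.+ (2 ℕ.* c₄)
      #P+1 = ℤ.≤-trans (ℤ.≤-reflexive (trans (cong (λ z → # P? ℤ.+ z) (sym (sum-one (_≡ b) (_≟ b) b refl (λ _ e → e)))) (sym (∑-distrib-+ (λ y → 𝟙 (P? y)) (λ y → 𝟙 (y ≟ b))))))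
        (ℤ.≤-trans (sum-mono-≤ split) (#-^≡-≤ (2 ℕ.* c₄) 1# {{2c≢0}}))
      #P≤ : # P? ℤ.≤ ℤ.+ m
      #P≤ = subst (ℤ._≤ ℤ.+ m) (cancel (# P?)) (ℤ.≤-trans (ℤ.+-monoˡ-≤ (ℤ.- ℤ.1ℤ) #P+1) (ℤ.≤-reflexive (pred (2 ℕ.* c₄) {{2c≢0}})))
        where
        cancel : ∀ x → x ℤ.+ ℤ.1ℤ ℤ.+ ℤ.- ℤ.1ℤ ≡ x
        cancel x = trans (ℤ.+-assoc x ℤ.1ℤ (ℤ.- ℤ.1ℤ)) (ℤ.+-identityʳ x)
        pred : ∀ j .{{_ : NonZero j}} → ℤ.+ j ℤ.+ ℤ.- ℤ.1ℤ ≡ ℤ.+ (j ∸ 1)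
        pred (suc j) = refl
      less : 2 ℕ.* m ℕ.< n
      less = ℕ.<-≤-trans (ℕ.*-monoʳ-< 2 (ℕ.≤-reflexive (ℕ.suc-pred (2 ℕ.* c₄) {{2c≢0}}))) (ℕ.≤-reflexive (sym n≡2·2c))

    ι : ℕ → K
    ι a = a ⨯ 1#

    ι-+ : ∀ a b → ι (a ℕ.+ b) ≡ ι a + ι b
    ι-+ = ×-homo-+ 1#

    ι-* : ∀ a b → ι (a ℕ.* b) ≡ ι a * ι b
    ι-* = ×1-homo-*

    ι-1 : ι 1 ≡ 1#
    ι-1 = ×-homo-1 1#

    ι-% : ∀ a → ι (a % p) ≡ ι a
    ι-% a = sym (trans (cong ι (m≡m%n+[m/n]*n a p)) (trans (ι-+ (a % p) _) (trans (cong (ι (a % p) +_) (trans (ι-* (a / p) p) (trans (cong (ι (a / p) *_) char) (zeroʳ _)))) (+-identityʳ _))))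

    ι-negOne : ι (p ∸ 1) ≡ - 1#
    ι-negOne = +-cancelʳ 1# (trans (trans (cong (ι (p ∸ 1) +_) (sym ι-1)) (trans (sym (ι-+ (p ∸ 1) 1)) (trans (cong ι (ℕ.m∸n+n≡m (ℕ.<⇒≤ (1<prime pp)))) char))) (sym (-‿inverseˡ 1#)))

    B-ι : ∀ a → B (ι a)
    B-ι zero    = B-0
    B-ι (suc a) = B-+ B-1 (B-ι a)

    primeInterpretation : Interpretation (primeOps p)
    primeInterpretation = record
      { ⟦_⟧ = ι ; ⟦one⟧ = ι-1 ; ⟦negOne⟧ = ι-negOne
      ; ⟦add⟧ = λ a b → trans (ι-% (a ℕ.+ b)) (ι-+ a b)
      ; ⟦mul⟧ = λ a b → trans (ι-% (a ℕ.* b)) (ι-* a b)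
      ; ⟦eq⟧ = λ a b t → cong ι (ℕ.≡ᵇ⇒≡ a b t) ; ⟦⟧∈B = B-ι }

    evalV : K → ∀ {j} → Vec ℕ j → K
    evalV α []       = 0#
    evalV α (c ∷ cs) = ι c + α * evalV α cs

    B-evalV : ∀ {α} → B α → ∀ {j} (v : Vec ℕ j) → B (evalV α v)
    B-evalV Bα []       = B-0
    B-evalV Bα (c ∷ cs) = B-+ (B-ι c) (B-* Bα (B-evalV Bα cs))

    evalV-0 : ∀ α j → evalV α (Vec.replicate j 0) ≡ 0#
    evalV-0 α zero    = refl
    evalV-0 α (suc j) = trans (+-identityˡ _) (trans (cong (α *_) (evalV-0 α j)) (zeroʳ α))

    module _ {d : ℕ} (g : Vec ℕ (suc d)) {α : K} (Bα : B α) (α^k : α ^ suc d ≡ evalV α g) where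
      open Power p g
      private
        ⟪_⟫ : ∀ {j} → Vec ℕ j → K
        ⟪ v ⟫ = evalV α v

      ⟪addV⟫ : ∀ {j} (v w : Vec ℕ j) → ⟪ addV v w ⟫ ≡ ⟪ v ⟫ + ⟪ w ⟫
      ⟪addV⟫ []       []       = sym (+-identityʳ 0#)
      ⟪addV⟫ (x ∷ xs) (y ∷ ys) = trans (cong₂ (λ a b → a + α * b) (trans (ι-% (x ℕ.+ y)) (ι-+ x y)) (⟪addV⟫ xs ys))
        (solve 5 (λ x y a v w → x :+ y :+ a :* (v :+ w) := x :+ a :* v :+ (y :+ a :* w)) refl (ι x) (ι y) α ⟪ xs ⟫ ⟪ ys ⟫)

      ⟪scaleV⟫ : ∀ {j} c (v : Vec ℕ j) → ⟪ scaleV c v ⟫ ≡ ι c * ⟪ v ⟫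
      ⟪scaleV⟫ c []       = sym (zeroʳ (ι c))
      ⟪scaleV⟫ c (x ∷ xs) = trans (cong₂ (λ a b → a + α * b) (trans (ι-% (c ℕ.* x)) (ι-* c x)) (⟪scaleV⟫ c xs))
        (solve 4 (λ c x a v → c :* x :+ a :* (c :* v) := c :* (x :+ a :* v)) refl (ι c) (ι x) α ⟪ xs ⟫)

      ⟪rotate⟫ : ∀ {j} c (w : Vec ℕ j) → ⟪ proj₁ (rotate c w) ⟫ + α ^ j * ι (proj₂ (rotate c w)) ≡ ι c + α * ⟪ w ⟫
      ⟪rotate⟫ c []       = trans (+-identityˡ _) (trans (*-identityˡ _) (sym (trans (cong (ι c +_) (zeroʳ α)) (+-identityʳ _))))
      ⟪rotate⟫ {suc j} c (x ∷ xs) = trans (solve 5 (λ c a y aj t → c :+ a :* y :+ a :* aj :* t := c :+ a :* (y :+ aj :* t)) refl (ι c) α ⟪ proj₁ (rotate x xs) ⟫ (α ^ j) (ι (proj₂ (rotate x xs))))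
        (cong (λ z → ι c + α * z) (⟪rotate⟫ x xs))

      ⟪mulα⟫ : ∀ w → ⟪ mulα w ⟫ ≡ α * ⟪ w ⟫
      ⟪mulα⟫ w = begin
        ⟪ mulα w ⟫ ≡⟨ trans (⟪addV⟫ (proj₁ (rotate 0 w)) (scaleV (proj₂ (rotate 0 w)) g)) (cong (⟪ proj₁ (rotate 0 w) ⟫ +_) (trans (⟪scaleV⟫ (proj₂ (rotate 0 w)) g) (trans (*-comm _ _) (cong (_* ι (proj₂ (rotate 0 w))) (sym α^k))))) ⟩
        ⟪ proj₁ (rotate 0 w) ⟫ + α ^ suc d * ι (proj₂ (rotate 0 w)) ≡⟨ ⟪rotate⟫ 0 w ⟩
        0# + α * ⟪ w ⟫ ≡⟨ +-identityˡ _ ⟩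
        α * ⟪ w ⟫ ∎

      ⟪mulV⟫ : ∀ {j} (v : Vec ℕ j) w → ⟪ mulV v w ⟫ ≡ ⟪ v ⟫ * ⟪ w ⟫
      ⟪mulV⟫ []       w = trans (evalV-0 α (suc d)) (sym (zeroˡ _))
      ⟪mulV⟫ (c ∷ cs) w = trans (⟪addV⟫ (scaleV c w) (mulα (mulV cs w))) (trans (cong₂ _+_ (⟪scaleV⟫ c w) (trans (⟪mulα⟫ (mulV cs w)) (cong (α *_) (⟪mulV⟫ cs w))))
        (solve 4 (λ c w a v → c :* w :+ a :* (v :* w) := (c :+ a :* v) :* w) refl (ι c) ⟪ w ⟫ α ⟪ cs ⟫))

      ⟪eqV⟫ : ∀ {j} (v w : Vec ℕ j) → T (eqV v w) → ⟪ v ⟫ ≡ ⟪ w ⟫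
      ⟪eqV⟫ []       []       t = refl
      ⟪eqV⟫ (x ∷ xs) (y ∷ ys) t = cong₂ (λ a b → ι a + α * b) (ℕ.≡ᵇ⇒≡ x y (proj₁ (∧-elim {x ℕ.≡ᵇ y} t))) (⟪eqV⟫ xs ys (proj₂ (∧-elim {x ℕ.≡ᵇ y} t)))

      ⟪constV⟫ : ∀ c → ⟪ constV c (suc d) ⟫ ≡ ι c
      ⟪constV⟫ c = trans (cong (λ z → ι c + α * z) (evalV-0 α d)) (trans (cong (ι c +_) (zeroʳ α)) (+-identityʳ _))

      powerInterpretation : Interpretation powerOps
      powerInterpretation = record
        { ⟦_⟧ = evalV α ; ⟦one⟧ = trans (⟪constV⟫ 1) ι-1 ; ⟦negOne⟧ = trans (⟪constV⟫ (p ∸ 1)) ι-negOne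
        ; ⟦add⟧ = ⟪addV⟫ ; ⟦mul⟧ = ⟪mulV⟫ ; ⟦eq⟧ = ⟪eqV⟫ ; ⟦⟧∈B = B-evalV Bα }

    module _ where
      open Cofactor p

      evalP : K → List ℕ → K
      evalP a cs = eval (List.map ι cs) a

      evalP-addP : ∀ a f g → evalP a (addP f g) ≡ evalP a f + evalP a g
      evalP-addP a []       g        = sym (+-identityˡ _)
      evalP-addP a (x ∷ xs) []       = sym (+-identityʳ _)
      evalP-addP a (x ∷ xs) (y ∷ ys) = trans (cong₂ (λ u v → u + a * v) (ι-+ x y) (evalP-addP a xs ys))
        (solve 5 (λ x y a v w → x :+ y :+ a :* (v :+ w) := x :+ a :* v :+ (y :+ a :* w)) refl (ι x) (ι y) a (evalP a xs) (evalP a ys))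

      evalP-scale : ∀ a c f → evalP a (List.map (c ℕ.*_) f) ≡ ι c * evalP a f
      evalP-scale a c []       = sym (zeroʳ _)
      evalP-scale a c (x ∷ xs) = trans (cong₂ (λ u v → u + a * v) (ι-* c x) (evalP-scale a c xs))
        (solve 4 (λ c x a v → c :* x :+ a :* (c :* v) := c :* (x :+ a :* v)) refl (ι c) (ι x) a (evalP a xs))

      evalP-mulP : ∀ a f g → evalP a (mulP f g) ≡ evalP a f * evalP a g
      evalP-mulP a []       g = sym (zeroˡ _)
      evalP-mulP a (x ∷ xs) g = trans (evalP-addP a (List.map (x ℕ.*_) g) (0 ∷ mulP xs g))
        (trans (cong₂ _+_ (evalP-scale a x g) (trans (+-identityˡ _) (cong (a *_) (evalP-mulP a xs g))))
          (solve 4 (λ x g a v → x :* g :+ a :* (v :* g) := (x :+ a :* v) :* g) refl (ι x) (evalP a g) a (evalP a xs)))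

      evalP-congruent : ∀ a f g → T (congruentᵇ f g) → evalP a f ≡ evalP a g
      evalP-congruent a []       []       t = refl
      evalP-congruent a (x ∷ xs) (y ∷ ys) t = cong₂ (λ u v → u + a * v)
        (trans (sym (ι-% x)) (trans (cong ι (ℕ.≡ᵇ⇒≡ (x % p) (y % p) (proj₁ (∧-elim {x % p ℕ.≡ᵇ y % p} t)))) (ι-% y))) (evalP-congruent a xs ys (proj₂ (∧-elim {x % p ℕ.≡ᵇ y % p} t)))

      evalP-modulus : ∀ a {j} (g : Vec ℕ j) → evalP a (modulus g) ≡ a ^ j + - 1# * evalV a g
      evalP-modulus a []       = trans (cong₂ _+_ ι-1 (zeroʳ a)) (cong (1# +_) (sym (zeroʳ _)))
      evalP-modulus a {suc j} (c ∷ cs) = trans (cong₂ (λ u v → u + a * v) (trans (ι-* (p ∸ 1) c) (cong (_* ι c) ι-negOne)) (evalP-modulus a cs))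
        (solve 5 (λ m c a aj v → m :* c :+ a :* (aj :+ m :* v) := a :* aj :+ m :* (c :+ a :* v)) refl (- 1#) (ι c) a (a ^ j) (evalV a cs))

      evalP-X^ : ∀ a j → evalP a (replicate j 0 ++ 1 ∷ []) ≡ a ^ j
      evalP-X^ a zero    = trans (cong₂ _+_ ι-1 (zeroʳ a)) (+-identityʳ _)
      evalP-X^ a (suc j) = trans (+-identityˡ _) (cong (a *_) (evalP-X^ a j))

      evalP-target : ∀ a → evalP a (0 ∷ p ∸ 1 ∷ replicate (q ∸ 2) 0 ++ 1 ∷ []) ≡ - a + a ^ q
      evalP-target a = begin
        0# + a * (ι (p ∸ 1) + a * evalP a (replicate (q ∸ 2) 0 ++ 1 ∷ [])) ≡⟨ trans (+-identityˡ _) (cong₂ (λ u v → a * (u + a * v)) ι-negOne (evalP-X^ a (q ∸ 2))) ⟩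
        a * (- 1# + a * a ^ (q ∸ 2)) ≡⟨ distribˡ a _ _ ⟩
        a * - 1# + a ^ (2 ℕ.+ (q ∸ 2)) ≡⟨ cong₂ _+_ (trans (sym (-‿distribʳ-* a 1#)) (cong -_ (*-identityʳ a))) (cong (a ^_) (ℕ.m+[n∸m]≡n 1<q)) ⟩
        - a + a ^ q ∎

      target : List ℕ
      target = 0 ∷ p ∸ 1 ∷ replicate (q ∸ 2) 0 ++ 1 ∷ []

      factor : ∀ {j} (g : Vec ℕ j) hs → T (splitsᵇ g q hs) → ∀ a → evalP a (modulus g) * evalP a hs ≡ - a + a ^ q
      factor g hs t a = trans (sym (evalP-mulP a (modulus g) hs))
        (trans (evalP-congruent a (mulP (modulus g) hs) target (proj₁ (∧-elim {congruentᵇ (mulP (modulus g) hs) target} t))) (evalP-target a))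

      -- A factor of X^q - X of degree k has a root, since its cofactor is too short to vanish on the q elements of B.
      root : ∀ {j} (g : Vec ℕ j) hs → T (splitsᵇ g q hs) → ∀ {θ} → ¬ B θ → ∃ λ α → B α × α ^ j ≡ evalV α g
      root g hs t {θ} θ∉B with any? (λ a → evalP a (modulus g) ≟ 0#)
      ... | yes (α , eq) = α , +-cancelˡ (- α) (trans (sym (factor g hs t α)) (trans (cong (_* evalP α hs) eq) (trans (zeroˡ _) (sym (-‿inverseˡ α))))) ,
              +-cancelʳ (- 1# * evalV α g) (trans (sym (evalP-modulus α g)) (trans eq (sym (trans (cong (evalV α g +_) (trans (sym (-‿distribˡ-* 1# _)) (cong -_ (*-identityˡ _)))) (-‿inverseʳ _)))))
      ... | no ¬root = ⊥-elim (contra (evalP θ hs ≟ 0#))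
        where
        short : length (List.map ι hs) ℕ.≤ q
        short = ℕ.≤-trans (ℕ.≤-reflexive (length-map ι hs)) (ℕ.≤ᵇ⇒≤ (length hs) q (proj₂ (∧-elim {congruentᵇ (mulP (modulus g) hs) target} t)))
        vanish : ∀ a → B a → evalP a hs ≡ 0#
        vanish a Ba = *-cancelˡ (λ eq → ¬root (a , eq)) (trans (factor g hs t a) (trans (cong (- a +_) Ba) (trans (-‿inverseˡ a) (sym (zeroʳ _)))))
        -- θ lies outside `B`, so it is no root of X ^ q - X and hence none of the cofactor. It is
        -- the point that shows the cofactor to be a nonzero polynomial.
        contra : Dec (evalP θ hs ≡ 0#) → ⊥
        contra (yes eq) = θ∉B (+-cancelˡ (- θ) (trans (sym (factor g hs t θ)) (trans (cong (evalP θ (modulus g) *_) eq) (trans (zeroʳ _) (sym (-‿inverseˡ θ))))))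
        contra (no ne)  = ℤ.<⇒≱ (subst (ℤ._< ℤ.+ length (List.map ι hs)) #B (#-roots< (List.map ι hs) B? vanish θ ne)) (ℤ.+≤+ short)

-- A translate set without 2-primitive elements.

module FieldOf41Squared where

  open FiniteFields
  open QuadraticExtensions
  open TwoPrimitiveElements
  open SieveCriterion using (∧-elim; ∨-elim)
  open Certificates
  open Soundness
  open import Data.Bool.Base using (Bool; true; false; T; _∧_; _∨_; not)
  open import Data.Bool.ListAction using (all)
  open import Data.List.Base using (List; []; _∷_)
  open import Data.Nat.Base as ℕ using (ℕ; zero; suc; s≤s; NonZero)
  import Data.Nat.Properties as ℕ
  open import Data.Nat.Divisibility using (_∣_; divides; *-cancelʳ-∣; ∣m+n∣m⇒∣n; n∣m*n; ∣⇒≤; ∣-trans; m%n≡0⇒n∣m; *-monoˡ-∣)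
  open import Data.Nat.Tactic.RingSolver using (solve-∀)

  ∧-intro : ∀ {a b} → T a → T b → T (a ∧ b)
  ∧-intro {true} {true} _ _ = tt

  not-intro : ∀ {b} → ¬ T b → T (not b)
  not-intro {true}  ¬t = ¬t tt
  not-intro {false} ¬t = tt

  all-intro : ∀ {A : Set} (P : A → Bool) {xs} → All (λ x → T (P x)) xs → T (all P xs)
  all-intro P []       = tt
  all-intro P (t ∷ ts) = ∧-intro t (all-intro P ts)

  module Exceptional {n : ℕ} (𝔽 : FiniteField n) {p : ℕ} (pp : Prime p) (k : ℕ)
    (1<q : 1 ℕ.< p ℕ.^ k) (N≡ : suc n ≡ (p ℕ.^ k) ℕ.* (p ℕ.^ k)) (c₄ : ℕ) (n≡4c : n ≡ 4 ℕ.* c₄)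
    (fuel : ℕ) (O : Ops) (I : Models.Interpretation 𝔽 pp k 1<q N≡ c₄ n≡4c O) (δ u : Ops.A O) (σ : FieldTheory.K 𝔽)
    (σσ≡δ : FieldTheory._*_ 𝔽 σ σ ≡ Models.Interpretation.⟦_⟧ I δ) (ols : List ℕ) (v : Ops.A O)
    (t : T (Extension.exceptionalᵇ fuel O (p ℕ.^ k) δ u ols v)) where
    open FieldTheory 𝔽
    open OrderTheory 𝔽
    open Quadratic 𝔽 pp k 1<q N≡
    open PrimitiveTheory 𝔽 pp k 1<q N≡ c₄ n≡4c
    open Models 𝔽 pp k 1<q N≡ c₄ n≡4c
    open Ops O
    open Interpretation I
    open Sound fuel O I δ u σ σσ≡δ
    open Extension fuel O q δ u
    open Primitive ols (proj₁ (∧-elim {primitiveᵇ ols} t))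
    open ≡-Reasoning

    private
      rest : T (unitᵇ v ∧ avoidsᵇ ols v #units 0 one²)
      rest = proj₂ (∧-elim {primitiveᵇ ols} t)

      0<c₄ : 0 ℕ.< c₄
      0<c₄ = ℕ.n≢0⇒n>0 (λ { refl → ℕ.<-irrefl (sym n≡4c) 0<n })

      c₄<2c₄ : c₄ ℕ.< 2 ℕ.* c₄
      c₄<2c₄ = ℕ.m<m+n c₄ (ℕ.<-≤-trans 0<c₄ (ℕ.≤-reflexive (sym (ℕ.+-identityʳ c₄))))

    σ∉B : ¬ B σ
    σ∉B Bσ = Ω∉B (B-+ (⟦⟧∈B u) (B-* (⟦⟧∈B one) Bσ))

    -- A pure multiple of σ: its translates are exactly the elements with σ-coordinate v, which is
    -- the coordinate that `avoidsᵇ` inspects.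
    θ₀ : K
    θ₀ = ⟦ v ⟧ * σ

    θ₀∉B : ¬ B θ₀
    θ₀∉B Bθ = unit-sound v (proj₁ (∧-elim {unitᵇ v} rest)) (Translates.linear σ∉B (⟦⟧∈B v) B-0 (subst B (sym (+-identityʳ θ₀)) Bθ))

    -- Converse of `good-sound`. From n ∣ m (n / 2) it follows that m is even; 4 ∣ m would bring the
    -- order down to a divisor of n / 4, and an odd prime l ∣ m to one of n / (2 l).
    twoPrimitive⇒good : ∀ m → TwoPrimitive (Ω ^ m) → T (goodᵇ ols m)
    twoPrimitive⇒good m (d^2c , minimal) = ∧-intro (ℕ.≡⇒≡ᵇ (m % 4) 2 m%4) (all-intro (λ l → not (l ∣ᵇ m)) (All.map (λ {l} ok → not-intro (λ l∣ → l∤m l ok (∣ᵇ⇒∣ l m l∣))) ols-ok))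
      where
      ≡1⇒∣ : ∀ j → (Ω ^ m) ^ j ≡ 1# → n ∣ m ℕ.* j
      ≡1⇒∣ j eq = Ω-order (m ℕ.* j) (trans (sym (^-assocʳ Ω m j)) eq)
      ∣⇒≡1 : ∀ j → n ∣ m ℕ.* j → (Ω ^ m) ^ j ≡ 1#
      ∣⇒≡1 j d = trans (^-assocʳ Ω m j) (n∣⇒Ω^≡1 d)
      2∣m : 2 ∣ m
      2∣m = *-cancelʳ-∣ {2} {m} (2 ℕ.* c₄) {{ℕ.>-nonZero (ℕ.<-trans 0<c₄ c₄<2c₄)}} (subst (_∣ m ℕ.* (2 ℕ.* c₄)) (trans n≡4c (ℕ.*-assoc 2 2 c₄)) (≡1⇒∣ (2 ℕ.* c₄) d^2c))
      m≡ : m ≡ m / 4 ℕ.* 4 ℕ.+ m % 4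
      m≡ = trans (m≡m%n+[m/n]*n m 4) (ℕ.+-comm (m % 4) _)
      2∣m%4 : 2 ∣ m % 4
      2∣m%4 = ∣m+n∣m⇒∣n (subst (2 ∣_) m≡ 2∣m) (∣-trans (divides 2 refl) (n∣m*n (m / 4)))
      m%4 : m % 4 ≡ 2
      m%4 = cases (m % 4) (m%n<n m 4) 2∣m%4 refl
        where
        cases : ∀ r → r ℕ.< 4 → 2 ∣ r → m % 4 ≡ r → m % 4 ≡ 2
        cases 0 _ _ eq = ⊥-elim (minimal c₄ 0<c₄ c₄<2c₄ (∣⇒≡1 c₄ (subst (_∣ m ℕ.* c₄) (sym n≡4c) (*-monoˡ-∣ c₄ (m%n≡0⇒n∣m m 4 eq)))))
        cases 1 _ (divides (suc _) ()) eq
        cases 2 _ _ eq = eq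
        cases 3 _ (divides (suc (suc _)) ()) eq
        cases (suc (suc (suc (suc _)))) (s≤s (s≤s (s≤s (s≤s ())))) _ eq
      l∤m : ∀ l → OddPrimeDivisor n l → ¬ (l ∣ m)
      l∤m l (pl , 2<l , l∣n) l∣m = conclude l∣c₄ l∣x 2∣m
        where
        l∤2 : ¬ (l ∣ 2)
        l∤2 d = ℕ.<⇒≱ 2<l (∣⇒≤ d)
        strip2 : ∀ x → l ∣ 2 ℕ.* x → l ∣ x
        strip2 x d = [ (λ d → ⊥-elim (l∤2 d)) , id ]′ (euclidsLemma 2 x pl d)
        l∣c₄ : l ∣ c₄
        l∣c₄ = strip2 c₄ (strip2 (2 ℕ.* c₄) (subst (l ∣_) (trans n≡4c (ℕ.*-assoc 2 2 c₄)) l∣n))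
        l∣x : ∀ x → m ≡ x ℕ.* 2 → l ∣ x
        l∣x x eq = strip2 x (subst (l ∣_) (trans eq (ℕ.*-comm x 2)) l∣m)
        conclude : l ∣ c₄ → (∀ x → m ≡ x ℕ.* 2 → l ∣ x) → 2 ∣ m → ⊥
        conclude (divides c′ c₄≡) l∣x (divides x m≡2x) = finish (l∣x x m≡2x)
          where
          c′≢0 : NonZero c′
          c′≢0 = ℕ.≢-nonZero (λ { refl → ℕ.<-irrefl (sym c₄≡) 0<c₄ })
          finish : l ∣ x → ⊥
          finish (divides y x≡) = minimal (2 ℕ.* c′) (ℕ.>-nonZero⁻¹ (2 ℕ.* c′) {{ℕ.m*n≢0 2 c′ {{_}} {{c′≢0}}}})
            (ℕ.*-monoʳ-< 2 (ℕ.<-≤-trans (ℕ.m<m*n c′ l {{c′≢0}} (1<prime pl)) (ℕ.≤-reflexive (sym c₄≡))))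
            (∣⇒≡1 (2 ℕ.* c′) (divides y (trans (cong (ℕ._* (2 ℕ.* c′)) (trans m≡2x (cong (ℕ._* 2) x≡))) (trans (lem y l c′) (cong (y ℕ.*_) (sym (trans n≡4c (cong (4 ℕ.*_) c₄≡))))))))
            where
            lem : ∀ y l c → y ℕ.* l ℕ.* 2 ℕ.* (2 ℕ.* c) ≡ y ℕ.* (4 ℕ.* (c ℕ.* l))
            lem = solve-∀

    avoids-sound : ∀ f m z → ⟦ z ⟧² ≡ Ω ^ m → T (avoidsᵇ ols v f m z) → ∀ j → j ℕ.< f → T (goodᵇ ols (m ℕ.+ j)) →
      ∃ λ a → ∃ λ b → Ω ^ (m ℕ.+ j) ≡ ⟦ a ⟧ + ⟦ b ⟧ * σ × ⟦ b ⟧ + - 1# * ⟦ v ⟧ ≢ 0#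
    avoids-sound (suc f) m z z≡ av zero _ g = proj₁ z , proj₂ z , trans (cong (Ω ^_) (ℕ.+-identityʳ m)) (sym z≡) ,
        λ eq → unit-sound (add (proj₂ z) (mul negOne v)) unit (trans (trans (⟦add⟧ _ _) (cong (⟦ proj₂ z ⟧ +_) (trans (⟦mul⟧ negOne v) (cong (_* ⟦ v ⟧) ⟦negOne⟧)))) eq)
      where
      unit : T (unitᵇ (add (proj₂ z) (mul negOne v)))
      unit = [ (λ n → ⊥-elim (not-elim n (subst (λ x → T (goodᵇ ols x)) (ℕ.+-identityʳ m) g))) , id ]′
        (∨-elim {not (goodᵇ ols m)} (proj₁ (∧-elim {not (goodᵇ ols m) ∨ unitᵇ (add (proj₂ z) (mul negOne v))} av)))
    avoids-sound (suc f) m z z≡ av (suc j) (s≤s j<f) g = subst (λ x → ∃ λ a → ∃ λ b → Ω ^ x ≡ ⟦ a ⟧ + ⟦ b ⟧ * σ × ⟦ b ⟧ + - 1# * ⟦ v ⟧ ≢ 0#) (sym (ℕ.+-suc m j))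
      (avoids-sound f (suc m) (mul² ω z) (trans (mul²-sound ω z) (cong (Ω *_) z≡)) (proj₂ (∧-elim {not (goodᵇ ols m) ∨ unitᵇ (add (proj₂ z) (mul negOne v))} av)) j j<f
        (subst (λ x → T (goodᵇ ols x)) (ℕ.+-suc m j) g))

    -- A 2-primitive translate would be a power Ω ^ m with a good exponent m, and the exhaustive run
    -- over all exponents shows that no such power has σ-coordinate v.
    no-translate : ∀ x → B x → ¬ TwoPrimitive (θ₀ + x)
    no-translate x Bx tp = go (Ω^-surjective d≢0)
      where
      d : K
      d = θ₀ + x
      d≢0 : d ≢ 0#
      d≢0 eq = 1≢0 (trans (sym (proj₁ tp)) (trans (cong (_^ (2 ℕ.* c₄)) eq) (0^ (2 ℕ.* c₄) {{ℕ.>-nonZero (ℕ.<-trans 0<c₄ c₄<2c₄)}})))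
        where
        0^ : ∀ m .{{_ : NonZero m}} → 0# ^ m ≡ 0#
        0^ (suc m) = 0^suc m
      go : (∃ λ m → m ℕ.< n × Ω ^ m ≡ d) → ⊥
      go (m , m<n , eq) = clash (avoids-sound #units 0 one² one²-sound (proj₂ (∧-elim {unitᵇ v} rest)) m (subst (m ℕ.<_) n≡q²-1 m<n) (twoPrimitive⇒good m (subst TwoPrimitive (sym eq) tp)))
        where
        clash : (∃ λ a → ∃ λ b → Ω ^ m ≡ ⟦ a ⟧ + ⟦ b ⟧ * σ × ⟦ b ⟧ + - 1# * ⟦ v ⟧ ≢ 0#) → ⊥
        clash (a , b , Ω^≡ , ne) = ne (Translates.linear σ∉B (B-+ (⟦⟧∈B b) (B-* (B-neg B-1) (⟦⟧∈B v))) (⟦⟧∈B a) (subst B (sym same) Bx))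
          where
          same : (⟦ b ⟧ + - 1# * ⟦ v ⟧) * σ + ⟦ a ⟧ ≡ x
          same = begin
            (⟦ b ⟧ + - 1# * ⟦ v ⟧) * σ + ⟦ a ⟧ ≡⟨ solve 5 (λ a b s m v → (b :+ m :* v) :* s :+ a := m :* (v :* s) :+ (a :+ b :* s)) refl ⟦ a ⟧ ⟦ b ⟧ σ (- 1#) ⟦ v ⟧ ⟩
            - 1# * θ₀ + (⟦ a ⟧ + ⟦ b ⟧ * σ) ≡⟨ cong₂ _+_ (trans (sym (-‿distribˡ-* 1# θ₀)) (cong -_ (*-identityˡ θ₀))) (trans (sym Ω^≡) eq) ⟩
            - θ₀ + (θ₀ + x) ≡⟨ trans (sym (+-assoc _ _ _)) (trans (cong (_+ x) (-‿inverseˡ θ₀)) (+-identityˡ x)) ⟩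
            x ∎

-- Passing between the given setoid field and its copy on `Fin`.

module Enumerations where

  open FiniteFields
  open IntegerSums using (𝟙-yes; #; sum-const; sum-cong-≗)
  open QuadraticExtensions
  open TwoPrimitiveElements
  open import Algebra.Structures using (IsCommutativeRing)
  open import Data.Fin.Base using (Fin)
  import Data.Integer.Base as ℤ
  import Data.Integer.Properties as ℤ
  open import Data.Nat.Base as ℕ using (ℕ; zero; suc; z≤n; s≤s; _∸_)
  import Data.Nat.Properties as ℕ

  -- Transporting the field to Fin (suc n) replaces its setoid equality by the propositional one.
  module Enumerated (F : Field) {n : ℕ} (size : FieldDefs.HasSize F (suc n)) where
    private module F = Field F
    open FieldDefs F using () renaming (_^_ to _^F_)

    el : Fin (suc n) → F.Carrier
    el = proj₁ size

    el-injective : ∀ {i j} → el i F.≈ el j → i ≡ j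
    el-injective = proj₁ (proj₂ size) _ _

    idx : F.Carrier → Fin (suc n)
    idx y = proj₁ (proj₂ (proj₂ size) y)

    el-idx : ∀ y → el (idx y) F.≈ y
    el-idx y = proj₂ (proj₂ (proj₂ size) y)

    idx-el : ∀ i → idx (el i) ≡ i
    idx-el i = el-injective (el-idx (el i))

    idx-cong : ∀ {x y} → x F.≈ y → idx x ≡ idx y
    idx-cong {x} {y} eq = el-injective (F.trans (el-idx x) (F.trans eq (F.sym (el-idx y))))

    idx-≡ : ∀ {y i} → y F.≈ el i → idx y ≡ i
    idx-≡ {y} eq = el-injective (F.trans (el-idx y) eq)

    private
      _⊕_ _⊗_ : Fin (suc n) → Fin (suc n) → Fin (suc n)
      i ⊕ j = idx (el i F.+ el j)
      i ⊗ j = idx (el i F.* el j)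
      ⊖_ : Fin (suc n) → Fin (suc n)
      ⊖ i = idx (F.- el i)
      0ᶠ 1ᶠ : Fin (suc n)
      0ᶠ = idx F.0#
      1ᶠ = idx F.1#

      ⊕F : ∀ i j → el (i ⊕ j) F.≈ el i F.+ el j
      ⊕F i j = el-idx _
      ⊗F : ∀ i j → el (i ⊗ j) F.≈ el i F.* el j
      ⊗F i j = el-idx _

      isCommutativeRing : IsCommutativeRing _≡_ _⊕_ _⊗_ ⊖_ 0ᶠ 1ᶠ
      isCommutativeRing = record
        { isRing = record
          { +-isAbelianGroup = record
            { isGroup = record
              { isMonoid = record
                { isSemigroup = record
                  { isMagma = record { isEquivalence = isEquivalence ; ∙-cong = cong₂ _⊕_ }
                  ; assoc = λ i j k → idx-cong (F.trans (F.+-cong (⊕F i j) F.refl) (F.trans (F.+-assoc _ _ _) (F.+-cong F.refl (F.sym (⊕F j k))))) }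
                ; identity = (λ i → idx-≡ (F.trans (F.+-cong (el-idx F.0#) F.refl) (F.+-identityˡ _))) ,
                             (λ i → idx-≡ (F.trans (F.+-cong F.refl (el-idx F.0#)) (F.+-identityʳ _))) }
              ; inverse = (λ i → idx-cong (F.trans (F.+-cong (el-idx _) F.refl) (F.-‿inverseˡ _))) ,
                          (λ i → idx-cong (F.trans (F.+-cong F.refl (el-idx _)) (F.-‿inverseʳ _)))
              ; ⁻¹-cong = cong ⊖_ }
            ; comm = λ i j → idx-cong (F.+-comm _ _) }
          ; *-cong = cong₂ _⊗_
          ; *-assoc = λ i j k → idx-cong (F.trans (F.*-cong (⊗F i j) F.refl) (F.trans (F.*-assoc _ _ _) (F.*-cong F.refl (F.sym (⊗F j k)))))
          ; *-identity = (λ i → idx-≡ (F.trans (F.*-cong (el-idx F.1#) F.refl) (F.*-identityˡ _))) ,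
                         (λ i → idx-≡ (F.trans (F.*-cong F.refl (el-idx F.1#)) (F.*-identityʳ _)))
          ; distrib = (λ i j k → idx-cong (F.trans (F.*-cong F.refl (⊕F j k)) (F.trans (F.distribˡ _ _ _) (F.+-cong (F.sym (⊗F i j)) (F.sym (⊗F i k)))))) ,
                      (λ i j k → idx-cong (F.trans (F.*-cong (⊕F j k) F.refl) (F.trans (F.distribʳ _ _ _) (F.+-cong (F.sym (⊗F j i)) (F.sym (⊗F k i)))))) }
        ; *-comm = λ i j → idx-cong (F.*-comm _ _) }

    𝔽 : FiniteField n
    𝔽 = record
      { _+_ = _⊕_ ; _*_ = _⊗_ ; -_ = ⊖_ ; 0# = 0ᶠ ; 1# = 1ᶠ ; isCommutativeRing = isCommutativeRing
      ; 1≢0 = λ eq → F.1≉0 (F.trans (F.sym (el-idx F.1#)) (F.trans (F.reflexive (cong el eq)) (el-idx F.0#)))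
      ; invertible = λ i i≢0 → let y , eq = F.inverse (el i) (λ z → i≢0 (sym (idx-≡ (F.sym z)))) in
          idx y , idx-cong (F.trans (F.*-cong F.refl (el-idx y)) eq) }

    open FieldTheory 𝔽

    el-+ : ∀ i j → el (i + j) F.≈ el i F.+ el j
    el-+ = ⊕F

    el-* : ∀ i j → el (i * j) F.≈ el i F.* el j
    el-* = ⊗F

    el-^ : ∀ i m → el (i ^ m) F.≈ el i ^F m
    el-^ i zero    = el-idx F.1#
    el-^ i (suc m) = F.trans (el-* i (i ^ m)) (F.*-cong F.refl (el-^ i m))

    ^F-cong : ∀ {x y} m → x F.≈ y → (x ^F m) F.≈ (y ^F m)
    ^F-cong zero    eq = F.refl
    ^F-cong (suc m) eq = F.*-cong eq (^F-cong m eq)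

  module TranslateTransport (F : Field) {p : ℕ} (pp : Prime p) (k : ℕ) (1<q : 1 ℕ.< p ℕ.^ k) {n : ℕ} (N≡ : suc n ≡ (p ℕ.^ k) ℕ.* (p ℕ.^ k))
    (c₄ : ℕ) (n≡4c : n ≡ 4 ℕ.* c₄) (size : FieldDefs.HasSize F (suc n)) where
    private module F = Field F
    open FieldDefs F using (InBase; IsSubfield; Generates; HasOrder; IsRPrimitive; TranslateProperty2) renaming (_^_ to _^F_)
    open Enumerated F size public
    open FieldTheory 𝔽
    open Quadratic 𝔽 pp k 1<q N≡
    open PrimitiveTheory 𝔽 pp k 1<q N≡ c₄ n≡4c

    InBase⇒B : ∀ {x} → InBase q x → B (idx x)
    InBase⇒B {x} eq = el-injective (F.trans (el-^ (idx x) q) (F.trans (^F-cong q (el-idx x)) (F.trans eq (F.sym (el-idx x)))))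

    B⇒InBase : ∀ {i} → B i → InBase q (el i)
    B⇒InBase {i} eq = F.trans (F.sym (el-^ i q)) (F.reflexive (cong el eq))

    B-proper : ¬ (∀ i → B i)
    B-proper all = ℕ.<⇒≢ (ℕ.m<m*n q q {{ℕ.>-nonZero (ℕ.<-trans (s≤s z≤n) 1<q)}} 1<q) (sym (trans (sym N≡) (ℤ.+-injective (trans (sym count) #B))))
      where
      count : # B? ≡ ℤ.+ suc n
      count = trans (sum-cong-≗ (λ i → 𝟙-yes (B? i) (all i))) (trans (sum-const (suc n) ℤ.1ℤ) (ℤ.*-identityʳ (ℤ.+ suc n)))

    B-isSubfield : IsSubfield (λ y → B (idx y))
    B-isSubfield = record
      { resp = λ eq → subst B (idx-cong eq)
      ; has0 = B-0
      ; has1 = B-1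
      ; add = λ {x} {y} bx by → subst B (idx-cong (F.+-cong (el-idx x) (el-idx y))) (B-+ bx by)
      ; neg = λ {x} bx → subst B (idx-cong (F.-‿cong (el-idx x))) (B-neg bx)
      ; mul = λ {x} {y} bx by → subst B (idx-cong (F.*-cong (el-idx x) (el-idx y))) (B-* bx by)
      ; inv = λ {x} {y} bx eq → B-inv bx (idx-cong (F.trans (F.*-cong (el-idx x) (el-idx y)) eq)) }

    -- `Generates` quantifies over all subfields that contain the base field. `B` itself is one, so
    -- a generator inside it would make `B` the whole field, against the count of its q elements.
    generates⇒∉B : ∀ {θ} → Generates q θ → ¬ B (idx θ)
    generates⇒∉B {θ} gen Bθ = B-proper (λ i → subst B (idx-el i) (gen (λ y → B (idx y)) B-isSubfield (λ x → InBase⇒B) Bθ (el i)))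

    ∉B⇒generates : ∀ {i} → ¬ B i → Generates q (el i)
    ∉B⇒generates {i} i∉B S sub base Sθ y = let a , b , Ba , Bb , eq = basis i∉B (idx y) in
      IsSubfield.resp sub (F.trans (F.sym (F.trans (el-+ a (b * i)) (F.+-cong F.refl (el-* b i)))) (F.trans (F.reflexive (cong el (sym eq))) (el-idx y)))
        (add (base (el a) (B⇒InBase Ba)) (mul (base (el b) (B⇒InBase Bb)) Sθ))
      where open IsSubfield sub using (add; mul)

    half : (q ℕ.^ 2 ∸ 1) / 2 ≡ 2 ℕ.* c₄
    half = trans (cong (_/ 2) (trans (cong (λ z → q ℕ.* z ∸ 1) (ℕ.*-identityʳ q)) (trans (cong (_∸ 1) (sym N≡)) (trans n≡4c (trans (ℕ.*-assoc 2 2 c₄) (ℕ.*-comm 2 (2 ℕ.* c₄))))))) (m*n/n≡m (2 ℕ.* c₄) 2)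

    twoPrimitive⇒F : ∀ {i y} → el i F.≈ y → TwoPrimitive i → IsRPrimitive q 2 2 y
    twoPrimitive⇒F {i} {y} eq (i^ , minimal) = subst (HasOrder y) (sym half)
      ( 0<2c , F.trans (F.sym (power (2 ℕ.* c₄))) (F.trans (F.reflexive (cong el i^)) (el-idx F.1#))
      , λ j 0<j j< yj → minimal j 0<j j< (el-injective (F.trans (power j) (F.trans yj (F.sym (el-idx F.1#))))))
      where
      power : ∀ j → el (i ^ j) F.≈ (y ^F j)
      power j = F.trans (el-^ i j) (^F-cong j eq)
      0<2c : 0 ℕ.< 2 ℕ.* c₄
      0<2c = ℕ.n≢0⇒n>0 (λ z → ℕ.<-irrefl (sym (trans n≡4c (trans (ℕ.*-assoc 2 2 c₄) (cong (2 ℕ.*_) z)))) 0<n)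

    F⇒twoPrimitive : ∀ {i y} → el i F.≈ y → IsRPrimitive q 2 2 y → TwoPrimitive i
    F⇒twoPrimitive {i} {y} eq prim = convert (subst (HasOrder y) half prim)
      where
      power : ∀ j → el (i ^ j) F.≈ (y ^F j)
      power j = F.trans (el-^ i j) (^F-cong j eq)
      convert : HasOrder y (2 ℕ.* c₄) → TwoPrimitive i
      convert (_ , y^ , minimal) = el-injective (F.trans (power (2 ℕ.* c₄)) (F.trans y^ (F.sym (el-idx F.1#)))) ,
        λ j 0<j j< ij → minimal j 0<j j< (F.trans (F.sym (power j)) (F.trans (F.reflexive (cong el ij)) (el-idx F.1#)))

    translateProperty : (∀ {θ} → ¬ B θ → ∃ λ x → B x × TwoPrimitive (θ + x)) → TranslateProperty2 q
    translateProperty tp θ gen = let x , Bx , prim = tp (generates⇒∉B gen) in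
      el x , B⇒InBase Bx , twoPrimitive⇒F (F.trans (el-+ (idx θ) x) (F.+-cong (el-idx θ) F.refl)) prim

    ¬translateProperty : ∀ {θ} → ¬ B θ → (∀ x → B x → ¬ TwoPrimitive (θ + x)) → ¬ TranslateProperty2 q
    ¬translateProperty {θ} θ∉B none tp = let x , base , prim = tp (el θ) (∉B⇒generates θ∉B) in
      none (idx x) (InBase⇒B base) (F⇒twoPrimitive (F.trans (el-+ θ (idx x)) (F.+-cong F.refl (el-idx x))) prim)

-- Evaluation of the criterion for every odd q below 2 ^ 17.

module SmallFields where

  open SieveCriterion
  open TwoPrimitiveElements using (1<prime)
  open import Data.Bool.Base using (Bool; true; false; T; _∧_; _∨_; not; if_then_else_)
  open import Data.List.Base using (List; []; _∷_; _++_; map)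
  open Certificates using (order)
  open CertificateData using (certificates)
  open import Data.Bool.ListAction using (any)
  import Data.List.Relation.Unary.Any.Properties as Anyₚ
  open import Data.List.Membership.DecPropositional using (_∈?_)
  open import Data.Nat.Base
  open import Data.Nat.Properties
  open import Data.Nat.DivMod
  open import Data.Nat.Divisibility

  -- The odd primes below the threshold 64. As 64 = 2 ^ 6, the scaled logarithm of the threshold is
  -- exactly 96.
  smallPrimes : List ℕ
  smallPrimes = 3 ∷ 5 ∷ 7 ∷ 11 ∷ 13 ∷ 17 ∷ 19 ∷ 23 ∷ 29 ∷ 31 ∷ 37 ∷ 41 ∷ 43 ∷ 47 ∷ 53 ∷ 59 ∷ 61 ∷ []

  smallPrimes-ok : All (λ p → Prime p × 2 < p × p < 64) smallPrimes
  smallPrimes-ok = toWitness {a? = all? (λ p → prime? p ×-dec ((2 <? p) ×-dec (p <? 64))) smallPrimes} tt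

  smallPrimes-unique : Unique smallPrimes
  smallPrimes-unique = toWitness {a? = allPairs? (λ x y → ¬? (x ≟ y)) smallPrimes} tt

  smallPrimes-complete : ∀ {ℓ} → ℓ < 64 → Prime ℓ → 2 < ℓ → ℓ ∈ smallPrimes
  smallPrimes-complete = toWitness {a? = allUpTo? (λ ℓ → prime? ℓ →-dec ((2 <? ℓ) →-dec (_∈?_ _≟_ ℓ smallPrimes))) 64} tt

  -- q is divisible by p without being a power of p.
  properᵇ : ℕ → ℕ → ℕ → Bool
  properᵇ f q zero      = false
  properᵇ f q p@(suc _) = (q % p ≡ᵇ 0) ∧ (not (strip f p q % p ≡ᵇ 0) ∧ not (strip f p q ≡ᵇ 1))

  not-power : ∀ f q p₀ k p → Prime p₀ → Prime p → q ≡ p₀ ^ k → ¬ T (properᵇ f q p)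
  not-power f q p₀ k p@(suc _) pp₀ pp refl t with ∧-elim {q % p ≡ᵇ 0} t
  ... | d , t′ with ∧-elim {not (strip f p q % p ≡ᵇ 0)} t′
  ... | nd , n1 = finish (prime∣prime⇒≡ pp₀ pp (prime∣^ k (m%n≡0⇒n∣m q p (≡ᵇ⇒≡ _ 0 d))))
    where
    prime∣^ : ∀ k → p ∣ p₀ ^ k → p ∣ p₀
    prime∣^ zero    p∣1 = ⊥-elim (<⇒≱ (1<prime pp) (∣⇒≤ p∣1))
    prime∣^ (suc k) p∣ with euclidsLemma p₀ (p₀ ^ k) pp p∣
    ... | inj₁ d = d
    ... | inj₂ d = prime∣^ k d
    not-elim : ∀ {b} → T (not b) → ¬ T b
    not-elim {false} _ ()
    finish : p ≡ p₀ → ⊥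
    finish refl with strip-^ f p k
    ... | zero  , eq = not-elim n1 (≡⇒≡ᵇ (strip f p q) 1 eq)
    ... | suc j , eq = not-elim nd (≡⇒≡ᵇ (strip f p q % p) 0 (trans (cong (_% p) eq) (n∣m⇒m%n≡0 (p * p ^ j) p (m∣m*n (p ^ j)))))

  -- r is kept equal to ⌈√q⌉ while q runs through the odd numbers.
  loopᵇ : (ℕ → ℕ → Bool) → ℕ → ℕ → ℕ → Bool
  stepᵇ : (ℕ → ℕ → Bool) → ℕ → ℕ → ℕ → Bool
  loopᵇ check zero    q r = true
  loopᵇ check (suc f) q r = if r * r <ᵇ q then stepᵇ check f q (suc r) else stepᵇ check f q r
  stepᵇ check f q r = (q ≤ᵇ r * r) ∧ (check q r ∧ loopᵇ check f (2 + q) r)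

  module OddLoop (check : ℕ → ℕ → Bool) (P : ℕ → Set) (bound : ℕ)
    (check-sound : ∀ q r → 1 < q → q < bound → q ≤ r * r → T (check q r) → P q) where

    private
      shift : ∀ q i → q + 2 * suc i ≡ 2 + q + 2 * i
      shift q i = trans (cong (q +_) (*-suc 2 i)) (trans (sym (+-assoc q 2 (2 * i))) (cong (_+ 2 * i) (+-comm q 2)))

    loop-sound : ∀ f q r → 1 < q → q + 2 * f < bound → T (loopᵇ check f q r) → ∀ i → i < f → P (q + 2 * i)
    step-sound : ∀ f q r → 1 < q → q + 2 * suc f < bound → T (stepᵇ check f q r) → ∀ i → i < suc f → P (q + 2 * i)
    loop-sound (suc f) q r 1<q hi t with r * r <ᵇ q
    ... | true  = step-sound f q (suc r) 1<q hi t
    ... | false = step-sound f q r 1<q hi t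
    step-sound f q r 1<q hi t zero    _ = subst P (sym (+-identityʳ q))
      (check-sound q r 1<q (≤-<-trans (m≤m+n q _) hi) (≤ᵇ⇒≤ q (r * r) (proj₁ (∧-elim {q ≤ᵇ r * r} t))) (proj₁ (∧-elim {check q r} (proj₂ (∧-elim {q ≤ᵇ r * r} t)))))
    step-sound f q r 1<q hi t (suc i) (s≤s i<f) = subst P (sym (shift q i))
      (loop-sound f (2 + q) r (≤-trans 1<q (m≤n+m q 2)) (≤-trans (≤-reflexive (cong suc (sym (shift q f)))) hi)
        (proj₂ (∧-elim {check q r} (proj₂ (∧-elim {q ≤ᵇ r * r} t)))) i i<f)

    all-odd : ∀ f q r → 1 < q → q + 2 * f < bound → loopᵇ check f q r ≡ true → ∀ i → i < f → P (q + 2 * i)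
    all-odd f q r 1<q hi eq = loop-sound f q r 1<q hi (subst T (sym eq) tt)

  module Check (Kc : ℕ) {{Kc≢0 : NonZero Kc}} (witnesses : List ℕ) (witnesses-prime : All Prime witnesses) (residual : List ℕ) where

    checkᵇ : ℕ → ℕ → Bool
    checkᵇ q r = sieveᵇ smallPrimes 64 Kc q r ∨ (any (properᵇ 40 q) witnesses ∨ any (q ≡ᵇ_) residual)

    -- Prime powers are never recognised as such: a number that fails the criterion is either shown
    -- not to be a prime power or found in the list of residual values.
    Outcome : ℕ → Set
    Outcome q = Sieveable q (q * q ∸ 1) ⊎ (∀ p k → Prime p → q ≡ p ^ k → ⊥) ⊎ q ∈ residual

    check-sound : ∀ q r → 1 < q → q < 2 ^ 20 → q ≤ r * r → T (checkᵇ q r) → Outcome q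
    check-sound q r 1<q q< q≤ t = [ sieved , rest ]′ (∨-elim {sieveᵇ smallPrimes 64 Kc q r} t)
      where
      sieved : T (sieveᵇ smallPrimes 64 Kc q r) → Outcome q
      sieved s = inj₁ (SieveCheck.sieve-sound smallPrimes 64 smallPrimes-ok smallPrimes-unique smallPrimes-complete (s≤s (s≤s (s≤s z≤n))) Kc q r 1<q q< q≤ s)
      go : ∀ ws → All Prime ws → T (any (properᵇ 40 q) ws) → ∀ p k → Prime p → q ≡ p ^ k → ⊥
      go (w ∷ ws) (pw ∷ pws) t p k pp eq = [ not-power 40 q p k w pp pw eq , (λ b → go ws pws b p k pp eq) ]′ (∨-elim {properᵇ 40 q w} t)
      rest : T (any (properᵇ 40 q) witnesses ∨ any (q ≡ᵇ_) residual) → Outcome q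
      rest t = inj₂ ([ (λ w → inj₁ (go witnesses witnesses-prime w)) , (λ m → inj₂ (Any.map (≡ᵇ⇒≡ q _) (Anyₚ.any⁻ (q ≡ᵇ_) residual m))) ]′ (∨-elim {any (properᵇ 40 q) witnesses} t))

  exceptions residuals : List ℕ
  exceptions = 5 ∷ 7 ∷ 11 ∷ 13 ∷ 31 ∷ 41 ∷ []
  residuals = exceptions ++ map order certificates

  -- The common denominator of the weights is 10 ^ 6. The witnesses 67, 73 and 83 serve products of
  -- primes that all exceed 61.
  open Check 1000000 (67 ∷ 73 ∷ 83 ∷ smallPrimes) (toWitness {a? = all? prime? (67 ∷ 73 ∷ 83 ∷ smallPrimes)} tt) residuals public
  open OddLoop checkᵇ Outcome (2 ^ 20) check-sound public

  -- The 65535 odd numbers from 3 to 2 ^ 17 - 1; the loop starts at q = 3 with r = 2 = ⌈√3⌉.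
  small-odd : ∀ i → i < 65535 → Outcome (3 + 2 * i)
  small-odd = all-odd 65535 3 2 (s≤s (s≤s z≤n)) (≤ᵇ⇒≤ _ _ tt) refl

-- Every odd q at least 3 has one of the three outcomes.

module Classification where

  open SieveCriterion
  open LargeFields
  open SmallFields
  open import Data.Nat.Base
  open import Data.Nat.Properties
  open import Data.Nat.DivMod
  open import Data.Nat.Divisibility

  odd-form : ∀ q → 3 ≤ q → ¬ (2 ∣ q) → q ≡ 3 + 2 * (q / 2 ∸ 1)
  odd-form q 3≤q 2∤q = go (q % 2) (m%n<n q 2) (m≡m%n+[m/n]*n q 2) (λ eq → 2∤q (m%n≡0⇒n∣m q 2 eq)) (m≥n⇒m/n>0 (≤-trans (n≤1+n 2) 3≤q))
    where
    go : ∀ r → r < 2 → q ≡ r + (q / 2) * 2 → r ≢ 0 → 0 < q / 2 → q ≡ 3 + 2 * (q / 2 ∸ 1)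
    go 0 _ eq ne 0< = ⊥-elim (ne refl)
    go 1 _ eq ne 0< = trans eq (trans (cong suc (*-comm (q / 2) 2)) (cong suc (double (q / 2) 0<)))
      where
      double : ∀ h → 0 < h → 2 * h ≡ 2 + 2 * (h ∸ 1)
      double (suc h) _ = *-suc 2 h
    go (suc (suc _)) (s≤s (s≤s ())) eq ne 0<

  classify : ∀ q → 3 ≤ q → ¬ (2 ∣ q) → Outcome q
  classify q 3≤q 2∤q = split (q <? 2 ^ 17)
    where
    open RangeCheck smallPrimes smallPrimes-ok smallPrimes-unique smallPrimes-complete q (<-≤-trans (s≤s (s≤s z≤n)) 3≤q)
    -- The multipliers 213942, 381560 and 999880 come from numerically solving the dual linear programs.
    large : ¬ (q < 2 ^ 17) → Dec (q ≤ 2 ^ 19) → Dec (q ≤ 2 ^ 24) → Dec (q ≤ 2 ^ 51) → Sieveable q n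
    -- The core may use 3, then 3 and 5, then 3, 5 and 7. R is the largest integer with (R + 1)²
    -- below the left end of the range or equal to it: 362² ≤ 2 ^ 17, 724² ≤ 2 ^ 19, 4096² = 2 ^ 24.
    large q≮2¹⁷ (yes q≤) _ _ = Core.inRange 1 1000000 361 17 19 213942 (≮⇒≥ q≮2¹⁷) q≤ (≤ᵇ⇒≤ _ _ tt) (≤ᵇ⇒≤ _ _ tt) (≤ᵇ⇒≤ _ _ tt)
    large _ (no q≰) (yes q≤) _ = Core.inRange 2 1000000 723 19 24 381560 (<⇒≤ (≰⇒> q≰)) q≤ (≤ᵇ⇒≤ _ _ tt) (≤ᵇ⇒≤ _ _ tt) (≤ᵇ⇒≤ _ _ tt)
    large _ (no _) (no q≰) (yes q≤) = Core.inRange 3 1000000 4095 24 51 999880 (<⇒≤ (≰⇒> q≰)) q≤ (≤ᵇ⇒≤ _ _ tt) (≤ᵇ⇒≤ _ _ tt) (≤ᵇ⇒≤ _ _ tt)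
    large _ (no _) (no _) (no q≰) = unbounded 25 (≤ᵇ⇒≤ _ _ tt) (≤-trans (≤ᵇ⇒≤ _ _ tt) (<⇒≤ (≰⇒> q≰))) (≤ᵇ⇒≤ _ _ tt)
    index<65535 : q < 2 ^ 17 → q / 2 ∸ 1 < 65535
    index<65535 q<2¹⁷ = *-cancelˡ-< 2 _ _ (+-cancelˡ-< 3 _ _ (subst (_< 3 + 2 * 65535) (odd-form q 3≤q 2∤q) (<-≤-trans q<2¹⁷ (≤ᵇ⇒≤ _ _ tt))))
    split : Dec (q < 2 ^ 17) → Outcome q
    split (yes q<2¹⁷) = subst Outcome (sym (odd-form q 3≤q 2∤q)) (small-odd (q / 2 ∸ 1) (index<65535 q<2¹⁷))
    split (no q≮2¹⁷)  = inj₁ (large q≮2¹⁷ (q ≤? 2 ^ 19) (q ≤? 2 ^ 24) (q ≤? 2 ^ 51))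

-- Assembly of the sieve, the certificates and the failure at 41.

module MainTheorem where

  open FiniteFields
  open QuadraticExtensions
  open TwoPrimitiveElements
  open SieveCriterion using (Sieveable; ∧-elim; wt; wt-ok)
  open Certificates
  open CertificateData
  open Soundness
  open BaseFieldModels
  open FieldOf41Squared
  open Enumerations
  open SmallFields
  open Classification
  open import Data.Bool.Base using (Bool; true; T)
  open import Data.Bool.ListAction using (all)
  open import Data.List.Base using ([]; _∷_; map)
  open import Data.List.Membership.Propositional.Properties using (∈-map⁻; ∈-++⁻)
  open import Data.Nat.Base as ℕ using (ℕ; suc; z≤n; s≤s; _∸_; NonZero; _*_; _^_; _<_; _≤_; _+_)
  import Data.Nat.Properties as ℕ
  open import Data.Nat.Divisibility using (_∣_; divides; m%n≡0⇒n∣m)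
  open import Data.Nat.Tactic.RingSolver using (solve-∀)
  open import Data.Vec.Base using (Vec)

  -- What oddness of q supplies: 4 ∣ q² - 1 for the modulus 4, and an even q + 1, by which elements
  -- of the base field become squares in the extension.
  record OddParameters (q : ℕ) : Set where
    field
      n c₄ h : ℕ
      N≡ : suc n ≡ q * q
      n≡4c : n ≡ 4 * c₄
      q+1≡2h : suc q ≡ 2 * h

  oddParameters : ∀ {q} → ¬ (2 ∣ q) → OddParameters q
  oddParameters {q} 2∤q = go (q % 2) (m%n<n q 2) (m≡m%n+[m/n]*n q 2) (λ eq → 2∤q (m%n≡0⇒n∣m q 2 eq))
    where
    go : ∀ r → r < 2 → q ≡ r + (q / 2) * 2 → r ≢ 0 → OddParameters q
    go 0 _ eq ne = ⊥-elim (ne refl)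
    go 1 _ eq ne = record { n = 4 * (m * suc m) ; c₄ = m * suc m ; h = suc m ; N≡ = trans (square m) (sym (cong₂ _*_ eq eq)) ; n≡4c = refl ; q+1≡2h = trans (cong suc eq) (next m) }
      where
      m : ℕ
      m = q / 2
      square : ∀ m → suc (4 * (m * suc m)) ≡ (1 + m * 2) * (1 + m * 2)
      square = solve-∀
      next : ∀ m → suc (1 + m * 2) ≡ 2 * suc m
      next = solve-∀
    go (suc (suc _)) (s≤s (s≤s ())) eq ne

  module _ (F : Field) where
    open FieldDefs F using (HasSize; TranslateProperty2)

    sieve-translates : ∀ {p} → Prime p → ∀ k → 1 < p ^ k → ¬ (2 ∣ p ^ k) → Sieveable (p ^ k) (p ^ k * p ^ k ∸ 1) → HasSize (p ^ k * p ^ k) → TranslateProperty2 (p ^ k)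
    sieve-translates {p} pp k 1<q 2∤q sv size = T.translateProperty (λ θ∉B →
        PrimitiveTheory.translate T.𝔽 pp k 1<q N≡ c₄ n≡4c θ∉B r q≤rr Cs Ss unique Cs-ok Ss-ok complete Kc {{Kc≢0}} (wt Kc) (wt-ok Kc) criterion)
      where
      open OddParameters (oddParameters 2∤q)
      module T = TranslateTransport F pp k 1<q N≡ c₄ n≡4c (subst HasSize (sym N≡) size)
      open Sieveable (subst (Sieveable (p ^ k)) (cong ℕ.pred (sym N≡)) sv)

    prime-certificate : ∀ fuel p .{{p≢0 : NonZero p}} δ u ols es → T (primeᵇ p) → T (extensionᵇ fuel (primeOps p {{p≢0}}) (p ^ 1) δ u ols es) →
      1 < p ^ 1 → ¬ (2 ∣ p ^ 1) → HasSize (p ^ 1 * p ^ 1) → TranslateProperty2 (p ^ 1)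
    prime-certificate fuel p {{p≢0}} δ u ols es tp te 1<q 2∤q size = M.translateProperty (λ θ∉B →
        S.Primitive.translates-sound ols (proj₁ t₁₂) es (proj₂ t₁₂) θ∉B)
      where
      open OddParameters (oddParameters 2∤q)
      pp : Prime p
      pp = primeᵇ⇒prime p tp
      t₁₂ : T (Extension.primitiveᵇ fuel (primeOps p {{p≢0}}) (p ^ 1) δ u ols) × T (Extension.translatesᵇ fuel (primeOps p {{p≢0}}) (p ^ 1) δ u ols es)
      t₁₂ = ∧-elim te
      module M = TranslateTransport F pp 1 1<q N≡ c₄ n≡4c (subst HasSize (sym N≡) size)
      module I = Interpretations M.𝔽 pp 1 1<q N≡ c₄ n≡4c h q+1≡2h
      root : _
      root = I.sqrt (Models.Interpretation.⟦⟧∈B I.primeInterpretation δ)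
      module S = Models.Sound M.𝔽 pp 1 1<q N≡ c₄ n≡4c fuel (primeOps p {{p≢0}}) I.primeInterpretation δ u (proj₁ root) (proj₂ root)

    power-certificate : ∀ fuel p .{{p≢0 : NonZero p}} {d} (g δ u : Vec ℕ (suc d)) ols es → T (primeᵇ p) → T (baseᵇ p {{p≢0}} g) → T (extensionᵇ fuel (Power.powerOps p {{p≢0}} g) (p ^ suc d) δ u ols es) →
      1 < p ^ suc d → ¬ (2 ∣ p ^ suc d) → HasSize (p ^ suc d * p ^ suc d) → TranslateProperty2 (p ^ suc d)
    power-certificate fuel p {{p≢0}} {d} g δ u ols es tp tb te 1<q 2∤q size = M.translateProperty found
      where
      open OddParameters (oddParameters 2∤q)
      pp : Prime p
      pp = primeᵇ⇒prime p tp
      t₁₂ : T (Extension.primitiveᵇ fuel (Power.powerOps p {{p≢0}} g) (p ^ suc d) δ u ols) × T (Extension.translatesᵇ fuel (Power.powerOps p {{p≢0}} g) (p ^ suc d) δ u ols es)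
      t₁₂ = ∧-elim te
      module M = TranslateTransport F pp (suc d) 1<q N≡ c₄ n≡4c (subst HasSize (sym N≡) size)
      module Q = Quadratic M.𝔽 pp (suc d) 1<q N≡
      module P = PrimitiveTheory M.𝔽 pp (suc d) 1<q N≡ c₄ n≡4c
      module I = Interpretations M.𝔽 pp (suc d) 1<q N≡ c₄ n≡4c h q+1≡2h
      open FieldTheory M.𝔽 using (K) renaming (_+_ to _+ᶠ_)
      found : ∀ {θ : K} → ¬ Q.B θ → ∃ λ x → Q.B x × P.TwoPrimitive (θ +ᶠ x)
      found θ∉B = let α , Bα , α^ = I.root g _ tb θ∉B
                      interp = I.powerInterpretation g Bα α^
                      σ , σσ = I.sqrt (Models.Interpretation.⟦⟧∈B interp δ)
        in Models.Sound.Primitive.translates-sound M.𝔽 pp (suc d) 1<q N≡ c₄ n≡4c fuel (Power.powerOps p {{p≢0}} g) interp δ u σ σσ ols (proj₁ t₁₂) es (proj₂ t₁₂) θ∉B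

    certified : ∀ c → T (validᵇ c) → 1 < order c → ¬ (2 ∣ order c) → HasSize (order c * order c) → TranslateProperty2 (order c)
    certified (prime-field p@(suc _) δ u ols es) t = prime-certificate 30 p δ u ols es (proj₁ (∧-elim {primeᵇ p} t)) (proj₂ (∧-elim {primeᵇ p} t))
    certified (power-field p@(suc _) k@(suc _) g δ u ols es) t = power-certificate 30 p g δ u ols es
      (proj₁ (∧-elim {primeᵇ p} t)) (proj₁ (∧-elim {baseᵇ p g} (proj₂ (∧-elim {primeᵇ p} t)))) (proj₂ (∧-elim {baseᵇ p g} (proj₂ (∧-elim {primeᵇ p} t))))

    exceptional : ∀ fuel p .{{p≢0 : NonZero p}} δ u ols v → primeᵇ p ≡ true → Extension.exceptionalᵇ fuel (primeOps p {{p≢0}}) (p ^ 1) δ u ols v ≡ true →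
      1 < p ^ 1 → ¬ (2 ∣ p ^ 1) → HasSize (p ^ 1 * p ^ 1) → ¬ TranslateProperty2 (p ^ 1)
    exceptional fuel p {{p≢0}} δ u ols v tp te 1<q 2∤q size = M.¬translateProperty E.θ₀∉B E.no-translate
      where
      open OddParameters (oddParameters 2∤q)
      pp : Prime p
      pp = primeᵇ⇒prime p (subst T (sym tp) tt)
      module M = TranslateTransport F pp 1 1<q N≡ c₄ n≡4c (subst HasSize (sym N≡) size)
      module I = Interpretations M.𝔽 pp 1 1<q N≡ c₄ n≡4c h q+1≡2h
      root : _
      root = I.sqrt (Models.Interpretation.⟦⟧∈B I.primeInterpretation δ)
      module E = Exceptional M.𝔽 pp 1 1<q N≡ c₄ n≡4c fuel (primeOps p {{p≢0}}) I.primeInterpretation δ u (proj₁ root) (proj₂ root) ols v (subst T (sym te) tt)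

  valid-∈ : ∀ {c} → c ∈ certificates → T (validᵇ c)
  valid-∈ = All.lookup (all-true validᵇ certificates valid)
    where
    all-true : ∀ {A : Set} (P : A → Bool) xs → all P xs ≡ true → All (λ x → T (P x)) xs
    all-true P xs eq = all-elim P xs (subst T (sym eq) tt)

  -- 3 is a non-residue modulo 41, ω = 4 + σ generates the 1680 = 2 ^ 4 · 3 · 5 · 7 units, and 38 =
  -- -3: the set of translates of -3 σ is the one without 2-primitive elements.
  exceptional-41 : Extension.exceptionalᵇ 30 (primeOps 41) (41 ^ 1) 3 4 (3 ∷ 5 ∷ 7 ∷ []) 38 ≡ true
  exceptional-41 = refl

  prime-41 : primeᵇ 41 ≡ true
  prime-41 = refl

  3≤odd-prime-power : ∀ {q} → IsPrimePower q → ¬ (2 ∣ q) → 3 ≤ q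
  3≤odd-prime-power (p , suc k , pp , _ , refl) 2∤q =
    ℕ.≤∧≢⇒< (ℕ.≤-trans (1<prime pp) (ℕ.m≤m*n p (p ^ k) {{ℕ.m^n≢0 p k {{prime⇒nonZero pp}}}})) (λ eq → 2∤q (divides 1 (trans (sym eq) refl)))

  translates : (q : ℕ) → IsPrimePower q → ¬ (2 ∣ q) → q ≢ 5 → q ≢ 7 → q ≢ 11 → q ≢ 13 → q ≢ 31 → q ≢ 41 →
    (F : Field) → FieldDefs.HasSize F (q * q) → FieldDefs.TranslateProperty2 F q
  translates q qpp@(p , k , pp , _ , q≡) 2∤q ≢5 ≢7 ≢11 ≢13 ≢31 ≢41 F size = [ sieved , [ (λ np → ⊥-elim (np p k pp q≡)) , listed ]′ ]′ (classify q 3≤q 2∤q)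
    where
    3≤q : 3 ≤ q
    3≤q = 3≤odd-prime-power qpp 2∤q
    1<q : 1 < q
    1<q = ℕ.<-≤-trans (s≤s (s≤s z≤n)) 3≤q
    sieved : Sieveable q (q * q ∸ 1) → FieldDefs.TranslateProperty2 F q
    sieved = go q≡
      where
      go : q ≡ p ^ k → Sieveable q (q * q ∸ 1) → FieldDefs.TranslateProperty2 F q
      go refl sv = sieve-translates F pp k 1<q 2∤q sv size
    listed : q ∈ residuals → FieldDefs.TranslateProperty2 F q
    listed q∈ = [ except , certificate ]′ (∈-++⁻ exceptions q∈)
      where
      except : q ∈ exceptions → FieldDefs.TranslateProperty2 F q
      except (here e) = ⊥-elim (≢5 e)
      except (there (here e)) = ⊥-elim (≢7 e)
      except (there (there (here e))) = ⊥-elim (≢11 e)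
      except (there (there (there (here e)))) = ⊥-elim (≢13 e)
      except (there (there (there (there (here e))))) = ⊥-elim (≢31 e)
      except (there (there (there (there (there (here e)))))) = ⊥-elim (≢41 e)
      certificate : q ∈ map order certificates → FieldDefs.TranslateProperty2 F q
      certificate m = let c , c∈ , eq = ∈-map⁻ order m in go c c∈ eq
        where
        go : ∀ c → c ∈ certificates → q ≡ order c → FieldDefs.TranslateProperty2 F q
        go c c∈ refl = certified F c (valid-∈ c∈) 1<q 2∤q size

  fails-41 : (F : Field) → FieldDefs.HasSize F (41 * 41) → ¬ FieldDefs.TranslateProperty2 F 41
  fails-41 F = exceptional F 30 41 3 4 (3 ∷ 5 ∷ 7 ∷ []) 38 prime-41 exceptional-41 (s≤s (s≤s z≤n)) (λ { (divides m eq) → odd m eq })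
    where
    odd : ∀ m → 41 ≢ m * 2
    odd m eq = 1≢0 (trans (cong (_% 2) eq) (m*n%n≡0 m 2))
      where
      1≢0 : 1 ≢ 0
      1≢0 ()

open import Data.Nat using (ℕ; _*_)
open import Relation.Binary.PropositionalEquality using (_≢_)
open import Data.Nat.Divisibility using (_∣_)
open import Data.Product using (_×_)
open import Relation.Nullary using (¬_)

theorem4 : ((q : ℕ) → IsPrimePower q → ¬ (2 ∣ q) →
    q ≢ 5 → q ≢ 7 → q ≢ 11 → q ≢ 13 → q ≢ 31 → q ≢ 41 →
    (F : Field) → FieldDefs.HasSize F (q * q) →
    FieldDefs.TranslateProperty2 F q)
    × ((F : Field) → FieldDefs.HasSize F (41 * 41) →
    ¬ FieldDefs.TranslateProperty2 F 41)
theorem4 = MainTheorem.translates , MainTheorem.fails-41
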